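{- There exists a constant $c > 0$ such that the following holds. Let $G$ be an $r$-regular graph on $n$ vertices, $r = r(n)$. Then $G \cup \mathbb{G}(n,p)$ is a.a.s. Hamiltonian whenever $p := p(n) \geq \min\left\{\frac{(1+o(1))\log n}{n}, \frac{c\sqrt{n^3 \log n}}{r^3}\right\}$.
   Context: For an $n$-vertex graph $G$, $G \cup \mathbb{G}(n,p)$ denotes the union $G \cup R$ where $R$ is the binomial random graph on the vertex set $V(G)$ in which each pair of vertices is an edge independently with probability $p$. "A.a.s." means with probability tending to $1$ as $n \to \infty$. A graph is Hamiltonian if it has a cycle through all its vertices. -}

module Defs where

open import Data.Bool.Base using (Bool; false; _∧_; _∨_; not; T)
open import Data.Bool.Properties using (∨-comm; T?)
open import Data.Empty using (⊥-elim)
open import Data.Fin.Base using (Fin; toℕ; fromℕ<)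
import Data.Fin.Properties as Fin
open import Data.Fin.Subset using (Subset; ∣_∣)
open import Data.Integer.Base as ℤ using (+_; +[1+_]; -[1+_]; +0)
import Data.Integer.Properties as ℤ
open import Data.List.Base using (List; []; _∷_; _++_; map; filter; length; foldr; allFin; cartesianProduct)
import Data.List.Membership.DecPropositional as ListMembership
open import Data.Nat.Base as ℕ using (ℕ; zero; suc)
open import Data.Nat.Coprimality using (1-coprimeTo) renaming (sym to coprime-sym)
open import Data.Nat.DivMod using (_mod_)
import Data.Nat.Properties as ℕ
open import Data.Product.Base using (Σ; ∃; _×_; _,_; proj₁; proj₂; ∃-syntax)
open import Data.Product.Properties using (≡-dec)
open import Data.Rational.Base as ℚ using (ℚ; mkℚ; 0ℚ; 1ℚ; ½; *≤*; *<*)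
import Data.Rational.Properties as ℚ
open import Data.Rational.Solver using (module +-*-Solver)
open import Data.Sum.Base using (_⊎_; inj₁; inj₂)
open import Data.Unit.Base using (⊤)
open import Data.Vec.Base using (Vec; []; _∷_; lookup; tabulate)
import Data.Vec.Membership.DecPropositional as VecMembership
open import Data.Vec.Relation.Unary.AllPairs using (allPairs?)
open import Data.Vec.Relation.Unary.Unique.Propositional using (Unique)
open import Data.Vec.Relation.Unary.Unique.Propositional.Properties using (lookup-injective)
open import Level using (0ℓ)
open import Relation.Binary.PropositionalEquality using (_≡_; refl; sym; trans; cong; cong₂; subst; subst₂)
open import Relation.Nullary using (¬_; Dec; yes; no; contradiction; ¬?)
open import Relation.Nullary.Decidable using (⌊_⌋; map′; _×-dec_)
open import Relation.Unary using (Pred; Decidable)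

------------------------------------------------------------------------
-- Auxiliary facts on ℚ

ℕ→ℚ : ℕ → ℚ
ℕ→ℚ n = mkℚ (+ n) 0 (coprime-sym (1-coprimeTo n))

1/suc : ℕ → ℚ
1/suc k = mkℚ (+ 1) k (1-coprimeTo (suc k))

private
  eqˡ : ∀ {p q r} → p ≡ q → p ℚ.≤ r → q ℚ.≤ r
  eqˡ refl h = h

  eqʳ : ∀ {p q r} → p ≡ q → r ℚ.≤ p → r ℚ.≤ q
  eqʳ refl h = h

  eq<ˡ : ∀ {p q r} → p ≡ q → p ℚ.< r → q ℚ.< r
  eq<ˡ refl h = h

  p≤∣p∣ : ∀ p → p ℚ.≤ ℚ.∣ p ∣
  p≤∣p∣ p with ℚ.≤-total 0ℚ p
  ... | inj₁ 0≤p = ℚ.≤-reflexive (sym (ℚ.0≤p⇒∣p∣≡p 0≤p))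
  ... | inj₂ p≤0 = ℚ.≤-trans p≤0 (ℚ.0≤∣p∣ p)

  add-sub : ∀ p q → q ℚ.+ (p ℚ.- q) ≡ p
  add-sub = solve 2 (λ p q → q :+ (p :- q) := p) refl
    where open +-*-Solver

  ∣-∣-swap : ∀ p q → ℚ.∣ p ℚ.- q ∣ ≡ ℚ.∣ q ℚ.- p ∣
  ∣-∣-swap p q = trans (sym (ℚ.∣-p∣≡∣p∣ (p ℚ.- q)))
    (cong ℚ.∣_∣ (solve 2 (λ p q → :- (p :- q) := q :- p) refl p q))
    where open +-*-Solver

  within⇒≤ : ∀ p q {ε} → ℚ.∣ p ℚ.- q ∣ ℚ.≤ ε → p ℚ.≤ q ℚ.+ ε
  within⇒≤ p q h = eqˡ (add-sub p q)
    (ℚ.+-monoʳ-≤ q (ℚ.≤-trans (p≤∣p∣ (p ℚ.- q)) h))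

  ≤⇒-≤ : ∀ p q {ε} → p ℚ.≤ q ℚ.+ ε → p ℚ.- q ℚ.≤ ε
  ≤⇒-≤ p q {ε} h = eqʳ
    (solve 2 (λ q e → (q :+ e) :- q := e) refl q ε) (ℚ.+-monoˡ-≤ (ℚ.- q) h)
    where open +-*-Solver

  ≤⇒within : ∀ p q {ε} → p ℚ.≤ q ℚ.+ ε → q ℚ.≤ p ℚ.+ ε → ℚ.∣ p ℚ.- q ∣ ℚ.≤ ε
  ≤⇒within p q h k with ℚ.∣p∣≡p∨∣p∣≡-p (p ℚ.- q)
  ... | inj₁ e = eqˡ (sym e) (≤⇒-≤ p q h)
  ... | inj₂ e = eqˡ
    (sym (trans e (solve 2 (λ p q → :- (p :- q) := q :- p) refl p q))) (≤⇒-≤ q p k)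
    where open +-*-Solver

  *-monoˡ : ∀ {r p q} → 0ℚ ℚ.≤ r → p ℚ.≤ q → r ℚ.* p ℚ.≤ r ℚ.* q
  *-monoˡ {r} 0≤r = ℚ.*-monoˡ-≤-nonNeg r {{ℚ.nonNegative 0≤r}}

  *-monoʳ : ∀ {r p q} → 0ℚ ℚ.≤ r → p ℚ.≤ q → p ℚ.* r ℚ.≤ q ℚ.* r
  *-monoʳ {r} 0≤r = ℚ.*-monoʳ-≤-nonNeg r {{ℚ.nonNegative 0≤r}}

  0≤* : ∀ {p q} → 0ℚ ℚ.≤ p → 0ℚ ℚ.≤ q → 0ℚ ℚ.≤ p ℚ.* q
  0≤* {p} 0≤p 0≤q = eqˡ (ℚ.*-zeroʳ p) (*-monoˡ 0≤p 0≤q)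

  0<* : ∀ {p q} → 0ℚ ℚ.< p → 0ℚ ℚ.< q → 0ℚ ℚ.< p ℚ.* q
  0<* {p} 0<p 0<q = eq<ˡ (ℚ.*-zeroʳ p)
    (ℚ.*-monoʳ-<-pos p {{ℚ.positive 0<p}} 0<q)

  p≤p+q : ∀ {p q} → 0ℚ ℚ.≤ q → p ℚ.≤ p ℚ.+ q
  p≤p+q {p} 0≤q = eqˡ (ℚ.+-identityʳ p) (ℚ.+-monoʳ-≤ p 0≤q)

  0<½ : 0ℚ ℚ.< ½
  0<½ = *<* (ℤ.+<+ (ℕ.s≤s ℕ.z≤n))

  ½+½ : ∀ ε → ½ ℚ.* ε ℚ.+ ½ ℚ.* ε ≡ ε
  ½+½ ε = trans (sym (ℚ.*-distribʳ-+ ε ½ ½)) (ℚ.*-identityˡ ε)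

  0<1/suc : ∀ k → 0ℚ ℚ.< 1/suc k
  0<1/suc k = *<* (ℤ.+<+ (ℕ.s≤s ℕ.z≤n))

  0≤ℕ→ℚ : ∀ n → 0ℚ ℚ.≤ ℕ→ℚ n
  0≤ℕ→ℚ n = ℚ.nonNegative⁻¹ (ℕ→ℚ n)

  ℕ→ℚ-mono : ∀ {m n} → m ℕ.≤ n → ℕ→ℚ m ℚ.≤ ℕ→ℚ n
  ℕ→ℚ-mono m≤n = *≤* (ℤ.*-monoʳ-≤-nonNeg (+ 1) (ℤ.+≤+ m≤n))

  ℕ→ℚ-zero : ℕ→ℚ 0 ≡ 0ℚ
  ℕ→ℚ-zero = refl

  ℕ→ℚ-suc : ∀ n → ℕ→ℚ (suc n) ≡ ℕ→ℚ n ℚ.+ 1ℚ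
  ℕ→ℚ-suc n = sym (trans (cong (ℚ._/ 1) eq) (ℚ.↥p/↧p≡p (ℕ→ℚ (suc n))))
    where
    eq : + n ℤ.* + 1 ℤ.+ + 1 ℤ.* + 1 ≡ + suc n
    eq = trans (cong (ℤ._+ + 1) (ℤ.*-identityʳ (+ n))) (cong +_ (ℕ.+-comm n 1))

  ℕ→ℚ-* : ∀ m n → ℕ→ℚ (m ℕ.* n) ≡ ℕ→ℚ m ℚ.* ℕ→ℚ n
  ℕ→ℚ-* m n = sym (trans (cong (ℚ._/ 1) (sym (ℤ.pos-* m n))) (ℚ.↥p/↧p≡p (ℕ→ℚ (m ℕ.* n))))

  suc*1/suc : ∀ k → ℕ→ℚ (suc k) ℚ.* 1/suc k ≡ 1ℚ
  suc*1/suc k = ℚ.*-inverseʳ (ℕ→ℚ (suc k))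

  1/suc-anti : ∀ {j k} → j ℕ.≤ k → 1/suc k ℚ.≤ 1/suc j
  1/suc-anti j≤k = *≤* (ℤ.*-monoˡ-≤-nonNeg (+ 1) (ℤ.+≤+ (ℕ.s≤s j≤k)))

  archimedean : ∀ ε → 0ℚ ℚ.< ε → ∃[ k ] 1/suc k ℚ.≤ ε
  archimedean ε@(mkℚ +[1+ n ] d _) _ = d , *≤* (ℤ.*-monoʳ-≤-nonNeg (+ suc d) {+ 1} {+ suc n} (ℤ.+≤+ (ℕ.s≤s ℕ.z≤n)))
  archimedean (mkℚ +0 d _) (*<* (ℤ.+<+ ()))
  archimedean (mkℚ -[1+ n ] d _) (*<* ())

  archimedean* : ∀ n ε → 0ℚ ℚ.< ε → ∃[ k ] ℕ→ℚ n ℚ.* 1/suc k ℚ.≤ ε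
  archimedean* n ε 0<ε with archimedean (1/suc n ℚ.* ε) (0<* (0<1/suc n) 0<ε)
  ... | k , h = k , ℚ.≤-trans (*-monoˡ (0≤ℕ→ℚ n) h)
    (ℚ.≤-trans (*-monoʳ (ℚ.<⇒≤ (0<* (0<1/suc n) 0<ε)) (ℕ→ℚ-mono (ℕ.n≤1+n n)))
      (ℚ.≤-reflexive (trans (sym (ℚ.*-assoc (ℕ→ℚ (suc n)) (1/suc n) ε))
        (trans (cong (ℚ._* ε) (suc*1/suc n)) (ℚ.*-identityˡ ε)))))

------------------------------------------------------------------------
-- Real numbers as Cauchy sequences of rationals

IsCauchy : (ℕ → ℚ) → Set
IsCauchy x = ∀ ε → 0ℚ ℚ.< ε →
  ∃[ N ] (∀ m n → N ℕ.≤ m → N ℕ.≤ n → ℚ.∣ x m ℚ.- x n ∣ ℚ.≤ ε)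

record ℝ : Set where
  constructor mkℝ
  field
    approx : ℕ → ℚ
    cauchy : IsCauchy approx

open ℝ public

infix 4 _≤_ _<_

_≤_ : ℝ → ℝ → Set
x ≤ y = ∀ ε → 0ℚ ℚ.< ε →
  ∃[ N ] (∀ n → N ℕ.≤ n → approx x n ℚ.≤ approx y n ℚ.+ ε)

_<_ : ℝ → ℝ → Set
x < y = ∃[ ε ] (0ℚ ℚ.< ε × ∃[ N ] (∀ n → N ℕ.≤ n → approx x n ℚ.+ ε ℚ.≤ approx y n))

fromℚ : ℚ → ℝ
fromℚ q = mkℝ (λ _ → q) λ ε 0<ε → 0 , λ _ _ _ _ →
  ≤⇒within q q (p≤p+q (ℚ.<⇒≤ 0<ε)) (p≤p+q (ℚ.<⇒≤ 0<ε))

fromℕ : ℕ → ℝ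
fromℕ n = fromℚ (ℕ→ℚ n)

0ℝ 1ℝ : ℝ
0ℝ = fromℚ 0ℚ
1ℝ = fromℚ 1ℚ

private
  -- One-sided criterion, symmetric in m and n.
  cauchy-≤ : ∀ {x : ℕ → ℚ} →
    (∀ ε → 0ℚ ℚ.< ε → ∃[ N ] (∀ m n → N ℕ.≤ m → N ℕ.≤ n → x m ℚ.≤ x n ℚ.+ ε)) → IsCauchy x
  cauchy-≤ {x} h ε 0<ε with h ε 0<ε
  ... | N , f = N , λ m n N≤m N≤n → ≤⇒within (x m) (x n) (f m n N≤m N≤n) (f n m N≤n N≤m)

  both : ∀ (x y : ℝ) {ε₁ ε₂} → 0ℚ ℚ.< ε₁ → 0ℚ ℚ.< ε₂ → ∃[ N ] (∀ m n → N ℕ.≤ m → N ℕ.≤ n →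
    ℚ.∣ approx x m ℚ.- approx x n ∣ ℚ.≤ ε₁ × ℚ.∣ approx y m ℚ.- approx y n ∣ ℚ.≤ ε₂)
  both x y p q with cauchy x _ p | cauchy y _ q
  ... | M , f | N , g = M ℕ.⊔ N , λ m n a b →
    f m n (ℕ.m⊔n≤o⇒m≤o M N a) (ℕ.m⊔n≤o⇒m≤o M N b) , g m n (ℕ.m⊔n≤o⇒n≤o M N a) (ℕ.m⊔n≤o⇒n≤o M N b)

  eventuallyBounded : ∀ x → ∃[ B ] (0ℚ ℚ.< B × ∃[ N ] (∀ n → N ℕ.≤ n → ℚ.∣ approx x n ∣ ℚ.≤ B))
  eventuallyBounded x with cauchy x 1ℚ (0<1/suc 0)
  ... | N , f = ℚ.∣ approx x N ∣ ℚ.+ 1ℚ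
    , ℚ.+-mono-≤-< (ℚ.0≤∣p∣ (approx x N)) (0<1/suc 0)
    , N
    , λ n N≤n → eqˡ (cong ℚ.∣_∣ (add-sub (approx x n) (approx x N)))
        (ℚ.≤-trans (ℚ.∣p+q∣≤∣p∣+∣q∣ (approx x N) (approx x n ℚ.- approx x N))
          (ℚ.+-monoʳ-≤ ℚ.∣ approx x N ∣ (f n N N≤n ℕ.≤-refl)))

infixl 6 _+_ _-_
infixl 7 _*_ _⊓_ _÷_
infixr 8 _^_
infix  8 -_

_+_ : ℝ → ℝ → ℝ
approx (x + y) n = approx x n ℚ.+ approx y n
cauchy (x + y) = cauchy-≤ λ ε 0<ε → let (N , f) = both x y (0<* 0<½ 0<ε) (0<* 0<½ 0<ε) in
  N , λ m n a b → let (p , q) = f m n a b in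
    eqʳ
      (trans (solve 3 (λ u v e → (u :+ e) :+ (v :+ e) := (u :+ v) :+ (e :+ e)) refl
               (approx x n) (approx y n) (½ ℚ.* ε))
        (cong (approx x n ℚ.+ approx y n ℚ.+_) (½+½ ε)))
      (ℚ.+-mono-≤ (within⇒≤ (approx x m) (approx x n) p) (within⇒≤ (approx y m) (approx y n) q))
  where open +-*-Solver

-_ : ℝ → ℝ
approx (- x) n = ℚ.- approx x n
cauchy (- x) ε 0<ε with cauchy x ε 0<ε
... | N , f = N , λ m n a b → eqˡ
  (trans (∣-∣-swap (approx x m) (approx x n)) (cong ℚ.∣_∣
    (solve 2 (λ u v → v :- u := (:- u) :- (:- v)) refl (approx x m) (approx x n))))
  (f m n a b)
  where open +-*-Solver

_-_ : ℝ → ℝ → ℝ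
x - y = x + (- y)

_*_ : ℝ → ℝ → ℝ
approx (x * y) n = approx x n ℚ.* approx y n
cauchy (x * y) ε 0<ε = N , bound
  where
  open +-*-Solver
  Bx = proj₁ (eventuallyBounded x)
  By = proj₁ (eventuallyBounded y)
  0<Bx = proj₁ (proj₂ (eventuallyBounded x))
  0<By = proj₁ (proj₂ (eventuallyBounded y))
  Nx = proj₁ (proj₂ (proj₂ (eventuallyBounded x)))
  Ny = proj₁ (proj₂ (proj₂ (eventuallyBounded y)))
  B = Bx ℚ.+ By
  0<B : 0ℚ ℚ.< B
  0<B = ℚ.+-mono-< 0<Bx 0<By
  instance
    B-pos : ℚ.Positive B
    B-pos = ℚ.positive 0<B
    B-nonZero : ℚ.NonZero B
    B-nonZero = ℚ.pos⇒nonZero B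
  ε′ = (ℚ.1/ B) ℚ.* ε
  0<ε′ : 0ℚ ℚ.< ε′
  0<ε′ = 0<* (ℚ.positive⁻¹ (ℚ.1/ B) {{ℚ.1/pos⇒pos B}}) 0<ε
  M = proj₁ (both x y 0<ε′ 0<ε′)
  N = M ℕ.⊔ (Nx ℕ.⊔ Ny)
  bound : ∀ m n → N ℕ.≤ m → N ℕ.≤ n →
    ℚ.∣ approx x m ℚ.* approx y m ℚ.- approx x n ℚ.* approx y n ∣ ℚ.≤ ε
  bound m n N≤m N≤n = begin
    ℚ.∣ a ℚ.* b ℚ.- c ℚ.* d ∣
      ≡⟨ cong ℚ.∣_∣ (solve 4 (λ a b c d → a :* b :- c :* d := a :* (b :- d) :+ d :* (a :- c)) refl a b c d) ⟩
    ℚ.∣ a ℚ.* (b ℚ.- d) ℚ.+ d ℚ.* (a ℚ.- c) ∣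
      ≤⟨ ℚ.∣p+q∣≤∣p∣+∣q∣ (a ℚ.* (b ℚ.- d)) (d ℚ.* (a ℚ.- c)) ⟩
    ℚ.∣ a ℚ.* (b ℚ.- d) ∣ ℚ.+ ℚ.∣ d ℚ.* (a ℚ.- c) ∣
      ≡⟨ cong₂ ℚ._+_ (ℚ.∣p*q∣≡∣p∣*∣q∣ a (b ℚ.- d)) (ℚ.∣p*q∣≡∣p∣*∣q∣ d (a ℚ.- c)) ⟩
    ℚ.∣ a ∣ ℚ.* ℚ.∣ b ℚ.- d ∣ ℚ.+ ℚ.∣ d ∣ ℚ.* ℚ.∣ a ℚ.- c ∣
      ≤⟨ ℚ.+-mono-≤ (prod (ℚ.0≤∣p∣ (b ℚ.- d)) 0<Bx a≤ (proj₂ close)) (prod (ℚ.0≤∣p∣ (a ℚ.- c)) 0<By d≤ (proj₁ close)) ⟩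
    Bx ℚ.* ε′ ℚ.+ By ℚ.* ε′
      ≡⟨ sym (ℚ.*-distribʳ-+ ε′ Bx By) ⟩
    B ℚ.* ((ℚ.1/ B) ℚ.* ε)
      ≡⟨ sym (ℚ.*-assoc B (ℚ.1/ B) ε) ⟩
    B ℚ.* (ℚ.1/ B) ℚ.* ε
      ≡⟨ cong (ℚ._* ε) (ℚ.*-inverseʳ B) ⟩
    1ℚ ℚ.* ε
      ≡⟨ ℚ.*-identityˡ ε ⟩
    ε ∎
    where
    open ℚ.≤-Reasoning
    a = approx x m
    b = approx y m
    c = approx x n
    d = approx y n
    close = proj₂ (both x y 0<ε′ 0<ε′) m n (ℕ.m⊔n≤o⇒m≤o M _ N≤m) (ℕ.m⊔n≤o⇒m≤o M _ N≤n)
    a≤ = proj₂ (proj₂ (proj₂ (eventuallyBounded x))) m (ℕ.m⊔n≤o⇒m≤o Nx Ny (ℕ.m⊔n≤o⇒n≤o M _ N≤m))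
    d≤ = proj₂ (proj₂ (proj₂ (eventuallyBounded y))) n (ℕ.m⊔n≤o⇒n≤o Nx Ny (ℕ.m⊔n≤o⇒n≤o M _ N≤n))
    prod : ∀ {u v p q} → 0ℚ ℚ.≤ v → 0ℚ ℚ.< p → u ℚ.≤ p → v ℚ.≤ q → u ℚ.* v ℚ.≤ p ℚ.* q
    prod 0≤v 0<p u≤p v≤q = ℚ.≤-trans (*-monoʳ 0≤v u≤p) (*-monoˡ (ℚ.<⇒≤ 0<p) v≤q)

_⊓_ : ℝ → ℝ → ℝ
approx (x ⊓ y) n = approx x n ℚ.⊓ approx y n
cauchy (x ⊓ y) = cauchy-≤ λ ε 0<ε → let (N , f) = both x y 0<ε 0<ε in
  N , λ m n a b → let (p , q) = f m n a b in
    eqʳ (sym (ℚ.mono-≤-distrib-⊓ (ℚ.+-monoˡ-≤ ε) (approx x n) (approx y n)))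
      (ℚ.⊓-mono-≤ (within⇒≤ (approx x m) (approx x n) p) (within⇒≤ (approx y m) (approx y n) q))

abs : ℝ → ℝ
approx (abs x) n = ℚ.∣ approx x n ∣
cauchy (abs x) = cauchy-≤ λ ε 0<ε → let (N , f) = cauchy x ε 0<ε in
  N , λ m n a b →
    eqˡ (cong ℚ.∣_∣ (add-sub (approx x m) (approx x n)))
      (ℚ.≤-trans (ℚ.∣p+q∣≤∣p∣+∣q∣ (approx x n) (approx x m ℚ.- approx x n))
        (ℚ.+-monoʳ-≤ ℚ.∣ approx x n ∣ (f m n a b)))

_^_ : ℝ → ℕ → ℝ
x ^ zero  = 1ℝ
x ^ suc n = x * x ^ n

-- Division by a natural number, with the junk value x ÷ 0 = 0.
_÷_ : ℝ → ℕ → ℝ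
x ÷ zero  = 0ℝ
x ÷ suc n = x * fromℚ (1/suc n)

sum : List ℝ → ℝ
sum = foldr _+_ 0ℝ

------------------------------------------------------------------------
-- Natural logarithm of a positive integer, from the expansion
-- log n = − log (1 − x) = Σ_{j ≥ 1} xʲ / j  with  x = 1 − 1/n ∈ [0, 1).

infixr 8 _^ℚ_

_^ℚ_ : ℚ → ℕ → ℚ
q ^ℚ zero  = 1ℚ
q ^ℚ suc n = q ℚ.* q ^ℚ n

logSum : ℚ → ℕ → ℚ
logSum x zero    = 0ℚ
logSum x (suc N) = logSum x N ℚ.+ x ^ℚ suc N ℚ.* 1/suc N

private
  module LogSum (n : ℕ) where
    open ℚ.≤-Reasoning
    open +-*-Solver

    x s : ℚ
    x = 1ℚ ℚ.- 1/suc n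
    s = ℕ→ℚ (suc n)

    0≤x : 0ℚ ℚ.≤ x
    0≤x = eqˡ (ℚ.+-inverseʳ (1/suc n)) (ℚ.+-monoˡ-≤ (ℚ.- 1/suc n) (1/suc-anti {0} {n} ℕ.z≤n))

    x≤1 : x ℚ.≤ 1ℚ
    x≤1 = eqʳ (ℚ.+-identityʳ 1ℚ) (ℚ.+-monoʳ-≤ 1ℚ (ℚ.neg-antimono-≤ (ℚ.<⇒≤ (0<1/suc n))))

    0≤x^ : ∀ k → 0ℚ ℚ.≤ x ^ℚ k
    0≤x^ zero    = ℚ.<⇒≤ (0<1/suc 0)
    0≤x^ (suc k) = 0≤* 0≤x (0≤x^ k)

    x^≤1 : ∀ k → x ^ℚ k ℚ.≤ 1ℚ
    x^≤1 zero    = ℚ.≤-refl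
    x^≤1 (suc k) = ℚ.≤-trans (*-monoˡ 0≤x (x^≤1 k)) (eqˡ (sym (ℚ.*-identityʳ x)) x≤1)

    term≥0 : ∀ k → 0ℚ ℚ.≤ x ^ℚ suc k ℚ.* 1/suc k
    term≥0 k = 0≤* (0≤x^ (suc k)) (ℚ.<⇒≤ (0<1/suc k))

    increasing : ∀ k d → logSum x k ℚ.≤ logSum x (d ℕ.+ k)
    increasing k zero    = ℚ.≤-refl
    increasing k (suc d) = ℚ.≤-trans (increasing k d) (p≤p+q (term≥0 (d ℕ.+ k)))

    geometric : ∀ y → s ℚ.* (x ℚ.* y) ℚ.+ y ≡ s ℚ.* y
    geometric y = trans
      (solve 3 (λ s t y → s :* ((con 1ℚ :- t) :* y) :+ y := s :* y :+ (con 1ℚ :- s :* t) :* y) refl s (1/suc n) y)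
      (trans (cong (λ z → s ℚ.* y ℚ.+ (1ℚ ℚ.- z) ℚ.* y) (suc*1/suc n))
        (trans (cong (s ℚ.* y ℚ.+_) (ℚ.*-zeroˡ y)) (ℚ.+-identityʳ (s ℚ.* y))))

    tail : ∀ k d → logSum x (d ℕ.+ k) ℚ.+ s ℚ.* x ^ℚ suc (d ℕ.+ k) ℚ.* 1/suc k
                   ℚ.≤ logSum x k ℚ.+ s ℚ.* 1/suc k
    tail k zero = ℚ.+-monoʳ-≤ (logSum x k) (*-monoʳ (ℚ.<⇒≤ (0<1/suc k))
      (eqʳ (ℚ.*-identityʳ s) (*-monoˡ (0≤ℕ→ℚ (suc n)) (x^≤1 (suc k)))))
    tail k (suc d) = begin
      L ℚ.+ y ℚ.* 1/suc (d ℕ.+ k) ℚ.+ s ℚ.* (x ℚ.* y) ℚ.* t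
        ≤⟨ ℚ.+-monoˡ-≤ (s ℚ.* (x ℚ.* y) ℚ.* t) (ℚ.+-monoʳ-≤ L (*-monoˡ (0≤x^ (suc (d ℕ.+ k))) (1/suc-anti (ℕ.m≤n+m k d)))) ⟩
      L ℚ.+ y ℚ.* t ℚ.+ s ℚ.* (x ℚ.* y) ℚ.* t
        ≡⟨ solve 4 (λ L y t z → L :+ y :* t :+ z :* t := L :+ (z :+ y) :* t) refl L y t (s ℚ.* (x ℚ.* y)) ⟩
      L ℚ.+ (s ℚ.* (x ℚ.* y) ℚ.+ y) ℚ.* t
        ≡⟨ cong (λ z → L ℚ.+ z ℚ.* t) (geometric y) ⟩
      L ℚ.+ s ℚ.* y ℚ.* t
        ≤⟨ tail k d ⟩
      logSum x k ℚ.+ s ℚ.* 1/suc k ∎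
      where
      L = logSum x (d ℕ.+ k)
      y = x ^ℚ suc (d ℕ.+ k)
      t = 1/suc k

    isCauchy : IsCauchy (logSum x)
    isCauchy = cauchy-≤ λ ε 0<ε → let (N , h) = archimedean* (suc n) ε 0<ε in
      N , λ m k _ N≤k → let small = ℚ.≤-trans (*-monoˡ (0≤ℕ→ℚ (suc n)) (1/suc-anti N≤k)) h in
        step m k ε (ℚ.<⇒≤ 0<ε) small (ℕ.≤-total k m)
      where
      step : ∀ m k ε → 0ℚ ℚ.≤ ε → s ℚ.* 1/suc k ℚ.≤ ε → k ℕ.≤ m ⊎ m ℕ.≤ k →
             logSum x m ℚ.≤ logSum x k ℚ.+ ε
      step m k ε 0≤ε small (inj₁ k≤m) = subst (λ j → logSum x j ℚ.≤ _) (ℕ.m∸n+n≡m k≤m)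
        (ℚ.≤-trans (p≤p+q (0≤* (0≤* (0≤ℕ→ℚ (suc n)) (0≤x^ (suc (m ℕ.∸ k ℕ.+ k)))) (ℚ.<⇒≤ (0<1/suc k))))
          (ℚ.≤-trans (tail k (m ℕ.∸ k)) (ℚ.+-monoʳ-≤ (logSum x k) small)))
      step m k ε 0≤ε small (inj₂ m≤k) = ℚ.≤-trans
        (subst (λ j → logSum x m ℚ.≤ logSum x j) (ℕ.m∸n+n≡m m≤k) (increasing m (k ℕ.∸ m)))
        (p≤p+q 0≤ε)

-- log 0 is a junk value.
log : ℕ → ℝ
log zero    = 0ℝ
log (suc n) = mkℝ (logSum (1ℚ ℚ.- 1/suc n)) (LogSum.isCauchy n)

------------------------------------------------------------------------
-- Square root: the k-th approximation of √x is the largest multiple of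
-- 1/(k+1) whose square is at most max(xₖ, 0).

largest : {P : Pred ℕ 0ℓ} → Decidable P → ℕ → ℕ
largest P? zero = zero
largest P? (suc b) with P? (suc b)
... | yes _ = suc b
... | no  _ = largest P? b

grid : ℕ → ℕ → ℚ
grid k j = ℕ→ℚ j ℚ.* 1/suc k

SquareBelow : ℚ → ℕ → Pred ℕ 0ℓ
SquareBelow q k j = grid k j ℚ.* grid k j ℚ.≤ q ℚ.⊔ 0ℚ

squareBelow? : ∀ q k → Decidable (SquareBelow q k)
squareBelow? q k j = grid k j ℚ.* grid k j ℚ.≤? q ℚ.⊔ 0ℚ

-- (1 + |numerator of q|)(k+1) bounds every candidate.
sqrtIndex : ℚ → ℕ → ℕ
sqrtIndex q k = largest (squareBelow? q k) (suc ℤ.∣ ℚ.numerator q ∣ ℕ.* suc k)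

sqrtGrid : ℚ → ℕ → ℚ
sqrtGrid q k = grid k (sqrtIndex q k)

private
  largest-sat : {P : Pred ℕ 0ℓ} (P? : Decidable P) → P 0 → ∀ b → P (largest P? b)
  largest-sat P? p0 zero = p0
  largest-sat P? p0 (suc b) with P? (suc b)
  ... | yes p = p
  ... | no  _ = largest-sat P? p0 b

  largest-max : {P : Pred ℕ 0ℓ} (P? : Decidable P) → ∀ b j → largest P? b ℕ.< j → j ℕ.≤ b → ¬ P j
  largest-max P? zero .zero () ℕ.z≤n
  largest-max P? (suc b) j l<j j≤b p with P? (suc b)
  ... | yes _ = ℕ.<⇒≱ l<j j≤b
  ... | no ¬p with ℕ.m≤n⇒m<n∨m≡n j≤b
  ...   | inj₁ (ℕ.s≤s j≤b′) = largest-max P? b j l<j j≤b′ p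
  ...   | inj₂ refl = ¬p p

  largest-next : {P : Pred ℕ 0ℓ} (P? : Decidable P) → ∀ b → (∀ j → b ℕ.≤ j → ¬ P j) →
                 ¬ P (suc (largest P? b))
  largest-next P? b above with suc (largest P? b) ℕ.≤? b
  ... | yes h = largest-max P? b (suc (largest P? b)) ℕ.≤-refl h
  ... | no ¬h = above (suc (largest P? b)) (ℕ.<⇒≤ (ℕ.≰⇒> ¬h))

  0≤grid : ∀ k j → 0ℚ ℚ.≤ grid k j
  0≤grid k j = 0≤* (0≤ℕ→ℚ j) (ℚ.<⇒≤ (0<1/suc k))

  grid-suc : ∀ k j → grid k (suc j) ≡ grid k j ℚ.+ 1/suc k
  grid-suc k j = trans (cong (ℚ._* 1/suc k) (ℕ→ℚ-suc j))
    (solve 2 (λ a t → (a :+ con 1ℚ) :* t := a :* t :+ t) refl (ℕ→ℚ j) (1/suc k))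
    where open +-*-Solver

  q⊔0≤num : ∀ q → q ℚ.⊔ 0ℚ ℚ.≤ ℕ→ℚ ℤ.∣ ℚ.numerator q ∣
  q⊔0≤num q@(mkℚ n d c) = ℚ.⊔-lub (ℚ.≤-trans (p≤∣p∣ q) le) (0≤ℕ→ℚ ℤ.∣ n ∣)
    where
    le : ℚ.∣ q ∣ ℚ.≤ ℕ→ℚ ℤ.∣ n ∣
    le = *≤* (ℤ.*-monoˡ-≤-nonNeg (+ ℤ.∣ n ∣) (ℤ.+≤+ (ℕ.s≤s ℕ.z≤n)))

  beyond : ∀ q k j → suc ℤ.∣ ℚ.numerator q ∣ ℕ.* suc k ℕ.≤ j → ¬ SquareBelow q k j
  beyond q k j h sq = ℚ.<-irrefl refl (ℚ.<-≤-trans a<a+1 (ℚ.≤-trans a+1≤g (ℚ.≤-trans g≤g² (ℚ.≤-trans sq (q⊔0≤num q)))))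
    where
    a = ℤ.∣ ℚ.numerator q ∣
    g = grid k j
    a<a+1 : ℕ→ℚ a ℚ.< ℕ→ℚ (suc a)
    a<a+1 = subst₂ ℚ._<_ (ℚ.+-identityʳ (ℕ→ℚ a)) (sym (ℕ→ℚ-suc a)) (ℚ.+-monoʳ-< (ℕ→ℚ a) (0<1/suc 0))
    a+1≤g : ℕ→ℚ (suc a) ℚ.≤ g
    a+1≤g = eqˡ
      (trans (cong (ℚ._* 1/suc k) (ℕ→ℚ-* (suc a) (suc k)))
        (trans (ℚ.*-assoc (ℕ→ℚ (suc a)) (ℕ→ℚ (suc k)) (1/suc k))
          (trans (cong (ℕ→ℚ (suc a) ℚ.*_) (suc*1/suc k)) (ℚ.*-identityʳ (ℕ→ℚ (suc a))))))
      (*-monoʳ (ℚ.<⇒≤ (0<1/suc k)) (ℕ→ℚ-mono h))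
    g≤g² : g ℚ.≤ g ℚ.* g
    g≤g² = eqˡ (ℚ.*-identityʳ g)
      (*-monoˡ (0≤grid k j) (ℚ.≤-trans (ℕ→ℚ-mono (ℕ.s≤s (ℕ.z≤n {a}))) a+1≤g))

  sqrtGrid-lower : ∀ q k → sqrtGrid q k ℚ.* sqrtGrid q k ℚ.≤ q ℚ.⊔ 0ℚ
  sqrtGrid-lower q k = largest-sat {SquareBelow q k} (squareBelow? q k) p0 (suc ℤ.∣ ℚ.numerator q ∣ ℕ.* suc k)
    where
    g0 : grid k 0 ≡ 0ℚ
    g0 = trans (cong (ℚ._* 1/suc k) ℕ→ℚ-zero) (ℚ.*-zeroˡ (1/suc k))
    p0 : SquareBelow q k 0
    p0 = subst (λ z → z ℚ.* z ℚ.≤ q ℚ.⊔ 0ℚ) (sym g0) (ℚ.p≤q⊔p q 0ℚ)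

  sqrtGrid-upper : ∀ q k → q ℚ.⊔ 0ℚ ℚ.≤ (sqrtGrid q k ℚ.+ 1/suc k) ℚ.* (sqrtGrid q k ℚ.+ 1/suc k)
  sqrtGrid-upper q k = subst (λ z → q ℚ.⊔ 0ℚ ℚ.≤ z ℚ.* z) (grid-suc k j) (ℚ.<⇒≤ (ℚ.≰⇒> notBelow))
    where
    j = sqrtIndex q k
    notBelow : ¬ SquareBelow q k (suc j)
    notBelow = largest-next {SquareBelow q k} (squareBelow? q k) (suc ℤ.∣ ℚ.numerator q ∣ ℕ.* suc k) (beyond q k)

infix 8 √_

√_ : ℝ → ℝ
approx (√ x) k = sqrtGrid (approx x k) k
cauchy (√ x) = cauchy-≤ main
  where
  open +-*-Solver
  main : ∀ ε → 0ℚ ℚ.< ε → ∃[ N ] (∀ m n → N ℕ.≤ m → N ℕ.≤ n →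
    sqrtGrid (approx x m) m ℚ.≤ sqrtGrid (approx x n) n ℚ.+ ε)
  main ε 0<ε = N , bound
    where
    h = ½ ℚ.* ε
    0<h : 0ℚ ℚ.< h
    0<h = 0<* 0<½ 0<ε
    K = proj₁ (archimedean h 0<h)
    M = proj₁ (cauchy x (h ℚ.* h) (0<* 0<h 0<h))
    N = K ℕ.⊔ M
    bound : ∀ m n → N ℕ.≤ m → N ℕ.≤ n →
      sqrtGrid (approx x m) m ℚ.≤ sqrtGrid (approx x n) n ℚ.+ ε
    bound m n N≤m N≤n = ℚ.≮⇒≥ λ u+ε<t → ℚ.<-irrefl refl (ℚ.<-≤-trans (u+ε²<t² u+ε<t) chain)
      where
      open ℚ.≤-Reasoning
      a = approx x m ℚ.⊔ 0ℚ
      b = approx x n ℚ.⊔ 0ℚ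
      t = sqrtGrid (approx x m) m
      u = sqrtGrid (approx x n) n
      0≤u : 0ℚ ℚ.≤ u
      0≤u = 0≤grid n (sqrtIndex (approx x n) n)
      0<u+ε : 0ℚ ℚ.< u ℚ.+ ε
      0<u+ε = ℚ.+-mono-≤-< 0≤u 0<ε
      u+ε²<t² : u ℚ.+ ε ℚ.< t → (u ℚ.+ ε) ℚ.* (u ℚ.+ ε) ℚ.< t ℚ.* t
      u+ε²<t² u+ε<t = ℚ.<-≤-trans (ℚ.*-monoʳ-<-pos (u ℚ.+ ε) {{ℚ.positive 0<u+ε}} u+ε<t)
        (*-monoʳ (ℚ.<⇒≤ (ℚ.<-trans 0<u+ε u+ε<t)) (ℚ.<⇒≤ u+ε<t))
      a≤b+h² : a ℚ.≤ b ℚ.+ h ℚ.* h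
      a≤b+h² = ℚ.⊔-lub
        (ℚ.≤-trans (within⇒≤ (approx x m) (approx x n) (proj₂ (cauchy x (h ℚ.* h) (0<* 0<h 0<h)) m n
            (ℕ.m⊔n≤o⇒n≤o K M N≤m) (ℕ.m⊔n≤o⇒n≤o K M N≤n)))
          (ℚ.+-monoˡ-≤ (h ℚ.* h) (ℚ.p≤p⊔q (approx x n) 0ℚ)))
        (ℚ.+-mono-≤ (ℚ.p≤q⊔p (approx x n) 0ℚ) (ℚ.<⇒≤ (0<* 0<h 0<h)))
      1/n≤h : 1/suc n ℚ.≤ h
      1/n≤h = ℚ.≤-trans (1/suc-anti (ℕ.m⊔n≤o⇒m≤o K M N≤n)) (proj₂ (archimedean h 0<h))
      u+1/n≤u+h : u ℚ.+ 1/suc n ℚ.≤ u ℚ.+ h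
      u+1/n≤u+h = ℚ.+-monoʳ-≤ u 1/n≤h
      0≤u+h : 0ℚ ℚ.≤ u ℚ.+ h
      0≤u+h = ℚ.+-mono-≤ 0≤u (ℚ.<⇒≤ 0<h)
      0≤u+1/n : 0ℚ ℚ.≤ u ℚ.+ 1/suc n
      0≤u+1/n = ℚ.+-mono-≤ 0≤u (ℚ.<⇒≤ (0<1/suc n))
      chain : t ℚ.* t ℚ.≤ (u ℚ.+ ε) ℚ.* (u ℚ.+ ε)
      chain = begin
        t ℚ.* t ≤⟨ sqrtGrid-lower (approx x m) m ⟩
        a ≤⟨ a≤b+h² ⟩
        b ℚ.+ h ℚ.* h ≤⟨ ℚ.+-monoˡ-≤ (h ℚ.* h) (sqrtGrid-upper (approx x n) n) ⟩
        (u ℚ.+ 1/suc n) ℚ.* (u ℚ.+ 1/suc n) ℚ.+ h ℚ.* h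
          ≤⟨ ℚ.+-monoˡ-≤ (h ℚ.* h) (ℚ.≤-trans (*-monoʳ 0≤u+1/n u+1/n≤u+h) (*-monoˡ 0≤u+h u+1/n≤u+h)) ⟩
        (u ℚ.+ h) ℚ.* (u ℚ.+ h) ℚ.+ h ℚ.* h
          ≤⟨ p≤p+q (ℚ.+-mono-≤ (0≤* 0≤u (ℚ.<⇒≤ 0<ε)) (ℚ.<⇒≤ (0<* (ℚ.+-mono-< 0<h 0<h) 0<h))) ⟩
        (u ℚ.+ h) ℚ.* (u ℚ.+ h) ℚ.+ h ℚ.* h ℚ.+ (u ℚ.* ε ℚ.+ (h ℚ.+ h) ℚ.* h)
          ≡⟨ cong (λ e → (u ℚ.+ h) ℚ.* (u ℚ.+ h) ℚ.+ h ℚ.* h ℚ.+ (u ℚ.* e ℚ.+ (h ℚ.+ h) ℚ.* h)) (sym (½+½ ε)) ⟩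
        (u ℚ.+ h) ℚ.* (u ℚ.+ h) ℚ.+ h ℚ.* h ℚ.+ (u ℚ.* (h ℚ.+ h) ℚ.+ (h ℚ.+ h) ℚ.* h)
          ≡⟨ solve 2 (λ u h → (u :+ h) :* (u :+ h) :+ h :* h :+ (u :* (h :+ h) :+ (h :+ h) :* h)
               := (u :+ (h :+ h)) :* (u :+ (h :+ h))) refl u h ⟩
        (u ℚ.+ (h ℚ.+ h)) ℚ.* (u ℚ.+ (h ℚ.+ h))
          ≡⟨ cong (λ e → (u ℚ.+ e) ℚ.* (u ℚ.+ e)) (½+½ ε) ⟩
        (u ℚ.+ ε) ℚ.* (u ℚ.+ ε) ∎

------------------------------------------------------------------------
-- Finite simple graphs on the vertex set Fin n

record Graph (n : ℕ) : Set where
  field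
    adj        : Fin n → Fin n → Bool
    symmetric  : ∀ u v → adj u v ≡ adj v u
    loopless   : ∀ v → adj v v ≡ false

open Graph public

infixl 6 _∪_

_∪_ : ∀ {n} → Graph n → Graph n → Graph n
adj       (G ∪ H) u v = adj G u v ∨ adj H u v
symmetric (G ∪ H) u v = cong₂ _∨_ (symmetric G u v) (symmetric H u v)
loopless  (G ∪ H) v   = cong₂ _∨_ (loopless G v) (loopless H v)

neighbours : ∀ {n} → Graph n → Fin n → Subset n
neighbours G v = tabulate (adj G v)

degree : ∀ {n} → Graph n → Fin n → ℕ
degree G v = ∣ neighbours G v ∣

IsRegular : ∀ {n} → Graph n → ℕ → Set
IsRegular G r = ∀ v → degree G v ≡ r

cyclicSuc : ∀ {k} → Fin k → Fin k
cyclicSuc {suc k} i = suc (toℕ i) mod suc k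

record IsCycle {n} (G : Graph n) {k} (c : Vec (Fin n) k) : Set where
  constructor isCycle
  field
    length≥3   : 3 ℕ.≤ k
    distinct   : Unique c
    successive : ∀ i → T (adj G (lookup c i) (lookup c (cyclicSuc i)))

module _ {n : ℕ} where
  open VecMembership (Fin._≟_ {n}) using (_∈_; _∈?_)

  Hamiltonian : Graph n → Set
  Hamiltonian G = ∃[ k ] Σ (Vec (Fin n) k) λ c → IsCycle G c × (∀ v → v ∈ c)

  private
    isCycle? : ∀ G {k} (c : Vec (Fin n) k) → Dec (IsCycle G c)
    isCycle? G {k} c = map′ (λ (a , b , d) → isCycle a b d)
      (λ (isCycle a b d) → a , b , d)
      (3 ℕ.≤? k
        ×-dec allPairs? (λ u v → ¬? (u Fin.≟ v)) c
        ×-dec Fin.all? λ i → T? (adj G (lookup c i) (lookup c (cyclicSuc i))))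

    anyVec? : ∀ k {P : Pred (Vec (Fin n) k) 0ℓ} → Decidable P → Dec (∃ P)
    anyVec? zero    P? = map′ (λ p → [] , p) (λ { ([] , p) → p }) (P? [])
    anyVec? (suc k) P? = map′ (λ (x , xs , p) → x ∷ xs , p) (λ { (x ∷ xs , p) → x , xs , p })
      (Fin.any? λ x → anyVec? k λ xs → P? (x ∷ xs))

  hamiltonian? : Decidable Hamiltonian
  hamiltonian? G = map′
    (λ (k , c , h) → toℕ k , c , h)
    (λ (k , c , h) → bounded k c h)
    (Fin.any? λ (k : Fin (suc n)) → anyVec? (toℕ k) λ c → isCycle? G c ×-dec Fin.all? (_∈? c))
    where
    Spanning : ℕ → Set
    Spanning k = Σ (Vec (Fin n) k) λ c → IsCycle G c × (∀ v → v ∈ c)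
    bounded : ∀ k (c : Vec (Fin n) k) → IsCycle G c × (∀ v → v ∈ c) → ∃[ j ] Spanning (toℕ {suc n} j)
    bounded k c h = fromℕ< k<1+n , subst Spanning (sym (Fin.toℕ-fromℕ< k<1+n)) (c , h)
      where
      k<1+n : k ℕ.< suc n
      k<1+n = ℕ.s≤s (Fin.injective⇒≤ λ {i} {j} →
        lookup-injective (IsCycle.distinct (proj₁ h)) i j)

------------------------------------------------------------------------
-- The binomial random graph

-- Each unordered pair of distinct vertices is listed once, as (u , v) with u < v.
vertexPairs : ∀ n → List (Fin n × Fin n)
vertexPairs n = filter (λ (u , v) → u Fin.<? v) (cartesianProduct (allFin n) (allFin n))

sublists : ∀ {A : Set} → List A → List (List A)
sublists []       = [] ∷ []
sublists (x ∷ xs) = map (x ∷_) (sublists xs) ++ sublists xs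

module _ {n : ℕ} where
  open ListMembership (≡-dec (Fin._≟_ {n}) (Fin._≟_ {n})) using (_∈?_)

  -- The first conjunct only discards loops, of which vertexPairs has none.
  fromEdges : List (Fin n × Fin n) → Graph n
  adj (fromEdges E) u v =
    not ⌊ u Fin.≟ v ⌋ ∧ (⌊ (u , v) ∈? E ⌋ ∨ ⌊ (v , u) ∈? E ⌋)
  symmetric (fromEdges E) u v = cong₂ (λ b c → not b ∧ c) (≟-sym u v)
    (∨-comm ⌊ (u , v) ∈? E ⌋ ⌊ (v , u) ∈? E ⌋)
    where
    ≟-sym : ∀ u v → ⌊ u Fin.≟ v ⌋ ≡ ⌊ v Fin.≟ u ⌋
    ≟-sym u v with u Fin.≟ v | v Fin.≟ u
    ... | yes _ | yes _ = refl
    ... | no _  | no _  = refl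
    ... | yes p | no q  = contradiction (sym p) q
    ... | no p  | yes q = contradiction (sym q) p
  loopless (fromEdges E) v with v Fin.≟ v
  ... | yes _ = refl
  ... | no ¬p = contradiction refl ¬p

-- The probability that R ∼ 𝔾(n,p) satisfies P: the edge set E of R has
-- probability p^|E| (1 − p)^(C(n,2) − |E|).
probability : ∀ {n} → ℝ → {P : Pred (Graph n) 0ℓ} → Decidable P → ℝ
probability {n} p P? = sum (map weight (filter (λ E → P? (fromEdges E)) (sublists (vertexPairs n))))
  where
  weight : List (Fin n × Fin n) → ℝ
  weight E = p ^ length E * (1ℝ - p) ^ (length (vertexPairs n) ℕ.∸ length E)

------------------------------------------------------------------------
-- Asymptotics

-- Convergence of a sequence that is only given at the indices n ∈ S.
TendsToAlong : (S : Pred ℕ 0ℓ) → (∀ n → S n → ℝ) → ℝ → Set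
TendsToAlong S x L = ∀ ε → 0ℝ < ε →
  ∃[ N ] (∀ n (s : S n) → N ℕ.≤ n → abs (x n s - L) ≤ ε)

IsLittleO1 : (ℕ → ℝ) → Set
IsLittleO1 δ = TendsToAlong (λ _ → ⊤) (λ n _ → δ n) 0ℝ

-- min { (1+δ) log n / n , c √(n³ log n) / r³ }, where the second term
-- is +∞ for r = 0.
threshold : (c δ : ℝ) (n r : ℕ) → ℝ
threshold c δ n zero      = ((1ℝ + δ) * log n) ÷ n
threshold c δ n r@(suc _) =
  (((1ℝ + δ) * log n) ÷ n) ⊓ ((c * √ (fromℕ (n ℕ.^ 3) * log n)) ÷ (r ℕ.^ 3))

{-# OPTIONS --safe #-}
module Submission where

open import Data.Bool.Base using (Bool; true; false; if_then_else_; T; _∧_; _∨_; not)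
open import Data.Bool.Properties using (T-∧; T-∨; T?)
open import Data.Empty using (⊥-elim; ⊥)
open import Data.Fin.Base as Fin using (Fin; toℕ; fromℕ; inject₁)
open import Data.Fin.Permutation as Perm using (Permutation; permutation; _⟨$⟩ʳ_; _⟨$⟩ˡ_; _∘ₚ_; transpose)
import Data.Fin.Properties as Fin
open import Data.Fin.Relation.Unary.Top using (view; ‵fromℕ; ‵inject₁; view-fromℕ; view-inject₁)
open import Data.Fin.Subset.Properties using (anySubset?)
open import Data.Integer.Base as ℤ using (+[1+_]; -[1+_]; +0)
import Data.Integer.Properties as ℤ
open import Data.List.Base using (List; []; _∷_; _++_; map; filter; length; foldr; reverse; allFin; tabulate; cartesianProductWith; cartesianProduct)
open import Data.List.Extrema.Nat using (argmin; argmin-all; f[argmin]≤f[xs])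
import Data.List.Membership.DecPropositional as ListMembership
open import Data.List.Membership.Propositional using (_∈_; _∉_)
open import Data.List.Membership.Propositional.Properties using (∈-++⁺ˡ; ∈-++⁺ʳ; ∈-++⁻; ∈-allFin; ∈-cartesianProductWith⁺; ∈-filter⁺)
open import Data.List.Membership.Propositional.Properties.WithK using (unique∧set⇒bag)
import Data.List.Properties as List
open import Data.List.Relation.Binary.BagAndSetEquality using (∼bag⇒↭)
open import Data.List.Relation.Binary.Permutation.Propositional using (_↭_; ↭-refl; ↭-trans; ↭-sym; ↭⇒↭ₛ; ↭-reflexive)
open import Data.List.Relation.Binary.Permutation.Propositional.Properties using (∈-resp-↭; ↭-reverse; ↭-length; map⁺; ++⁺ʳ; ++-comm)
open import Data.List.Relation.Binary.Permutation.Setoid.Properties using (Unique-resp-↭)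
open import Data.List.Relation.Binary.Subset.Propositional using (_⊆_)
open import Data.List.Relation.Unary.All as All using (All; []; _∷_)
open import Data.List.Relation.Unary.All.Properties using (¬Any⇒All¬)
import Data.List.Relation.Unary.All.Properties as All
open import Data.List.Relation.Unary.AllPairs using (allPairs?; []; _∷_)
open import Data.List.Relation.Unary.Any using (here; there)
open import Data.List.Relation.Unary.Unique.Propositional using (Unique)
open import Data.List.Relation.Unary.Unique.Propositional.Properties using (allFin⁺)
import Data.List.Relation.Unary.Unique.Propositional.Properties as Unique
open import Data.Maybe.Base using (Maybe; just; nothing; is-just)
import Data.Maybe.Properties as Maybe
open import Data.Nat.Base as ℕ using (ℕ; zero; suc)
open import Data.Nat.Induction using (<-wellFounded; Acc; acc)
open import Data.Nat.ListAction.Properties using (sum-↭; sum-++)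
import Data.Nat.Properties as ℕ
import Data.Nat.Tactic.RingSolver as ℕSolver
open import Data.Product.Base using (_×_; _,_; ∃-syntax; proj₁; proj₂; Σ)
open import Data.Product.Properties using (≡-dec)
import Data.Rational.Properties as ℚ
open import Data.Sum.Base as Sum using (_⊎_; inj₁; inj₂)
open import Data.Vec.Membership.Propositional.Properties using (∈-fromList⁺)
open import Data.Vec.Properties using (lookup∘tabulate)
import Data.Vec.Relation.Unary.All.Properties as VecAll
open import Data.Vec.Relation.Unary.AllPairs using ([]; _∷_)
open import Data.Vec.Relation.Unary.Unique.Propositional using () renaming (Unique to VecUnique)
open import Data.Vec.Relation.Unary.Unique.Propositional.Properties using (lookup-injective)
open import Defs using (1/suc; _^ℚ_; ℝ; approx; sublists; Graph; fromEdges; probability; vertexPairs; adj; symmetric; loopless; degree; cyclicSuc; isCycle; Hamiltonian; hamiltonian?; IsRegular; _∪_; logSum; mkℝ; cauchy; IsCauchy; log; √_; largest; grid; SquareBelow; squareBelow?; sqrtGrid; threshold; TendsToAlong; IsLittleO1) renaming (ℕ→ℚ to ι)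
import Defs as ℝ
open import Function.Base using (_∘_; id)
open import Function.Bundles using (Equivalence; mk⇔)
open import Level using (0ℓ)
open import Relation.Binary.Definitions using (tri<; tri≈; tri>)
open import Relation.Binary.PropositionalEquality using (_≡_; refl; sym; trans; cong; cong₂; subst; subst₂; module ≡-Reasoning; _≢_; setoid)
open import Relation.Nullary using (Dec; yes; no; does; ¬_; ¬?; contradiction)
open import Relation.Nullary.Decidable using (dec⇒maybe; map′; _×-dec_; dec-true; dec-false; toSum; toWitness; fromWitness; ⌊_⌋; _⊎-dec_; from-yes)
open import Relation.Unary using (Pred; Decidable)
open import Tactic.RingSolver.Core.AlmostCommutativeRing using (AlmostCommutativeRing; fromCommutativeRing)

-- Call a non-adjacent pair of consecutive vertices in an ordering of V(H) a gap, and let φ(H) be 0 if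
-- H is Hamiltonian and 1 + (least number of gaps) otherwise.  Rotating an optimal ordering at both
-- ends yields at least d²/2 pairs whose addition lowers φ, where d is the minimum degree of H or, by
-- Pósa's lemma, the size up to which all sets S satisfy |N(S) ∖ S| ≥ 2|S|.  Exposing 𝔾(n,p) in many
-- rounds therefore lowers φ at rate p d²/2 until H is Hamiltonian, so G ∪ 𝔾(n,p) fails to be
-- Hamiltonian with probability at most 4 φ(G) / (p d²).
--
-- For p ≥ √(n³ log n) / r³ this is applied with d = r, and φ(G) = O(n / √r): a permutation of V(G) all
-- of whose cycles have length at least √r, with the fewest arcs v ↦ π v outside G, has only O(n / √r)
-- such arcs.  For if there are k of them, alternating walks starting there reach k more vertices in
-- every step, since |N(A)| ≥ |A| in a regular graph; the vertices that a walk of √r steps must avoid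
-- are too few to matter.
--
-- For p ≥ (1 + δ) log n / n a first portion of the random edges makes every S with |S| ≤ n / 32
-- expand, by a union bound over 𝔼 θ^|N(S) ∖ S|, and the remaining portion is used with d = n / 32 and
-- the trivial bound φ ≤ n + 1.

-- The reals are Cauchy sequences, so inequalities between them cannot be decided. Every estimate is
-- therefore proved for rational densities at a late index of the approximations, with `log n`
-- present only through partial sums of its series, and with Bernoulli's inequality in place of the
-- exponential function. As `probability` is a polynomial in p, the estimates carry over to the
-- reals.
--
-- At the second term of the minimum, 4 φ / (p d²) is O(√(r / (n log n))) for every fixed c, so c =
-- 1 is taken. The shape of δ comes from the first term. For small sets to expand, the parameter θ
-- must be O(1 / log n), at a cost of θ⁻² per vertex; so n (1 - p₁)^n has to fall below 1 / log³ n,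
-- where p₁ = p (1 - 1/J) is the first portion. A surplus of order 1/J in p gains a factor n^(1/J),
-- which exceeds log³ n when J is about log log n. Hence δ = 8/J with J = `lglg n` + 1, where the 8
-- pays for this factor, for the second portion p/J and for all roundings.

-- Rational inequalities standing in for the exponential function

module Rationals where
  open import Data.Rational.Base
  open import Tactic.RingSolver using (solve-∀)

  ℚ-ring : AlmostCommutativeRing 0ℓ 0ℓ
  ℚ-ring = fromCommutativeRing ℚ.+-*-commutativeRing λ q → dec⇒maybe (0ℚ ℚ.≟ q)

  0≤1 : 0ℚ ≤ 1ℚ
  0≤1 = *≤* (ℤ.+≤+ ℕ.z≤n)

  0<1 : 0ℚ < 1ℚ
  0<1 = *<* (ℤ.+<+ (ℕ.s≤s ℕ.z≤n))

  ≤-respˡ : ∀ {p q r} → p ≡ q → p ≤ r → q ≤ r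
  ≤-respˡ refl p≤r = p≤r

  ≤-respʳ : ∀ {p q r} → p ≡ q → r ≤ p → r ≤ q
  ≤-respʳ refl r≤p = r≤p

  *-monoˡ : ∀ {r p q} → 0ℚ ≤ r → p ≤ q → r * p ≤ r * q
  *-monoˡ {r} 0≤r = ℚ.*-monoˡ-≤-nonNeg r {{nonNegative 0≤r}}

  *-monoʳ : ∀ {r p q} → 0ℚ ≤ r → p ≤ q → p * r ≤ q * r
  *-monoʳ {r} 0≤r = ℚ.*-monoʳ-≤-nonNeg r {{nonNegative 0≤r}}

  *-mono : ∀ {p q r s} → 0ℚ ≤ p → 0ℚ ≤ s → p ≤ q → r ≤ s → p * r ≤ q * s
  *-mono 0≤p 0≤s p≤q r≤s = ℚ.≤-trans (*-monoˡ 0≤p r≤s) (*-monoʳ 0≤s p≤q)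

  0≤* : ∀ {p q} → 0ℚ ≤ p → 0ℚ ≤ q → 0ℚ ≤ p * q
  0≤* {p} 0≤p 0≤q = subst (_≤ p * _) (ℚ.*-zeroʳ p) (*-monoˡ 0≤p 0≤q)

  0<* : ∀ {p q} → 0ℚ < p → 0ℚ < q → 0ℚ < p * q
  0<* {p} 0<p 0<q = subst (_< p * _) (ℚ.*-zeroʳ p) (ℚ.*-monoʳ-<-pos p {{positive 0<p}} 0<q)

  0≤+ : ∀ {p q} → 0ℚ ≤ p → 0ℚ ≤ q → 0ℚ ≤ p + q
  0≤+ = ℚ.+-mono-≤

  ≤+ : ∀ {p q} → 0ℚ ≤ q → p ≤ p + q
  ≤+ {p} 0≤q = subst (_≤ p + _) (ℚ.+-identityʳ p) (ℚ.+-monoʳ-≤ p 0≤q)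

  ≤-from : ∀ {p q} d → 0ℚ ≤ d → p + d ≡ q → p ≤ q
  ≤-from d 0≤d eq = ≤-respʳ eq (≤+ 0≤d)

  0≤⇒- : ∀ {p q} → p ≤ q → 0ℚ ≤ q - p
  0≤⇒- {p} {q} h = subst (_≤ q - p) (ℚ.+-inverseʳ p) (ℚ.+-monoˡ-≤ (- p) h)

  -⇒≤ : ∀ {p q} → 0ℚ ≤ q - p → p ≤ q
  -⇒≤ {p} {q} h = ≤-from (q - p) h (lemma p q)
    where
    lemma : ∀ p q → p + (q - p) ≡ q
    lemma = solve-∀ ℚ-ring

  +-cancelʳ : ∀ {p q} r → p + r ≤ q + r → p ≤ q
  +-cancelʳ {p} {q} r h = subst₂ _≤_ (lemma p r) (lemma q r) (ℚ.+-monoˡ-≤ (- r) h)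
    where
    lemma : ∀ p r → p + r - r ≡ p
    lemma = solve-∀ ℚ-ring

  *-cancelˡ : ∀ {p q} r → 0ℚ < r → r * p ≤ r * q → p ≤ q
  *-cancelˡ r 0<r = ℚ.*-cancelˡ-≤-pos r {{positive 0<r}}

  0≤ι : ∀ n → 0ℚ ≤ ι n
  0≤ι n = ℚ.nonNegative⁻¹ (ι n)

  0<ι : ∀ {n} → 1 ℕ.≤ n → 0ℚ < ι n
  0<ι {suc n} _ = ℚ.positive⁻¹ (ι (suc n))

  ι-mono : ∀ {m n} → m ℕ.≤ n → ι m ≤ ι n
  ι-mono m≤n = *≤* (ℤ.*-monoʳ-≤-nonNeg (ℤ.+ 1) (ℤ.+≤+ m≤n))

  ι-+ : ∀ m n → ι (m ℕ.+ n) ≡ ι m + ι n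
  ι-+ m n = sym (trans (cong (_/ 1) eq) (ℚ.↥p/↧p≡p (ι (m ℕ.+ n))))
    where
    eq : ℤ.+ m ℤ.* ℤ.+ 1 ℤ.+ ℤ.+ n ℤ.* ℤ.+ 1 ≡ ℤ.+ (m ℕ.+ n)
    eq = trans (cong₂ ℤ._+_ (ℤ.*-identityʳ (ℤ.+ m)) (ℤ.*-identityʳ (ℤ.+ n))) refl

  ι-suc : ∀ n → ι (suc n) ≡ 1ℚ + ι n
  ι-suc n = ι-+ 1 n

  ι-* : ∀ m n → ι (m ℕ.* n) ≡ ι m * ι n
  ι-* m n = sym (trans (cong (_/ 1) (sym (ℤ.pos-* m n))) (ℚ.↥p/↧p≡p (ι (m ℕ.* n))))

  ι-^ : ∀ m k → ι (m ℕ.^ k) ≡ ι m ^ℚ k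
  ι-^ m zero    = refl
  ι-^ m (suc k) = trans (ι-* m (m ℕ.^ k)) (cong (ι m *_) (ι-^ m k))

  0<1/suc : ∀ k → 0ℚ < 1/suc k
  0<1/suc k = *<* (ℤ.+<+ (ℕ.s≤s ℕ.z≤n))

  0≤1/suc : ∀ k → 0ℚ ≤ 1/suc k
  0≤1/suc k = ℚ.<⇒≤ (0<1/suc k)

  suc*1/suc : ∀ k → ι (suc k) * 1/suc k ≡ 1ℚ
  suc*1/suc k = ℚ.*-inverseʳ (ι (suc k))

  1/suc≤1 : ∀ k → 1/suc k ≤ 1ℚ
  1/suc≤1 k = *≤* (ℤ.*-monoˡ-≤-nonNeg (ℤ.+ 1) (ℤ.+≤+ (ℕ.s≤s (ℕ.z≤n {k}))))

  archimedean : ∀ ε → 0ℚ < ε → ∃[ k ] 1/suc k ≤ ε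
  archimedean (mkℚ +[1+ n ] d _) _ = d , *≤* (ℤ.*-monoʳ-≤-nonNeg (ℤ.+ suc d) {ℤ.+ 1} {ℤ.+ suc n} (ℤ.+≤+ (ℕ.s≤s ℕ.z≤n)))
  archimedean (mkℚ +0 d _) (*<* (ℤ.+<+ ()))
  archimedean (mkℚ -[1+ n ] d _) (*<* ())

  ^-nonneg : ∀ {q} → 0ℚ ≤ q → ∀ n → 0ℚ ≤ q ^ℚ n
  ^-nonneg 0≤q zero    = 0≤1
  ^-nonneg 0≤q (suc n) = 0≤* 0≤q (^-nonneg 0≤q n)

  ^-mono : ∀ {p q} → 0ℚ ≤ p → p ≤ q → ∀ n → p ^ℚ n ≤ q ^ℚ n
  ^-mono 0≤p p≤q zero    = ℚ.≤-refl
  ^-mono 0≤p p≤q (suc n) = *-mono 0≤p (^-nonneg (ℚ.≤-trans 0≤p p≤q) n) p≤q (^-mono 0≤p p≤q n)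

  ^-+ : ∀ q m n → q ^ℚ (m ℕ.+ n) ≡ q ^ℚ m * q ^ℚ n
  ^-+ q zero    n = sym (ℚ.*-identityˡ (q ^ℚ n))
  ^-+ q (suc m) n = trans (cong (q *_) (^-+ q m n)) (sym (ℚ.*-assoc q (q ^ℚ m) (q ^ℚ n)))

  ^-*-distrib : ∀ p q n → (p * q) ^ℚ n ≡ p ^ℚ n * q ^ℚ n
  ^-*-distrib p q zero    = refl
  ^-*-distrib p q (suc n) = trans (cong (p * q *_) (^-*-distrib p q n)) (lemma p q (p ^ℚ n) (q ^ℚ n))
    where
    lemma : ∀ p q a b → p * q * (a * b) ≡ p * a * (q * b)
    lemma = solve-∀ ℚ-ring

  1^ : ∀ n → 1ℚ ^ℚ n ≡ 1ℚ
  1^ zero    = refl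
  1^ (suc n) = trans (ℚ.*-identityˡ (1ℚ ^ℚ n)) (1^ n)

  ^-^ : ∀ q m n → q ^ℚ (m ℕ.* n) ≡ (q ^ℚ n) ^ℚ m
  ^-^ q zero    n = refl
  ^-^ q (suc m) n = trans (^-+ q n (m ℕ.* n)) (cong (q ^ℚ n *_) (^-^ q m n))

  ^-≤1 : ∀ {q} → 0ℚ ≤ q → q ≤ 1ℚ → ∀ n → q ^ℚ n ≤ 1ℚ
  ^-≤1 0≤q q≤1 n = ≤-respʳ (1^ n) (^-mono 0≤q q≤1 n)

  1≤^ : ∀ {q} → 1ℚ ≤ q → ∀ n → 1ℚ ≤ q ^ℚ n
  1≤^ 1≤q n = ≤-respˡ (1^ n) (^-mono 0≤1 1≤q n)

  ^-anti : ∀ {q} → 0ℚ ≤ q → q ≤ 1ℚ → ∀ {m n} → m ℕ.≤ n → q ^ℚ n ≤ q ^ℚ m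
  ^-anti {q} 0≤q q≤1 {m} {n} m≤n = subst₂ _≤_
    (trans (sym (^-+ q m (n ℕ.∸ m))) (cong (q ^ℚ_) (ℕ.m+[n∸m]≡n m≤n)))
    (ℚ.*-identityʳ (q ^ℚ m))
    (*-monoˡ (^-nonneg 0≤q m) (^-≤1 0≤q q≤1 (n ℕ.∸ m)))

  ^-incr : ∀ {q} → 1ℚ ≤ q → ∀ {m n} → m ℕ.≤ n → q ^ℚ m ≤ q ^ℚ n
  ^-incr {q} 1≤q {m} {n} m≤n = subst₂ _≤_
    (ℚ.*-identityʳ (q ^ℚ m))
    (trans (sym (^-+ q m (n ℕ.∸ m))) (cong (q ^ℚ_) (ℕ.m+[n∸m]≡n m≤n)))
    (*-monoˡ (^-nonneg (ℚ.≤-trans 0≤1 1≤q) m) (1≤^ 1≤q (n ℕ.∸ m)))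

  bernoulli : ∀ {q} → 0ℚ ≤ q → ∀ n → 1ℚ + ι n * q ≤ (1ℚ + q) ^ℚ n
  bernoulli {q} 0≤q zero    = ℚ.≤-reflexive (trans (cong (1ℚ +_) (ℚ.*-zeroˡ q)) (ℚ.+-identityʳ 1ℚ))
  bernoulli {q} 0≤q (suc n) = ℚ.≤-trans
    (≤-from (q * (ι n * q)) (0≤* 0≤q (0≤* (0≤ι n) 0≤q))
      (trans (cong (λ t → 1ℚ + t * q + q * (ι n * q)) (ι-suc n)) (lemma q (ι n))))
    (*-monoˡ (0≤+ 0≤1 0≤q) (bernoulli 0≤q n))
    where
    lemma : ∀ q n → 1ℚ + (1ℚ + n) * q + q * (n * q) ≡ (1ℚ + q) * (1ℚ + n * q)
    lemma = solve-∀ ℚ-ring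

  bernoulli⁻ : ∀ {q} → 0ℚ ≤ q → q ≤ 1ℚ → ∀ n → 1ℚ ≤ (1ℚ - q) ^ℚ n + ι n * q
  bernoulli⁻ {q} 0≤q q≤1 zero = ℚ.≤-reflexive (sym (trans (cong (1ℚ +_) (ℚ.*-zeroˡ q)) (ℚ.+-identityʳ 1ℚ)))
  bernoulli⁻ {q} 0≤q q≤1 (suc n) = ℚ.≤-trans (bernoulli⁻ 0≤q q≤1 n)
    (≤-from (q * (1ℚ - a)) (0≤* 0≤q (0≤⇒- (^-≤1 (0≤⇒- q≤1) (≤-from q 0≤q (e q)) n)))
      (trans (lemma q a (ι n)) (cong (λ t → (1ℚ - q) * a + t * q) (sym (ι-suc n)))))
    where
    a = (1ℚ - q) ^ℚ n
    e : ∀ q → 1ℚ - q + q ≡ 1ℚ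
    e = solve-∀ ℚ-ring
    lemma : ∀ q a n → a + n * q + q * (1ℚ - a) ≡ (1ℚ - q) * a + (1ℚ + n) * q
    lemma = solve-∀ ℚ-ring

  1-≤1 : ∀ {q} → 0ℚ ≤ q → 1ℚ - q ≤ 1ℚ
  1-≤1 {q} 0≤q = ≤-from q 0≤q (e q)
    where
    e : ∀ q → 1ℚ - q + q ≡ 1ℚ
    e = solve-∀ ℚ-ring

  -- Bernoulli's inequality for 1 + q, then (1 - q)(1 + q) ≤ 1. It replaces (1 - q)^n ≤ e^(-nq);
  -- where exponential decay is needed, a bound by ½ obtained here is raised to a power.
  ^-inverse-bound : ∀ {q} → 0ℚ ≤ q → q ≤ 1ℚ → ∀ n → (1ℚ - q) ^ℚ n * (1ℚ + ι n * q) ≤ 1ℚ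
  ^-inverse-bound {q} 0≤q q≤1 n = ℚ.≤-trans
    (*-monoˡ (^-nonneg (0≤⇒- q≤1) n) (bernoulli 0≤q n))
    (subst (_≤ 1ℚ) (^-*-distrib (1ℚ - q) (1ℚ + q) n)
      (^-≤1 (0≤* (0≤⇒- q≤1) (0≤+ 0≤1 0≤q)) (≤-from (q * q) (0≤* 0≤q 0≤q) (e q)) n))
    where
    e : ∀ q → (1ℚ - q) * (1ℚ + q) + q * q ≡ 1ℚ
    e = solve-∀ ℚ-ring

  -- The same with the signs exchanged: (1 + q)^n is at most 1 / (1 - n q) as long as n q < 1.
  [1+]^-bound : ∀ {q} → 0ℚ ≤ q → q ≤ 1ℚ → ∀ n → (1ℚ + q) ^ℚ n * (1ℚ - ι n * q) ≤ 1ℚ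
  [1+]^-bound {q} 0≤q q≤1 n = ℚ.≤-trans
    (*-monoˡ (^-nonneg (0≤+ 0≤1 0≤q) n) (+-cancelʳ (ι n * q) (≤-respˡ (sym (e′ (ι n * q))) (bernoulli⁻ 0≤q q≤1 n))))
    (subst (_≤ 1ℚ) (^-*-distrib (1ℚ + q) (1ℚ - q) n)
      (^-≤1 (0≤* (0≤+ 0≤1 0≤q) (0≤⇒- q≤1)) (≤-from (q * q) (0≤* 0≤q 0≤q) (e q)) n))
    where
    e : ∀ q → (1ℚ + q) * (1ℚ - q) + q * q ≡ 1ℚ
    e = solve-∀ ℚ-ring
    e′ : ∀ q → 1ℚ - q + q ≡ 1ℚ
    e′ = solve-∀ ℚ-ring

  [1+]^≤2 : ∀ {q} n → 0ℚ ≤ q → q ≤ 1ℚ → ι 2 * (ι n * q) ≤ 1ℚ → (1ℚ + q) ^ℚ n ≤ ι 2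
  [1+]^≤2 {q} n 0≤q q≤1 h = ℚ.≤-trans
    (≤-from (A * (1ℚ - ι 2 * w)) (0≤* (^-nonneg (0≤+ 0≤1 0≤q) n) (0≤⇒- h)) (lemma A w))
    (≤-respʳ (ℚ.*-identityʳ (ι 2)) (*-monoˡ (0≤ι 2) ([1+]^-bound 0≤q q≤1 n)))
    where
    A = (1ℚ + q) ^ℚ n
    w = ι n * q
    lemma : ∀ A w → A + A * (1ℚ - (1ℚ + 1ℚ) * w) ≡ (1ℚ + 1ℚ) * (A * (1ℚ - w))
    lemma = solve-∀ ℚ-ring

  [1+]^-excess : ∀ {q} n → 0ℚ ≤ q → q ≤ 1ℚ → ι 2 * (ι n * q) ≤ 1ℚ → (1ℚ + q) ^ℚ n - 1ℚ ≤ ι 2 * (ι n * q)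
  [1+]^-excess {q} n 0≤q q≤1 h = ℚ.≤-trans
    (≤-from (1ℚ - A * (1ℚ - w)) (0≤⇒- ([1+]^-bound 0≤q q≤1 n)) (lemma A w))
    (*-monoʳ (0≤* (0≤ι n) 0≤q) ([1+]^≤2 n 0≤q q≤1 h))
    where
    A = (1ℚ + q) ^ℚ n
    w = ι n * q
    lemma : ∀ A w → A - 1ℚ + (1ℚ - A * (1ℚ - w)) ≡ A * w
    lemma = solve-∀ ℚ-ring

-- Random sublists and expectations over them

module Expectation where
  open import Data.Rational.Base
  open import Tactic.RingSolver using (solve-∀)
  open Rationals

  ⟦_⟧ : Bool → ℚ
  ⟦ b ⟧ = if b then 1ℚ else 0ℚ

  0≤⟦⟧ : ∀ b → 0ℚ ≤ ⟦ b ⟧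
  0≤⟦⟧ true  = 0≤1
  0≤⟦⟧ false = ℚ.≤-refl

  ⟦⟧≤1 : ∀ b → ⟦ b ⟧ ≤ 1ℚ
  ⟦⟧≤1 true  = ℚ.≤-refl
  ⟦⟧≤1 false = 0≤1

  -- The random sublist keeps each entry with probability q. The recursion exposes the entries one
  -- by one, so independence is built in; being a polynomial in q, it is also meaningful for q
  -- outside [0, 1].
  𝔼 : {A : Set} → ℚ → List A → (List A → ℚ) → ℚ
  𝔼 q []       f = f []
  𝔼 q (x ∷ xs) f = q * 𝔼 q xs (λ E → f (x ∷ E)) + (1ℚ - q) * 𝔼 q xs f

  private variable
    A : Set

  𝔼-cong : ∀ q (xs : List A) {f g} → (∀ E → f E ≡ g E) → 𝔼 q xs f ≡ 𝔼 q xs g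
  𝔼-cong q []       h = h []
  𝔼-cong q (x ∷ xs) h = cong₂ (λ a b → q * a + (1ℚ - q) * b) (𝔼-cong q xs λ E → h (x ∷ E)) (𝔼-cong q xs h)

  𝔼-+ : ∀ q (xs : List A) f g → 𝔼 q xs (λ E → f E + g E) ≡ 𝔼 q xs f + 𝔼 q xs g
  𝔼-+ q []       f g = refl
  𝔼-+ q (x ∷ xs) f g = trans
    (cong₂ (λ a b → q * a + (1ℚ - q) * b) (𝔼-+ q xs (λ E → f (x ∷ E)) (λ E → g (x ∷ E))) (𝔼-+ q xs f g))
    (lemma q (𝔼 q xs λ E → f (x ∷ E)) (𝔼 q xs f) (𝔼 q xs λ E → g (x ∷ E)) (𝔼 q xs g))
    where
    lemma : ∀ q a b c d → q * (a + c) + (1ℚ - q) * (b + d) ≡ q * a + (1ℚ - q) * b + (q * c + (1ℚ - q) * d)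
    lemma = solve-∀ ℚ-ring

  𝔼-*ˡ : ∀ q (xs : List A) c f → 𝔼 q xs (λ E → c * f E) ≡ c * 𝔼 q xs f
  𝔼-*ˡ q []       c f = refl
  𝔼-*ˡ q (x ∷ xs) c f = trans
    (cong₂ (λ a b → q * a + (1ℚ - q) * b) (𝔼-*ˡ q xs c (λ E → f (x ∷ E))) (𝔼-*ˡ q xs c f))
    (lemma q c (𝔼 q xs λ E → f (x ∷ E)) (𝔼 q xs f))
    where
    lemma : ∀ q c a b → q * (c * a) + (1ℚ - q) * (c * b) ≡ c * (q * a + (1ℚ - q) * b)
    lemma = solve-∀ ℚ-ring

  𝔼-const : ∀ q (xs : List A) c → 𝔼 q xs (λ _ → c) ≡ c
  𝔼-const q []       c = refl
  𝔼-const q (x ∷ xs) c = trans (cong₂ (λ a b → q * a + (1ℚ - q) * b) (𝔼-const q xs c) (𝔼-const q xs c)) (lemma q c)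
    where
    lemma : ∀ q c → q * c + (1ℚ - q) * c ≡ c
    lemma = solve-∀ ℚ-ring

  IsProb : ℚ → Set
  IsProb q = 0ℚ ≤ q × q ≤ 1ℚ

  convex-mono : ∀ {q} → IsProb q → ∀ {a b c d} → a ≤ c → b ≤ d → q * a + (1ℚ - q) * b ≤ q * c + (1ℚ - q) * d
  convex-mono (0≤q , q≤1) a≤c b≤d = ℚ.+-mono-≤ (*-monoˡ 0≤q a≤c) (*-monoˡ (0≤⇒- q≤1) b≤d)

  𝔼-mono : ∀ {q} → IsProb q → ∀ (xs : List A) {f g} → (∀ E → f E ≤ g E) → 𝔼 q xs f ≤ 𝔼 q xs g
  𝔼-mono pq []       h = h []
  𝔼-mono pq (x ∷ xs) h = convex-mono pq (𝔼-mono pq xs λ E → h (x ∷ E)) (𝔼-mono pq xs h)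

  𝔼-nonneg : ∀ {q} → IsProb q → ∀ (xs : List A) {f} → (∀ E → 0ℚ ≤ f E) → 0ℚ ≤ 𝔼 q xs f
  𝔼-nonneg {q = q} pq xs h = ≤-respˡ (𝔼-const q xs 0ℚ) (𝔼-mono pq xs h)

  𝔼-≤ : ∀ {q} → IsProb q → ∀ (xs : List A) {f c} → (∀ E → f E ≤ c) → 𝔼 q xs f ≤ c
  𝔼-≤ {q = q} pq xs h = ≤-respʳ (𝔼-const q xs _) (𝔼-mono pq xs h)

  -- `⊆` compares underlying sets, so an antitone function ignores order and repetitions. This lets
  -- the list `E ++ E′` stand for a union.
  Antitone : (List A → ℚ) → Set
  Antitone f = ∀ {E E′} → E ⊆ E′ → f E′ ≤ f E

  antitone-∷ : ∀ {f : List A → ℚ} x → Antitone f → Antitone (λ E → f (x ∷ E))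
  antitone-∷ x h E⊆E′ = h λ { (here refl) → here refl ; (there m) → there (E⊆E′ m) }

  antitone-++ : ∀ {f : List A → ℚ} E₀ → Antitone f → Antitone (λ E → f (E₀ ++ E))
  antitone-++ []       h = h
  antitone-++ (x ∷ E₀) h = antitone-++ E₀ (antitone-∷ x h)

  -- In the density of a single entry the expectation is affine with slope a - b ≤ 0, since the
  -- entry can only lower f. This takes the place of a coupling.
  𝔼-anti : ∀ {q q′} → IsProb q → IsProb q′ → q ≤ q′ → ∀ (xs : List A) {f} → Antitone f → 𝔼 q′ xs f ≤ 𝔼 q xs f
  𝔼-anti _ _ _ [] h = ℚ.≤-refl
  𝔼-anti {q = q} {q′} pq pq′ q≤q′ (x ∷ xs) {f} h = ℚ.≤-trans
    (convex-mono pq′ (𝔼-anti pq pq′ q≤q′ xs (antitone-∷ x h)) (𝔼-anti pq pq′ q≤q′ xs h))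
    (≤-from ((q′ - q) * (b - a)) (0≤* (0≤⇒- q≤q′) (0≤⇒- (𝔼-mono pq xs λ E → h there))) (lemma q q′ a b))
    where
    a = 𝔼 q xs (λ E → f (x ∷ E))
    b = 𝔼 q xs f
    lemma : ∀ q q′ a b → q′ * a + (1ℚ - q′) * b + (q′ - q) * (b - a) ≡ q * a + (1ℚ - q) * b
    lemma = solve-∀ ℚ-ring

  -- The union of independent random sets of densities p and q has density 1 - (1 - p)(1 - q).
  infixl 6 _⊎ₚ_
  _⊎ₚ_ : ℚ → ℚ → ℚ
  p ⊎ₚ q = p + q - p * q

  ⊎ₚ-prob : ∀ {p q} → IsProb p → IsProb q → IsProb (p ⊎ₚ q)
  ⊎ₚ-prob {p} {q} (0≤p , p≤1) (0≤q , q≤1) =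
    ≤-respʳ (lemma p q) (0≤+ 0≤p (0≤* 0≤q (0≤⇒- p≤1))) ,
    ≤-from ((1ℚ - p) * (1ℚ - q)) (0≤* (0≤⇒- p≤1) (0≤⇒- q≤1)) (lemma′ p q)
    where
    lemma : ∀ p q → p + q * (1ℚ - p) ≡ p + q - p * q
    lemma = solve-∀ ℚ-ring
    lemma′ : ∀ p q → p + q - p * q + (1ℚ - p) * (1ℚ - q) ≡ 1ℚ
    lemma′ = solve-∀ ℚ-ring

  -- Of the four cases for x, three put it into the union. An antitone f cannot tell these apart,
  -- and their total weight is `p ⊎ₚ q`.
  𝔼-∪ : ∀ p q (xs : List A) {f} → Antitone f →
        𝔼 p xs (λ E → 𝔼 q xs λ E′ → f (E ++ E′)) ≡ 𝔼 (p ⊎ₚ q) xs f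
  𝔼-∪ p q []       h = refl
  𝔼-∪ {A} p q (x ∷ xs) {f} h = begin
    p * 𝔼 p xs (λ E → q * 𝔼 q xs (λ E′ → f (x ∷ E ++ x ∷ E′)) + (1ℚ - q) * 𝔼 q xs (λ E′ → f (x ∷ E ++ E′))) +
    (1ℚ - p) * 𝔼 p xs (λ E → q * 𝔼 q xs (λ E′ → f (E ++ x ∷ E′)) + (1ℚ - q) * 𝔼 q xs (λ E′ → f (E ++ E′)))
      ≡⟨ cong₂ (λ s t → p * s + (1ℚ - p) * t)
           (𝔼-cong p xs λ E → cong (λ s → q * s + (1ℚ - q) * 𝔼 q xs (λ E′ → f (x ∷ E ++ E′))) (𝔼-cong q xs λ E′ → both E E′))
           (𝔼-cong p xs λ E → cong (λ s → q * s + (1ℚ - q) * 𝔼 q xs (λ E′ → f (E ++ E′))) (𝔼-cong q xs λ E′ → right E E′)) ⟩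
    p * 𝔼 p xs (λ E → q * 𝔼 q xs (λ E′ → f (x ∷ E ++ E′)) + (1ℚ - q) * 𝔼 q xs (λ E′ → f (x ∷ E ++ E′))) +
    (1ℚ - p) * 𝔼 p xs (λ E → q * 𝔼 q xs (λ E′ → f (x ∷ E ++ E′)) + (1ℚ - q) * 𝔼 q xs (λ E′ → f (E ++ E′)))
      ≡⟨ cong₂ (λ s t → p * s + (1ℚ - p) * t)
           (𝔼-cong p xs λ E → lemma₁ q (𝔼 q xs λ E′ → f (x ∷ E ++ E′)))
           (trans (𝔼-+ p xs _ _) (cong₂ _+_ (𝔼-*ˡ p xs q _) (𝔼-*ˡ p xs (1ℚ - q) _))) ⟩
    p * a + (1ℚ - p) * (q * a + (1ℚ - q) * b)
      ≡⟨ lemma₂ p q a b ⟩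
    (p ⊎ₚ q) * a + (1ℚ - (p ⊎ₚ q)) * b
      ≡⟨ cong₂ (λ s t → (p ⊎ₚ q) * s + (1ℚ - (p ⊎ₚ q)) * t) (𝔼-∪ p q xs (antitone-∷ x h)) (𝔼-∪ p q xs h) ⟩
    (p ⊎ₚ q) * 𝔼 (p ⊎ₚ q) xs (λ E → f (x ∷ E)) + (1ℚ - (p ⊎ₚ q)) * 𝔼 (p ⊎ₚ q) xs f ∎
    where
    open ≡-Reasoning
    a = 𝔼 p xs (λ E → 𝔼 q xs λ E′ → f (x ∷ E ++ E′))
    b = 𝔼 p xs (λ E → 𝔼 q xs λ E′ → f (E ++ E′))
    move : ∀ E E′ → E ++ x ∷ E′ ⊆ x ∷ E ++ E′
    move E E′ m with ∈-++⁻ E m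
    ... | inj₁ k           = there (∈-++⁺ˡ k)
    ... | inj₂ (here refl) = here refl
    ... | inj₂ (there k)   = there (∈-++⁺ʳ E k)
    back : ∀ E E′ → x ∷ E ++ E′ ⊆ E ++ x ∷ E′
    back E E′ (here refl) = ∈-++⁺ʳ E (here refl)
    back E E′ (there m) with ∈-++⁻ E m
    ... | inj₁ k = ∈-++⁺ˡ k
    ... | inj₂ k = ∈-++⁺ʳ E (there k)
    right : ∀ E E′ → f (E ++ x ∷ E′) ≡ f (x ∷ E ++ E′)
    right E E′ = ℚ.≤-antisym (h (back E E′)) (h (move E E′))
    both : ∀ E E′ → f (x ∷ E ++ x ∷ E′) ≡ f (x ∷ E ++ E′)
    both E E′ = ℚ.≤-antisym
      (h λ { (here refl) → here refl ; (there m) → there (back E E′ (there m)) })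
      (h λ { (here refl) → here refl ; (there m) → move E E′ m })
    lemma₁ : ∀ q a → q * a + (1ℚ - q) * a ≡ a
    lemma₁ = solve-∀ ℚ-ring
    lemma₂ : ∀ p q a b → p * a + (1ℚ - p) * (q * a + (1ℚ - q) * b) ≡ (p + q - p * q) * a + (1ℚ - (p + q - p * q)) * b
    lemma₂ = solve-∀ ℚ-ring

  count : (A → Bool) → List A → ℕ
  count b []       = 0
  count b (x ∷ xs) = if b x then suc (count b xs) else count b xs

  avoids : (A → Bool) → List A → Bool
  avoids b []      = true
  avoids b (x ∷ E) = if b x then false else avoids b E

  𝔼-avoids : ∀ q (b : A → Bool) xs → 𝔼 q xs (λ E → ⟦ avoids b E ⟧) ≡ (1ℚ - q) ^ℚ count b xs
  𝔼-avoids q b []       = refl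
  𝔼-avoids q b (x ∷ xs) with b x
  ... | true  = trans (cong₂ (λ s t → q * s + (1ℚ - q) * t) (𝔼-const q xs 0ℚ) (𝔼-avoids q b xs)) (lemma q _)
    where
    lemma : ∀ q c → q * 0ℚ + (1ℚ - q) * c ≡ (1ℚ - q) * c
    lemma = solve-∀ ℚ-ring
  ... | false = trans (cong (λ s → q * s + (1ℚ - q) * s) (𝔼-avoids q b xs)) (lemma q _)
    where
    lemma : ∀ q c → q * c + (1ℚ - q) * c ≡ c
    lemma = solve-∀ ℚ-ring

  avoids-false : ∀ (b : A → Bool) E → avoids b E ≡ false → ∃[ e ] (e ∈ E × b e ≡ true)
  avoids-false b (x ∷ E) h with b x in eq
  ... | true  = x , here refl , eq
  ... | false = let (e , m , t) = avoids-false b E h in e , there m , t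

  sumℚ : List ℚ → ℚ
  sumℚ = foldr _+_ 0ℚ

  sumℚ-++ : ∀ xs ys → sumℚ (xs ++ ys) ≡ sumℚ xs + sumℚ ys
  sumℚ-++ []       ys = sym (ℚ.+-identityˡ (sumℚ ys))
  sumℚ-++ (x ∷ xs) ys = trans (cong (x +_) (sumℚ-++ xs ys)) (sym (ℚ.+-assoc x (sumℚ xs) (sumℚ ys)))

  sumℚ-*ˡ : ∀ c (f : A → ℚ) xs → sumℚ (map (λ x → c * f x) xs) ≡ c * sumℚ (map f xs)
  sumℚ-*ˡ c f []       = sym (ℚ.*-zeroʳ c)
  sumℚ-*ˡ c f (x ∷ xs) = trans (cong (c * f x +_) (sumℚ-*ˡ c f xs)) (sym (ℚ.*-distribˡ-+ c (f x) (sumℚ (map f xs))))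

  sumℚ-cong : ∀ {f g : A → ℚ} {xs} → All (λ x → f x ≡ g x) xs → sumℚ (map f xs) ≡ sumℚ (map g xs)
  sumℚ-cong []       = refl
  sumℚ-cong (e ∷ es) = cong₂ _+_ e (sumℚ-cong es)

  sublists-length : ∀ (xs : List A) → All (λ E → length E ℕ.≤ length xs) (sublists xs)
  sublists-length []       = ℕ.z≤n ∷ []
  sublists-length (x ∷ xs) = All.++⁺ (All.map⁺ (All.map ℕ.s≤s (sublists-length xs)))
    (All.map ℕ.m≤n⇒m≤1+n (sublists-length xs))

  -- Splitting `sublists` at its first entry matches the recursion of `𝔼`. The truncated subtraction
  -- is exact because no sublist is longer than the list.
  sublists-sum : ∀ q (xs : List A) f →
    sumℚ (map (λ E → q ^ℚ length E * (1ℚ - q) ^ℚ (length xs ℕ.∸ length E) * f E) (sublists xs)) ≡ 𝔼 q xs f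
  sublists-sum q []       f = trans (ℚ.+-identityʳ (1ℚ * 1ℚ * f [])) (ℚ.*-identityˡ (f []))
  sublists-sum {A} q (x ∷ xs) f = begin
    sumℚ (map w (map (x ∷_) L ++ L))
      ≡⟨ cong sumℚ (List.map-++ w (map (x ∷_) L) L) ⟩
    sumℚ (map w (map (x ∷_) L) ++ map w L)
      ≡⟨ sumℚ-++ (map w (map (x ∷_) L)) (map w L) ⟩
    sumℚ (map w (map (x ∷_) L)) + sumℚ (map w L)
      ≡⟨ cong₂ _+_ (trans (cong sumℚ (sym (List.map-∘ L))) (trans (sumℚ-cong (All.universal first L)) (sumℚ-*ˡ q _ L)))
                   (trans (sumℚ-cong (All.map (λ {E} → second {E}) (sublists-length xs))) (sumℚ-*ˡ (1ℚ - q) _ L)) ⟩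
    q * sumℚ (map (λ E → w₀ E * f (x ∷ E)) L) + (1ℚ - q) * sumℚ (map (λ E → w₀ E * f E) L)
      ≡⟨ cong₂ (λ s t → q * s + (1ℚ - q) * t) (sublists-sum q xs λ E → f (x ∷ E)) (sublists-sum q xs f) ⟩
    q * 𝔼 q xs (λ E → f (x ∷ E)) + (1ℚ - q) * 𝔼 q xs f ∎
    where
    open ≡-Reasoning
    L = sublists xs
    w w₀ : List A → ℚ
    w E = q ^ℚ length E * (1ℚ - q) ^ℚ (suc (length xs) ℕ.∸ length E) * f E
    w₀ E = q ^ℚ length E * (1ℚ - q) ^ℚ (length xs ℕ.∸ length E)
    lemma₁ : ∀ q a b c → q * a * b * c ≡ q * (a * b * c)
    lemma₁ = solve-∀ ℚ-ring
    lemma₂ : ∀ q a b c → a * (q * b) * c ≡ q * (a * b * c)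
    lemma₂ = solve-∀ ℚ-ring
    first : ∀ E → w (x ∷ E) ≡ q * (w₀ E * f (x ∷ E))
    first E = lemma₁ q (q ^ℚ length E) ((1ℚ - q) ^ℚ (length xs ℕ.∸ length E)) (f (x ∷ E))
    second : ∀ {E} → length E ℕ.≤ length xs → w E ≡ (1ℚ - q) * (w₀ E * f E)
    second {E} h = trans
      (cong (λ k → q ^ℚ length E * (1ℚ - q) ^ℚ k * f E) (ℕ.+-∸-assoc 1 h))
      (lemma₂ (1ℚ - q) (q ^ℚ length E) ((1ℚ - q) ^ℚ (length xs ℕ.∸ length E)) (f E))

  sumℚ-filter : ∀ {P : Pred A 0ℓ} (P? : Decidable P) (w : A → ℚ) xs →
    sumℚ (map w (filter P? xs)) ≡ sumℚ (map (λ x → w x * ⟦ does (P? x) ⟧) xs)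
  sumℚ-filter P? w [] = refl
  sumℚ-filter P? w (x ∷ xs) with P? x
  ... | yes _ = cong₂ _+_ (sym (ℚ.*-identityʳ (w x))) (sumℚ-filter P? w xs)
  ... | no _  = trans (sumℚ-filter P? w xs)
    (trans (sym (ℚ.+-identityˡ _)) (cong (_+ _) (sym (ℚ.*-zeroʳ (w x)))))

  approx-sum : ∀ (w : A → ℝ) L m → approx (ℝ.sum (map w L)) m ≡ sumℚ (map (λ E → approx (w E) m) L)
  approx-sum w []      m = refl
  approx-sum w (x ∷ L) m = cong (approx (w x) m +_) (approx-sum w L m)

  approx-^ : ∀ (p : ℝ) k m → approx (p ℝ.^ k) m ≡ approx p m ^ℚ k
  approx-^ p zero    m = refl
  approx-^ p (suc k) m = cong (approx p m *_) (approx-^ p k m)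

  -- Both sides are the same polynomial, so nothing is assumed about the rational `approx p m`,
  -- which may lie outside [0, 1].
  approx-probability : ∀ {n} (p : ℝ) {P : Pred (Graph n) 0ℓ} (P? : Decidable P) m →
    approx (probability p P?) m ≡ 𝔼 (approx p m) (vertexPairs n) (λ E → ⟦ does (P? (fromEdges E)) ⟧)
  approx-probability {n} p P? m = trans
    (approx-sum _ (filter (λ E → P? (fromEdges E)) L) m)
    (trans (sumℚ-filter (λ E → P? (fromEdges E)) _ L)
      (trans (sumℚ-cong (All.universal weight L))
        (sublists-sum (approx p m) (vertexPairs n) (λ E → ⟦ does (P? (fromEdges E)) ⟧))))
    where
    L = sublists (vertexPairs n)
    N = length (vertexPairs n)
    weight : ∀ E → approx (p ℝ.^ length E ℝ.* (ℝ.1ℝ ℝ.- p) ℝ.^ (N ℕ.∸ length E)) m * ⟦ does (P? (fromEdges E)) ⟧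
                 ≡ approx p m ^ℚ length E * (1ℚ - approx p m) ^ℚ (N ℕ.∸ length E) * ⟦ does (P? (fromEdges E)) ⟧
    weight E = cong (_* _) (cong₂ _*_ (approx-^ p (length E) m) (approx-^ (ℝ.1ℝ ℝ.- p) (N ℕ.∸ length E) m))

-- Vertex orderings, their gaps and the potential

module Arrangements where
  open import Data.Fin.Base using (zero; suc)
  open import Data.Fin.Subset using (∣_∣)
  open import Data.Nat.Base
  open import Data.Nat.DivMod using (_%_; m<n⇒m%n≡m; n%n≡0; m%n<n)
  open import Data.Nat.ListAction using () renaming (sum to sumᴸ)
  open import Data.Nat.Properties
  open import Data.Vec.Base as Vec using (Vec; fromList; lookup)
  open import Algebra.Properties.Semiring.Sum +-*-semiring using (∑-comm; ∑-distrib-+; sum-cong-≗; sum-replicate-zero; *-distribˡ-sum; *-distribʳ-sum; sum-permute) renaming (sum to Σᶠ) public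

  χ : Bool → ℕ
  χ b = if b then 1 else 0

  χ≤1 : ∀ b → χ b ≤ 1
  χ≤1 true  = s≤s z≤n
  χ≤1 false = z≤n

  Σᶠ-mono : ∀ {n} {f g : Fin n → ℕ} → (∀ i → f i ≤ g i) → Σᶠ f ≤ Σᶠ g
  Σᶠ-mono {zero}  h = z≤n
  Σᶠ-mono {suc n} h = +-mono-≤ (h zero) (Σᶠ-mono (h ∘ suc))

  Σᶠ-const : ∀ n c → Σᶠ {n} (λ _ → c) ≡ n * c
  Σᶠ-const zero    c = refl
  Σᶠ-const (suc n) c = cong (c +_) (Σᶠ-const n c)

  Σᶠχ≤n : ∀ {n} (b : Fin n → Bool) → Σᶠ (χ ∘ b) ≤ n
  Σᶠχ≤n {n} b = ≤-trans (Σᶠ-mono (χ≤1 ∘ b)) (≤-reflexive (trans (Σᶠ-const n 1) (*-identityʳ n)))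

  Σᶠ-term : ∀ {n} (f : Fin n → ℕ) i → f i ≤ Σᶠ f
  Σᶠ-term f zero    = m≤m+n (f zero) _
  Σᶠ-term f (suc i) = ≤-trans (Σᶠ-term (f ∘ suc) i) (m≤n+m _ (f zero))

  ∣tabulate∣ : ∀ {n} (b : Fin n → Bool) → ∣ Vec.tabulate b ∣ ≡ Σᶠ (χ ∘ b)
  ∣tabulate∣ {zero}  b = refl
  ∣tabulate∣ {suc n} b with b zero
  ... | true  = cong suc (∣tabulate∣ (b ∘ suc))
  ... | false = ∣tabulate∣ (b ∘ suc)

  degree-Σᶠ : ∀ {n} (G : Graph n) v → degree G v ≡ Σᶠ (λ u → χ (adj G v u))
  degree-Σᶠ G v = ∣tabulate∣ (adj G v)

  sumᴸ-tabulate : ∀ {n} (f : Fin n → ℕ) → sumᴸ (tabulate f) ≡ Σᶠ f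
  sumᴸ-tabulate {zero}  f = refl
  sumᴸ-tabulate {suc n} f = cong (f zero +_) (sumᴸ-tabulate (f ∘ suc))

  T-true : ∀ {b} → T b → b ≡ true
  T-true {true} _ = refl

  module _ {n : ℕ} where

    V : Set
    V = Fin n

    Arrangement : List V → Set
    Arrangement l = l ↭ allFin n

    arrangement-sum : ∀ {l} → Arrangement l → ∀ (f : V → ℕ) → sumᴸ (map f l) ≡ Σᶠ f
    arrangement-sum p f = trans (sum-↭ (map⁺ f p))
      (trans (cong sumᴸ (List.map-tabulate id f)) (sumᴸ-tabulate f))

    arrangement-∈ : ∀ {l} → Arrangement l → ∀ v → v ∈ l
    arrangement-∈ p v = ∈-resp-↭ (↭-sym p) (∈-allFin v)

    arrangement-unique : ∀ {l} → Arrangement l → Unique l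
    arrangement-unique p = Unique-resp-↭ (setoid V) (↭⇒↭ₛ (↭-sym p)) (allFin⁺ n)

    arrangement-length : ∀ {l} → Arrangement l → length l ≡ n
    arrangement-length p = trans (↭-length p) (List.length-tabulate id)

    mkArrangement : ∀ {l} → Unique l → (∀ v → v ∈ l) → Arrangement l
    mkArrangement u full = ∼bag⇒↭ (unique∧set⇒bag u (allFin⁺ n) (mk⇔ (λ _ → ∈-allFin _) (λ _ → full _)))

    arrangement? : Decidable Arrangement
    arrangement? l = map′ (λ (u , f) → mkArrangement u f)
      (λ p → arrangement-unique p , arrangement-∈ p)
      (allPairs? (λ u v → ¬? (u Fin.≟ v)) l ×-dec Fin.all? (_∈? l))
      where open ListMembership (Fin._≟_ {n}) using (_∈?_)

    gap : Graph n → V → V → ℕ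
    gap H u v = if adj H u v then 0 else 1

    gaps : Graph n → List V → ℕ
    gaps H []          = 0
    gaps H (x ∷ [])    = 0
    gaps H (x ∷ y ∷ l) = gap H x y + gaps H (y ∷ l)

    lastOf : V → List V → V
    lastOf x []      = x
    lastOf x (y ∷ l) = lastOf y l

    gap≤1 : ∀ H u v → gap H u v ≤ 1
    gap≤1 H u v with adj H u v
    ... | true  = z≤n
    ... | false = s≤s z≤n

    gap-sym : ∀ H u v → gap H u v ≡ gap H v u
    gap-sym H u v = cong (λ b → if b then 0 else 1) (symmetric H u v)

    gap-adj : ∀ H {u v} → T (adj H u v) → gap H u v ≡ 0
    gap-adj H {u} {v} t = cong (λ b → if b then 0 else 1) (T-true t)

    gap≡0⇒adj : ∀ H {u v} → gap H u v ≡ 0 → T (adj H u v)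
    gap≡0⇒adj H {u} {v} e with adj H u v
    ... | true = _

    gaps≤length : ∀ H l → gaps H l ≤ length l
    gaps≤length H []          = z≤n
    gaps≤length H (x ∷ [])    = z≤n
    gaps≤length H (x ∷ y ∷ l) = +-mono-≤ (gap≤1 H x y) (gaps≤length H (y ∷ l))

    gaps-split : ∀ H pre y z suf →
      gaps H (pre ++ y ∷ z ∷ suf) ≡ gaps H (pre ++ y ∷ []) + (gap H y z + gaps H (z ∷ suf))
    gaps-split H []            y z suf = refl
    gaps-split H (a ∷ [])      y z suf = trans
      (cong (_+ (gap H y z + gaps H (z ∷ suf))) (sym (+-identityʳ (gap H a y)))) refl
    gaps-split H (a ∷ b ∷ pre) y z suf = trans
      (cong (gap H a b +_) (gaps-split H (b ∷ pre) y z suf))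
      (sym (+-assoc (gap H a b) (gaps H (b ∷ pre ++ y ∷ [])) _))

    gaps-reverse : ∀ H l → gaps H (reverse l) ≡ gaps H l
    gaps-reverse H []          = refl
    gaps-reverse H (x ∷ [])    = refl
    gaps-reverse H (x ∷ y ∷ l) = begin
      gaps H (reverse (x ∷ y ∷ l))
        ≡⟨ cong (gaps H) (trans (List.unfold-reverse x (y ∷ l)) (cong (_++ x ∷ []) (List.unfold-reverse y l))) ⟩
      gaps H ((reverse l ++ y ∷ []) ++ x ∷ [])
        ≡⟨ cong (gaps H) (List.++-assoc (reverse l) (y ∷ []) (x ∷ [])) ⟩
      gaps H (reverse l ++ y ∷ x ∷ [])
        ≡⟨ gaps-split H (reverse l) y x [] ⟩
      gaps H (reverse l ++ y ∷ []) + (gap H y x + 0)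
        ≡⟨ cong₂ _+_ (trans (cong (gaps H) (sym (List.unfold-reverse y l))) (gaps-reverse H (y ∷ l)))
                     (trans (+-identityʳ _) (gap-sym H y x)) ⟩
      gaps H (y ∷ l) + gap H x y
        ≡⟨ +-comm (gaps H (y ∷ l)) _ ⟩
      gap H x y + gaps H (y ∷ l) ∎
      where open ≡-Reasoning

    lastOf-++ : ∀ x pre z suf → lastOf x (pre ++ z ∷ suf) ≡ lastOf z suf
    lastOf-++ x []        z suf = refl
    lastOf-++ x (a ∷ pre) z suf = lastOf-++ a pre z suf

    snoc-lastOf : ∀ x l → ∃[ s ] (x ∷ l ≡ s ++ lastOf x l ∷ [])
    snoc-lastOf x []      = [] , refl
    snoc-lastOf x (y ∷ l) = let (s , e) = snoc-lastOf y l in x ∷ s , cong (x ∷_) e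

    -- Pósa's rotation of `pre ++ y ∷ z ∷ suf` along an edge from its first vertex to z: everything
    -- before z is reversed, so y becomes first. Only the tail after y is returned, which keeps the
    -- new first vertex visible in types.
    rotate : List V → V → V → List V → List V
    rotate pre y z suf = reverse pre ++ z ∷ suf

    rotate-↭ : ∀ pre y z suf → y ∷ rotate pre y z suf ↭ pre ++ y ∷ z ∷ suf
    rotate-↭ pre y z suf = ↭-trans (↭-reflexive e)
      (↭-trans (++⁺ʳ (z ∷ suf) (↭-reverse (pre ++ y ∷ [])))
        (↭-reflexive (List.++-assoc pre (y ∷ []) (z ∷ suf))))
      where
      e : y ∷ reverse pre ++ z ∷ suf ≡ reverse (pre ++ y ∷ []) ++ z ∷ suf
      e = cong (_++ z ∷ suf) (sym (List.reverse-++ pre (y ∷ [])))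

    rotate-last : ∀ pre y z suf → lastOf y (rotate pre y z suf) ≡ lastOf z suf
    rotate-last pre y z suf = lastOf-++ y (reverse pre) z suf

    -- The rotation trades the pair y z for x z, which is an edge; all other pairs survive, some of
    -- them reversed.
    rotate-gaps : ∀ H x l pre y z suf → x ∷ l ≡ pre ++ y ∷ z ∷ suf → T (adj H x z) →
      gaps H (y ∷ rotate pre y z suf) ≤ gaps H (x ∷ l)
    rotate-gaps H x l []        y z suf refl t = ≤-refl
    rotate-gaps H x l (x ∷ pre) y z suf refl t = begin
      gaps H (y ∷ reverse (x ∷ pre) ++ z ∷ suf)
        ≡⟨ cong (λ k → gaps H (y ∷ k ++ z ∷ suf)) (List.unfold-reverse x pre) ⟩
      gaps H (y ∷ (reverse pre ++ x ∷ []) ++ z ∷ suf)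
        ≡⟨ cong (λ k → gaps H (y ∷ k)) (List.++-assoc (reverse pre) (x ∷ []) (z ∷ suf)) ⟩
      gaps H ((y ∷ reverse pre) ++ x ∷ z ∷ suf)
        ≡⟨ gaps-split H (y ∷ reverse pre) x z suf ⟩
      gaps H (y ∷ reverse pre ++ x ∷ []) + (gap H x z + gaps H (z ∷ suf))
        ≡⟨ cong₂ (λ s t → s + (t + gaps H (z ∷ suf))) e (gap-adj H t) ⟩
      gaps H ((x ∷ pre) ++ y ∷ []) + gaps H (z ∷ suf)
        ≤⟨ +-monoʳ-≤ (gaps H ((x ∷ pre) ++ y ∷ [])) (m≤n+m _ (gap H y z)) ⟩
      gaps H ((x ∷ pre) ++ y ∷ []) + (gap H y z + gaps H (z ∷ suf))
        ≡⟨ gaps-split H (x ∷ pre) y z suf ⟨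
      gaps H ((x ∷ pre) ++ y ∷ z ∷ suf) ∎
      where
      open ≤-Reasoning
      e : gaps H (y ∷ reverse pre ++ x ∷ []) ≡ gaps H ((x ∷ pre) ++ y ∷ [])
      e = trans (cong (gaps H) (sym (trans (List.reverse-++ (x ∷ pre) (y ∷ [])) (cong (y ∷_) (List.unfold-reverse x pre)))))
            (gaps-reverse H ((x ∷ pre) ++ y ∷ []))

    find-gap : ∀ H x l → 1 ≤ gaps H (x ∷ l) →
      ∃[ pre ] ∃[ y ] ∃[ z ] ∃[ suf ] (x ∷ l ≡ pre ++ y ∷ z ∷ suf × gap H y z ≡ 1)
    find-gap H x (y ∷ l) h with gap H x y in e
    ... | suc k = [] , x , y , l , refl , trans e (cong suc (n≤0⇒n≡0 (s≤s⁻¹ (subst (_≤ 1) e (gap≤1 H x y)))))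
    ... | zero  = let (pre , y′ , z , suf , eq , g) = find-gap H y l h in
      x ∷ pre , y′ , z , suf , cong (x ∷_) eq , g

    fromList-unique : ∀ {l : List V} → Unique l → VecUnique (fromList l)
    fromList-unique []       = []
    fromList-unique (a ∷ as) = VecAll.fromList⁺ a ∷ fromList-unique as

    unique-length : ∀ {l : List V} → Unique l → length l ≤ n
    unique-length u = Fin.injective⇒≤ λ {i} {j} → lookup-injective (fromList-unique u) i j

    private
      path-lookup : ∀ H x l → gaps H (x ∷ l) ≡ 0 → (j : Fin (length l)) →
        T (adj H (lookup (fromList (x ∷ l)) (inject₁ j)) (lookup (fromList l) j))
      path-lookup H x (y ∷ l) e zero    = gap≡0⇒adj H (m+n≡0⇒m≡0 (gap H x y) e)
      path-lookup H x (y ∷ l) e (suc j) = path-lookup H y l (m+n≡0⇒n≡0 (gap H x y) e) j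

      lookup-last : ∀ x l → lookup (fromList (x ∷ l)) (fromℕ (length l)) ≡ lastOf x l
      lookup-last x []      = refl
      lookup-last x (y ∷ l) = lookup-last y l

      cyclicSuc-inject₁ : ∀ {k} (j : Fin k) → cyclicSuc (inject₁ j) ≡ suc j
      cyclicSuc-inject₁ {k} j = Fin.toℕ-injective (trans (Fin.toℕ-fromℕ< (m%n<n (suc (toℕ (inject₁ j))) (suc k)))
        (trans (cong (λ i → suc i % suc k) (Fin.toℕ-inject₁ j)) (m<n⇒m%n≡m (s≤s (Fin.toℕ<n j)))))

      cyclicSuc-fromℕ : ∀ k → cyclicSuc (fromℕ k) ≡ zero
      cyclicSuc-fromℕ k = Fin.toℕ-injective (trans (Fin.toℕ-fromℕ< (m%n<n (suc (toℕ (fromℕ k))) (suc k)))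
        (trans (cong (λ i → suc i % suc k) (Fin.toℕ-fromℕ k)) (n%n≡0 (suc k))))

    closed⇒hamiltonian : ∀ H → 3 ≤ n → ∀ x l → Arrangement (x ∷ l) →
      gaps H (x ∷ l) ≡ 0 → T (adj H (lastOf x l) x) → Hamiltonian H
    closed⇒hamiltonian H 3≤n x l arr g t = suc (length l) , fromList (x ∷ l) ,
      isCycle (subst (3 ≤_) (sym (arrangement-length arr)) 3≤n) (fromList-unique (arrangement-unique arr)) successive ,
      λ v → ∈-fromList⁺ (arrangement-∈ arr v)
      where
      c = fromList (x ∷ l)
      successive : ∀ i → T (adj H (lookup c i) (lookup c (cyclicSuc i)))
      successive i with view i
      ... | ‵fromℕ     = subst T (sym (cong₂ (λ a b → adj H a (lookup c b)) (lookup-last x l) (cyclicSuc-fromℕ (length l)))) t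
      ... | ‵inject₁ j = subst (λ b → T (adj H (lookup c (inject₁ j)) (lookup c b))) (sym (cyclicSuc-inject₁ j)) (path-lookup H x l g j)

    infix 4 _⊑_
    _⊑_ : Graph n → Graph n → Set
    H ⊑ H′ = ∀ u v → T (adj H u v) → T (adj H′ u v)

    hamiltonian-⊑ : ∀ {H H′} → H ⊑ H′ → Hamiltonian H → Hamiltonian H′
    hamiltonian-⊑ s (k , c , isCycle a b d , f) = k , c , isCycle a b (λ i → s _ _ (d i)) , f

    gap-⊑ : ∀ {H H′} → H ⊑ H′ → ∀ u v → gap H′ u v ≤ gap H u v
    gap-⊑ {H} {H′} s u v with adj H u v in e
    ... | false = gap≤1 H′ u v
    ... | true  = ≤-reflexive (gap-adj H′ (s u v (subst T (sym e) _)))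

    gaps-⊑ : ∀ {H H′} → H ⊑ H′ → ∀ l → gaps H′ l ≤ gaps H l
    gaps-⊑ s []          = z≤n
    gaps-⊑ s (x ∷ [])    = z≤n
    gaps-⊑ {H} {H′} s (x ∷ y ∷ l) = +-mono-≤ (gap-⊑ {H} {H′} s x y) (gaps-⊑ {H} {H′} s (y ∷ l))

    private
      allLists : ℕ → List (List V)
      allLists zero    = [] ∷ []
      allLists (suc k) = cartesianProductWith _∷_ (allFin n) (allLists k)

      ∈-allLists : ∀ (l : List V) → l ∈ allLists (length l)
      ∈-allLists []      = here refl
      ∈-allLists (x ∷ l) = ∈-cartesianProductWith⁺ _∷_ (∈-allFin x) (∈-allLists l)

      arrangements : List (List V)
      arrangements = filter arrangement? (allLists n)

      ∈-arrangements : ∀ {l} → Arrangement l → l ∈ arrangements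
      ∈-arrangements {l} arr = ∈-filter⁺ arrangement? (subst (λ k → l ∈ allLists k) (arrangement-length arr) (∈-allLists l)) arr

    abstract
      best : Graph n → List V
      best H = argmin (gaps H) (allFin n) arrangements

      best-arrangement : ∀ H → Arrangement (best H)
      best-arrangement H = argmin-all (gaps H) ↭-refl (All.all-filter arrangement? (allLists n))

      best-minimal : ∀ H {l} → Arrangement l → gaps H (best H) ≤ gaps H l
      best-minimal H arr = All.lookup (f[argmin]≤f[xs] {f = gaps H} (allFin n) arrangements) (∈-arrangements arr)

    minGaps : Graph n → ℕ
    minGaps H = gaps H (best H)

    abstract
      -- The successor separates a non-Hamiltonian graph with a Hamilton path from a Hamiltonian
      -- one, so that closing the path lowers the potential as well.
      φ : Graph n → ℕ
      φ H = if does (hamiltonian? H) then 0 else suc (minGaps H)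

      φ-yes : ∀ {H} → Hamiltonian H → φ H ≡ 0
      φ-yes {H} h = cong (λ b → if b then 0 else suc (minGaps H)) (dec-true (hamiltonian? H) h)

      φ-no : ∀ {H} → ¬ Hamiltonian H → φ H ≡ suc (minGaps H)
      φ-no {H} ¬h = cong (λ b → if b then 0 else suc (minGaps H)) (dec-false (hamiltonian? H) ¬h)

      hamiltonian-⊎ : ∀ (H : Graph n) → Hamiltonian H ⊎ ¬ Hamiltonian H
      hamiltonian-⊎ H = toSum (hamiltonian? H)

    φ≤1+gaps : ∀ H {l} → Arrangement l → φ H ≤ suc (gaps H l)
    φ≤1+gaps H arr with hamiltonian-⊎ H
    ... | inj₁ h  = ≤-trans (≤-reflexive (φ-yes h)) z≤n
    ... | inj₂ ¬h = ≤-trans (≤-reflexive (φ-no ¬h)) (s≤s (best-minimal H arr))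

    φ≤1+n : ∀ H → φ H ≤ suc n
    φ≤1+n H = ≤-trans (φ≤1+gaps H ↭-refl) (s≤s (≤-trans (gaps≤length H (allFin n)) (≤-reflexive (List.length-tabulate id))))

    φ-⊑ : ∀ {H H′} → H ⊑ H′ → φ H′ ≤ φ H
    φ-⊑ {H} {H′} s with hamiltonian-⊎ H
    ... | inj₁ h  = ≤-trans (≤-reflexive (φ-yes (hamiltonian-⊑ {H} {H′} s h))) z≤n
    ... | inj₂ ¬h = ≤-trans (φ≤1+gaps H′ (best-arrangement H))
      (≤-trans (s≤s (gaps-⊑ {H} {H′} s (best H))) (≤-reflexive (sym (φ-no ¬h))))

    Optimal : Graph n → List V → Set
    Optimal H l = Arrangement l × gaps H l ≤ minGaps H

    -- The last and the first vertex are adjacent, so the ordering closes up to a cyclic one, which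
    -- may be cut open at any pair. Cutting it at a gap removes that gap.
    cut-at-gap : ∀ H x l → Arrangement (x ∷ l) → T (adj H (lastOf x l) x) → 1 ≤ gaps H (x ∷ l) →
      minGaps H < gaps H (x ∷ l)
    cut-at-gap H′ x l arr t g with find-gap H′ x l g
    ... | pre , y , z , suf , eq , gyz = begin
      suc (minGaps H′)
        ≤⟨ s≤s (best-minimal H′ arr′) ⟩
      suc (gaps H′ (z ∷ suf ++ pre ++ y ∷ []))
        ≡⟨ cong suc joined ⟩
      suc (gaps H′ (z ∷ suf) + gaps H′ (pre ++ y ∷ []))
        ≡⟨ cong suc (+-comm (gaps H′ (z ∷ suf)) _) ⟩
      suc (gaps H′ (pre ++ y ∷ []) + gaps H′ (z ∷ suf))
        ≡⟨ +-suc _ _ ⟨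
      gaps H′ (pre ++ y ∷ []) + (1 + gaps H′ (z ∷ suf))
        ≡⟨ cong (λ k → gaps H′ (pre ++ y ∷ []) + (k + gaps H′ (z ∷ suf))) gyz ⟨
      gaps H′ (pre ++ y ∷ []) + (gap H′ y z + gaps H′ (z ∷ suf))
        ≡⟨ gaps-split H′ pre y z suf ⟨
      gaps H′ (pre ++ y ∷ z ∷ suf)
        ≡⟨ cong (gaps H′) eq ⟨
      gaps H′ (x ∷ l) ∎
      where
      open ≤-Reasoning
      arr′ : Arrangement (z ∷ suf ++ pre ++ y ∷ [])
      arr′ = ↭-trans (++-comm (z ∷ suf) (pre ++ y ∷ []))
        (↭-trans (↭-reflexive (trans (List.++-assoc pre (y ∷ []) (z ∷ suf)) (sym eq))) arr)
      last≡ : lastOf z suf ≡ lastOf x l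
      last≡ = trans (sym (lastOf-++ x pre y (z ∷ suf))) (lemma pre eq)
        where
        lemma : ∀ pre → x ∷ l ≡ pre ++ y ∷ z ∷ suf → lastOf x (pre ++ y ∷ z ∷ suf) ≡ lastOf x l
        lemma []        refl = refl
        lemma (_ ∷ pre) refl = refl
      head-x : ∃[ p ] (pre ++ y ∷ [] ≡ x ∷ p)
      head-x = lemma pre eq
        where
        lemma : ∀ pre → x ∷ l ≡ pre ++ y ∷ z ∷ suf → ∃[ p ] (pre ++ y ∷ [] ≡ x ∷ p)
        lemma []        refl = [] , refl
        lemma (_ ∷ pre) refl = _ , refl
      joined : gaps H′ (z ∷ suf ++ pre ++ y ∷ []) ≡ gaps H′ (z ∷ suf) + gaps H′ (pre ++ y ∷ [])
      joined = let (s , e) = snoc-lastOf z suf ; (p , e′) = head-x in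
        trans (cong₂ (λ a b → gaps H′ (a ++ b)) e e′)
        (trans (cong (gaps H′) (List.++-assoc s (lastOf z suf ∷ []) (x ∷ p)))
        (trans (gaps-split H′ s (lastOf z suf) x p)
        (cong₂ _+_ (cong (gaps H′) (sym e))
          (cong₂ _+_ (gap-adj H′ (subst (λ w → T (adj H′ w x)) (sym last≡) t)) (cong (gaps H′) (sym e′))))))

    -- Joining the ends of an optimal ordering closes a cycle. Either the cycle has no gap and is
    -- Hamiltonian, or it is reopened at a gap.
    closing-edge : ∀ {H H′} → 3 ≤ n → ¬ Hamiltonian H → H ⊑ H′ → ∀ x l → Optimal H (x ∷ l) →
      T (adj H′ (lastOf x l) x) → φ H′ < φ H
    closing-edge {H} {H′} 3≤n ¬h s x l (arr , opt) t = subst (φ H′ <_) (sym (φ-no ¬h)) (s≤s (case (hamiltonian-⊎ H′) (1 ≤? gaps H′ (x ∷ l))))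
      where
      case : Hamiltonian H′ ⊎ ¬ Hamiltonian H′ → Dec (1 ≤ gaps H′ (x ∷ l)) → φ H′ ≤ minGaps H
      case (inj₁ h′)  _       = ≤-trans (≤-reflexive (φ-yes h′)) z≤n
      case (inj₂ ¬h′) (no g)  = ⊥-elim (¬h′ (closed⇒hamiltonian H′ 3≤n x l arr (n<1⇒n≡0 (≰⇒> g)) t))
      case (inj₂ ¬h′) (yes g) = ≤-trans (≤-reflexive (φ-no ¬h′))
        (≤-trans (cut-at-gap H′ x l arr t g) (≤-trans (gaps-⊑ {H} {H′} s (x ∷ l)) opt))

-- Boosters: pairs whose addition lowers the potential

module Boosters where
  open import Data.Nat.Base
  open import Data.Nat.ListAction using () renaming (sum to sumᴸ)
  open import Data.Nat.Properties
  open Arrangements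
  open Expectation using (count)

  private
    sumOver : {A : Set} → (A → ℕ) → List A → ℕ
    sumOver f l = sumᴸ (map f l)

    count-filter : ∀ {A : Set} {P : Pred A 0ℓ} (P? : Decidable P) b xs →
      count b (filter P? xs) ≡ sumOver (λ x → if does (P? x) then χ (b x) else 0) xs
    count-filter P? b [] = refl
    count-filter P? b (x ∷ xs) with does (P? x)
    ... | false = count-filter P? b xs
    ... | true with b x
    ...   | true  = cong suc (count-filter P? b xs)
    ...   | false = count-filter P? b xs

    sum-allFin : ∀ {n} (f : Fin n → ℕ) → sumOver f (allFin n) ≡ Σᶠ f
    sum-allFin f = arrangement-sum ↭-refl f

    sum-cartesianProduct : ∀ {A B : Set} (f : A × B → ℕ) xs ys →
      sumOver f (cartesianProduct xs ys) ≡ sumOver (λ x → sumOver (λ y → f (x , y)) ys) xs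
    sum-cartesianProduct f []       ys = refl
    sum-cartesianProduct f (x ∷ xs) ys = trans
      (cong sumᴸ (List.map-++ f (map (x ,_) ys) (cartesianProduct xs ys)))
      (trans (sum-++ (map f (map (x ,_) ys)) (map f (cartesianProduct xs ys)))
        (cong₂ _+_ (cong sumᴸ (sym (List.map-∘ ys))) (sum-cartesianProduct f xs ys)))

  count-vertexPairs : ∀ {n} (b : Fin n × Fin n → Bool) →
    count b (vertexPairs n) ≡ Σᶠ λ u → Σᶠ λ v → if does (u Fin.<? v) then χ (b (u , v)) else 0
  count-vertexPairs {n} b = trans (count-filter (λ (u , v) → u Fin.<? v) b (cartesianProduct (allFin n) (allFin n)))
    (trans (sum-cartesianProduct f (allFin n) (allFin n))
      (trans (sum-allFin (λ u → sumOver (λ v → f (u , v)) (allFin n))) (sum-cong-≗ λ u → sum-allFin (λ v → f (u , v)))))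
    where
    f : Fin n × Fin n → ℕ
    f (u , v) = if does (u Fin.<? v) then χ (b (u , v)) else 0

  -- `vertexPairs` lists one of the two orientations of a pair, symmetry identifies them, and the
  -- diagonal contributes nothing.
  ordered≤2unordered : ∀ {n} (b : Fin n × Fin n → Bool) →
    (∀ u v → b (u , v) ≡ b (v , u)) → (∀ u → b (u , u) ≡ false) →
    Σᶠ (λ u → Σᶠ λ v → χ (b (u , v))) ≤ 2 * count b (vertexPairs n)
  ordered≤2unordered {n} b b-sym b-irrefl = begin
    Σᶠ (λ u → Σᶠ λ v → χ (b (u , v)))
      ≤⟨ Σᶠ-mono (λ u → Σᶠ-mono λ v → pointwise u v) ⟩
    Σᶠ (λ u → Σᶠ λ v → f u v + f v u)
      ≡⟨ sum-cong-≗ (λ u → ∑-distrib-+ (f u) (λ v → f v u)) ⟩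
    Σᶠ (λ u → Σᶠ (f u) + Σᶠ λ v → f v u)
      ≡⟨ ∑-distrib-+ (λ u → Σᶠ (f u)) (λ u → Σᶠ λ v → f v u) ⟩
    Σᶠ (λ u → Σᶠ (f u)) + Σᶠ (λ u → Σᶠ λ v → f v u)
      ≡⟨ cong (Σᶠ (λ u → Σᶠ (f u)) +_) (∑-comm (λ u v → f v u)) ⟩
    Σᶠ (λ u → Σᶠ (f u)) + Σᶠ (λ u → Σᶠ (f u))
      ≡⟨ cong₂ _+_ (sym (count-vertexPairs b)) (trans (sym (count-vertexPairs b)) (sym (+-identityʳ _))) ⟩
    2 * count b (vertexPairs n) ∎
    where
    open ≤-Reasoning
    f : Fin n → Fin n → ℕ
    f u v = if does (u Fin.<? v) then χ (b (u , v)) else 0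
    f-yes : ∀ {u v} → u Fin.< v → f u v ≡ χ (b (u , v))
    f-yes {u} {v} h = cong (λ d → if d then χ (b (u , v)) else 0) (dec-true (u Fin.<? v) h)
    pointwise : ∀ u v → χ (b (u , v)) ≤ f u v + f v u
    pointwise u v with Fin.<-cmp u v
    ... | tri< u<v _ _  = ≤-trans (≤-reflexive (sym (f-yes u<v))) (m≤m+n (f u v) (f v u))
    ... | tri≈ _ refl _ = ≤-trans (≤-reflexive (cong χ (b-irrefl u))) z≤n
    ... | tri> _ _ v<u  = ≤-trans (≤-reflexive (trans (cong χ (b-sym u v)) (sym (f-yes v<u)))) (m≤n+m (f v u) (f u v))

  does-true : ∀ {P : Set} (d : Dec P) → does d ≡ true → P
  does-true (yes p) _ = p

  module _ {n : ℕ} where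
    open ListMembership (≡-dec (Fin._≟_ {n}) (Fin._≟_ {n})) using (_∈?_)

    private
      T-not : ∀ {P : Set} (d : Dec P) → T (not ⌊ d ⌋) → ¬ P
      T-not (no ¬p) _ = ¬p

      not-T : ∀ {P : Set} (d : Dec P) → ¬ P → T (not ⌊ d ⌋)
      not-T (yes p) ¬p = ¬p p
      not-T (no _)  _  = _

    fromEdges-adj⁻ : ∀ E (u v : Fin n) → T (adj (fromEdges E) u v) → u ≢ v × ((u , v) ∈ E ⊎ (v , u) ∈ E)
    fromEdges-adj⁻ E u v t =
      let (a , b) = Equivalence.to (T-∧ {not ⌊ u Fin.≟ v ⌋}) t in
      T-not (u Fin.≟ v) a , Sum.map (toWitness {a? = (u , v) ∈? E}) (toWitness {a? = (v , u) ∈? E})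
        (Equivalence.to (T-∨ {⌊ (u , v) ∈? E ⌋}) b)

    fromEdges-adj⁺ : ∀ E (u v : Fin n) → u ≢ v → (u , v) ∈ E ⊎ (v , u) ∈ E → T (adj (fromEdges E) u v)
    fromEdges-adj⁺ E u v u≢v h = Equivalence.from (T-∧ {not ⌊ u Fin.≟ v ⌋})
      (not-T (u Fin.≟ v) u≢v , Equivalence.from (T-∨ {⌊ (u , v) ∈? E ⌋}) (Sum.map (fromWitness {a? = (u , v) ∈? E}) (fromWitness {a? = (v , u) ∈? E}) h))

    ∪-⊑ˡ : ∀ (G H : Graph n) → G ⊑ G ∪ H
    ∪-⊑ˡ G H u v t = Equivalence.from (T-∨ {adj G u v}) (inj₁ t)

    ∪-⊑ʳ : ∀ (G H : Graph n) → H ⊑ G ∪ H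
    ∪-⊑ʳ G H u v t = Equivalence.from (T-∨ {adj G u v}) (inj₂ t)

    ∪-lub : ∀ {G H K : Graph n} → G ⊑ K → H ⊑ K → G ∪ H ⊑ K
    ∪-lub {G} {H} {K} s t u v e with Equivalence.to (T-∨ {adj G u v}) e
    ... | inj₁ a = s u v a
    ... | inj₂ b = t u v b

    ∪-monoʳ : ∀ (G : Graph n) {H K} → H ⊑ K → G ∪ H ⊑ G ∪ K
    ∪-monoʳ G {H} {K} s = ∪-lub {G} {H} {G ∪ K} (∪-⊑ˡ G K) (λ u v t → ∪-⊑ʳ G K u v (s u v t))

    fromEdges-⊆ : ∀ {E E′} → E ⊆ E′ → fromEdges {n} E ⊑ fromEdges E′
    fromEdges-⊆ {E} {E′} s u v t = let (ne , h) = fromEdges-adj⁻ E u v t in fromEdges-adj⁺ E′ u v ne (Sum.map s s h)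

    edge : Fin n × Fin n → Graph n
    edge e = fromEdges (e ∷ [])

    booster : Graph n → Fin n × Fin n → Bool
    booster H e = does (φ (H ∪ edge e) <? φ H)

    booster-true⁻ : ∀ H e → booster H e ≡ true → φ (H ∪ edge e) < φ H
    booster-true⁻ H e = does-true (φ (H ∪ edge e) <? φ H)

    booster-sym : ∀ H u v → booster H (u , v) ≡ booster H (v , u)
    booster-sym H u v = cong (λ k → does (k <? φ H)) (≤-antisym
      (φ-⊑ {H = H ∪ edge (v , u)} {H ∪ edge (u , v)} (∪-monoʳ H {edge (v , u)} {edge (u , v)} (flip v u)))
      (φ-⊑ {H = H ∪ edge (u , v)} {H ∪ edge (v , u)} (∪-monoʳ H {edge (u , v)} {edge (v , u)} (flip u v))))
      where
      swap-∈ : ∀ {u v a b : Fin n} → (a , b) ∈ (u , v) ∷ [] → (b , a) ∈ (v , u) ∷ []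
      swap-∈ (here refl) = here refl
      flip : ∀ u v → edge (u , v) ⊑ edge (v , u)
      flip u v a b t = let (ne , h) = fromEdges-adj⁻ ((u , v) ∷ []) a b t in
        fromEdges-adj⁺ ((v , u) ∷ []) a b ne (Sum.swap (Sum.map swap-∈ swap-∈ h))

    booster-irrefl : ∀ H u → booster H (u , u) ≡ false
    booster-irrefl H u = dec-false (φ (H ∪ edge (u , u)) <? φ H)
      (≤⇒≯ (φ-⊑ {H = H ∪ edge (u , u)} {H} (∪-lub {H} {edge (u , u)} {H} (λ _ _ t → t) λ a b t →
        let (ne , h) = fromEdges-adj⁻ ((u , u) ∷ []) a b t in ⊥-elim (ne (loop h)))))
      where
      loop : ∀ {a b : Fin n} → (a , b) ∈ (u , u) ∷ [] ⊎ (b , a) ∈ (u , u) ∷ [] → a ≡ b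
      loop (inj₁ (here refl)) = refl
      loop (inj₂ (here refl)) = refl

    -- Rotating an optimal arrangement with its last vertex fixed reaches at least d first vertices;
    -- this is phrased with weights so that it can be iterated over both ends without forming the set.
    ManyEnds : Graph n → ℕ → Set
    ManyEnds H d = ∀ x l → Optimal H (x ∷ l) → ∀ (w : Fin n → ℕ) c →
      (∀ y l′ → Optimal H (y ∷ l′) → lastOf y l′ ≡ lastOf x l → c ≤ w y) → d * c ≤ Σᶠ w

    private
      last∈ : ∀ (x y : Fin n) l → lastOf x (y ∷ l) ∈ y ∷ l
      last∈ x y []      = here refl
      last∈ x y (z ∷ l) = there (last∈ y z l)

      last≢head : 3 ≤ n → ∀ {z : Fin n} {l} → Arrangement (z ∷ l) → lastOf z l ≢ z
      last≢head 3≤n {z} {[]}    arr = contradiction (subst (3 ≤_) (sym (arrangement-length arr)) 3≤n) λ { (s≤s ()) }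
      last≢head 3≤n {z} {y ∷ l} arr eq with arrangement-unique arr
      ... | nz ∷ _ = All.lookup nz (last∈ z y l) (sym eq)

      last-snoc : ∀ (w : Fin n) s t y → w ∷ s ≡ t ++ y ∷ [] → lastOf w s ≡ y
      last-snoc w s []      y refl = refl
      last-snoc w s (a ∷ t) y refl = lastOf-++ a t y []

      nonempty : 3 ≤ n → ∀ (l : List (Fin n)) → Arrangement l → ∃[ x ] ∃[ l′ ] (l ≡ x ∷ l′)
      nonempty 3≤n []      arr = contradiction (subst (3 ≤_) (sym (arrangement-length arr)) 3≤n) λ ()
      nonempty 3≤n (x ∷ l) arr = x , l , refl

    reverse-optimal : ∀ (H : Graph n) y l → Optimal H (y ∷ l) →
      ∃[ w ] ∃[ l′ ] (Optimal H (w ∷ l′) × lastOf w l′ ≡ y)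
    reverse-optimal H y l (arr , opt) = w , reverse s ,
      (↭-trans (↭-reflexive eq) (↭-trans (↭-reverse (y ∷ l)) arr) ,
       ≤-trans (≤-reflexive (trans (cong (gaps H) eq) (gaps-reverse H (y ∷ l)))) opt) ,
      last-snoc w (reverse s) (reverse l) y (trans eq (List.unfold-reverse y l))
      where
      w = lastOf y l
      s = proj₁ (snoc-lastOf y l)
      eq : w ∷ reverse s ≡ reverse (y ∷ l)
      eq = sym (trans (cong reverse (proj₂ (snoc-lastOf y l))) (List.reverse-++ s (w ∷ [])))

    -- `ManyEnds` is applied twice: to the first vertex, weighted by the number of boosters at it,
    -- and after a reversal, with that vertex now last, to the other end. There every pair of ends
    -- is a booster by `closing-edge`, which makes d² ordered pairs.
    many-boosters : 3 ≤ n → ∀ (H : Graph n) d → ¬ Hamiltonian H → ManyEnds H d → d * d ≤ 2 * count (booster H) (vertexPairs n)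
    many-boosters 3≤n H d ¬h many =
      let (x , l , eq) = nonempty 3≤n (best H) (best-arrangement H)
          opt : Optimal H (x ∷ l)
          opt = subst (Optimal H) eq (best-arrangement H , ≤-refl) in
      ≤-trans (many x l opt (λ y → Σᶠ λ z → χ (booster H (y , z))) d λ y l′ opt′ _ → inner y l′ opt′)
        (ordered≤2unordered (booster H) (booster-sym H) (booster-irrefl H))
      where
      inner : ∀ y l → Optimal H (y ∷ l) → d ≤ Σᶠ λ z → χ (booster H (y , z))
      inner y l opt = let (w , l′ , opt′ , e) = reverse-optimal H y l opt in
        ≤-trans (≤-reflexive (sym (*-identityʳ d)))
          (many w l′ opt′ (λ z → χ (booster H (y , z))) 1 λ z l″ opt″ e″ → closes z l″ opt″ (trans e″ e))
        where
        closes : ∀ z l″ → Optimal H (z ∷ l″) → lastOf z l″ ≡ y → 1 ≤ χ (booster H (y , z))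
        closes z l″ opt″ e = ≤-reflexive (sym (cong χ (dec-true (φ (H ∪ edge (y , z)) <? φ H)
          (closing-edge {H = H} {H ∪ edge (y , z)} 3≤n ¬h (∪-⊑ˡ H (edge (y , z))) z l″ opt″
            (∪-⊑ʳ H (edge (y , z)) (lastOf z l″) z (subst (λ a → T (adj (edge (y , z)) a z)) (sym e)
              (fromEdges-adj⁺ ((y , z) ∷ []) y z (λ y≡z → last≢head 3≤n (proj₁ opt″) (trans e y≡z)) (inj₁ (here refl)))))))))

    rotate-optimal : ∀ (H : Graph n) x l pre y z suf → Optimal H (x ∷ l) → x ∷ l ≡ pre ++ y ∷ z ∷ suf → T (adj H x z) →
      Optimal H (y ∷ rotate pre y z suf) × lastOf y (rotate pre y z suf) ≡ lastOf x l
    rotate-optimal H x l pre y z suf (arr , opt) eq t =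
      (↭-trans (rotate-↭ pre y z suf) (↭-trans (↭-reflexive (sym eq)) arr) ,
       ≤-trans (rotate-gaps H x l pre y z suf eq t) opt) ,
      trans (rotate-last pre y z suf) (last-eq pre eq)
      where
      last-eq : ∀ pre → x ∷ l ≡ pre ++ y ∷ z ∷ suf → lastOf z suf ≡ lastOf x l
      last-eq []        refl = refl
      last-eq (_ ∷ pre) refl = sym (lastOf-++ x pre y (z ∷ suf))

    -- Rotating at a neighbour z of x makes the predecessor y of z first, and distinct z have
    -- distinct predecessors. Accordingly `along` charges the indicator at z to the weight at y, one
    -- position earlier.
    minDegree⇒manyEnds : ∀ {G H : Graph n} {r} → G ⊑ H → (∀ v → r ≤ degree G v) → ManyEnds H r
    minDegree⇒manyEnds {G} {H} {r} s deg x l opt w c h = begin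
      r * c
        ≤⟨ *-monoˡ-≤ c (≤-trans (deg x) (≤-reflexive (degree-Σᶠ G x))) ⟩
      Σᶠ a * c
        ≡⟨ cong (_* c) (sym (arrangement-sum (proj₁ opt) a)) ⟩
      (a x + sumOver a l) * c
        ≡⟨ cong (λ k → (χ k + sumOver a l) * c) (loopless G x) ⟩
      sumOver a l * c
        ≤⟨ along [] x l refl ⟩
      sumOver w (x ∷ l)
        ≡⟨ arrangement-sum (proj₁ opt) w ⟩
      Σᶠ w ∎
      where
      open ≤-Reasoning
      a : Fin n → ℕ
      a v = χ (adj G x v)
      along : ∀ pre y suf → x ∷ l ≡ pre ++ y ∷ suf → sumOver a suf * c ≤ sumOver w (y ∷ suf)
      along pre y []        eq = z≤n
      along pre y (z ∷ suf) eq = begin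
        (a z + sumOver a suf) * c
          ≡⟨ *-distribʳ-+ c (a z) (sumOver a suf) ⟩
        a z * c + sumOver a suf * c
          ≤⟨ +-mono-≤ here-bound (along (pre ++ y ∷ []) z suf (trans eq (sym (List.++-assoc pre (y ∷ []) (z ∷ suf))))) ⟩
        w y + sumOver w (z ∷ suf) ∎
        where
        here-bound : a z * c ≤ w y
        here-bound with adj G x z in e
        ... | false = z≤n
        ... | true  = let (opt′ , last′) = rotate-optimal H x l pre y z suf opt eq (s x z (subst T (sym e) _)) in
          ≤-trans (≤-reflexive (*-identityˡ c)) (h y _ opt′ last′)

-- Exposure of the random edges in rounds

module Boosting where
  open import Data.Rational.Base
  open import Tactic.RingSolver using (solve-∀)
  open Rationals
  open Expectation
  open Arrangements using (φ; φ-⊑; hamiltonian-⊑; hamiltonian-⊎; _⊑_)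
  open Boosters using (booster; booster-true⁻; edge; ∪-⊑ʳ; ∪-lub; ∪-monoʳ; fromEdges-⊆)

  module _ {n : ℕ} (G : Graph n) where

    private
      Edges = List (Fin n × Fin n)
      H : Edges → Graph n
      H E = G ∪ fromEdges E

      H-⊆ : ∀ E E′ → E ⊆ E′ → H E ⊑ H E′
      H-⊆ E E′ s = ∪-monoʳ G {fromEdges E} {fromEdges E′} (fromEdges-⊆ {E = E} {E′} s)

    abstract
      fails : Edges → ℚ
      fails E = ⟦ not (does (hamiltonian? (G ∪ fromEdges E))) ⟧

      fails-complement : ∀ E → ⟦ does (hamiltonian? (G ∪ fromEdges E)) ⟧ + fails E ≡ 1ℚ
      fails-complement E = lemma (does (hamiltonian? (G ∪ fromEdges E)))
        where
        lemma : ∀ b → ⟦ b ⟧ + ⟦ not b ⟧ ≡ 1ℚ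
        lemma true  = refl
        lemma false = refl

      fails-yes : ∀ {E} → Hamiltonian (H E) → fails E ≡ 0ℚ
      fails-yes {E} h = cong (λ b → ⟦ not b ⟧) (dec-true (hamiltonian? (H E)) h)

      fails-no : ∀ {E} → ¬ Hamiltonian (H E) → fails E ≡ 1ℚ
      fails-no {E} ¬h = cong (λ b → ⟦ not b ⟧) (dec-false (hamiltonian? (H E)) ¬h)

      0≤fails : ∀ E → 0ℚ ≤ fails E
      0≤fails E = 0≤⟦⟧ _

      fails≤1 : ∀ E → fails E ≤ 1ℚ
      fails≤1 E = ⟦⟧≤1 _

    fails-antitone : Antitone fails
    fails-antitone {E} {E′} s with hamiltonian-⊎ (H E)
    ... | inj₁ h  = ℚ.≤-trans (ℚ.≤-reflexive (fails-yes (hamiltonian-⊑ {H = H E} {H E′} (H-⊆ E E′ s) h))) (0≤fails E)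
    ... | inj₂ ¬h = ℚ.≤-trans (fails≤1 E′) (ℚ.≤-reflexive (sym (fails-no ¬h)))

    potential : Edges → ℚ
    potential E = ι (φ (G ∪ fromEdges E))

    -- Random edges of density p reduce the potential at rate at least β p as long as
    -- the graph is not Hamiltonian.
    module _ (β : ℕ) (E₀ : Edges)
      (boosters : ∀ E → E₀ ⊆ E → ¬ Hamiltonian (G ∪ fromEdges E) → β ℕ.≤ count (booster (G ∪ fromEdges E)) (vertexPairs n)) where

      private
        xs = vertexPairs n

        hit : ∀ {E E′} e → e ∈ E′ → booster (H E) e ≡ true → potential (E ++ E′) + 1ℚ ≤ potential E
        hit {E} {E′} e m t = ≤-respˡ (trans (ι-suc (φ (H (E ++ E′)))) (ℚ.+-comm 1ℚ (potential (E ++ E′))))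
          (ι-mono (ℕ.≤-trans (ℕ.s≤s (φ-⊑ {H = H E ∪ edge e} {H (E ++ E′)} sub)) (booster-true⁻ (H E) e t)))
          where
          sub : H E ∪ edge e ⊑ H (E ++ E′)
          sub = ∪-lub {G = H E} {edge e} {H (E ++ E′)} (H-⊆ E (E ++ E′) ∈-++⁺ˡ)
            (λ u v a → ∪-⊑ʳ G (fromEdges (E ++ E′)) u v
              (fromEdges-⊆ {E = e ∷ []} {E ++ E′} (λ { (here refl) → ∈-++⁺ʳ E m }) u v a))

      -- The probability that a round of density q contains one of β given pairs.
      drop : ℚ → ℚ
      drop q = 1ℚ - (1ℚ - q) ^ℚ β

      -- No round raises the potential, and a round lowers it by at least 1 unless it misses all
      -- boosters, an event of probability at most (1 - q)^β.
      one-round : ∀ {q} → IsProb q → ∀ E → E₀ ⊆ E →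
        drop q * fails E + 𝔼 q xs (λ E′ → potential (E ++ E′)) ≤ potential E
      one-round {q} pq E E₀⊆E with hamiltonian-⊎ (H E)
      ... | inj₁ h = ≤-respˡ
        (sym (trans (cong (λ t → drop q * t + 𝔼 q xs (λ E′ → potential (E ++ E′))) (fails-yes h))
          (trans (cong (_+ 𝔼 q xs (λ E′ → potential (E ++ E′))) (ℚ.*-zeroʳ (drop q))) (ℚ.+-identityˡ _))))
        (𝔼-≤ pq xs λ E′ → ι-mono (φ-⊑ {H = H E} {H (E ++ E′)} (H-⊆ E (E ++ E′) ∈-++⁺ˡ)))
      ... | inj₂ ¬h = ℚ.≤-trans
        (ℚ.+-mono-≤ (ℚ.≤-reflexive (trans (cong (drop q *_) (fails-no ¬h)) (ℚ.*-identityʳ (drop q))))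
          (𝔼-mono pq xs pointwise))
        (≤-respˡ (cong (drop q +_) (sym (trans (𝔼-+ q xs _ _) (cong₂ _+_ (𝔼-avoids q b xs) (𝔼-const q xs (potential E - 1ℚ))))))
          (≤-from ((1ℚ - q) ^ℚ β - (1ℚ - q) ^ℚ count b xs)
            (0≤⇒- (^-anti (0≤⇒- (proj₂ pq)) (1-≤1 (proj₁ pq)) (boosters E E₀⊆E ¬h)))
            (lemma ((1ℚ - q) ^ℚ β) ((1ℚ - q) ^ℚ count b xs) (potential E))))
        where
        b = booster (H E)
        lemma : ∀ a c f → 1ℚ - a + (c + (f - 1ℚ)) + (a - c) ≡ f
        lemma = solve-∀ ℚ-ring
        lemma₁ : ∀ f → f ≡ 1ℚ + (f - 1ℚ)
        lemma₁ = solve-∀ ℚ-ring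
        pointwise : ∀ E′ → potential (E ++ E′) ≤ ⟦ avoids b E′ ⟧ + (potential E - 1ℚ)
        pointwise E′ with avoids b E′ in eq
        ... | true  = ≤-respʳ (lemma₁ (potential E)) (ι-mono (φ-⊑ {H = H E} {H (E ++ E′)} (H-⊆ E (E ++ E′) ∈-++⁺ˡ)))
        ... | false = let (e , m , t) = avoids-false b E′ eq in
          -⇒≤ (≤-respʳ (shift (potential E) (potential (E ++ E′))) (0≤⇒- (hit {E} {E′} e m t)))
          where
          shift : ∀ g f → g - (f + 1ℚ) ≡ 0ℚ + (g - 1ℚ) - f
          shift = solve-∀ ℚ-ring

      density : ℚ → ℕ → ℚ
      density q zero    = 0ℚ
      density q (suc i) = q ⊎ₚ density q i

      density-prob : ∀ {q} → IsProb q → ∀ i → IsProb (density q i)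
      density-prob pq zero    = ℚ.≤-refl , 0≤1
      density-prob pq (suc i) = ⊎ₚ-prob pq (density-prob pq i)

      density≤ : ∀ {q} → IsProb q → ∀ i → density q i ≤ ι i * q
      density≤ {q} pq zero    = ℚ.≤-reflexive (sym (ℚ.*-zeroˡ q))
      density≤ {q} pq (suc i) = ℚ.≤-trans
        (≤-from (q * density q i) (0≤* (proj₁ pq) (proj₁ (density-prob pq i))) (lemma q (density q i)))
        (≤-respʳ (trans (lemma′ q (ι i)) (cong (_* q) (sym (ι-suc i)))) (ℚ.+-monoʳ-≤ q (density≤ pq i)))
        where
        lemma : ∀ q d → q + d - q * d + q * d ≡ q + d
        lemma = solve-∀ ℚ-ring
        lemma′ : ∀ q i → q + i * q ≡ (1ℚ + i) * q
        lemma′ = solve-∀ ℚ-ring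

      0≤drop : ∀ {q} → IsProb q → 0ℚ ≤ drop q
      0≤drop (0≤q , q≤1) = 0≤⇒- (^-≤1 (0≤⇒- q≤1) (1-≤1 0≤q) β)

      -- This telescopes `one-round`. Failure after the last round implies failure before every
      -- round, so the final failure probability bounds each summand from below.
      rounds : ∀ {q} → IsProb q → ∀ i E → E₀ ⊆ E →
        drop q * ι i * 𝔼 (density q i) xs (λ E′ → fails (E ++ E′)) ≤ potential E
      rounds {q} pq zero E _ = ≤-respˡ (sym (trans (cong (_* K) (ℚ.*-zeroʳ (drop q))) (ℚ.*-zeroˡ K))) (0≤ι (φ (H E)))
        where
        K = 𝔼 (density q zero) xs (λ E′ → fails (E ++ E′))
      rounds {q} pq (suc i) E E₀⊆E = ℚ.≤-trans
        (≤-respˡ (sym split)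
          (ℚ.+-mono-≤ (*-monoˡ (0≤drop pq) (𝔼-≤ (density-prob pq (suc i)) xs λ E′ → fails-antitone ∈-++⁺ˡ))
            (≤-respˡ (𝔼-*ˡ q xs (drop q * ι i) _)
              (𝔼-mono pq xs λ E′ → rounds pq i (E ++ E′) λ m → ∈-++⁺ˡ (E₀⊆E m)))))
        (one-round pq E E₀⊆E)
        where
        K : ℚ
        K = 𝔼 (density q (suc i)) xs (λ E′ → fails (E ++ E′))
        K-step : K ≡ 𝔼 q xs (λ E′ → 𝔼 (density q i) xs (λ E″ → fails ((E ++ E′) ++ E″)))
        K-step = sym (trans
          (𝔼-cong q xs λ E′ → 𝔼-cong (density q i) xs λ E″ → cong fails (List.++-assoc E E′ E″))
          (𝔼-∪ q (density q i) xs (antitone-++ E fails-antitone)))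
        lemma : ∀ s i K → s * (1ℚ + i) * K ≡ s * K + s * i * K
        lemma = solve-∀ ℚ-ring
        split : drop q * ι (suc i) * K ≡ drop q * K + drop q * ι i * 𝔼 q xs (λ E′ → 𝔼 (density q i) xs (λ E″ → fails ((E ++ E′) ++ E″)))
        split = trans (cong (λ t → drop q * t * K) (ι-suc i))
          (trans (lemma (drop q) (ι i) K) (cong (λ t → drop q * K + drop q * ι i * t) K-step))

    -- The β rounds of density q = p / β have a union of density at most p. By `^-inverse-bound`
    -- each satisfies `drop` = 1 - (1 - q)^β ≥ p / (1 + p) ≥ p / 2, and the factor β on the left is
    -- the number of rounds.
    boost : ∀ b (E₀ : Edges) →
      (∀ E → E₀ ⊆ E → ¬ Hamiltonian (G ∪ fromEdges E) → suc b ℕ.≤ count (booster (G ∪ fromEdges E)) (vertexPairs n)) →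
      ∀ {p} → IsProb p →
      p * ι (suc b) * 𝔼 p (vertexPairs n) (λ E → fails (E₀ ++ E)) ≤ ι 2 * potential E₀
    boost b E₀ boosters {p} pp@(0≤p , p≤1) = ℚ.≤-trans
      (*-monoˡ (0≤* 0≤p (0≤ι β)) (𝔼-anti (density-prob β E₀ boosters pq β) pp density≤p xs (antitone-++ E₀ fails-antitone)))
      (ℚ.≤-trans (*-monoʳ (𝔼-nonneg (density-prob β E₀ boosters pq β) xs λ E → 0≤fails (E₀ ++ E)) (*-monoʳ (0≤ι β) p≤2drop))
        (≤-respˡ (lemma (drop β E₀ boosters q) (ι β) K)
          (*-monoˡ (0≤ι 2) (rounds β E₀ boosters pq β E₀ λ m → m))))
      where
      β = suc b
      xs = vertexPairs n
      q = p * 1/suc b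
      K = 𝔼 (density β E₀ boosters q β) xs (λ E → fails (E₀ ++ E))
      βq≡p : ι β * q ≡ p
      βq≡p = trans (e (ι β) p (1/suc b)) (trans (cong (p *_) (suc*1/suc b)) (ℚ.*-identityʳ p))
        where
        e : ∀ a p c → a * (p * c) ≡ p * (a * c)
        e = solve-∀ ℚ-ring
      pq : IsProb q
      pq = 0≤* 0≤p (0≤1/suc b) , ℚ.≤-trans (*-monoˡ 0≤p (1/suc≤1 b)) (≤-respˡ (sym (ℚ.*-identityʳ p)) p≤1)
      density≤p : density β E₀ boosters q β ≤ p
      density≤p = ≤-respʳ βq≡p (density≤ β E₀ boosters pq β)
      lemma : ∀ s β K → ι 2 * (s * β * K) ≡ ι 2 * s * β * K
      lemma s β K = trans (sym (ℚ.*-assoc (ι 2) (s * β) K)) (cong (_* K) (sym (ℚ.*-assoc (ι 2) s β)))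
      a = (1ℚ - q) ^ℚ β
      a-bound : a * (1ℚ + p) ≤ 1ℚ
      a-bound = subst (λ t → a * (1ℚ + t) ≤ 1ℚ) βq≡p (^-inverse-bound (proj₁ pq) (proj₂ pq) β)
      p≤2drop : p ≤ ι 2 * drop β E₀ boosters q
      p≤2drop = *-cancelˡ (1ℚ + p) (ℚ.<-≤-trans 0<1 (≤+ 0≤p)) (≤-from (ι 2 * (1ℚ - a * (1ℚ + p)) + p * (1ℚ - p))
        (0≤+ (0≤* (0≤ι 2) (0≤⇒- a-bound)) (0≤* 0≤p (0≤⇒- p≤1))) (e p a))
        where
        e₀ : ∀ p a → (1ℚ + p) * p + ((1ℚ + 1ℚ) * (1ℚ - a * (1ℚ + p)) + p * (1ℚ - p)) ≡ (1ℚ + p) * ((1ℚ + 1ℚ) * (1ℚ - a))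
        e₀ = solve-∀ ℚ-ring
        e : ∀ p a → (1ℚ + p) * p + (ι 2 * (1ℚ - a * (1ℚ + p)) + p * (1ℚ - p)) ≡ (1ℚ + p) * (ι 2 * (1ℚ - a))
        e = e₀

-- From rotation ends to a failure bound

module BoostingEnds where
  open import Data.Nat.Base using (⌈_/2⌉)
  open import Data.Rational.Base
  open import Tactic.RingSolver using (solve-∀)
  open Rationals
  open Expectation
  open Boosters using (booster; many-boosters; ManyEnds)
  open Boosting

  -- Of the factor 4, one 2 comes from having only β = ⌈d² / 2⌉ boosters and the other from `boost`.
  -- E₀ holds the edges of an earlier portion, on which the supply of ends may rest.
  boost-ends : ∀ {n} (G : Graph n) → 3 ℕ.≤ n → ∀ d → 1 ℕ.≤ d → ∀ E₀ → (∀ E → E₀ ⊆ E → ManyEnds (G ∪ fromEdges E) d) →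
    ∀ {p} → IsProb p →
    p * ι (d ℕ.* d) * 𝔼 p (vertexPairs n) (λ E → fails G (E₀ ++ E)) ≤ ι 4 * potential G E₀
  boost-ends {n} G 3≤n d 1≤d E₀ many {p} pp@(0≤p , _) = begin
    p * ι (d ℕ.* d) * X
      ≤⟨ *-monoʳ 0≤X (*-monoˡ 0≤p (ι-mono dd≤2β)) ⟩
    p * ι (2 ℕ.* β) * X
      ≡⟨ trans (cong (λ t → p * t * X) (ι-* 2 β)) (e p (ι 2) (ι β) X) ⟩
    ι 2 * (p * ι β * X)
      ≤⟨ *-monoˡ (0≤ι 2) (boosted β (ℕ.⌈n/2⌉-mono (ℕ.*-mono-≤ 1≤d 1≤d)) half) ⟩
    ι 2 * (ι 2 * potential G E₀)
      ≡⟨ sym (ℚ.*-assoc (ι 2) (ι 2) (potential G E₀)) ⟩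
    ι 4 * potential G E₀ ∎
    where
    open ℚ.≤-Reasoning
    X = 𝔼 p (vertexPairs n) (λ E → fails G (E₀ ++ E))
    0≤X = 𝔼-nonneg pp (vertexPairs n) (λ E → 0≤fails G (E₀ ++ E))
    β = ⌈ d ℕ.* d /2⌉
    dd≤2β : d ℕ.* d ℕ.≤ 2 ℕ.* β
    dd≤2β = ℕ.≤-trans (ℕ.≤-reflexive (sym (ℕ.⌊n/2⌋+⌈n/2⌉≡n (d ℕ.* d))))
      (ℕ.≤-trans (ℕ.+-monoˡ-≤ β (ℕ.⌊n/2⌋≤⌈n/2⌉ (d ℕ.* d))) (ℕ.≤-reflexive (cong (β ℕ.+_) (sym (ℕ.+-identityʳ β)))))
    Many : ℕ → Set
    Many β = ∀ E → E₀ ⊆ E → ¬ Hamiltonian (G ∪ fromEdges E) → β ℕ.≤ count (booster (G ∪ fromEdges E)) (vertexPairs n)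
    half : Many β
    half E E₀⊆E ¬h = ℕ.≤-trans (ℕ.⌈n/2⌉-mono (many-boosters 3≤n (G ∪ fromEdges E) d ¬h (many E E₀⊆E)))
      (ℕ.≤-reflexive (trans (cong (λ k → ⌈ c ℕ.+ k /2⌉) (ℕ.+-identityʳ c)) (sym (ℕ.n≡⌈n+n/2⌉ c))))
      where c = count (booster (G ∪ fromEdges E)) (vertexPairs n)
    boosted : ∀ β → 1 ℕ.≤ β → Many β → p * ι β * X ≤ ι 2 * potential G E₀
    boosted (suc b) _ h = boost G b E₀ h pp
    e : ∀ p k b X → p * (k * b) * X ≡ k * (p * b * X)
    e = solve-∀ ℚ-ring

-- Permutations with long cycles, and switches

module Permutations where
  open import Data.Fin.Base using (zero; suc)
  open import Data.Nat.Base
  open import Data.Nat.ListAction using () renaming (sum to sumᴸ)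
  open import Data.Nat.Properties
  open import Data.Nat.Tactic.RingSolver using (solve-∀)
  open Arrangements

  module _ {A : Set} where

    iter : (A → A) → ℕ → A → A
    iter f zero    x = x
    iter f (suc i) x = f (iter f i x)

    iter-shift : ∀ f i x → iter f i (f x) ≡ f (iter f i x)
    iter-shift f zero    x = refl
    iter-shift f (suc i) x = cong f (iter-shift f i x)

    iter-comm : ∀ f i j x → iter f i (iter f j x) ≡ iter f j (iter f i x)
    iter-comm f i zero    x = refl
    iter-comm f i (suc j) x = trans (iter-shift f i (iter f j x)) (cong f (iter-comm f i j x))

    orbit : (A → A) → ℕ → A → List A
    orbit f zero    x = []
    orbit f (suc i) x = iter f i x ∷ orbit f i x

    orbit-length : ∀ f i x → length (orbit f i x) ≡ i
    orbit-length f zero    x = refl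
    orbit-length f (suc i) x = cong suc (orbit-length f i x)

    ∈-orbit : ∀ f {i j} x → j < i → iter f j x ∈ orbit f i x
    ∈-orbit f {suc i} {j} x j<1+i with j ≟ i
    ... | yes refl = here refl
    ... | no  j≢i  = there (∈-orbit f x (≤∧≢⇒< (s≤s⁻¹ j<1+i) j≢i))

  Σᶠ-update : ∀ {n} {f g : Fin n → ℕ} z → (∀ v → v ≢ z → f v ≡ g v) → Σᶠ f + g z ≡ Σᶠ g + f z
  Σᶠ-update {suc n} {f} {g} zero h = trans
    (cong (λ t → f zero + t + g zero) (sum-cong-≗ {n} λ i → h (suc i) λ ()))
    (lemma (f zero) (Σᶠ {n} (g ∘ suc)) (g zero))
    where
    lemma : ∀ a b c → a + b + c ≡ c + b + a
    lemma = solve-∀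
  Σᶠ-update {suc n} {f} {g} (suc z) h = trans
    (+-assoc (f zero) _ _)
    (trans (cong₂ _+_ (h zero λ ()) (Σᶠ-update {n} {f ∘ suc} {g ∘ suc} z λ v v≢z → h (suc v) (v≢z ∘ Fin.suc-injective)))
      (sym (+-assoc (g zero) _ _)))

  Σᶠ-single : ∀ {n} (y : Fin n) → Σᶠ (λ z → χ (does (z Fin.≟ y))) ≡ 1
  Σᶠ-single {n} y = +-cancelʳ-≡ 0 _ 1 (trans
    (Σᶠ-update {f = λ z → χ (does (z Fin.≟ y))} {λ _ → 0} y λ v v≢y → cong χ (dec-false (v Fin.≟ y) v≢y))
    (cong₂ _+_ (trans (Σᶠ-const n 0) (*-zeroʳ n)) (cong χ (dec-true (y Fin.≟ y) refl))))

  module _ {n : ℕ} where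
    open ListMembership (Fin._≟_ {n}) using (_∈?_)

    private
      Σᶠ-∈ : ∀ (F : List (Fin n)) → Σᶠ (λ z → χ (does (z ∈? F))) ≤ length F
      Σᶠ-∈ [] = ≤-reflexive (trans (Σᶠ-const n 0) (*-zeroʳ n))
      Σᶠ-∈ (y ∷ F) = begin
        Σᶠ (λ z → χ (does (z ∈? (y ∷ F))))
          ≤⟨ Σᶠ-mono (λ z → χ-∨ (does (z Fin.≟ y)) (does (z ∈? F))) ⟩
        Σᶠ (λ z → χ (does (z Fin.≟ y)) + χ (does (z ∈? F)))
          ≡⟨ ∑-distrib-+ (λ z → χ (does (z Fin.≟ y))) (λ z → χ (does (z ∈? F))) ⟩
        Σᶠ (λ z → χ (does (z Fin.≟ y))) + Σᶠ (λ z → χ (does (z ∈? F)))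
          ≤⟨ +-mono-≤ (≤-reflexive (Σᶠ-single y)) (Σᶠ-∈ F) ⟩
        suc (length F) ∎
        where
        open ≤-Reasoning
        χ-∨ : ∀ a b → χ (a ∨ b) ≤ χ a + χ b
        χ-∨ true  b = s≤s z≤n
        χ-∨ false b = ≤-refl

    Σᶠ-avoiding : ∀ (b : Fin n → Bool) F → Σᶠ (χ ∘ b) ≤ Σᶠ (λ z → χ (b z ∧ not (does (z ∈? F)))) + length F
    Σᶠ-avoiding b F = begin
      Σᶠ (χ ∘ b)
        ≤⟨ Σᶠ-mono (λ z → pointwise (b z) (does (z ∈? F))) ⟩
      Σᶠ (λ z → χ (b z ∧ not (does (z ∈? F))) + χ (does (z ∈? F)))
        ≡⟨ ∑-distrib-+ (λ z → χ (b z ∧ not (does (z ∈? F)))) (λ z → χ (does (z ∈? F))) ⟩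
      Σᶠ (λ z → χ (b z ∧ not (does (z ∈? F)))) + Σᶠ (λ z → χ (does (z ∈? F)))
        ≤⟨ +-monoʳ-≤ (Σᶠ (λ z → χ (b z ∧ not (does (z ∈? F))))) (Σᶠ-∈ F) ⟩
      Σᶠ (λ z → χ (b z ∧ not (does (z ∈? F)))) + length F ∎
      where
      open ≤-Reasoning
      pointwise : ∀ a c → χ a ≤ χ (a ∧ not c) + χ c
      pointwise false c     = z≤n
      pointwise true  true  = s≤s z≤n
      pointwise true  false = s≤s z≤n

  module _ {n : ℕ} where

    LongCycles : ℕ → Permutation n n → Set
    LongCycles L π = ∀ v i → 1 ≤ i → i < L → iter (π ⟨$⟩ʳ_) i v ≢ v

    -- `∘ₚ` applies its left argument first, so e and z exchange their images. This joins two cycles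
    -- or splits one, and a split is what may create a short cycle.
    switch : Permutation n n → Fin n → Fin n → Permutation n n
    switch π e z = transpose e z ∘ₚ π

    private
      transpose-else : ∀ (e z : Fin n) {v} → v ≢ e → v ≢ z → transpose e z ⟨$⟩ʳ v ≡ v
      transpose-else e z {v} v≢e v≢z rewrite dec-false (v Fin.≟ e) v≢e | dec-false (v Fin.≟ z) v≢z = refl

      transpose-first : ∀ (e z : Fin n) → transpose e z ⟨$⟩ʳ e ≡ z
      transpose-first e z rewrite dec-true (e Fin.≟ e) refl = refl

      transpose-second : ∀ (e z : Fin n) → transpose e z ⟨$⟩ʳ z ≡ e
      transpose-second e z with z Fin.≟ e
      ... | yes z≡e = z≡e
      ... | no  _ rewrite dec-true (z Fin.≟ z) refl = refl

    switch-else : ∀ π e z {v} → v ≢ e → v ≢ z → switch π e z ⟨$⟩ʳ v ≡ π ⟨$⟩ʳ v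
    switch-else π e z v≢e v≢z = cong (π ⟨$⟩ʳ_) (transpose-else e z v≢e v≢z)

    switch-first : ∀ π e z → switch π e z ⟨$⟩ʳ e ≡ π ⟨$⟩ʳ z
    switch-first π e z = cong (π ⟨$⟩ʳ_) (transpose-first e z)

    switch-second : ∀ π e z → switch π e z ⟨$⟩ʳ z ≡ π ⟨$⟩ʳ e
    switch-second π e z = cong (π ⟨$⟩ʳ_) (transpose-second e z)

    private
      -- Only e and z change their images, so the old and the new orbit agree up to the first visit
      -- to either.
      follow : ∀ π e z i x → let f = π ⟨$⟩ʳ_ ; f′ = switch π e z ⟨$⟩ʳ_ in
        iter f′ i x ≡ iter f i x ⊎
        (∃[ j ] (j < i × (iter f j x ≡ z ⊎ iter f j x ≡ e) × iter f′ j x ≡ iter f j x))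
      follow π e z zero    x = inj₁ refl
      follow π e z (suc i) x with follow π e z i x
      ... | inj₂ (j , j<i , h) = inj₂ (j , m<n⇒m<1+n j<i , h)
      ... | inj₁ eq with iter (π ⟨$⟩ʳ_) i x Fin.≟ z | iter (π ⟨$⟩ʳ_) i x Fin.≟ e
      ...   | yes h | _     = inj₂ (i , ≤-refl , inj₁ h , eq)
      ...   | no _  | yes h = inj₂ (i , ≤-refl , inj₂ h , eq)
      ...   | no ¬z | no ¬e = inj₁ (trans (cong (switch π e z ⟨$⟩ʳ_) eq) (switch-else π e z ¬e ¬z))

    -- A new cycle that avoids e and z was already a cycle of π. A short one through z continues
    -- along the old orbit of π e: coming back to z is excluded by the first hypothesis, and meeting
    -- e before that would be a short cycle of π. For a short one through e the roles are exchanged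
    -- and the second hypothesis applies.
    switch-longCycles : ∀ L π e z → LongCycles L π →
      (∀ i → i < L → iter (π ⟨$⟩ʳ_) i (π ⟨$⟩ʳ e) ≢ z) →
      (∀ i → i < L → iter (π ⟨$⟩ʳ_) i z ≢ e) →
      LongCycles L (switch π e z)
    switch-longCycles L π e z long fwd bwd v (suc i) 1≤i i<L periodic with follow π e z (suc i) v
    ... | inj₁ eq = long v (suc i) 1≤i i<L (trans (sym eq) periodic)
    ... | inj₂ (j , _ , end , eq) = case end
      where
      f f′ : Fin n → Fin n
      f  = π ⟨$⟩ʳ_
      f′ = switch π e z ⟨$⟩ʳ_
      i<L′ : i < L
      i<L′ = <-trans (n<1+n i) i<L
      periodic′ : ∀ {y} → iter f j v ≡ y → iter f′ i (f′ y) ≡ y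
      periodic′ refl = trans (iter-shift f′ i _) (trans (cong (iter f′ (suc i)) (sym eq))
        (trans (iter-comm f′ (suc i) j v) (trans (cong (iter f′ j) periodic) eq)))
      case : iter f j v ≡ z ⊎ iter f j v ≡ e → ⊥
      case (inj₁ h) with subst (λ y → iter f′ i y ≡ z) (switch-second π e z) (periodic′ h) | follow π e z i (f e)
      ... | p | inj₁ q = fwd i i<L′ (trans (sym q) p)
      ... | p | inj₂ (k , k<i , inj₁ q , _) = fwd k (<-trans k<i i<L′) q
      ... | p | inj₂ (k , k<i , inj₂ q , _) = long e (suc k) (s≤s z≤n) (≤-<-trans k<i i<L′) (trans (sym (iter-shift f k e)) q)
      case (inj₂ h) with subst (λ y → iter f′ i y ≡ e) (switch-first π e z) (periodic′ h) | follow π e z i (f z)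
      ... | p | inj₁ q = bwd (suc i) i<L (trans (sym (iter-shift f i z)) (trans (sym q) p))
      ... | p | inj₂ (k , k<i , inj₁ q , _) = long z (suc k) (s≤s z≤n) (≤-<-trans k<i i<L′) (trans (sym (iter-shift f k z)) q)
      ... | p | inj₂ (k , k<i , inj₂ q , _) = bwd (suc k) (≤-<-trans k<i i<L′) (trans (sym (iter-shift f k z)) q)

  module _ {m : ℕ} where

    private
      next prev : Fin (suc m) → Fin (suc m)
      next i with view i
      ... | ‵fromℕ     = zero
      ... | ‵inject₁ j = suc j
      prev zero    = fromℕ m
      prev (suc j) = inject₁ j

      next-fromℕ : next (fromℕ m) ≡ zero
      next-fromℕ rewrite view-fromℕ m = refl

      next-inject₁ : ∀ j → next (inject₁ j) ≡ suc j
      next-inject₁ j rewrite view-inject₁ j = refl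

      next-prev : ∀ i → next (prev i) ≡ i
      next-prev zero    = next-fromℕ
      next-prev (suc j) = next-inject₁ j

      prev-next : ∀ i → prev (next i) ≡ i
      prev-next i with view i
      ... | ‵fromℕ     = refl
      ... | ‵inject₁ j = refl

    cycle : Permutation (suc m) (suc m)
    cycle = permutation next prev next-prev prev-next

    private
      toℕ-next : ∀ v → toℕ v < m → toℕ (next v) ≡ suc (toℕ v)
      toℕ-next v h with view v
      ... | ‵fromℕ     = contradiction (subst (_< m) (Fin.toℕ-fromℕ m) h) (<-irrefl refl)
      ... | ‵inject₁ j = cong suc (sym (Fin.toℕ-inject₁ j))

      toℕ-iter : ∀ i v → toℕ v + i ≤ m → toℕ (iter next i v) ≡ toℕ v + i
      toℕ-iter zero    v h = sym (+-identityʳ (toℕ v))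
      toℕ-iter (suc i) v h = trans
        (toℕ-next (iter next i v) (subst (_< m) (sym ih) (subst (_≤ m) (+-suc (toℕ v) i) h)))
        (trans (cong suc ih) (sym (+-suc (toℕ v) i)))
        where
        ih : toℕ (iter next i v) ≡ toℕ v + i
        ih = toℕ-iter i v (≤-trans (+-monoʳ-≤ (toℕ v) (n≤1+n i)) h)

      iter-+ : ∀ i j v → iter next (i + j) v ≡ iter next i (iter next j v)
      iter-+ zero    j v = refl
      iter-+ (suc i) j v = cong next (iter-+ i j v)

    -- In fewer than m + 1 steps the iterate counts upwards and wraps around to 0 at most once; a
    -- return to v after a wrap would need exactly m + 1 steps.
    cycle-long : LongCycles (suc m) cycle
    cycle-long v i 1≤i i<1+m eq with toℕ v + i ≤? m
    ... | yes h = <⇒≢ (m<m+n (toℕ v) 1≤i) (trans (sym (cong toℕ eq)) (toℕ-iter i v h))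
    ... | no ¬h = <-irrefl refl (subst (i <_) (trans 1+m≡ i≡) i<1+m)
      where
      j = m ∸ toℕ v
      v≤m : toℕ v ≤ m
      v≤m = s≤s⁻¹ (Fin.toℕ<n v)
      v+j : toℕ v + j ≡ m
      v+j = m+[n∸m]≡n v≤m
      k = i ∸ suc j
      j<i : suc j ≤ i
      j<i = +-cancelˡ-< (toℕ v) j i (subst (_< toℕ v + i) (sym v+j) (≰⇒> ¬h))
      i≡ : k + suc j ≡ i
      i≡ = m∸n+n≡m j<i
      at-top : iter next j v ≡ fromℕ m
      at-top = Fin.toℕ-injective (trans (toℕ-iter j v (≤-reflexive v+j)) (trans v+j (sym (Fin.toℕ-fromℕ m))))
      from-zero : iter next i v ≡ iter next k zero
      from-zero = trans (cong (λ t → iter next t v) (sym i≡)) (trans (iter-+ k (suc j) v)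
        (cong (iter next k) (trans (cong next at-top) next-fromℕ)))
      k≤m : k ≤ m
      k≤m = ≤-trans (m∸n≤m i (suc j)) (s≤s⁻¹ i<1+m)
      k≡v : toℕ v ≡ k
      k≡v = trans (cong toℕ (trans (sym eq) from-zero)) (toℕ-iter k zero k≤m)
      1+m≡ : suc m ≡ k + suc j
      1+m≡ = trans (cong suc (sym v+j)) (trans (sym (+-suc (toℕ v) j)) (cong (_+ suc j) k≡v))

-- Orderings of a regular graph with few gaps

module PathCover where
  open import Data.Nat.Base
  open import Data.Nat.ListAction using () renaming (sum to sumᴸ)
  open import Data.Nat.Properties
  open import Data.Nat.Tactic.RingSolver using (solve-∀)
  open Arrangements
  open Permutations

  module _ {n : ℕ} (G : Graph n) where

    missing : Permutation n n → Fin n → Bool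
    missing π v = not (adj G v (π ⟨$⟩ʳ v))

    cost : Permutation n n → ℕ
    cost π = Σᶠ λ v → χ (missing π v)

    offCost : Permutation n n → Fin n → ℕ
    offCost π e = Σᶠ λ v → if does (v Fin.≟ e) then 0 else χ (missing π v)

    private
      if-true : ∀ {b} {x y : ℕ} → b ≡ true → (if b then x else y) ≡ x
      if-true refl = refl

      if-false : ∀ {b} {x y : ℕ} → b ≡ false → (if b then x else y) ≡ y
      if-false refl = refl

    offCost-cost : ∀ π e → offCost π e + χ (missing π e) ≡ cost π
    offCost-cost π e = trans
      (Σᶠ-update {f = λ v → if does (v Fin.≟ e) then 0 else χ (missing π v)} {λ v → χ (missing π v)} e
        λ v v≢e → if-false (dec-false (v Fin.≟ e) v≢e))
      (trans (cong (cost π +_) (if-true (dec-true (e Fin.≟ e) refl))) (+-identityʳ (cost π)))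

    switch-offCost : ∀ π e z → z ≢ e → T (adj G (π ⟨$⟩ʳ e) z) →
      offCost (switch π e z) e + χ (missing π z) ≡ offCost π e
    switch-offCost π e z z≢e t = trans
      (cong (offCost (switch π e z) e +_) (sym (if-false {x = 0} (dec-false (z Fin.≟ e) z≢e))))
      (trans (Σᶠ-update {f = f} {g} z same)
        (trans (cong (offCost π e +_) (trans (if-false (dec-false (z Fin.≟ e) z≢e)) new)) (+-identityʳ _)))
      where
      f g : Fin n → ℕ
      f v = if does (v Fin.≟ e) then 0 else χ (missing (switch π e z) v)
      g v = if does (v Fin.≟ e) then 0 else χ (missing π v)
      same : ∀ v → v ≢ z → f v ≡ g v
      same v v≢z = case (v Fin.≟ e)
        where
        case : Dec (v ≡ e) → f v ≡ g v
        case (yes v≡e) = trans (if-true (dec-true (v Fin.≟ e) v≡e)) (sym (if-true (dec-true (v Fin.≟ e) v≡e)))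
        case (no  v≢e) = cong (λ u → if does (v Fin.≟ e) then 0 else χ (not (adj G v u))) (switch-else π e z v≢e v≢z)
      new : χ (missing (switch π e z) z) ≡ 0
      new = trans (cong (λ u → χ (not (adj G z u))) (switch-second π e z))
        (cong (λ b → χ (not b)) (trans (symmetric G z (π ⟨$⟩ʳ e)) (T-true t)))

    -- Alternating walks: trading π e = x for z ↦ x, e ↦ π z keeps the number of missing arcs off e.
    module Walk (L : ℕ) (π₀ : Permutation n n) (long₀ : LongCycles L π₀) where
      open ListMembership (Fin._≟_ {n}) using (_∈?_)

      private
        k = cost π₀

      Improvement : Set
      Improvement = ∃[ π ] (LongCycles L π × cost π < k)

      -- An alternating walk of at most t switches that ends at a. The hole is its starting vertex;
      -- after each switch it carries the image π₀ a of the latest vertex, and this is the arc to be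
      -- traded next. `off` holds because the first arc of the hole was missing and no switch
      -- creates a missing arc elsewhere.
      record State (t : ℕ) (a : Fin n) : Set where
        constructor mkState
        field
          perm    : Permutation n n
          hole    : Fin n
          touched : List (Fin n)
          long    : LongCycles L perm
          at      : perm ⟨$⟩ʳ hole ≡ π₀ ⟨$⟩ʳ a
          off     : offCost perm hole < k
          agree   : ∀ v → v ∉ touched → perm ⟨$⟩ʳ v ≡ π₀ ⟨$⟩ʳ v
          hole∈   : hole ∈ touched
          short   : length touched ≤ suc t

      open State

      -- At a vertex z on one of the two orbits the switch could close a cycle shorter than L.
      forbidden : ∀ {t a} → State t a → List (Fin n)
      forbidden {t} {a} s = touched s ++ orbit (perm s ⟨$⟩ʳ_) L (π₀ ⟨$⟩ʳ a) ++ orbit (perm s ⟨$⟩ˡ_) L (hole s)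

      forbidden-length : ∀ {t a} (s : State t a) → length (forbidden s) ≤ suc t + (L + L)
      forbidden-length {t} {a} s = begin
        length (forbidden s)
          ≡⟨ List.length-++ (touched s) ⟩
        length (touched s) + length (orbit (perm s ⟨$⟩ʳ_) L (π₀ ⟨$⟩ʳ a) ++ orbit (perm s ⟨$⟩ˡ_) L (hole s))
          ≡⟨ cong (length (touched s) +_) (trans (List.length-++ (orbit (perm s ⟨$⟩ʳ_) L (π₀ ⟨$⟩ʳ a)))
               (cong₂ _+_ (orbit-length (perm s ⟨$⟩ʳ_) L (π₀ ⟨$⟩ʳ a)) (orbit-length (perm s ⟨$⟩ˡ_) L (hole s)))) ⟩
        length (touched s) + (L + L)
          ≤⟨ +-monoˡ-≤ (L + L) (short s) ⟩
        suc t + (L + L) ∎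
        where open ≤-Reasoning

      private
        iter-inverse : ∀ (π : Permutation n n) i z → iter (π ⟨$⟩ˡ_) i (iter (π ⟨$⟩ʳ_) i z) ≡ z
        iter-inverse π zero    z = refl
        iter-inverse π (suc i) z = trans (sym (iter-shift (π ⟨$⟩ˡ_) i _))
          (trans (cong (iter (π ⟨$⟩ˡ_) i) (Perm.inverseˡ π)) (iter-inverse π i z))

      start : ∀ t a → missing π₀ a ≡ true → State t a
      start t a m = mkState π₀ a (a ∷ []) long₀ refl
        (≤-reflexive (trans (cong (λ b → 1 + b) (sym (+-identityʳ _))) (trans (sym (+-suc (offCost π₀ a) 0))
          (trans (cong (λ b → offCost π₀ a + χ b) (sym m)) (offCost-cost π₀ a)))))
        (λ _ _ → refl) (here refl) (s≤s z≤n)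

      module _ {t a} (s : State t a) z (edge : T (adj G (π₀ ⟨$⟩ʳ a) z)) (z∉ : z ∉ forbidden s) where

        private
          π = perm s
          e = hole s
          π′ = switch π e z
          z∉touched : z ∉ touched s
          z∉touched = z∉ ∘ ∈-++⁺ˡ
          z≢e : z ≢ e
          z≢e z≡e = z∉touched (subst (_∈ touched s) (sym z≡e) (hole∈ s))
          off-eq : offCost π′ e + χ (missing π z) ≡ offCost π e
          off-eq = switch-offCost π e z z≢e (subst (λ x → T (adj G x z)) (sym (at s)) edge)
          long′ : LongCycles L π′
          long′ = switch-longCycles L π e z (long s)
            (λ i i<L eq → z∉ (∈-++⁺ʳ (touched s) (∈-++⁺ˡ (subst (_∈ orbit (π ⟨$⟩ʳ_) L (π₀ ⟨$⟩ʳ a))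
              (trans (cong (iter (π ⟨$⟩ʳ_) i) (sym (at s))) eq) (∈-orbit (π ⟨$⟩ʳ_) (π₀ ⟨$⟩ʳ a) i<L)))))
            (λ i i<L eq → z∉ (∈-++⁺ʳ (touched s) (∈-++⁺ʳ (orbit (π ⟨$⟩ʳ_) L (π₀ ⟨$⟩ʳ a)) (subst (_∈ orbit (π ⟨$⟩ˡ_) L e)
              (trans (cong (iter (π ⟨$⟩ˡ_) i) (sym eq)) (iter-inverse π i z)) (∈-orbit (π ⟨$⟩ˡ_) e i<L)))))

        advance : State (suc t) z
        advance = mkState π′ e (z ∷ touched s) long′
          -- As z is untouched, the image it hands over to the hole is still π₀ z.
          (trans (switch-first π e z) (agree s z z∉touched))
          (≤-<-trans (≤-trans (m≤m+n _ _) (≤-reflexive off-eq)) (off s))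
          (λ v v∉ → trans (switch-else π e z (λ { refl → v∉ (there (hole∈ s)) }) (λ { refl → v∉ (here refl) }))
            (agree s v (v∉ ∘ there)))
          (there (hole∈ s)) (s≤s (short s))

        -- The switch repairs the missing arc at z. Even if the new arc at the hole is missing, the
        -- total stays below k.
        improve : missing π₀ z ≡ true → Improvement
        improve m = π′ , long′ , (begin-strict
          cost π′
            ≡⟨ offCost-cost π′ e ⟨
          offCost π′ e + χ (missing π′ e)
            ≤⟨ +-monoʳ-≤ (offCost π′ e) (χ≤1 (missing π′ e)) ⟩
          offCost π′ e + 1
            ≡⟨ cong (λ b → offCost π′ e + χ b) (trans (cong (λ x → not (adj G z x)) (agree s z z∉touched)) m) ⟨
          offCost π′ e + χ (missing π z)
            ≡⟨ off-eq ⟩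
          offCost π e
            <⟨ off s ⟩
          k ∎)
          where open ≤-Reasoning

      -- One optional walk per vertex: `size` counts the ends of walks, and a single walk to each
      -- end is enough to continue.
      Stage : ℕ → Set
      Stage t = ∀ a → Maybe (State t a)

      size : ∀ {t} → Stage t → ℕ
      size st = Σᶠ λ a → χ (is-just (st a))

      allowed : ∀ {t a} → Maybe (State t a) → Fin n → Bool
      allowed         nothing  z = false
      allowed {a = a} (just s) z = adj G (π₀ ⟨$⟩ʳ a) z ∧ not (does (z ∈? forbidden s))

      private
        T-not-does : ∀ {P : Set} (d : Dec P) → T (not (does d)) → ¬ P
        T-not-does (no ¬p) _ = ¬p

        allowed⁻ : ∀ {t a} (m : Maybe (State t a)) z → T (allowed m z) →
          Σ (State t a) λ s → T (adj G (π₀ ⟨$⟩ʳ a) z) × z ∉ forbidden s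
        allowed⁻ {a = a} (just s) z h = let (x , y) = Equivalence.to (T-∧ {adj G (π₀ ⟨$⟩ʳ a) z}) h in
          s , x , T-not-does (z ∈? forbidden s) y

      module _ (r : ℕ) (regular : IsRegular G r) where

        module _ {t} (st : Stage t) where

          private
            ok : Fin n → Fin n → Bool
            ok a = allowed (st a)

            Reached : Fin n → Set
            Reached z = ∃[ a ] T (ok a z)

            reached? : ∀ z → Dec (Reached z)
            reached? z = Fin.any? λ a → T? (ok a z)

            -- Vertices with a missing arc start a fresh walk at every stage, so these k vertices
            -- always belong to it.
            next : ∀ z b → missing π₀ z ≡ b → Dec (Reached z) → Maybe (State (suc t) z)
            next z true  m _             = just (start (suc t) z m)
            next z false m (no _)        = nothing
            next z false m (yes (a , h)) = let (s , e , z∉) = allowed⁻ (st a) z h in just (advance s z e z∉)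

            next-just : ∀ z b m d → ¬ (b ≡ true × Reached z) → χ (is-just (next z b m d)) ≡ χ b + χ (does d)
            next-just z true  m (yes p) h = contradiction (refl , p) h
            next-just z true  m (no _)  h = refl
            next-just z false m (no _)  h = refl
            next-just z false m (yes p) h = refl

            ex = suc t + (L + L)

            out-of : ∀ a → χ (is-just (st a)) * r ≤ Σᶠ (λ z → χ (ok a z)) + χ (is-just (st a)) * ex
            out-of a with st a
            ... | nothing = z≤n
            ... | just s = begin
              1 * r
                ≡⟨ trans (*-identityˡ r) (trans (sym (regular (π₀ ⟨$⟩ʳ a))) (degree-Σᶠ G (π₀ ⟨$⟩ʳ a))) ⟩
              Σᶠ (λ z → χ (adj G (π₀ ⟨$⟩ʳ a) z))
                ≤⟨ Σᶠ-avoiding (adj G (π₀ ⟨$⟩ʳ a)) (forbidden s) ⟩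
              Σᶠ (λ z → χ (allowed (just s) z)) + length (forbidden s)
                ≤⟨ +-monoʳ-≤ (Σᶠ (λ z → χ (allowed (just s) z))) (≤-trans (forbidden-length s) (≤-reflexive (sym (*-identityˡ ex)))) ⟩
              Σᶠ (λ z → χ (allowed (just s) z)) + 1 * ex ∎
              where open ≤-Reasoning

            allowed≤adj : ∀ {a} (m : Maybe (State t a)) z → χ (allowed m z) ≤ χ (adj G (π₀ ⟨$⟩ʳ a) z)
            allowed≤adj nothing  z = z≤n
            allowed≤adj {a} (just s) z with adj G (π₀ ⟨$⟩ʳ a) z
            ... | true  = χ≤1 _
            ... | false = z≤n

            χ-false : ∀ {b} → ¬ T b → χ b ≡ 0
            χ-false {false} _ = refl
            χ-false {true}  h = contradiction _ h

            -- π₀ is injective, so at most r of the vertices π₀ a are neighbours of z.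
            into : ∀ z → Σᶠ (λ a → χ (ok a z)) ≤ r * χ (does (reached? z))
            into z with reached? z
            ... | no ¬p = ≤-reflexive (trans (sum-cong-≗ (λ a → χ-false λ t → ¬p (a , t)))
                            (trans (trans (Σᶠ-const n 0) (*-zeroʳ n)) (sym (*-zeroʳ r))))
            ... | yes _ = begin
              Σᶠ (λ a → χ (ok a z))
                ≤⟨ Σᶠ-mono (λ a → allowed≤adj (st a) z) ⟩
              Σᶠ (λ a → χ (adj G (π₀ ⟨$⟩ʳ a) z))
                ≡⟨ sum-permute (λ x → χ (adj G x z)) π₀ ⟨
              Σᶠ (λ x → χ (adj G x z))
                ≡⟨ sum-cong-≗ (λ x → cong χ (symmetric G x z)) ⟩
              Σᶠ (λ x → χ (adj G z x))
                ≡⟨ trans (sym (degree-Σᶠ G z)) (trans (regular z) (sym (*-identityʳ r))) ⟩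
              r * 1 ∎
              where open ≤-Reasoning

            -- Double counting of the edges from π₀ a to z; this is where regularity is used.
            flow : size st * r ≤ r * Σᶠ (λ z → χ (does (reached? z))) + size st * ex
            flow = begin
              size st * r
                ≡⟨ *-distribʳ-sum r (λ a → χ (is-just (st a))) ⟩
              Σᶠ (λ a → χ (is-just (st a)) * r)
                ≤⟨ Σᶠ-mono out-of ⟩
              Σᶠ (λ a → Σᶠ (λ z → χ (ok a z)) + χ (is-just (st a)) * ex)
                ≡⟨ ∑-distrib-+ (λ a → Σᶠ (λ z → χ (ok a z))) (λ a → χ (is-just (st a)) * ex) ⟩
              Σᶠ (λ a → Σᶠ (λ z → χ (ok a z))) + Σᶠ (λ a → χ (is-just (st a)) * ex)
                ≡⟨ cong₂ _+_ (∑-comm (λ a z → χ (ok a z))) (sym (*-distribʳ-sum ex (λ a → χ (is-just (st a))))) ⟩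
              Σᶠ (λ z → Σᶠ (λ a → χ (ok a z))) + size st * ex
                ≤⟨ +-monoˡ-≤ (size st * ex) (Σᶠ-mono into) ⟩
              Σᶠ (λ z → r * χ (does (reached? z))) + size st * ex
                ≡⟨ cong (_+ size st * ex) (sym (*-distribˡ-sum r (λ z → χ (does (reached? z))))) ⟩
              r * Σᶠ (λ z → χ (does (reached? z))) + size st * ex ∎
              where open ≤-Reasoning

          -- If no reached vertex has a missing arc, the N reached vertices and the k starting ones
          -- are disjoint, and the new stage has k + N members. By `flow` N falls short of the old
          -- size by at most n · ex / r; all terms are multiplied by r to avoid division.
          grow : Improvement ⊎ Σ (Stage (suc t)) λ st′ → r * size st + r * k ≤ r * size st′ + n * ex
          grow with Fin.any? (λ z → T? (missing π₀ z) ×-dec reached? z)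
          ... | yes (z , m , a , h) = let (s , e , z∉) = allowed⁻ (st a) z h in inj₁ (improve s z e z∉ (T-true m))
          ... | no ¬imp = inj₂ (st′ , (begin
            r * size st + r * k
              ≡⟨ cong (_+ r * k) (*-comm r (size st)) ⟩
            size st * r + r * k
              ≤⟨ +-monoˡ-≤ (r * k) flow ⟩
            r * N + size st * ex + r * k
              ≤⟨ +-monoˡ-≤ (r * k) (+-monoʳ-≤ (r * N) (*-monoˡ-≤ ex (Σᶠχ≤n (is-just ∘ st)))) ⟩
            r * N + n * ex + r * k
              ≡⟨ lemma r N k (n * ex) ⟩
            r * (k + N) + n * ex
              ≡⟨ cong (λ x → r * x + n * ex) (sym size′) ⟩
            r * size st′ + n * ex ∎))
            where
            open ≤-Reasoning
            N = Σᶠ (λ z → χ (does (reached? z)))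
            st′ : Stage (suc t)
            st′ z = next z (missing π₀ z) refl (reached? z)
            size′ : size st′ ≡ k + N
            size′ = trans
              (sum-cong-≗ λ z → next-just z (missing π₀ z) refl (reached? z) λ (m , p) → ¬imp (z , subst T (sym m) _ , p))
              (∑-distrib-+ (λ z → χ (missing π₀ z)) (λ z → χ (does (reached? z))))
            lemma : ∀ r N k e → r * N + e + r * k ≡ r * (k + N) + e
            lemma = solve-∀

        stages : ∀ t → Improvement ⊎ Σ (Stage t) λ st → t * (r * k) ≤ r * size st + t * (n * (t + (L + L)))
        stages zero = inj₂ ((λ _ → nothing) , z≤n)
        stages (suc t) with stages t
        ... | inj₁ imp = inj₁ imp
        ... | inj₂ (st , h) with grow st
        ...   | inj₁ imp = inj₁ imp
        ...   | inj₂ (st′ , h′) = inj₂ (st′ , (begin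
          r * k + t * (r * k)
            ≤⟨ +-monoʳ-≤ (r * k) (≤-trans h (+-monoʳ-≤ (r * size st) (*-monoʳ-≤ t (*-monoʳ-≤ n (n≤1+n (t + (L + L))))))) ⟩
          r * k + (r * size st + t * e)
            ≡⟨ lemma (r * k) (r * size st) (t * e) ⟩
          r * size st + r * k + t * e
            ≤⟨ +-monoˡ-≤ (t * e) h′ ⟩
          r * size st′ + e + t * e
            ≡⟨ +-assoc (r * size st′) e (t * e) ⟩
          r * size st′ + suc t * e ∎))
          where
          open ≤-Reasoning
          e = n * (suc t + (L + L))
          lemma : ∀ a b c → a + (b + c) ≡ b + a + c
          lemma = solve-∀

        -- A stage cannot outgrow the n vertices. For t = L about √r the second alternative says k =
        -- O(n / √r).
        descend-or-stop : ∀ t → Improvement ⊎ t * (r * k) ≤ r * n + t * (n * (t + (L + L)))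
        descend-or-stop t with stages t
        ... | inj₁ imp      = inj₁ imp
        ... | inj₂ (st , h) = inj₂ (≤-trans h (+-monoˡ-≤ _ (*-monoʳ-≤ r (Σᶠχ≤n (is-just ∘ st)))))

    module _ (r : ℕ) (regular : IsRegular G r) (L t : ℕ) where

      few-missing : ∀ π → LongCycles L π → ∃[ π′ ] (LongCycles L π′ × t * (r * cost π′) ≤ r * n + t * (n * (t + (L + L))))
      few-missing π long = go π long (<-wellFounded (cost π))
        where
        go : ∀ π → LongCycles L π → Acc _<_ (cost π) → ∃[ π′ ] (LongCycles L π′ × t * (r * cost π′) ≤ r * n + t * (n * (t + (L + L))))
        go π long (acc rec) with Walk.descend-or-stop L π long r regular t
        ... | inj₂ h = π , long , h
        ... | inj₁ (π′ , long′ , lt) = go π′ long′ (rec lt)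

    module _ (L : ℕ) (π : Permutation n n) (long : LongCycles L π) where
      open ListMembership (Fin._≟_ {n}) using (_∈?_)

      private
        f : Fin n → Fin n
        f = π ⟨$⟩ʳ_

        f-injective : ∀ {u v} → f u ≡ f v → u ≡ v
        f-injective e = trans (sym (Perm.inverseˡ π)) (trans (cong (π ⟨$⟩ˡ_) e) (Perm.inverseˡ π))

        weight : List (Fin n) → ℕ
        weight l = sumᴸ (map (λ v → χ (missing π v)) l)

        ∉⇒All≢ : ∀ {x : Fin n} {l} → x ∉ l → All (x ≢_) l
        ∉⇒All≢ h = ¬Any⇒All¬ _ h

        gap-missing : ∀ u → gap G (f u) u ≡ χ (missing π u)
        gap-missing u = trans (gap-sym G (f u) u) (lemma (adj G u (f u)))
          where
          lemma : ∀ b → (if b then 0 else 1) ≡ χ (not b)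
          lemma true  = refl
          lemma false = refl

        gaps-++ : ∀ c l → gaps G (c ++ l) ≤ gaps G c + suc (gaps G l)
        gaps-++ []          l       = n≤1+n _
        gaps-++ (x ∷ [])    []      = z≤n
        gaps-++ (x ∷ [])    (y ∷ l) = +-monoˡ-≤ (gaps G (y ∷ l)) (gap≤1 G x y)
        gaps-++ (x ∷ y ∷ c) l       = ≤-trans (+-monoʳ-≤ (gap G x y) (gaps-++ (y ∷ c) l)) (≤-reflexive (sym (+-assoc (gap G x y) _ _)))

        module _ (l : List (Fin n)) (closed : ∀ v → f v ∈ l → v ∈ l) (v : Fin n) (v∉l : v ∉ l) where

          -- The stretch of the orbit of v traversed so far, latest vertex u first, so that
          -- consecutive entries are f x and x, and a gap is a missing arc at x. By `preimage` only
          -- v can lack its preimage in c, which is why the orbit can close nowhere but at v.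
          record Trace (u : Fin n) (c : List (Fin n)) : Set where
            field
              unique   : Unique (u ∷ c)
              disjoint : ∀ {x} → x ∈ u ∷ c → x ∉ l
              iterate  : iter f (length c) v ≡ u
              few      : gaps G (u ∷ c) ≤ weight c
              preimage : ∀ y → f y ∈ u ∷ c → f y ≡ v ⊎ y ∈ c

          open Trace

          Cycle : List (Fin n) → Set
          Cycle c = Unique c × (∀ {x} → x ∈ c → x ∉ l) × gaps G c ≤ weight c × (∀ y → f y ∈ c → y ∈ c) × L ≤ length c × v ∈ c

          first : Trace v []
          first = record
            { unique = [] ∷ [] ; disjoint = λ { (here refl) → v∉l } ; iterate = refl ; few = z≤n
            ; preimage = λ { y (here e) → inj₁ e } }

          closeup : ∀ u c → Trace u c → f u ≡ v → v ∈ u ∷ c → Cycle (u ∷ c)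
          closeup u c tr fu≡v v∈ = unique tr , disjoint tr , ≤-trans (few tr) (m≤n+m _ _) , back ,
            ≮⇒≥ (λ lt → long v (suc (length c)) (s≤s z≤n) lt (trans (cong f (iterate tr)) fu≡v)) , v∈
            where
            back : ∀ y → f y ∈ u ∷ c → y ∈ u ∷ c
            back y m with preimage tr y m
            ... | inj₁ e = here (f-injective (trans e (sym fu≡v)))
            ... | inj₂ k = there k

          extend : ∀ u c → Trace u c → f u ≢ v → Trace (f u) (u ∷ c)
          extend u c tr fu≢v = record
            { unique = ∉⇒All≢ fu∉ ∷ unique tr
            ; disjoint = λ { (here refl) m → disjoint tr (here refl) (closed u m) ; (there m) → disjoint tr m }
            ; iterate = cong f (iterate tr)
            ; few = +-mono-≤ (≤-reflexive (gap-missing u)) (few tr)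
            ; preimage = λ { y (here e) → inj₂ (here (f-injective e))
                           ; y (there m) → Sum.map₂ there (preimage tr y m) }
            }
            where
            fu∉ : f u ∉ u ∷ c
            fu∉ m with preimage tr u m | unique tr
            ... | inj₁ e | _      = fu≢v e
            ... | inj₂ k | u∉ ∷ _ = All.lookup u∉ k refl

          -- The fuel cannot run out before the orbit closes, as the entries are distinct.
          trace : ∀ fuel u c → Trace u c → v ∈ u ∷ c → n ≤ length c + fuel → ∃[ c′ ] Cycle c′
          trace zero u c tr v∈ h = contradiction (≤-trans (unique-length (unique tr)) (≤-trans h (≤-reflexive (+-identityʳ (length c))))) (<-irrefl refl)
          trace (suc fuel) u c tr v∈ h with f u Fin.≟ v
          ... | yes e = u ∷ c , closeup u c tr e v∈
          ... | no ne = trace fuel (f u) (u ∷ c) (extend u c tr ne) (there v∈) (≤-trans h (≤-reflexive (+-suc (length c) fuel)))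

          cycle-through : ∃[ c ] Cycle c
          cycle-through = trace n v [] first (here refl) ≤-refl

      -- The cycles are cut open and concatenated. Each junction costs at most one gap, and cycles
      -- of length at least L number at most n / L. The vertices already listed are closed under
      -- preimages, so the cycle of an unlisted vertex avoids them.
      linearize : ∃[ l ] ∃[ q ] (Arrangement l × gaps G l ≤ cost π + q × q * L ≤ n)
      linearize = go n [] 0 [] (λ _ ()) z≤n z≤n ≤-refl
        where
        go : ∀ fuel l q → Unique l → (∀ v → f v ∈ l → v ∈ l) → gaps G l ≤ weight l + q → q * L ≤ length l →
          n ≤ length l + fuel → ∃[ l ] ∃[ q ] (Arrangement l × gaps G l ≤ cost π + q × q * L ≤ n)
        go fuel l q u closed g qL h with Fin.all? (λ v → v ∈? l)
        ... | yes full = l , q , arr , ≤-trans g (≤-reflexive (cong (_+ q) (arrangement-sum arr _))) ,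
          ≤-trans qL (≤-reflexive (arrangement-length arr))
          where
          arr : Arrangement l
          arr = mkArrangement u full
        ... | no ¬full with Fin.¬∀⟶∃¬ n (_∈ l) (λ v → v ∈? l) ¬full
        ...   | v , v∉l with cycle-through l closed v v∉l | fuel
        ...     | c , uc , disj , gc , back , Lc , v∈c | suc fuel′ = go fuel′ (c ++ l) (suc q)
          (Unique.++⁺ uc u λ (m , k) → disj m k)
          closed′
          (begin
            gaps G (c ++ l)
              ≤⟨ gaps-++ c l ⟩
            gaps G c + suc (gaps G l)
              ≤⟨ +-mono-≤ gc (s≤s g) ⟩
            weight c + suc (weight l + q)
              ≡⟨ lemma (weight c) (weight l) q ⟩
            weight c + weight l + suc q
              ≡⟨ cong (_+ suc q) (sym (trans (cong sumᴸ (List.map-++ _ c l)) (sum-++ (map _ c) (map _ l)))) ⟩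
            weight (c ++ l) + suc q ∎)
          (≤-trans (+-mono-≤ Lc qL) (≤-reflexive (sym (List.length-++ c))))
          (≤-trans h (≤-trans (≤-reflexive (+-suc (length l) fuel′))
            (+-monoˡ-≤ fuel′ (≤-trans (+-monoˡ-≤ (length l) (nonempty v∈c)) (≤-reflexive (sym (List.length-++ c)))))))
          where
          open ≤-Reasoning
          lemma : ∀ a b c → a + suc (b + c) ≡ a + b + suc c
          lemma = solve-∀
          nonempty : ∀ {x : Fin n} {c} → x ∈ c → 1 ≤ length c
          nonempty (here _)  = s≤s z≤n
          nonempty (there _) = s≤s z≤n
          closed′ : ∀ y → f y ∈ c ++ l → y ∈ c ++ l
          closed′ y m with ∈-++⁻ c m
          ... | inj₁ k = ∈-++⁺ˡ (back y k)
          ... | inj₂ k = ∈-++⁺ʳ c (closed y k)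
        ...     | c , uc , disj , _ | zero = contradiction
          (≤-trans (unique-length (∉⇒All≢ v∉l ∷ u)) (≤-trans h (≤-reflexive (+-identityʳ (length l))))) (<-irrefl refl)

-- The second term of the threshold

module DenseCase where
  open import Data.Fin.Base using (zero; suc)
  open import Data.Nat.Base using (⌈_/2⌉)
  open import Data.Rational.Base
  open import Tactic.RingSolver using (solve-∀)
  open Rationals
  open Expectation
  open Arrangements using (φ-⊑; φ≤1+gaps; Arrangement; gaps; degree-Σᶠ; Σᶠχ≤n)
  open Boosters using (minDegree⇒manyEnds; ∪-⊑ˡ)
  open Boosting
  open BoostingEnds
  open Permutations using (cycle; cycle-long; LongCycles)
  open PathCover using (cost; few-missing; linearize)

  √-floor : ∀ n → ∃[ q ] (q ℕ.* q ℕ.≤ n × n ℕ.< suc q ℕ.* suc q)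
  √-floor zero = 0 , ℕ.z≤n , ℕ.s≤s ℕ.z≤n
  √-floor (suc n) with √-floor n
  ... | q , lo , hi with suc n ℕ.<? suc q ℕ.* suc q
  ...   | yes h = q , ℕ.m≤n⇒m≤1+n lo , h
  ...   | no ¬h = suc q , ℕ.≮⇒≥ ¬h , ℕ.≤-<-trans hi (ℕ.*-mono-< (ℕ.n<1+n (suc q)) (ℕ.n<1+n (suc q)))

  m*m≤n⇒m≤n : ∀ m {n} → m ℕ.* m ℕ.≤ n → m ℕ.≤ n
  m*m≤n⇒m≤n zero    h = ℕ.z≤n
  m*m≤n⇒m≤n (suc m) h = ℕ.≤-trans (ℕ.m≤m*n (suc m) (suc m)) h

  module _ {n : ℕ} (G : Graph n) (r : ℕ) (regular : IsRegular G r) where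

    private
      r≤n : 1 ℕ.≤ n → r ℕ.≤ n
      r≤n (ℕ.s≤s _) = ℕ.≤-trans (ℕ.≤-reflexive (trans (sym (regular zero)) (degree-Σᶠ G zero))) (Σᶠχ≤n (adj G zero))

    -- q is both the cycle length and the number of walk steps. The loss 3 q² n is at most 3 r n
    -- since q² ≤ r, so the missing arcs number at most 4 n / q, and the junctions of the cycles add
    -- n / q.
    few-gaps : ∀ q → q ℕ.* q ℕ.≤ r → 1 ℕ.≤ r → 1 ℕ.≤ n → ∃[ l ] (Arrangement l × q ℕ.* gaps G l ℕ.≤ 5 ℕ.* n)
    few-gaps q qq≤r 1≤r 1≤n@(ℕ.s≤s {n = m} _) =
      let (π , long , few) = few-missing G r regular q q cycle long-cycle
          (l , c , arr , g , cq) = linearize G q π long in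
      l , arr , bound (cost G π) c (gaps G l) few g cq
      where
      open ℕ.≤-Reasoning
      q≤n : q ℕ.≤ n
      q≤n = ℕ.≤-trans (m*m≤n⇒m≤n q qq≤r) (r≤n 1≤n)
      long-cycle : LongCycles q cycle
      long-cycle v i 1≤i i<q = cycle-long v i 1≤i (ℕ.<-≤-trans i<q q≤n)
      l₁ : ∀ r q k → r ℕ.* (q ℕ.* k) ≡ q ℕ.* (r ℕ.* k)
      l₁ = ℕSolver.solve-∀
      l₂ : ∀ r q n → r ℕ.* n ℕ.+ q ℕ.* (n ℕ.* (q ℕ.+ (q ℕ.+ q))) ≡ r ℕ.* n ℕ.+ q ℕ.* q ℕ.* (3 ℕ.* n)
      l₂ = ℕSolver.solve-∀
      l₃ : ∀ r n → r ℕ.* n ℕ.+ r ℕ.* (3 ℕ.* n) ≡ r ℕ.* (4 ℕ.* n)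
      l₃ = ℕSolver.solve-∀
      l₄ : ∀ n → 4 ℕ.* n ℕ.+ n ≡ 5 ℕ.* n
      l₄ = ℕSolver.solve-∀
      bound : ∀ k c g → q ℕ.* (r ℕ.* k) ℕ.≤ r ℕ.* n ℕ.+ q ℕ.* (n ℕ.* (q ℕ.+ (q ℕ.+ q))) → g ℕ.≤ k ℕ.+ c → c ℕ.* q ℕ.≤ n →
        q ℕ.* g ℕ.≤ 5 ℕ.* n
      bound k c g few g≤ cq = begin
        q ℕ.* g                 ≤⟨ ℕ.*-monoʳ-≤ q g≤ ⟩
        q ℕ.* (k ℕ.+ c)         ≡⟨ ℕ.*-distribˡ-+ q k c ⟩
        q ℕ.* k ℕ.+ q ℕ.* c     ≤⟨ ℕ.+-mono-≤ qk (ℕ.≤-trans (ℕ.≤-reflexive (ℕ.*-comm q c)) cq) ⟩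
        4 ℕ.* n ℕ.+ n           ≡⟨ l₄ n ⟩
        5 ℕ.* n                 ∎
        where
        qk : q ℕ.* k ℕ.≤ 4 ℕ.* n
        qk = ℕ.*-cancelˡ-≤ r {{ℕ.>-nonZero 1≤r}} (begin
          r ℕ.* (q ℕ.* k)                         ≡⟨ l₁ r q k ⟩
          q ℕ.* (r ℕ.* k)                         ≤⟨ few ⟩
          _                                       ≡⟨ l₂ r q n ⟩
          r ℕ.* n ℕ.+ q ℕ.* q ℕ.* (3 ℕ.* n)       ≤⟨ ℕ.+-monoʳ-≤ (r ℕ.* n) (ℕ.*-monoˡ-≤ (3 ℕ.* n) qq≤r) ⟩
          r ℕ.* n ℕ.+ r ℕ.* (3 ℕ.* n)             ≡⟨ l₃ r n ⟩
          r ℕ.* (4 ℕ.* n)                         ∎)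

    -- Here h = ⌊√n⌋, and j stands in for √(log n). With q = ⌊√r⌋ one has φ ≤ 6 n / q, so the
    -- failure probability is at most 4 φ / (p r²) ≤ 48 r / (q h j). Since r < (q + 1)² ≤ 4 q² ≤ 4 q
    -- h, this is at most 192 / j.
    dense-case : 3 ℕ.≤ n → 1 ℕ.≤ r → ∀ j h → n ℕ.< suc h ℕ.* suc h → ∀ {p} → IsProb p →
      ι (j ℕ.* n ℕ.* h) ≤ ι 2 * (p * ι (r ℕ.^ 3)) →
      ι j * 𝔼 p (vertexPairs n) (fails G) ≤ ι 192
    dense-case 3≤n 1≤r j h n<h {p} pp@(0≤p , _) thr with √-floor r
    ... | q , qq≤r , r<q = *-cancelˡ (ι (n ℕ.* q ℕ.* h)) (0<ι (ℕ.*-mono-≤ (ℕ.*-mono-≤ 1≤n 1≤q) (ℕ.≤-trans 1≤q q≤h))) (begin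
      ι (n ℕ.* q ℕ.* h) * (ι j * X)
        ≡⟨ trans (sym (ℚ.*-assoc (ι (n ℕ.* q ℕ.* h)) (ι j) X)) (cong (_* X) (trans (sym (ι-* (n ℕ.* q ℕ.* h) j)) (trans (cong ι (e₀ n q h j)) (ι-* q (j ℕ.* n ℕ.* h))))) ⟩
      ι q * ι (j ℕ.* n ℕ.* h) * X
        ≤⟨ *-monoʳ 0≤X (*-monoˡ (0≤ι q) thr) ⟩
      ι q * (ι 2 * (p * ι (r ℕ.^ 3))) * X
        ≡⟨ trans (cong (λ t → ι q * (ι 2 * (p * t)) * X) (trans (cong ι (e₁ r)) (ι-* r (r ℕ.* r)))) (e₂ (ι q) (ι 2) p (ι r) (ι (r ℕ.* r)) X) ⟩
      ι q * ι 2 * ι r * (p * ι (r ℕ.* r) * X)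
        ≤⟨ *-monoˡ (0≤* (0≤* (0≤ι q) (0≤ι 2)) (0≤ι r)) pr²X ⟩
      ι q * ι 2 * ι r * (ι 4 * ι (suc g))
        ≡⟨ sym (trans (ι-* (q ℕ.* 2 ℕ.* r) (4 ℕ.* suc g)) (cong₂ _*_ (trans (ι-* (q ℕ.* 2) r) (cong (_* ι r) (ι-* q 2))) (ι-* 4 (suc g)))) ⟩
      ι (q ℕ.* 2 ℕ.* r ℕ.* (4 ℕ.* suc g))
        ≤⟨ ι-mono final ⟩
      ι (n ℕ.* q ℕ.* h ℕ.* 192)
        ≡⟨ ι-* (n ℕ.* q ℕ.* h) 192 ⟩
      ι (n ℕ.* q ℕ.* h) * ι 192 ∎)
      where
      open ℚ.≤-Reasoning
      X = 𝔼 p (vertexPairs n) (fails G)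
      0≤X = 𝔼-nonneg pp (vertexPairs n) (0≤fails G)
      1≤n : 1 ℕ.≤ n
      1≤n = ℕ.≤-trans (ℕ.s≤s ℕ.z≤n) 3≤n
      ≤-root : ∀ {a b m} → a ℕ.* a ℕ.≤ m → m ℕ.< suc b ℕ.* suc b → a ℕ.≤ b
      ≤-root {a} {b} lo hi = ℕ.≮⇒≥ λ b<a → ℕ.<⇒≱ hi (ℕ.≤-trans (ℕ.*-mono-≤ b<a b<a) lo)
      1≤q : 1 ℕ.≤ q
      1≤q = ≤-root {1} {q} 1≤r r<q
      q≤h : q ℕ.≤ h
      q≤h = ≤-root (ℕ.≤-trans qq≤r (r≤n 1≤n)) n<h
      cover = few-gaps q qq≤r 1≤r 1≤n
      g = gaps G (proj₁ cover)
      qg : q ℕ.* suc g ℕ.≤ 6 ℕ.* n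
      qg = ℕ.≤-trans (ℕ.≤-reflexive (ℕ.*-suc q g)) (ℕ.+-mono-≤ (ℕ.≤-trans (m*m≤n⇒m≤n q qq≤r) (r≤n 1≤n)) (proj₂ (proj₂ cover)))
      pr²X : p * ι (r ℕ.* r) * X ≤ ι 4 * ι (suc g)
      pr²X = ℚ.≤-trans
        (boost-ends G 3≤n r 1≤r [] (λ E _ → minDegree⇒manyEnds {G = G} {G ∪ fromEdges E} (∪-⊑ˡ G (fromEdges E)) λ v → ℕ.≤-reflexive (sym (regular v))) pp)
        (*-monoˡ (0≤ι 4) (ι-mono (ℕ.≤-trans (φ-⊑ {H = G} {G ∪ fromEdges []} (∪-⊑ˡ G (fromEdges []))) (φ≤1+gaps G (proj₁ (proj₂ cover))))))
      e₀ : ∀ n q h j → n ℕ.* q ℕ.* h ℕ.* j ≡ q ℕ.* (j ℕ.* n ℕ.* h)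
      e₀ = ℕSolver.solve-∀
      e₁ : ∀ r → r ℕ.* (r ℕ.* (r ℕ.* 1)) ≡ r ℕ.* (r ℕ.* r)
      e₁ = ℕSolver.solve-∀
      e₂ : ∀ q k p r s X → q * (k * (p * (r * s))) * X ≡ q * k * r * (p * s * X)
      e₂ = solve-∀ ℚ-ring
      final : q ℕ.* 2 ℕ.* r ℕ.* (4 ℕ.* suc g) ℕ.≤ n ℕ.* q ℕ.* h ℕ.* 192
      final = ℕ.≤-trans (ℕ.≤-reflexive (l₁ q r (suc g)))
        (ℕ.≤-trans (ℕ.*-mono-≤ (ℕ.*-monoʳ-≤ 8 r≤4qh) qg) (ℕ.≤-reflexive (l₂ q h n)))
        where
        l₁ : ∀ q r g → q ℕ.* 2 ℕ.* r ℕ.* (4 ℕ.* g) ≡ 8 ℕ.* r ℕ.* (q ℕ.* g)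
        l₁ = ℕSolver.solve-∀
        l₂ : ∀ q h n → 8 ℕ.* (4 ℕ.* (q ℕ.* h)) ℕ.* (6 ℕ.* n) ≡ n ℕ.* q ℕ.* h ℕ.* 192
        l₂ = ℕSolver.solve-∀
        r≤4qh : r ℕ.≤ 4 ℕ.* (q ℕ.* h)
        r≤4qh = ℕ.≤-trans (ℕ.<⇒≤ r<q) (ℕ.≤-trans (ℕ.*-mono-≤ (ℕ.+-monoˡ-≤ q 1≤q) (ℕ.+-monoˡ-≤ q 1≤q))
          (ℕ.≤-trans (ℕ.≤-reflexive (l₃ q)) (ℕ.*-monoʳ-≤ 4 (ℕ.*-monoʳ-≤ q q≤h))))
          where
          l₃ : ∀ q → (q ℕ.+ q) ℕ.* (q ℕ.+ q) ≡ 4 ℕ.* (q ℕ.* q)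
          l₃ = ℕSolver.solve-∀

-- Pósa's lemma for expanders

module Posa where
  open import Data.Nat.Base
  open import Data.Nat.ListAction using () renaming (sum to sumᴸ)
  open import Data.Nat.Properties
  open Arrangements
  open Boosters using (ManyEnds; rotate-optimal; does-true)
  open Permutations using (Σᶠ-update; Σᶠ-single)

  module _ {n : ℕ} where

    outer : Graph n → (Fin n → Bool) → Fin n → Bool
    outer G S v = not (S v) ∧ does (Fin.any? λ u → T? (S u ∧ adj G u v))

    IsExpander : Graph n → ℕ → Set
    IsExpander G s₀ = ∀ S → 1 ≤ Σᶠ (χ ∘ S) → Σᶠ (χ ∘ S) ≤ s₀ → 2 * Σᶠ (χ ∘ S) ≤ Σᶠ (χ ∘ outer G S)

    data Consec (y z : Fin n) : List (Fin n) → Set where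
      here  : ∀ {l} → Consec y z (y ∷ z ∷ l)
      there : ∀ {x l} → Consec y z l → Consec y z (x ∷ l)

    consec? : ∀ y z l → Dec (Consec y z l)
    consec? y z [] = no λ ()
    consec? y z (x ∷ []) = no λ { (there ()) }
    consec? y z (a ∷ b ∷ l) = map′ to from ((y Fin.≟ a ×-dec z Fin.≟ b) ⊎-dec consec? y z (b ∷ l))
      where
      to : (y ≡ a × z ≡ b) ⊎ Consec y z (b ∷ l) → Consec y z (a ∷ b ∷ l)
      to (inj₁ (refl , refl)) = here
      to (inj₂ c)             = there c
      from : Consec y z (a ∷ b ∷ l) → (y ≡ a × z ≡ b) ⊎ Consec y z (b ∷ l)
      from here      = inj₁ (refl , refl)
      from (there c) = inj₂ c

    private
      consec-fst∈ : ∀ {y z l} → Consec y z l → y ∈ l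
      consec-fst∈ here      = here refl
      consec-fst∈ (there c) = there (consec-fst∈ c)

      consec-snd∈ : ∀ {y z x l} → Consec y z (x ∷ l) → z ∈ l
      consec-snd∈ here = here refl
      consec-snd∈ {l = _ ∷ _} (there c) = there (consec-snd∈ c)

      head∉ : ∀ {x : Fin n} {l} → Unique (x ∷ l) → x ∉ l
      head∉ (a ∷ _) m = All.lookup a m refl

      tail-unique : ∀ {x : Fin n} {l} → Unique (x ∷ l) → Unique l
      tail-unique (_ ∷ u) = u

      pred-unique : ∀ {a b z l} → Unique l → Consec a z l → Consec b z l → a ≡ b
      pred-unique u here      here      = refl
      pred-unique u here      (there c) = contradiction (consec-snd∈ c) (head∉ (tail-unique u))
      pred-unique u (there c) here      = contradiction (consec-snd∈ c) (head∉ (tail-unique u))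
      pred-unique u (there c) (there d) = pred-unique (tail-unique u) c d

      succ-unique : ∀ {a b z l} → Unique l → Consec z a l → Consec z b l → a ≡ b
      succ-unique u here      here      = refl
      succ-unique u here      (there c) = contradiction (consec-fst∈ c) (head∉ u)
      succ-unique u (there c) here      = contradiction (consec-fst∈ c) (head∉ u)
      succ-unique u (there c) (there d) = succ-unique (tail-unique u) c d

      last-no-succ : ∀ {x y l} → Unique (x ∷ l) → ¬ Consec (lastOf x l) y (x ∷ l)
      last-no-succ {l = []}    u (there ())
      last-no-succ {x} {l = z ∷ l} u c = case c
        where
        last∈ : ∀ z l → lastOf z l ∈ z ∷ l
        last∈ z []      = here refl
        last∈ z (w ∷ l) = there (last∈ w l)
        fst : ∀ {a y} → Consec a y (x ∷ z ∷ l) → a ≡ x ⊎ Consec a y (z ∷ l)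
        fst here      = inj₁ refl
        fst (there c) = inj₂ c
        case : Consec (lastOf z l) _ (x ∷ z ∷ l) → ⊥
        case c with fst c
        ... | inj₁ e = head∉ u (subst (_∈ z ∷ l) e (last∈ z l))
        ... | inj₂ d = last-no-succ (tail-unique u) d

      consec-split⁻ : ∀ {a b} p u w s → Consec a b (p ++ u ∷ w ∷ s) →
        Consec a b (p ++ u ∷ []) ⊎ (a ≡ u × b ≡ w) ⊎ Consec a b (w ∷ s)
      consec-split⁻ []          u w s here      = inj₂ (inj₁ (refl , refl))
      consec-split⁻ []          u w s (there c) = inj₂ (inj₂ c)
      consec-split⁻ (x ∷ [])    u w s here      = inj₁ here
      consec-split⁻ (x ∷ y ∷ p) u w s here      = inj₁ here
      consec-split⁻ (x ∷ p)     u w s (there c) = Sum.map₁ there (consec-split⁻ p u w s c)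

      consec-left : ∀ {a b} p u w s → Consec a b (p ++ u ∷ []) → Consec a b (p ++ u ∷ w ∷ s)
      consec-left []          u w s (there ())
      consec-left (x ∷ [])    u w s here      = here
      consec-left (x ∷ y ∷ p) u w s here      = here
      consec-left (x ∷ p)     u w s (there c) = there (consec-left p u w s c)

      consec-right : ∀ {a b} p s → Consec a b s → Consec a b (p ++ s)
      consec-right []      s c = c
      consec-right (x ∷ p) s c = there (consec-right p s c)

      consec-reverse : ∀ {a b} x l → Consec a b (reverse (x ∷ l)) → Consec b a (x ∷ l)
      consec-reverse x [] (there ())
      consec-reverse {a} {b} x (y ∷ l) c with consec-split⁻ (reverse l) y x []
        (subst (Consec a b) (trans (List.unfold-reverse x (y ∷ l))
          (trans (cong (_++ x ∷ []) (List.unfold-reverse y l)) (List.++-assoc (reverse l) (y ∷ []) (x ∷ [])))) c)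
      ... | inj₁ d = there (consec-reverse y l (subst (Consec a b) (sym (List.unfold-reverse y l)) d))
      ... | inj₂ (inj₁ (refl , refl)) = here
      ... | inj₂ (inj₂ (there ()))

      consec-middle : ∀ pre y z suf → Consec y z (pre ++ y ∷ z ∷ suf)
      consec-middle []        y z suf = here
      consec-middle (x ∷ pre) y z suf = there (consec-middle pre y z suf)

      find-pred : ∀ {z : Fin n} x l → z ∈ x ∷ l → z ≢ x → ∃[ pre ] ∃[ y ] ∃[ suf ] (x ∷ l ≡ pre ++ y ∷ z ∷ suf)
      find-pred x l       (here refl) ne = contradiction refl ne
      find-pred {z} x (y ∷ l) (there m) ne with z Fin.≟ y
      ... | yes refl = [] , x , l , refl
      ... | no z≢y   = let (pre , w , suf , e) = find-pred y l m z≢y in x ∷ pre , w , suf , cong (x ∷_) e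

    Adjacent : List (Fin n) → Fin n → Fin n → Set
    Adjacent l y z = Consec y z l ⊎ Consec z y l

    -- The rotation creates a single new pair, (x , z). The reversed segment keeps its pairs in the
    -- opposite direction, hence `Adjacent`.
    rotate-adjacent : ∀ {a b} x l pre y z suf → x ∷ l ≡ pre ++ y ∷ z ∷ suf → Consec a b (y ∷ rotate pre y z suf) →
      Adjacent (x ∷ l) a b ⊎ (a ≡ x × b ≡ z)
    rotate-adjacent x l [] y z suf refl c = inj₁ (inj₁ c)
    rotate-adjacent {a} {b} x l (x ∷ p) y z suf refl c with consec-split⁻ (y ∷ reverse p) x z suf
      (subst (Consec a b) (cong (y ∷_) (trans (cong (_++ z ∷ suf) (List.unfold-reverse x p)) (List.++-assoc (reverse p) (x ∷ []) (z ∷ suf)))) c)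
    ... | inj₁ d = inj₁ (inj₂ (consec-left (x ∷ p) y z suf (consec-reverse x (p ++ y ∷ [])
      (subst (Consec a b) (sym (trans (List.reverse-++ (x ∷ p) (y ∷ [])) (cong (y ∷_) (List.unfold-reverse x p)))) d))))
    ... | inj₂ (inj₁ e) = inj₂ e
    ... | inj₂ (inj₂ d) = inj₁ (inj₁ (consec-right (x ∷ p) (y ∷ z ∷ suf) (there d)))

    module _ {G H : Graph n} (G⊑H : G ⊑ H) (x₀ : Fin n) (l₀ : List (Fin n)) (opt₀ : Optimal H (x₀ ∷ l₀)) where

      private
        full = x₀ ∷ l₀
        u₀ : Unique full
        u₀ = arrangement-unique (proj₁ opt₀)

      Near : (Fin n → Bool) → Fin n → Set
      Near S z = T (S z) ⊎ ∃[ y ] (T (S y) × Adjacent full y z)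

      -- Pairs that became consecutive by rotations have both members in S or next to S in the original
      -- ordering, so a vertex that is not near S still has its original neighbours.
      Reachable : (Fin n → Bool) → Fin n → Set
      Reachable S x = ∃[ l ] (Optimal H (x ∷ l) × lastOf x l ≡ lastOf x₀ l₀ ×
        (∀ a b → Consec a b (x ∷ l) → Adjacent full a b ⊎ (Near S a × Near S b)))

      -- Some m + 1 reachable ends rather than all of them. The set grows one vertex at a time and
      -- stops at s₀ + 1, so expansion is invoked for sets of at most s₀ vertices only.
      record EndSet (m : ℕ) : Set where
        constructor endSet
        field
          set    : Fin n → Bool
          card   : Σᶠ (χ ∘ set) ≡ suc m
          origin : T (set x₀)
          reach  : ∀ x → T (set x) → Reachable set x

      private
        Frontier : (Fin n → Bool) → Fin n → Fin n → Set
        Frontier S x z = T (S x) × T (adj G x z) × ¬ T (S z) × ¬ (∃[ y ] (T (S y) × Adjacent full y z))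

        adjacent? : ∀ (S : Fin n → Bool) z → Dec (∃[ y ] (T (S y) × Adjacent full y z))
        adjacent? S z = Fin.any? λ y → T? (S y) ×-dec (consec? y z full ⊎-dec consec? z y full)

        frontier? : ∀ (S : Fin n → Bool) → Dec (∃[ x ] ∃[ z ] Frontier S x z)
        frontier? S = Fin.any? λ x → Fin.any? λ z → T? (S x) ×-dec T? (adj G x z) ×-dec ¬? (T? (S z)) ×-dec ¬? (adjacent? S z)

        module _ (S : Fin n → Bool) (sx₀ : T (S x₀)) where
          after before : Fin n → Bool
          after  z = does (Fin.any? λ y → T? (S y) ×-dec consec? y z full)
          before z = does (Fin.any? λ y → T? (S y) ×-dec consec? z y full)

          after⁻ : ∀ z → after z ≡ true → ∃[ y ] (T (S y) × Consec y z full)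
          after⁻ z = does-true (Fin.any? λ y → T? (S y) ×-dec consec? y z full)

          before⁻ : ∀ z → before z ≡ true → ∃[ y ] (T (S y) × Consec z y full)
          before⁻ z = does-true (Fin.any? λ y → T? (S y) ×-dec consec? z y full)

          sumS : (Fin n → Bool) → List (Fin n) → ℕ
          sumS b l = sumᴸ (map (χ ∘ b) l)

          χ-imp : ∀ {a b} → (a ≡ true → T b) → χ a ≤ χ b
          χ-imp {false}        h = z≤n
          χ-imp {true} {true}  h = s≤s z≤n
          χ-imp {true} {false} h = ⊥-elim (h refl)

          shift-after : ∀ x l → (∀ {a z} → Consec a z (x ∷ l) → Consec a z full) → sumS after l ≤ sumS S (x ∷ l)
          shift-after x []      inc = z≤n
          shift-after x (z ∷ l) inc = +-mono-≤
            (χ-imp λ t → let (y , sy , c) = after⁻ z t in subst (T ∘ S) (pred-unique u₀ c (inc here)) sy)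
            (shift-after z l (inc ∘ there))

          shift-before : ∀ x l → (∀ {a z} → Consec a z (x ∷ l) → Consec a z full) → before (lastOf x l) ≡ false →
            sumS before (x ∷ l) ≤ sumS S l
          shift-before x []      inc e = ≤-reflexive (trans (+-identityʳ _) (cong χ e))
          shift-before x (z ∷ l) inc e = +-mono-≤
            (χ-imp λ t → let (y , sy , c) = before⁻ x t in subst (T ∘ S) (succ-unique u₀ c (inc here)) sy)
            (shift-before z l (inc ∘ there) e)

          not-true : ∀ {b} → b ≢ true → b ≡ false
          not-true {false} _ = refl
          not-true {true}  h = contradiction refl h

          -- Each member of S has at most one successor and one predecessor in the original
          -- ordering, and x₀, being first, has no predecessor. This makes the inequality strict.
          few-outer : (∀ z → T (outer G S z) → ∃[ y ] (T (S y) × Adjacent full y z)) → Σᶠ (χ ∘ outer G S) < 2 * Σᶠ (χ ∘ S)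
          few-outer h = begin-strict
            Σᶠ (χ ∘ outer G S)
              ≤⟨ Σᶠ-mono pointwise ⟩
            Σᶠ (λ z → χ (after z) + χ (before z))
              ≡⟨ ∑-distrib-+ (χ ∘ after) (χ ∘ before) ⟩
            Σᶠ (χ ∘ after) + Σᶠ (χ ∘ before)
              ≡⟨ cong₂ _+_ (sym (arrangement-sum (proj₁ opt₀) (χ ∘ after))) (sym (arrangement-sum (proj₁ opt₀) (χ ∘ before))) ⟩
            sumS after full + sumS before full
              ≡⟨ cong (λ b → χ b + sumS after l₀ + sumS before full) (not-true λ t → let (y , _ , c) = after⁻ x₀ t in head∉ u₀ (consec-snd∈ c)) ⟩
            sumS after l₀ + sumS before full
              ≤⟨ +-mono-≤ (shift-after x₀ l₀ (λ c → c)) (shift-before x₀ l₀ (λ c → c) (not-true λ t → let (y , _ , c) = before⁻ _ t in last-no-succ u₀ c)) ⟩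
            sumS S full + sumS S l₀
              <⟨ +-monoʳ-< (sumS S full) (≤-reflexive (cong (λ b → χ b + sumS S l₀) (sym (T-true sx₀)))) ⟩
            sumS S full + sumS S full
              ≡⟨ cong₂ _+_ (arrangement-sum (proj₁ opt₀) (χ ∘ S)) (trans (arrangement-sum (proj₁ opt₀) (χ ∘ S)) (sym (+-identityʳ _))) ⟩
            2 * Σᶠ (χ ∘ S) ∎
            where
            open ≤-Reasoning
            pointwise : ∀ z → χ (outer G S z) ≤ χ (after z) + χ (before z)
            pointwise z with outer G S z in e
            ... | false = z≤n
            ... | true with h z (subst T (sym e) _)
            ...   | y , sy , inj₁ c = ≤-trans (≤-reflexive (sym (cong χ (dec-true (Fin.any? λ y → T? (S y) ×-dec consec? y z full) (y , sy , c))))) (m≤m+n _ _)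
            ...   | y , sy , inj₂ c = ≤-trans (≤-reflexive (sym (cong χ (dec-true (Fin.any? λ y → T? (S y) ×-dec consec? z y full) (y , sy , c))))) (m≤n+m _ _)

        T-not⁻ : ∀ {b} → T (not b) → ¬ T b
        T-not⁻ {false} _ ()

        outer⁻ : ∀ S z → T (outer G S z) → ¬ T (S z) × ∃[ x ] (T (S x) × T (adj G x z))
        outer⁻ S z t =
          let (a , b) = Equivalence.to (T-∧ {not (S z)}) t
              (x , c) = does-true (Fin.any? λ u → T? (S u ∧ adj G u z)) (T-true b) in
          T-not⁻ a , x , Equivalence.to (T-∧ {S x}) c

        insert : (Fin n → Bool) → Fin n → Fin n → Bool
        insert S y v = S v ∨ does (v Fin.≟ y)

        insert-new : ∀ S y → T (insert S y y)
        insert-new S y with S y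
        ... | true = _
        ... | false = subst T (sym (dec-true (y Fin.≟ y) refl)) _

        insert-old : ∀ S y {v} → T (S v) → T (insert S y v)
        insert-old S y {v} t with S v
        ... | true = _

        insert⁻ : ∀ S y v → T (insert S y v) → T (S v) ⊎ v ≡ y
        insert⁻ S y v t with S v
        ... | true  = inj₁ _
        ... | false = inj₂ (does-true (v Fin.≟ y) (T-true t))

        near-mono : ∀ S y {z} → Near S z → Near (insert S y) z
        near-mono S y {z} (inj₁ t)           = inj₁ (insert-old S y {z} t)
        near-mono S y (inj₂ (w , t , a)) = inj₂ (w , insert-old S y {w} t , a)

        -- Rotating along x z makes the current predecessor y of z an end. As z is not near S, y was
        -- next to z from the beginning, and as z is not next to S, y is new.
        enlarge : ∀ {m} → (E : EndSet m) → ∃[ x ] ∃[ z ] Frontier (EndSet.set E) x z → EndSet (suc m)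
        enlarge {m} (endSet S card origin reach) (x , z , sx , xz , ¬sz , ¬az) with reach x sx
        ... | l , opt , last , inv with find-pred x l (arrangement-∈ (proj₁ opt) z) z≢x
          where
          z≢x : z ≢ x
          z≢x refl = subst T (loopless G z) xz
        ...   | pre , y , suf , eq = endSet S′ card′ (insert-old S y {x₀} origin) reach′
          where
          S′ = insert S y
          yz : Adjacent full y z
          yz with inv y z (subst (Consec y z) (sym eq) (consec-middle pre y z suf))
          ... | inj₁ a = a
          ... | inj₂ (_ , inj₁ t) = contradiction t ¬sz
          ... | inj₂ (_ , inj₂ a) = contradiction a ¬az
          ¬sy : ¬ T (S y)
          ¬sy t = ¬az (y , t , yz)
          T-false : ∀ {b} → ¬ T b → b ≡ false
          T-false {false} _ = refl
          T-false {true}  h = contradiction _ h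
          card′ : Σᶠ (χ ∘ S′) ≡ suc (suc m)
          card′ = +-cancelʳ-≡ 0 _ _ (trans
            (trans (cong (λ b → Σᶠ (χ ∘ S′) + χ b) (sym (T-false ¬sy)))
              (Σᶠ-update {f = χ ∘ S′} {χ ∘ S} y λ v v≢y → trans (cong (λ b → χ (S v ∨ b)) (dec-false (v Fin.≟ y) v≢y)) (cong χ (∨-false (S v)))))
            (trans (cong₂ _+_ card (cong χ (T-true (insert-new S y)))) (trans (+-comm (suc m) 1) (sym (+-identityʳ _)))))
            where
            ∨-false : ∀ b → b ∨ false ≡ b
            ∨-false true  = refl
            ∨-false false = refl
          rotated = rotate-optimal H x l pre y z suf opt eq (G⊑H x z xz)
          reach′ : ∀ v → T (S′ v) → Reachable S′ v
          reach′ v t with insert⁻ S y v t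
          ... | inj₁ sv = let (lv , ov , ev , iv) = reach v sv in
            lv , ov , ev , λ a b c → Sum.map₂ (λ (p , q) → near-mono S y p , near-mono S y q) (iv a b c)
          ... | inj₂ refl = rotate pre y z suf , proj₁ rotated , trans (proj₂ rotated) last , inv′
            where
            swap-near : ∀ {a b} → Adjacent full b a ⊎ (Near S b × Near S a) → Adjacent full a b ⊎ (Near S′ a × Near S′ b)
            swap-near (inj₁ a)       = inj₁ (Sum.swap a)
            swap-near (inj₂ (p , q)) = inj₂ (near-mono S y q , near-mono S y p)
            inv′ : ∀ a b → Consec a b (y ∷ rotate pre y z suf) → Adjacent full a b ⊎ (Near S′ a × Near S′ b)
            inv′ a b c with rotate-adjacent x l pre y z suf eq c
            ... | inj₁ (inj₁ d) = Sum.map₂ (λ (p , q) → near-mono S y p , near-mono S y q) (inv a b d)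
            ... | inj₁ (inj₂ d) = swap-near (inv b a d)
            -- The pair created by the rotation: x lies in S, and z is next to the new member y.
            ... | inj₂ (refl , refl) = inj₂ (inj₁ (insert-old S y {x} sx) , inj₂ (y , insert-new S y , yz))

      module _ {s₀ : ℕ} (expander : IsExpander G s₀) where

        ends : ∀ m → m ≤ s₀ → EndSet m
        ends zero _ = endSet (λ v → does (v Fin.≟ x₀)) (Σᶠ-single x₀) (subst T (sym (dec-true (x₀ Fin.≟ x₀) refl)) _) λ x t →
          subst (Reachable _) (sym (does-true (x Fin.≟ x₀) (T-true t))) (l₀ , opt₀ , refl , λ a b c → inj₁ (inj₁ c))
        ends (suc m) m<s₀ = case (ends m (<⇒≤ m<s₀))
          where
          case : EndSet m → EndSet (suc m)
          case E@(endSet S card origin reach) with frontier? S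
          ... | yes f = enlarge E f
          ... | no ¬f = contradiction
            (expander S (subst (1 ≤_) (sym card) (s≤s z≤n)) (subst (_≤ s₀) (sym card) m<s₀))
            (<⇒≱ (few-outer S origin blocked))
            where
            blocked : ∀ z → T (outer G S z) → ∃[ y ] (T (S y) × Adjacent full y z)
            blocked z t with adjacent? S z | outer⁻ S z t
            ... | yes a | _ = a
            ... | no ¬a | ¬sz , x , sx , xz = contradiction (x , z , sx , xz , ¬sz , ¬a) ¬f

    expander⇒manyEnds : ∀ {G H : Graph n} {s₀} → G ⊑ H → IsExpander G s₀ → ManyEnds H s₀
    expander⇒manyEnds {G} {H} {s₀} G⊑H expander x l opt w c h = begin
      s₀ * c
        ≤⟨ *-monoˡ-≤ c (n≤1+n s₀) ⟩
      suc s₀ * c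
        ≡⟨ cong (_* c) (sym card) ⟩
      Σᶠ (χ ∘ set) * c
        ≡⟨ *-distribʳ-sum c (χ ∘ set) ⟩
      Σᶠ (λ y → χ (set y) * c)
        ≤⟨ Σᶠ-mono pointwise ⟩
      Σᶠ w ∎
      where
      open ≤-Reasoning
      open EndSet (ends {G} {H} G⊑H x l opt expander s₀ ≤-refl)
      pointwise : ∀ y → χ (set y) * c ≤ w y
      pointwise y with set y in e
      ... | false = z≤n
      ... | true  = let (l′ , opt′ , last , _) = reach y (subst T (sym e) _) in
        ≤-trans (≤-reflexive (*-identityˡ c)) (h y l′ opt′ last)

-- The generating function of the outer neighbourhood of a fixed set

module OuterNeighbours where
  open import Data.Fin.Base using (zero; suc)
  open import Data.Rational.Base
  open import Tactic.RingSolver using (solve-∀)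
  open Rationals
  open Expectation
  open Arrangements using (χ; Σᶠ; Σᶠ-mono; Σᶠ-term; ∑-distrib-+; *-distribʳ-sum; T-true)
  open Boosters using (ordered≤2unordered; fromEdges-adj⁺; does-true)
  open Permutations using (Σᶠ-single)
  open Posa using (outer)

  Πᶠ : ∀ {n} → (Fin n → ℚ) → ℚ
  Πᶠ {zero}  f = 1ℚ
  Πᶠ {suc n} f = f zero * Πᶠ (f ∘ suc)

  Πᶠ-nonneg : ∀ {n} {f : Fin n → ℚ} → (∀ i → 0ℚ ≤ f i) → 0ℚ ≤ Πᶠ f
  Πᶠ-nonneg {zero}  h = 0≤1
  Πᶠ-nonneg {suc n} h = 0≤* (h zero) (Πᶠ-nonneg (h ∘ suc))

  Πᶠ-mono : ∀ {n} {f g : Fin n → ℚ} → (∀ i → 0ℚ ≤ f i) → (∀ i → f i ≤ g i) → Πᶠ f ≤ Πᶠ g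
  Πᶠ-mono {zero}  0≤f h = ℚ.≤-refl
  Πᶠ-mono {suc n} 0≤f h = *-mono (0≤f zero) (ℚ.≤-trans (Πᶠ-nonneg (0≤f ∘ suc)) (Πᶠ-mono (0≤f ∘ suc) (h ∘ suc))) (h zero) (Πᶠ-mono (0≤f ∘ suc) (h ∘ suc))

  Πᶠ-cong : ∀ {n} {f g : Fin n → ℚ} → (∀ i → f i ≡ g i) → Πᶠ f ≡ Πᶠ g
  Πᶠ-cong {zero}  h = refl
  Πᶠ-cong {suc n} h = cong₂ _*_ (h zero) (Πᶠ-cong (h ∘ suc))

  Πᶠ-convex : ∀ {n} p {f g h : Fin n → ℚ} u → (∀ v → v ≢ u → f v ≡ h v) → (∀ v → v ≢ u → g v ≡ h v) →
    p * f u + (1ℚ - p) * g u ≡ h u → p * Πᶠ f + (1ℚ - p) * Πᶠ g ≡ Πᶠ h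
  Πᶠ-convex {suc n} p {f} {g} {h} zero ef eg e = trans
    (cong₂ (λ a b → p * (f zero * a) + (1ℚ - p) * (g zero * b)) (Πᶠ-cong λ i → ef (suc i) λ ()) (Πᶠ-cong λ i → eg (suc i) λ ()))
    (trans (lemma p (f zero) (g zero) (Πᶠ (h ∘ suc))) (cong (_* Πᶠ (h ∘ suc)) e))
    where
    lemma : ∀ p a b c → p * (a * c) + (1ℚ - p) * (b * c) ≡ (p * a + (1ℚ - p) * b) * c
    lemma = solve-∀ ℚ-ring
  Πᶠ-convex {suc n} p {f} {g} {h} (suc u) ef eg e = trans
    (cong₂ (λ a b → p * (a * Πᶠ (f ∘ suc)) + (1ℚ - p) * (b * Πᶠ (g ∘ suc))) (ef zero λ ()) (eg zero λ ()))
    (trans (lemma p (h zero) (Πᶠ (f ∘ suc)) (Πᶠ (g ∘ suc)))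
      (cong (h zero *_) (Πᶠ-convex p u (λ v ne → ef (suc v) (ne ∘ Fin.suc-injective)) (λ v ne → eg (suc v) (ne ∘ Fin.suc-injective)) e)))
    where
    lemma : ∀ p a b c → p * (a * b) + (1ℚ - p) * (a * c) ≡ a * (p * b + (1ℚ - p) * c)
    lemma = solve-∀ ℚ-ring

  Πᶠ-power : ∀ {n} θ (b : Fin n → Bool) → Πᶠ (λ v → if b v then θ else 1ℚ) ≡ θ ^ℚ Σᶠ (χ ∘ b)
  Πᶠ-power {zero}  θ b = refl
  Πᶠ-power {suc n} θ b with b zero
  ... | true  = cong (θ *_) (Πᶠ-power θ (b ∘ suc))
  ... | false = trans (ℚ.*-identityˡ _) (Πᶠ-power θ (b ∘ suc))

  Πᶠ-complement : ∀ {n} y (b : Fin n → Bool) → 0ℚ ≤ y → 1ℚ ≤ ι 2 * y →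
    Πᶠ (λ v → if b v then 1ℚ else y) ≤ ι 2 ^ℚ Σᶠ (χ ∘ b) * y ^ℚ n
  Πᶠ-complement {zero}  y b 0≤y h = ℚ.≤-refl
  Πᶠ-complement {suc n} y b 0≤y h with b zero
  ... | true = ℚ.≤-trans (*-mono 0≤1 (0≤* (^-nonneg (0≤ι 2) s) (^-nonneg 0≤y n)) h (Πᶠ-complement y (b ∘ suc) 0≤y h))
    (ℚ.≤-reflexive (lemma (ι 2) y (ι 2 ^ℚ s) (y ^ℚ n)))
    where
    s = Σᶠ (χ ∘ b ∘ suc)
    lemma : ∀ t y a b → t * y * (a * b) ≡ t * a * (y * b)
    lemma = solve-∀ ℚ-ring
  ... | false = ℚ.≤-trans (*-monoˡ 0≤y (Πᶠ-complement y (b ∘ suc) 0≤y h))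
    (ℚ.≤-reflexive (lemma y (ι 2 ^ℚ Σᶠ (χ ∘ b ∘ suc)) (y ^ℚ n)))
    where
    lemma : ∀ y a b → y * (a * b) ≡ a * (y * b)
    lemma = solve-∀ ℚ-ring

  χ-mono : ∀ {a b} → (a ≡ true → b ≡ true) → χ a ℕ.≤ χ b
  χ-mono {false} h = ℕ.z≤n
  χ-mono {true}  h = ℕ.≤-reflexive (sym (cong χ (h refl)))

  module _ {n : ℕ} (S : Fin n → Bool) where

    private
      V = Fin n

      _≟ₘ_ : (x y : Maybe V) → Dec (x ≡ y)
      _≟ₘ_ = Maybe.≡-dec Fin._≟_

    -- The one vertex that this pair could add to the outer neighbourhood of S. A pair has at most
    -- one target, so different vertices depend on disjoint sets of pairs.
    target : V × V → Maybe V
    target (a , b) = if S a then (if S b then nothing else just b) else (if S b then just a else nothing)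

    target-sym : ∀ a b → target (a , b) ≡ target (b , a)
    target-sym a b with S a | S b
    ... | true  | true  = refl
    ... | true  | false = refl
    ... | false | true  = refl
    ... | false | false = refl

    target⁻ : ∀ a b {v} → target (a , b) ≡ just v → S v ≡ false × ((T (S a) × b ≡ v) ⊎ (T (S b) × a ≡ v))
    target⁻ a b e with S a in ea | S b in eb
    target⁻ a b refl | true  | false = eb , inj₁ (_ , refl)
    target⁻ a b refl | false | true  = ea , inj₂ (_ , refl)

    target-loop : ∀ a → target (a , a) ≡ nothing
    target-loop a with S a
    ... | true  = refl
    ... | false = refl

    target⁺ : ∀ {v w} → S v ≡ false → T (S w) → target (v , w) ≡ just v
    target⁺ {v} {w} ev tw rewrite ev | T-true tw = refl

    hits : V → V × V → Bool
    hits v e = does (target e ≟ₘ just v)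

    mark : Maybe V → (V → Bool) → V → Bool
    mark nothing  τ v = τ v
    mark (just u) τ v = τ v ∨ does (v Fin.≟ u)

    -- The set of targets is accumulated in the order in which `𝔼` exposes pairs; starting from a
    -- general τ makes the induction of `𝔼-touch` possible.
    touch : (V → Bool) → List (V × V) → V → Bool
    touch τ []      = τ
    touch τ (e ∷ E) = touch (mark (target e) τ) E

    touch⁻ : ∀ τ E v → touch τ E v ≡ true → τ v ≡ true ⊎ ∃[ e ] (e ∈ E × target e ≡ just v)
    touch⁻ τ []      v t = inj₁ t
    touch⁻ τ (e ∷ E) v t with touch⁻ (mark (target e) τ) E v t
    ... | inj₂ (e′ , m , h) = inj₂ (e′ , there m , h)
    ... | inj₁ h = lemma (target e) refl h
      where
      lemma : ∀ m → target e ≡ m → mark m τ v ≡ true → τ v ≡ true ⊎ ∃[ e′ ] (e′ ∈ e ∷ E × target e′ ≡ just v)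
      lemma nothing  eq h = inj₁ h
      lemma (just u) eq h with τ v
      ... | true  = inj₁ refl
      ... | false = inj₂ (e , here refl , trans eq (cong just (sym (does-true (v Fin.≟ u) h))))

    touched≤outer : ∀ E v → χ (touch (λ _ → false) E v) ℕ.≤ χ (outer (fromEdges E) S v)
    touched≤outer E v = χ-mono λ t → Sum.[ (λ ()) , (λ ((a , b) , m , h) → touched a b m (target⁻ a b h)) ] (touch⁻ (λ _ → false) E v t)
      where
      outer-true : S v ≡ false → ∀ u → T (S u) → (u , v) ∈ E ⊎ (v , u) ∈ E → outer (fromEdges E) S v ≡ true
      outer-true sv u su m = cong₂ _∧_ (cong not sv)
        (dec-true (Fin.any? λ u → T? (S u ∧ adj (fromEdges E) u v))
          (u , Equivalence.from (T-∧ {S u}) (su , fromEdges-adj⁺ E u v (λ { refl → subst T sv su }) m)))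
      touched : ∀ a b → (a , b) ∈ E → S v ≡ false × ((T (S a) × b ≡ v) ⊎ (T (S b) × a ≡ v)) → outer (fromEdges E) S v ≡ true
      touched a b m (sv , inj₁ (sa , refl)) = outer-true sv a sa (inj₁ m)
      touched a b m (sv , inj₂ (sb , refl)) = outer-true sv b sb (inj₂ m)

    -- v forms a pair with each of the s members of S. Among ordered pairs, row v contributes s and
    -- every row in S one more.
    hits-count : ∀ v → S v ≡ false → Σᶠ (χ ∘ S) ℕ.≤ count (hits v) (vertexPairs n)
    hits-count v sv = ℕ.*-cancelˡ-≤ 2 (ℕ.≤-trans rows (ordered≤2unordered (hits v)
      (λ a b → cong (λ m → does (m ≟ₘ just v)) (target-sym a b))
      (λ a → dec-false (target (a , a) ≟ₘ just v) λ e → contradiction (trans (sym (target-loop a)) e) λ ())))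
      where
      open ℕ.≤-Reasoning
      s = Σᶠ (χ ∘ S)
      in-S : ∀ {u} → S u ≡ true → target (u , v) ≡ just v
      in-S {u} su = trans (target-sym u v) (target⁺ sv (subst T (sym su) _))
      row : ∀ u → χ (does (u Fin.≟ v)) ℕ.* s ℕ.+ χ (S u) ℕ.≤ Σᶠ (λ w → χ (hits v (u , w)))
      row u = case (u Fin.≟ v)
        where
        case : Dec (u ≡ v) → χ (does (u Fin.≟ v)) ℕ.* s ℕ.+ χ (S u) ℕ.≤ Σᶠ (λ w → χ (hits v (u , w)))
        case (yes refl) = begin
          χ (does (v Fin.≟ v)) ℕ.* s ℕ.+ χ (S v)
            ≡⟨ cong₂ (λ b c → χ b ℕ.* s ℕ.+ χ c) (dec-true (v Fin.≟ v) refl) sv ⟩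
          1 ℕ.* s ℕ.+ 0
            ≡⟨ trans (ℕ.+-identityʳ _) (ℕ.*-identityˡ s) ⟩
          s
            ≤⟨ Σᶠ-mono (λ w → χ-mono λ sw → dec-true (target (v , w) ≟ₘ just v) (target⁺ sv (subst T (sym sw) _))) ⟩
          Σᶠ (λ w → χ (hits v (v , w))) ∎
        case (no u≢v) = begin
          χ (does (u Fin.≟ v)) ℕ.* s ℕ.+ χ (S u)
            ≡⟨ cong (λ b → χ b ℕ.* s ℕ.+ χ (S u)) (dec-false (u Fin.≟ v) u≢v) ⟩
          χ (S u)
            ≤⟨ χ-mono (λ su → dec-true (target (u , v) ≟ₘ just v) (in-S su)) ⟩
          χ (hits v (u , v))
            ≤⟨ Σᶠ-term (λ w → χ (hits v (u , w))) v ⟩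
          Σᶠ (λ w → χ (hits v (u , w))) ∎
      rows : 2 ℕ.* s ℕ.≤ Σᶠ (λ u → Σᶠ (λ w → χ (hits v (u , w))))
      rows = begin
        2 ℕ.* s
          ≡⟨⟩
        s ℕ.+ (s ℕ.+ 0)
          ≡⟨ cong₂ ℕ._+_ (sym (trans (cong (ℕ._* s) (Σᶠ-single v)) (ℕ.*-identityˡ s))) (ℕ.+-identityʳ s) ⟩
        Σᶠ (λ u → χ (does (u Fin.≟ v))) ℕ.* s ℕ.+ s
          ≡⟨ cong (ℕ._+ s) (*-distribʳ-sum s (λ u → χ (does (u Fin.≟ v)))) ⟩
        Σᶠ (λ u → χ (does (u Fin.≟ v)) ℕ.* s) ℕ.+ s
          ≡⟨ ∑-distrib-+ (λ u → χ (does (u Fin.≟ v)) ℕ.* s) (χ ∘ S) ⟨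
        Σᶠ (λ u → χ (does (u Fin.≟ v)) ℕ.* s ℕ.+ χ (S u))
          ≤⟨ Σᶠ-mono row ⟩
        Σᶠ (λ u → Σᶠ (λ w → χ (hits v (u , w)))) ∎

    module _ (p θ : ℚ) where

      -- The expected contribution of one vertex, θ if touched and 1 if not, when d of the remaining
      -- pairs could touch it; the Boolean says that it has been touched already.
      factor : Bool → ℕ → ℚ
      factor b d = if b then θ else θ + (1ℚ - θ) * (1ℚ - p) ^ℚ d

      -- The expectation of the product factorises by independence: exposing a pair affects only the
      -- factor of its target, which is the convex combination of its two outcomes.
      𝔼-touch : ∀ xs τ → 𝔼 p xs (λ E → Πᶠ (λ v → if touch τ E v then θ else 1ℚ)) ≡ Πᶠ (λ v → factor (τ v) (count (hits v) xs))
      𝔼-touch [] τ = Πᶠ-cong λ v → base (τ v)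
        where
        lemma : ∀ θ → 1ℚ ≡ θ + (1ℚ - θ) * 1ℚ
        lemma = solve-∀ ℚ-ring
        base : ∀ b → (if b then θ else 1ℚ) ≡ factor b 0
        base true  = refl
        base false = lemma θ
      𝔼-touch (e ∷ xs) τ = trans
        (cong₂ (λ a b → p * a + (1ℚ - p) * b) (𝔼-touch xs (mark (target e) τ)) (𝔼-touch xs τ))
        (step (target e) refl)
        where
        d : V → ℕ
        d v = count (hits v) xs
        d′ : V → ℕ
        d′ v = count (hits v) (e ∷ xs)
        d′-hit : ∀ {v} → target e ≡ just v → d′ v ≡ suc (d v)
        d′-hit {v} h = cong (λ b → if b then suc (d v) else d v) (dec-true (target e ≟ₘ just v) h)
        d′-miss : ∀ {v} → target e ≢ just v → d′ v ≡ d v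
        d′-miss {v} h = cong (λ b → if b then suc (d v) else d v) (dec-false (target e ≟ₘ just v) h)
        convex : ∀ p a → p * a + (1ℚ - p) * a ≡ a
        convex = solve-∀ ℚ-ring
        convex′ : ∀ p θ a → p * θ + (1ℚ - p) * (θ + (1ℚ - θ) * a) ≡ θ + (1ℚ - θ) * ((1ℚ - p) * a)
        convex′ = solve-∀ ℚ-ring
        at-u : ∀ b d → p * θ + (1ℚ - p) * factor b d ≡ factor b (suc d)
        at-u true  d = convex p θ
        at-u false d = convex′ p θ ((1ℚ - p) ^ℚ d)
        step : ∀ m → target e ≡ m →
          p * Πᶠ (λ v → factor (mark m τ v) (d v)) + (1ℚ - p) * Πᶠ (λ v → factor (τ v) (d v)) ≡ Πᶠ (λ v → factor (τ v) (d′ v))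
        step nothing eq = trans (convex p (Πᶠ (λ v → factor (τ v) (d v))))
          (Πᶠ-cong λ v → cong (factor (τ v)) (sym (d′-miss λ h → contradiction (trans (sym eq) h) λ ())))
        step (just u) eq = Πᶠ-convex p u
          (λ v v≢u → cong₂ factor (trans (cong (τ v ∨_) (dec-false (v Fin.≟ u) v≢u)) (∨-false (τ v))) (miss v≢u))
          (λ v v≢u → cong (factor (τ v)) (miss v≢u))
          (trans (cong (λ b → p * factor b (d u) + (1ℚ - p) * factor (τ u) (d u)) (trans (cong (τ u ∨_) (dec-true (u Fin.≟ u) refl)) (∨-true (τ u))))
            (trans (at-u (τ u) (d u)) (cong (factor (τ u)) (sym (d′-hit eq)))))
          where
          ∨-false : ∀ b → b ∨ false ≡ b
          ∨-false true  = refl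
          ∨-false false = refl
          ∨-true : ∀ b → b ∨ true ≡ true
          ∨-true true  = refl
          ∨-true false = refl
          miss : ∀ {v} → v ≢ u → d v ≡ d′ v
          miss v≢u = sym (d′-miss λ h → v≢u (sym (Maybe.just-injective (trans (sym eq) h))))

    fewOuter : List (V × V) → Bool
    fewOuter E = does (Σᶠ (χ ∘ outer (fromEdges E) S) ℕ.<? 2 ℕ.* Σᶠ (χ ∘ S))

    -- Markov's inequality for θ ^ |N(S) \ S| with θ = 1 / suc t.
    fewOuter-bound : ∀ t {p} → IsProb p → let θ = 1/suc t ; s = Σᶠ (χ ∘ S) in
      𝔼 p (vertexPairs n) (λ E → ⟦ fewOuter E ⟧) ≤
      ι (suc t) ^ℚ (2 ℕ.* s) * Πᶠ (λ v → if S v then 1ℚ else θ + (1ℚ - θ) * (1ℚ - p) ^ℚ s)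
    fewOuter-bound t {p} pp@(0≤p , p≤1) = ℚ.≤-trans
      (𝔼-mono pp xs pointwise)
      (≤-respˡ (sym (trans (𝔼-*ˡ p xs (Θ ^ℚ (2 ℕ.* s)) _) (cong (Θ ^ℚ (2 ℕ.* s) *_) (𝔼-touch p θ xs (λ _ → false)))))
        (*-monoˡ (^-nonneg (0≤ι (suc t)) (2 ℕ.* s)) (Πᶠ-mono (λ v → 0≤y (count (hits v) xs)) factors)))
      where
      xs = vertexPairs n
      s = Σᶠ (χ ∘ S)
      θ = 1/suc t
      Θ = ι (suc t)
      1≤Θ : 1ℚ ≤ Θ
      1≤Θ = ι-mono {1} {suc t} (ℕ.s≤s ℕ.z≤n)
      0≤1-θ : 0ℚ ≤ 1ℚ - θ
      0≤1-θ = 0≤⇒- (1/suc≤1 t)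
      0≤1-p = 0≤⇒- p≤1
      0≤y : ∀ d → 0ℚ ≤ θ + (1ℚ - θ) * (1ℚ - p) ^ℚ d
      0≤y d = 0≤+ (0≤1/suc t) (0≤* 0≤1-θ (^-nonneg 0≤1-p d))
      lemma : ∀ θ → θ + (1ℚ - θ) * 1ℚ ≡ 1ℚ
      lemma = solve-∀ ℚ-ring
      factors : ∀ v → θ + (1ℚ - θ) * (1ℚ - p) ^ℚ count (hits v) xs ≤ (if S v then 1ℚ else θ + (1ℚ - θ) * (1ℚ - p) ^ℚ s)
      factors v with S v in sv
      ... | true  = ≤-respʳ (lemma θ) (ℚ.+-monoʳ-≤ θ (*-monoˡ 0≤1-θ (^-≤1 0≤1-p (1-≤1 0≤p) (count (hits v) xs))))
      ... | false = ℚ.+-monoʳ-≤ θ (*-monoˡ 0≤1-θ (^-anti 0≤1-p (1-≤1 0≤p) (hits-count v sv)))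
      large : ∀ c → c ℕ.≤ 2 ℕ.* s → 1ℚ ≤ Θ ^ℚ (2 ℕ.* s) * θ ^ℚ c
      large c h = ℚ.≤-trans (ℚ.≤-reflexive (sym (trans (sym (^-*-distrib Θ θ c)) (trans (cong (_^ℚ c) (suc*1/suc t)) (1^ c)))))
        (*-monoʳ (^-nonneg (0≤1/suc t) c) (^-incr 1≤Θ h))
      pointwise : ∀ E → ⟦ fewOuter E ⟧ ≤ Θ ^ℚ (2 ℕ.* s) * Πᶠ (λ v → if touch (λ _ → false) E v then θ else 1ℚ)
      pointwise E = ≤-respʳ (cong (Θ ^ℚ (2 ℕ.* s) *_) (sym (Πᶠ-power θ (touch (λ _ → false) E)))) (case (fewOuter E) refl)
        where
        c = Σᶠ (χ ∘ touch (λ _ → false) E)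
        case : ∀ b → fewOuter E ≡ b → ⟦ b ⟧ ≤ Θ ^ℚ (2 ℕ.* s) * θ ^ℚ c
        case false _ = 0≤* (^-nonneg (0≤ι (suc t)) (2 ℕ.* s)) (^-nonneg (0≤1/suc t) c)
        case true  h = large c (ℕ.≤-trans (Σᶠ-mono (touched≤outer E)) (ℕ.<⇒≤ (does-true (_ ℕ.<? _) h)))

-- The union bound over all small sets

module Expansion where
  open import Data.Rational.Base
  open import Data.Vec.Base as Vec using (Vec; []; _∷_; lookup)
  open import Tactic.RingSolver using (solve-∀)
  open Rationals
  open Expectation
  open Arrangements using (χ; Σᶠ; Σᶠ-mono; sum-cong-≗; T-true)
  open Boosters using (does-true)
  open Posa using (outer; IsExpander)
  open OuterNeighbours

  sumSub : ∀ {n} → (Vec Bool n → ℚ) → ℚ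
  sumSub {zero}  F = F []
  sumSub {suc n} F = sumSub (λ S → F (true ∷ S)) + sumSub (λ S → F (false ∷ S))

  sumSub-mono : ∀ {n} {F G : Vec Bool n → ℚ} → (∀ S → F S ≤ G S) → sumSub F ≤ sumSub G
  sumSub-mono {zero}  h = h []
  sumSub-mono {suc n} h = ℚ.+-mono-≤ (sumSub-mono λ S → h (true ∷ S)) (sumSub-mono λ S → h (false ∷ S))

  sumSub-+ : ∀ {n} (F G : Vec Bool n → ℚ) → sumSub (λ S → F S + G S) ≡ sumSub F + sumSub G
  sumSub-+ {zero}  F G = refl
  sumSub-+ {suc n} F G = trans
    (cong₂ _+_ (sumSub-+ (λ S → F (true ∷ S)) (λ S → G (true ∷ S))) (sumSub-+ (λ S → F (false ∷ S)) (λ S → G (false ∷ S))))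
    (lemma (sumSub λ S → F (true ∷ S)) (sumSub λ S → G (true ∷ S)) (sumSub λ S → F (false ∷ S)) (sumSub λ S → G (false ∷ S)))
    where
    lemma : ∀ a b c d → a + b + (c + d) ≡ a + c + (b + d)
    lemma = solve-∀ ℚ-ring

  sumSub-*ˡ : ∀ {n} c (F : Vec Bool n → ℚ) → sumSub (λ S → c * F S) ≡ c * sumSub F
  sumSub-*ˡ {zero}  c F = refl
  sumSub-*ˡ {suc n} c F = trans
    (cong₂ _+_ (sumSub-*ˡ c (λ S → F (true ∷ S))) (sumSub-*ˡ c (λ S → F (false ∷ S))))
    (sym (ℚ.*-distribˡ-+ c (sumSub λ S → F (true ∷ S)) (sumSub λ S → F (false ∷ S))))

  sumSub-nonneg : ∀ {n} {F : Vec Bool n → ℚ} → (∀ S → 0ℚ ≤ F S) → 0ℚ ≤ sumSub F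
  sumSub-nonneg {zero}  h = h []
  sumSub-nonneg {suc n} h = 0≤+ (sumSub-nonneg λ S → h (true ∷ S)) (sumSub-nonneg λ S → h (false ∷ S))

  sumSub-term : ∀ {n} {F : Vec Bool n → ℚ} → (∀ S → 0ℚ ≤ F S) → ∀ S → F S ≤ sumSub F
  sumSub-term h []          = ℚ.≤-refl
  sumSub-term h (true ∷ S)  = ℚ.≤-trans (sumSub-term (λ S → h (true ∷ S)) S) (≤+ (sumSub-nonneg λ S → h (false ∷ S)))
  sumSub-term {F = F} h (false ∷ S) = ℚ.≤-trans (sumSub-term (λ S → h (false ∷ S)) S)
    (≤-respʳ (ℚ.+-comm (sumSub (λ S → F (false ∷ S))) (sumSub (λ S → F (true ∷ S)))) (≤+ (sumSub-nonneg λ S → h (true ∷ S))))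

  card : ∀ {n} → Vec Bool n → ℕ
  card S = Σᶠ (χ ∘ lookup S)

  sumSub-power : ∀ n x → sumSub {n} (λ S → x ^ℚ card S) ≡ (1ℚ + x) ^ℚ n
  sumSub-power zero    x = refl
  sumSub-power (suc n) x = trans
    (cong₂ _+_ (trans (sumSub-*ˡ {n} x (λ S → x ^ℚ card S)) (cong (x *_) (sumSub-power n x))) (sumSub-power n x))
    (lemma x ((1ℚ + x) ^ℚ n))
    where
    lemma : ∀ x a → x * a + a ≡ (1ℚ + x) * a
    lemma = solve-∀ ℚ-ring

  𝔼-sumSub : ∀ {A : Set} {n} p (xs : List A) (F : Vec Bool n → List A → ℚ) →
    𝔼 p xs (λ E → sumSub (λ S → F S E)) ≡ sumSub (λ S → 𝔼 p xs (F S))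
  𝔼-sumSub {n = zero}  p xs F = refl
  𝔼-sumSub {n = suc n} p xs F = trans (𝔼-+ p xs _ _)
    (cong₂ _+_ (𝔼-sumSub p xs (λ S → F (true ∷ S))) (𝔼-sumSub p xs (λ S → F (false ∷ S))))

  module _ {n : ℕ} (s₀ : ℕ) where

    private
      relevant : Vec Bool n → Bool
      relevant S = does (1 ℕ.≤? card S) ∧ does (card S ℕ.≤? s₀)

      violates : Vec Bool n → List (Fin n × Fin n) → Bool
      violates S E = relevant S ∧ fewOuter (lookup S) E

    violations : List (Fin n × Fin n) → ℚ
    violations E = sumSub λ S → ⟦ violates S E ⟧

    violations-nonneg : ∀ E → 0ℚ ≤ violations E
    violations-nonneg E = sumSub-nonneg λ S → 0≤⟦⟧ (violates S E)

    private
      outer-cong : ∀ (G : Graph n) {S S′ : Fin n → Bool} → (∀ v → S v ≡ S′ v) → ∀ v → outer G S v ≡ true → outer G S′ v ≡ true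
      outer-cong G {S} {S′} eq v h =
        let (a , b) = Equivalence.to (T-∧ {not (S v)}) (subst T (sym h) _)
            (u , c) = does-true (Fin.any? λ u → T? (S u ∧ adj G u v)) (T-true b) in
        cong₂ _∧_ (trans (cong not (sym (eq v))) (T-true a))
          (dec-true (Fin.any? λ u → T? (S′ u ∧ adj G u v)) (u , subst (λ b → T (b ∧ adj G u v)) (eq u) c))

    expander-or-violation : ∀ E → 1ℚ ≤ violations E ⊎ IsExpander (fromEdges E) s₀
    expander-or-violation E with anySubset? (λ S → T? (violates S E))
    ... | yes (S , t) = inj₁ (ℚ.≤-trans (ℚ.≤-reflexive (sym (cong ⟦_⟧ (T-true t)))) (sumSub-term (λ S → 0≤⟦⟧ (violates S E)) S))
    ... | no ¬v = inj₂ λ S 1≤s s≤s₀ → ℕ.≮⇒≥ λ few → ¬v (Vec.tabulate S , subst T (sym (violates-true S 1≤s s≤s₀ few)) _)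
      where
      violates-true : ∀ S → 1 ℕ.≤ Σᶠ (χ ∘ S) → Σᶠ (χ ∘ S) ℕ.≤ s₀ → Σᶠ (χ ∘ outer (fromEdges E) S) ℕ.< 2 ℕ.* Σᶠ (χ ∘ S) →
        violates (Vec.tabulate S) E ≡ true
      violates-true S 1≤s s≤s₀ few = cong₂ _∧_
        (cong₂ _∧_ (dec-true (1 ℕ.≤? card (Vec.tabulate S)) (subst (1 ℕ.≤_) (sym eq) 1≤s))
                   (dec-true (card (Vec.tabulate S) ℕ.≤? s₀) (subst (ℕ._≤ s₀) (sym eq) s≤s₀)))
        (dec-true (_ ℕ.<? _) (ℕ.≤-<-trans
          (Σᶠ-mono λ v → χ-mono (outer-cong (fromEdges E) (lookup∘tabulate S) v))
          (subst (λ k → Σᶠ (χ ∘ outer (fromEdges E) S) ℕ.< 2 ℕ.* k) (sym eq) few)))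
        where
        eq : card (Vec.tabulate S) ≡ Σᶠ (χ ∘ S)
        eq = sum-cong-≗ λ v → cong χ (lookup∘tabulate S v)

    private
      -- κ = 9/16 bounds θ + (1 - θ)(1 - p)^s for θ = 1/8 and (1 - p)^s ≤ ½. The weight ¼^s turns a
      -- sum over all sets into (5/4)^n, and κ · 5/4 = 45/64 has square below ½; with n ≥ 32 s₀ this
      -- outweighs 512^s₀.
      κ ¼ : ℚ
      κ = 1/suc 7 + (1ℚ - 1/suc 7) * ½
      ¼ = 1/suc 3

    module _ (t : ℕ) (1≤t : 1 ℕ.≤ t) {p : ℚ} (pp : IsProb p) (4pn≤Θ : ι 4 * (ι n * p) ≤ ι (suc t)) (32s₀≤n : s₀ ℕ.* 32 ℕ.≤ n) where

      private
        0≤p = proj₁ pp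
        p≤1 = proj₂ pp
        θ = 1/suc t
        Θ = ι (suc t)
        xs = vertexPairs n
        0≤1-p = 0≤⇒- p≤1
        2ᵣ = ι 2

      -- The price per vertex of a small set S: Θ² from Markov's inequality at 2 s outer neighbours,
      -- one factor 2 from `Πᶠ-complement`, and another from (1 + z)^n ≤ 2.
      ratio : ℚ
      ratio = Θ * Θ * (ι 2 * ι 2 * (1ℚ - p) ^ℚ n)

      0≤ratio : 0ℚ ≤ ratio
      0≤ratio = 0≤* (0≤* (0≤ι (suc t)) (0≤ι (suc t))) (0≤* (0≤* (0≤ι 2) (0≤ι 2)) (^-nonneg 0≤1-p n))

      private
        z = 2ᵣ * (θ * p)

        0≤z : 0ℚ ≤ z
        0≤z = 0≤* (0≤ι 2) (0≤* (0≤1/suc t) 0≤p)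

        z≤1 : z ≤ 1ℚ
        z≤1 = *-cancelˡ Θ (0<ι (ℕ.s≤s ℕ.z≤n)) (≤-respˡ (sym Θz)
          (*-mono (0≤ι 2) 0≤1 (ι-mono (ℕ.s≤s 1≤t)) p≤1))
          where
          lemma : ∀ k Θ θ p → Θ * (k * (θ * p)) ≡ k * ((Θ * θ) * p)
          lemma = solve-∀ ℚ-ring
          Θz : Θ * z ≡ 2ᵣ * p
          Θz = trans (lemma 2ᵣ Θ θ p) (trans (cong (λ a → 2ᵣ * (a * p)) (suc*1/suc t)) (cong (2ᵣ *_) (ℚ.*-identityˡ p)))

        nz≤½ : 2ᵣ * (ι n * z) ≤ 1ℚ
        nz≤½ = *-cancelˡ Θ (0<ι (ℕ.s≤s ℕ.z≤n)) (≤-respˡ (sym eq) (≤-respʳ (sym (ℚ.*-identityʳ Θ)) 4pn≤Θ))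
          where
          l₀ : ∀ k Θ θ p n → Θ * (k * (n * (k * (θ * p)))) ≡ k * k * (n * ((Θ * θ) * p))
          l₀ = solve-∀ ℚ-ring
          eq : Θ * (2ᵣ * (ι n * z)) ≡ ι 4 * (ι n * p)
          eq = trans (l₀ 2ᵣ Θ θ p (ι n)) (cong (λ a → ι 4 * (ι n * a)) (trans (cong (_* p) (suc*1/suc t)) (ℚ.*-identityˡ p)))

        [1+z]^n≤2 : (1ℚ + z) ^ℚ n ≤ 2ᵣ
        [1+z]^n≤2 = [1+]^≤2 n 0≤z z≤1 nz≤½

        -- While a = (1 - p)^s is at least ½, y = a + θ (1 - a) ≤ a + θ s p ≤ a (1 + s z) ≤ a (1 +
        -- z)^s with z = 2 θ p. The n-th power of y is therefore at most (2 (1 - p)^n)^s.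
        regime₁ : ∀ (S : Vec Bool n) → let s = card S in ½ ≤ (1ℚ - p) ^ℚ s →
          𝔼 p xs (λ E → ⟦ fewOuter (lookup S) E ⟧) ≤ ratio ^ℚ s
        regime₁ S ½≤a = ℚ.≤-trans (fewOuter-bound (lookup S) t pp)
          (ℚ.≤-trans (*-monoˡ (^-nonneg (0≤ι (suc t)) (2 ℕ.* s)) (Πᶠ-complement y (lookup S) 0≤y 1≤2y))
            (ℚ.≤-trans (*-monoˡ (^-nonneg (0≤ι (suc t)) (2 ℕ.* s)) (*-monoˡ (^-nonneg (0≤ι 2) s) y^n))
              (ℚ.≤-reflexive collect)))
          where
          s = card S
          a = (1ℚ - p) ^ℚ s
          y = θ + (1ℚ - θ) * a
          0≤a = ^-nonneg 0≤1-p s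
          1≤2a : 1ℚ ≤ 2ᵣ * a
          1≤2a = *-monoˡ {2ᵣ} (0≤ι 2) ½≤a
          a≤1 : a ≤ 1ℚ
          a≤1 = ^-≤1 0≤1-p (1-≤1 0≤p) s
          y≡ : ∀ θ a → a + θ * (1ℚ - a) ≡ θ + (1ℚ - θ) * a
          y≡ = solve-∀ ℚ-ring
          a≤y : a ≤ y
          a≤y = ≤-from (θ * (1ℚ - a)) (0≤* (0≤1/suc t) (0≤⇒- a≤1)) (y≡ θ a)
          0≤y = ℚ.≤-trans 0≤a a≤y
          1≤2y : 1ℚ ≤ 2ᵣ * y
          1≤2y = ℚ.≤-trans 1≤2a (*-monoˡ (0≤ι 2) a≤y)
          1-a≤sp : 1ℚ - a ≤ ι s * p
          1-a≤sp = -⇒≤ (≤-respʳ (l a (ι s * p)) (0≤⇒- (bernoulli⁻ 0≤p p≤1 s)))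
            where
            l : ∀ a b → a + b - 1ℚ ≡ b - (1ℚ - a)
            l = solve-∀ ℚ-ring
          y≤ : y ≤ a * (1ℚ + z) ^ℚ s
          y≤ = ℚ.≤-trans (≤-respˡ (y≡ θ a) (ℚ.+-monoʳ-≤ a (*-monoˡ (0≤1/suc t) 1-a≤sp)))
            (ℚ.≤-trans (≤-from (θ * (ι s * p) * (2ᵣ * a - 1ℚ)) (0≤* (0≤* (0≤1/suc t) (0≤* (0≤ι s) 0≤p)) (0≤⇒- 1≤2a)) (l a θ (ι s) p))
              (*-monoˡ 0≤a (bernoulli 0≤z s)))
            where
            l : ∀ a θ s p → a + θ * (s * p) + θ * (s * p) * ((1ℚ + 1ℚ) * a - 1ℚ) ≡ a * (1ℚ + s * ((1ℚ + 1ℚ) * (θ * p)))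
            l = solve-∀ ℚ-ring
          swap-^ : ∀ q → (q ^ℚ s) ^ℚ n ≡ (q ^ℚ n) ^ℚ s
          swap-^ q = trans (sym (^-^ q n s)) (trans (cong (q ^ℚ_) (ℕ.*-comm n s)) (^-^ q s n))
          y^n : y ^ℚ n ≤ ((1ℚ - p) ^ℚ n) ^ℚ s * 2ᵣ ^ℚ s
          y^n = ℚ.≤-trans (^-mono 0≤y y≤ n)
            (≤-respˡ (sym (trans (^-*-distrib a ((1ℚ + z) ^ℚ s) n) (cong₂ _*_ (swap-^ (1ℚ - p)) (swap-^ (1ℚ + z)))))
              (*-monoˡ (^-nonneg (^-nonneg 0≤1-p n) s) (^-mono (^-nonneg (0≤+ 0≤1 0≤z) n) [1+z]^n≤2 s)))
          collect : Θ ^ℚ (2 ℕ.* s) * (2ᵣ ^ℚ s * (((1ℚ - p) ^ℚ n) ^ℚ s * 2ᵣ ^ℚ s)) ≡ ratio ^ℚ s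
          collect = trans (cong (_* (2ᵣ ^ℚ s * (B * 2ᵣ ^ℚ s))) (trans (^-+ Θ s (s ℕ.+ 0)) (cong (λ k → Θ ^ℚ s * Θ ^ℚ k) (ℕ.+-identityʳ s))))
            (trans (l (Θ ^ℚ s) (2ᵣ ^ℚ s) B)
              (sym (trans (^-*-distrib (Θ * Θ) _ s) (cong₂ _*_ (^-*-distrib Θ Θ s)
                (trans (^-*-distrib (2ᵣ * 2ᵣ) _ s) (cong (_* B) (^-*-distrib 2ᵣ 2ᵣ s)))))))
            where
            B = ((1ℚ - p) ^ℚ n) ^ℚ s
            l : ∀ T k B → T * T * (k * (B * k)) ≡ T * T * (k * k * B)
            l = solve-∀ ℚ-ring

        C : ℚ
        C = ι 512 ^ℚ s₀ * κ ^ℚ n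

        0≤κ : 0ℚ ≤ κ
        0≤κ = from-yes (0ℚ ℚ.≤? κ)

        0≤C : 0ℚ ≤ C
        0≤C = 0≤* (^-nonneg (0≤ι 512) s₀) (^-nonneg 0≤κ n)

        -- For larger sets a constant θ = 1/8 suffices, every factor being at most κ. The prefactor
        -- 8^(2s) 2^s is written as ¼^s 512^s, so that the sum over S stays under control.
        regime₂ : ∀ (S : Vec Bool n) → let s = card S in s ℕ.≤ s₀ → (1ℚ - p) ^ℚ s ≤ ½ →
          𝔼 p xs (λ E → ⟦ fewOuter (lookup S) E ⟧) ≤ C * ¼ ^ℚ s
        regime₂ S s≤s₀ a≤½ = ℚ.≤-trans (fewOuter-bound (lookup S) 7 pp)
          (ℚ.≤-trans (*-monoˡ (^-nonneg (0≤ι 8) (2 ℕ.* s)) (ℚ.≤-trans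
            (Πᶠ-mono nonneg (λ v → at-most (lookup S v)))
            (Πᶠ-complement κ (lookup S) 0≤κ (from-yes (1ℚ ℚ.≤? 2ᵣ * κ)))))
            (≤-respˡ (sym collect)
              (≤-respʳ (l′ (¼ ^ℚ s) (ι 512 ^ℚ s₀) (κ ^ℚ n))
                (*-monoˡ (^-nonneg (0≤1/suc 3) s) (*-monoʳ (^-nonneg 0≤κ n) (^-incr (ι-mono {1} {512} (ℕ.s≤s ℕ.z≤n)) s≤s₀))))))
          where
          s = card S
          a = (1ℚ - p) ^ℚ s
          y = 1/suc 7 + (1ℚ - 1/suc 7) * a
          0≤7/8 : 0ℚ ≤ 1ℚ - 1/suc 7
          0≤7/8 = 0≤⇒- (1/suc≤1 7)
          y≤κ : y ≤ κ
          y≤κ = ℚ.+-monoʳ-≤ (1/suc 7) (*-monoˡ 0≤7/8 a≤½)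
          nonneg : ∀ v → 0ℚ ≤ (if lookup S v then 1ℚ else y)
          nonneg v with lookup S v
          ... | true  = 0≤1
          ... | false = 0≤+ (0≤1/suc 7) (0≤* 0≤7/8 (^-nonneg 0≤1-p s))
          at-most : ∀ b → (if b then 1ℚ else y) ≤ (if b then 1ℚ else κ)
          at-most true  = ℚ.≤-refl
          at-most false = y≤κ
          l′ : ∀ a b c → a * (b * c) ≡ b * c * a
          l′ = solve-∀ ℚ-ring
          collect : ι 8 ^ℚ (2 ℕ.* s) * (2ᵣ ^ℚ s * κ ^ℚ n) ≡ ¼ ^ℚ s * (ι 512 ^ℚ s * κ ^ℚ n)
          collect = trans (cong (_* (2ᵣ ^ℚ s * κ ^ℚ n)) (trans (^-+ (ι 8) s (s ℕ.+ 0)) (cong (λ k → ι 8 ^ℚ s * ι 8 ^ℚ k) (ℕ.+-identityʳ s))))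
            (trans (l (ι 8 ^ℚ s) (2ᵣ ^ℚ s) (κ ^ℚ n))
              (trans (cong (_* κ ^ℚ n) (trans (cong (_* 2ᵣ ^ℚ s) (sym (^-*-distrib (ι 8) (ι 8) s)))
                  (trans (sym (^-*-distrib (ι 8 * ι 8) 2ᵣ s)) (^-*-distrib ¼ (ι 512) s))))
                (ℚ.*-assoc (¼ ^ℚ s) (ι 512 ^ℚ s) (κ ^ℚ n))))
            where
            l : ∀ e k c → e * e * (k * c) ≡ e * e * k * c
            l = solve-∀ ℚ-ring

        -- 0 ^ card S is 1 for the empty set only, which is thus left out of the sum of the powers of ratio.
        term-bound : ∀ S → 𝔼 p xs (λ E → ⟦ violates S E ⟧) ≤ ratio ^ℚ card S - 0ℚ ^ℚ card S + C * ¼ ^ℚ card S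
        term-bound S = cases (relevant S) refl
          where
          s = card S
          Bound : Bool → Set
          Bound b = 𝔼 p xs (λ E → ⟦ b ∧ fewOuter (lookup S) E ⟧) ≤ ratio ^ℚ s - 0ℚ ^ℚ s + C * ¼ ^ℚ s
          difference≥0 : ∀ s → 0ℚ ≤ ratio ^ℚ s - 0ℚ ^ℚ s
          difference≥0 zero    = ℚ.≤-refl
          difference≥0 (suc s) = 0≤⇒- (≤-respˡ (sym (ℚ.*-zeroˡ (0ℚ ^ℚ s))) (^-nonneg 0≤ratio (suc s)))
          0^ : ∀ {s} → 1 ℕ.≤ s → ratio ^ℚ s ≡ ratio ^ℚ s - 0ℚ ^ℚ s
          0^ {suc s} _ = sym (trans (cong (λ t → ratio ^ℚ suc s - t) (ℚ.*-zeroˡ (0ℚ ^ℚ s))) (ℚ.+-identityʳ _))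
          regimes : 1 ℕ.≤ s → s ℕ.≤ s₀ → ½ ≤ (1ℚ - p) ^ℚ s ⊎ (1ℚ - p) ^ℚ s ≤ ½ → Bound true
          regimes 1≤s _ (inj₁ h) = ℚ.≤-trans (regime₁ S h) (≤-respˡ (sym (0^ 1≤s)) (≤+ (0≤* 0≤C (^-nonneg (0≤1/suc 3) s))))
          regimes 1≤s s≤s₀ (inj₂ h) = ℚ.≤-trans (regime₂ S s≤s₀ h)
            (≤-respʳ (ℚ.+-comm (C * ¼ ^ℚ s) (ratio ^ℚ s - 0ℚ ^ℚ s)) (≤+ (≤-respʳ (0^ 1≤s) (^-nonneg 0≤ratio s))))
          cases : ∀ b → relevant S ≡ b → Bound (relevant S)
          cases false e = subst Bound (sym e) (ℚ.≤-trans (ℚ.≤-reflexive (𝔼-const p xs 0ℚ))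
            (0≤+ (difference≥0 s) (0≤* 0≤C (^-nonneg (0≤1/suc 3) s))))
          cases true e = let (a , b) = Equivalence.to (T-∧ {does (1 ℕ.≤? s)}) (subst T (sym e) _) in
            subst Bound (sym e) (regimes (does-true (1 ℕ.≤? s) (T-true a)) (does-true (s ℕ.≤? s₀) (T-true b)) (ℚ.≤-total ½ ((1ℚ - p) ^ℚ s)))

      -- The binomial theorem sums the powers of `ratio` over nonempty sets and those of ¼ over all
      -- sets.
      expected-violations : 𝔼 p (vertexPairs n) violations ≤ (1ℚ + ratio) ^ℚ n - 1ℚ + ½ ^ℚ s₀
      expected-violations = ℚ.≤-trans (ℚ.≤-reflexive (𝔼-sumSub p xs (λ S E → ⟦ violates S E ⟧)))
        (ℚ.≤-trans (sumSub-mono term-bound) (≤-respˡ (sym total) (ℚ.+-monoʳ-≤ ((1ℚ + ratio) ^ℚ n - 1ℚ) tail)))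
        where
        total : sumSub {n} (λ S → ratio ^ℚ card S - 0ℚ ^ℚ card S + C * ¼ ^ℚ card S) ≡ (1ℚ + ratio) ^ℚ n - 1ℚ + C * (1ℚ + ¼) ^ℚ n
        total = trans (sumSub-+ {n} (λ S → ratio ^ℚ card S - 0ℚ ^ℚ card S) (λ S → C * ¼ ^ℚ card S))
          (cong₂ _+_
            (trans (sumSub-+ {n} (λ S → ratio ^ℚ card S) (λ S → - (0ℚ ^ℚ card S)))
              (cong₂ _+_ (sumSub-power n ratio) (trans (sumSub-neg {n} (λ S → 0ℚ ^ℚ card S)) (cong -_ (trans (sumSub-power n 0ℚ) (1^ n))))))
            (trans (sumSub-*ˡ {n} C (λ S → ¼ ^ℚ card S)) (cong (C *_) (sumSub-power n ¼))))
          where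
          sumSub-neg : ∀ {n} (F : Vec Bool n → ℚ) → sumSub (λ S → - F S) ≡ - sumSub F
          sumSub-neg {zero}  F = refl
          sumSub-neg {suc n} F = trans (cong₂ _+_ (sumSub-neg (λ S → F (true ∷ S))) (sumSub-neg (λ S → F (false ∷ S))))
            (sym (ℚ.neg-distrib-+ (sumSub (λ S → F (true ∷ S))) (sumSub (λ S → F (false ∷ S)))))
        μ : ℚ
        μ = κ * (1ℚ + ¼)
        0≤μ : 0ℚ ≤ μ
        0≤μ = from-yes (0ℚ ℚ.≤? μ)
        μ^32 : μ ^ℚ 32 ≤ ½ ^ℚ 16
        μ^32 = ≤-respˡ (sym (^-^ μ 16 2)) (^-mono (^-nonneg 0≤μ 2) (from-yes (μ ^ℚ 2 ℚ.≤? ½)) 16)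
        base : ι 512 * μ ^ℚ 32 ≤ ½
        base = ℚ.≤-trans (*-monoˡ (0≤ι 512) μ^32) (from-yes (ι 512 * ½ ^ℚ 16 ℚ.≤? ½))
        tail : C * (1ℚ + ¼) ^ℚ n ≤ ½ ^ℚ s₀
        tail = ≤-respˡ (sym (trans (ℚ.*-assoc (ι 512 ^ℚ s₀) (κ ^ℚ n) ((1ℚ + ¼) ^ℚ n)) (cong (ι 512 ^ℚ s₀ *_) (sym (^-*-distrib κ (1ℚ + ¼) n)))))
          (ℚ.≤-trans (*-monoˡ (^-nonneg (0≤ι 512) s₀) (^-anti 0≤μ (from-yes (μ ℚ.≤? 1ℚ)) 32s₀≤n))
            (≤-respˡ (trans (^-*-distrib (ι 512) (μ ^ℚ 32) s₀) (cong (ι 512 ^ℚ s₀ *_) (sym (^-^ μ s₀ 32))))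
              (^-mono (0≤* (0≤ι 512) (^-nonneg 0≤μ 32)) base s₀)))

-- Two portions of random edges

module SparseCase where
  open import Data.Nat.Base using (_/_)
  open import Data.Nat.DivMod using (m/n*n≤m; m≡m%n+[m/n]*n; m%n<n; /-mono-≤; m*n/n≡m)
  open import Data.Rational.Base hiding (_/_)
  open import Tactic.RingSolver using (solve-∀)
  open Rationals
  open Expectation
  open Arrangements using (φ≤1+n)
  open Boosters using (∪-⊑ʳ; fromEdges-⊆)
  open Boosting
  open BoostingEnds
  open Posa using (IsExpander; expander⇒manyEnds)
  open Expansion using (violations; violations-nonneg; expander-or-violation; ratio; 0≤ratio; expected-violations)

  module _ {n : ℕ} (G : Graph n) (k j : ℕ) (3≤n : 3 ℕ.≤ n) (131072≤k : 131072 ℕ.≤ k) (JJ≤k : suc j ℕ.* suc j ℕ.≤ k)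
    (32J≤n : suc j ℕ.* 32 ℕ.≤ n) where

    private
      J = suc j
      s₀ = n / 32

      32s₀≤n : s₀ ℕ.* 32 ℕ.≤ n
      32s₀≤n = m/n*n≤m n 32

      J≤s₀ : J ℕ.≤ s₀
      J≤s₀ = ℕ.≤-trans (ℕ.≤-reflexive (sym (m*n/n≡m J 32))) (/-mono-≤ 32J≤n (ℕ.≤-refl {32}))

      1≤s₀ : 1 ℕ.≤ s₀
      1≤s₀ = ℕ.≤-trans (ℕ.s≤s ℕ.z≤n) J≤s₀

      1+n≤64s₀ : suc n ℕ.≤ 64 ℕ.* s₀
      1+n≤64s₀ = ℕ.≤-trans (ℕ.s≤s (ℕ.≤-reflexive (m≡m%n+[m/n]*n n 32)))
        (ℕ.≤-trans (ℕ.+-monoˡ-≤ (s₀ ℕ.* 32) (m%n<n n 32))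
          (ℕ.≤-trans (ℕ.+-monoˡ-≤ (s₀ ℕ.* 32) (ℕ.≤-trans (ℕ.≤-reflexive (sym (ℕ.*-identityˡ 32))) (ℕ.*-monoˡ-≤ 32 1≤s₀)))
            (ℕ.≤-reflexive (l s₀))))
        where
        l : ∀ s → s ℕ.* 32 ℕ.+ s ℕ.* 32 ≡ 64 ℕ.* s
        l = ℕSolver.solve-∀

      1≤k : 1 ℕ.≤ k
      1≤k = ℕ.≤-trans (ℕ.s≤s ℕ.z≤n) 131072≤k

      J≤k : J ℕ.≤ k
      J≤k = ℕ.≤-trans (ℕ.m≤m*n J J) JJ≤k

    module _ {p : ℚ} (pp : IsProb p)
      (lower : ι (n ℕ.* (k ℕ.* k ℕ.* k)) * (1ℚ - (p - p * 1/suc j)) ^ℚ n ≤ 1ℚ)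
      (k≤8pn : ι k ≤ ι 8 * (p * ι n)) (pn≤32k : p * ι n ≤ ι (32 ℕ.* k)) where

      private
        xs = vertexPairs n
        0≤p = proj₁ pp
        p₂ = p * 1/suc j
        p₁ = p - p₂

        p₂≤p : p₂ ≤ p
        p₂≤p = ≤-respʳ (ℚ.*-identityʳ p) (*-monoˡ 0≤p (1/suc≤1 j))

        0≤p₂ : 0ℚ ≤ p₂
        0≤p₂ = 0≤* 0≤p (0≤1/suc j)

        p₁≤p : p₁ ≤ p
        p₁≤p = ≤-from p₂ 0≤p₂ (l p p₂)
          where
          l : ∀ p q → p - q + q ≡ p
          l = solve-∀ ℚ-ring

        pp₂ : IsProb p₂
        pp₂ = 0≤p₂ , ℚ.≤-trans p₂≤p (proj₂ pp)

        pp₁ : IsProb p₁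
        pp₁ = 0≤⇒- p₂≤p , ℚ.≤-trans p₁≤p (proj₂ pp)

        Jp₂≡p : ι J * p₂ ≡ p
        Jp₂≡p = trans (l (ι J) p (1/suc j)) (trans (cong (p *_) (suc*1/suc j)) (ℚ.*-identityʳ p))
          where
          l : ∀ a p c → a * (p * c) ≡ p * (a * c)
          l = solve-∀ ℚ-ring

        -- Chosen so that Θ = 128 k; this is at least 4 p₁ n because p n ≤ 32 k.
        t = ℕ.pred (128 ℕ.* k)

        1+t≡ : suc t ≡ 128 ℕ.* k
        1+t≡ = ℕ.suc-pred (128 ℕ.* k) {{ℕ.>-nonZero (ℕ.*-mono-≤ {1} {128} (ℕ.s≤s ℕ.z≤n) 1≤k)}}

        1≤t : 1 ℕ.≤ t
        1≤t = ℕ.s≤s⁻¹ (ℕ.≤-trans (ℕ.*-mono-≤ {2} {128} (ℕ.s≤s (ℕ.s≤s ℕ.z≤n)) 1≤k) (ℕ.≤-reflexive (sym 1+t≡)))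

        4p₁n≤Θ : ι 4 * (ι n * p₁) ≤ ι (suc t)
        4p₁n≤Θ = begin
          ι 4 * (ι n * p₁)        ≤⟨ *-monoˡ (0≤ι 4) (*-monoˡ (0≤ι n) p₁≤p) ⟩
          ι 4 * (ι n * p)         ≡⟨ cong (ι 4 *_) (ℚ.*-comm (ι n) p) ⟩
          ι 4 * (p * ι n)         ≤⟨ *-monoˡ (0≤ι 4) pn≤32k ⟩
          ι 4 * ι (32 ℕ.* k)      ≡⟨ trans (sym (ι-* 4 (32 ℕ.* k))) (cong ι (trans (sym (ℕ.*-assoc 4 32 k)) (sym 1+t≡))) ⟩
          ι (suc t)                 ∎
          where open ℚ.≤-Reasoning

        x = ratio {n} s₀ t 1≤t pp₁ 4p₁n≤Θ 32s₀≤n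
        0≤x : 0ℚ ≤ x
        0≤x = 0≤ratio {n} s₀ t 1≤t pp₁ 4p₁n≤Θ 32s₀≤n

        -- 65536 = 128² · 4 collects the constants of `ratio`. Of the k³ in `lower`, two powers pay
        -- for Θ² and the third makes n x at most 65536 / k; the hypothesis 131072 ≤ k then gives 2
        -- n x ≤ 1.
        knx : ι k * (ι n * x) ≤ ι 65536
        knx = begin
          K * (ι n * (ι (suc t) * ι (suc t) * (ι 2 * ι 2 * B)))
            ≡⟨ cong (λ T → K * (ι n * (T * T * (ι 2 * ι 2 * B)))) (trans (cong ι 1+t≡) (ι-* 128 k)) ⟩
          K * (ι n * (ι 128 * K * (ι 128 * K) * (ι 2 * ι 2 * B)))
            ≡⟨ l K (ι n) (ι 128) (ι 2) B ⟩
          ι 128 * ι 128 * (ι 2 * ι 2) * (ι n * (K * K * K) * B)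
            ≡⟨ cong (λ m → ι 65536 * (m * B)) (sym (trans (ι-* n (k ℕ.* k ℕ.* k)) (cong (ι n *_) (trans (ι-* (k ℕ.* k) k) (cong (_* K) (ι-* k k)))))) ⟩
          ι 65536 * (ι (n ℕ.* (k ℕ.* k ℕ.* k)) * B)
            ≤⟨ *-monoˡ (0≤ι 65536) lower ⟩
          ι 65536 * 1ℚ
            ≡⟨ ℚ.*-identityʳ (ι 65536) ⟩
          ι 65536 ∎
          where
          open ℚ.≤-Reasoning
          K = ι k
          B = (1ℚ - p₁) ^ℚ n
          l : ∀ K n a b B → K * (n * (a * K * (a * K) * (b * b * B))) ≡ a * a * (b * b) * (n * (K * K * K) * B)
          l = solve-∀ ℚ-ring

        2nx≤1 : ι 2 * (ι n * x) ≤ 1ℚ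
        2nx≤1 = *-cancelˡ (ι k) (0<ι 1≤k) (begin
          ι k * (ι 2 * (ι n * x))   ≡⟨ l (ι k) (ι 2) (ι n * x) ⟩
          ι 2 * (ι k * (ι n * x))   ≤⟨ *-monoˡ (0≤ι 2) knx ⟩
          ι 2 * ι 65536               ≤⟨ ι-mono 131072≤k ⟩
          ι k                           ≡⟨ ℚ.*-identityʳ (ι k) ⟨
          ι k * 1ℚ                      ∎)
          where
          open ℚ.≤-Reasoning
          l : ∀ a b c → a * (b * c) ≡ b * (a * c)
          l = solve-∀ ℚ-ring

        x≤1 : x ≤ 1ℚ
        x≤1 = ℚ.≤-trans (≤-respˡ (ℚ.*-identityˡ x)
          (*-monoʳ 0≤x (ι-mono {1} {2 ℕ.* n} (ℕ.*-mono-≤ {1} {2} (ℕ.s≤s ℕ.z≤n) (ℕ.≤-trans (ℕ.s≤s ℕ.z≤n) 3≤n)))))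
          (≤-respˡ (trans (sym (ℚ.*-assoc (ι 2) (ι n) x)) (cong (_* x) (sym (ι-* 2 n)))) 2nx≤1)

        sum-bound : ι J * ((1ℚ + x) ^ℚ n - 1ℚ) ≤ ι 131072
        sum-bound = begin
          ι J * ((1ℚ + x) ^ℚ n - 1ℚ)    ≤⟨ *-mono (0≤ι J) (0≤* (0≤ι 2) (0≤* (0≤ι n) 0≤x)) (ι-mono J≤k) ([1+]^-excess n 0≤x x≤1 2nx≤1) ⟩
          ι k * (ι 2 * (ι n * x))   ≡⟨ l (ι k) (ι 2) (ι n * x) ⟩
          ι 2 * (ι k * (ι n * x))   ≤⟨ *-monoˡ (0≤ι 2) knx ⟩
          ι 131072                      ∎
          where
          open ℚ.≤-Reasoning
          l : ∀ a b c → a * (b * c) ≡ b * (a * c)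
          l = solve-∀ ℚ-ring

        halves : ι J * ½ ^ℚ s₀ ≤ 1ℚ
        halves = ℚ.≤-trans (*-monoʳ (^-nonneg {½} (ℚ.nonNegative⁻¹ ½) s₀)
            (ℚ.≤-trans (ι-mono J≤s₀) (ℚ.≤-trans (≤-from 1ℚ 0≤1 (l (ι s₀))) (bernoulli 0≤1 s₀))))
          (ℚ.≤-reflexive (trans (sym (^-*-distrib (1ℚ + 1ℚ) ½ s₀)) (1^ s₀)))
          where
          l : ∀ s → s + 1ℚ ≡ 1ℚ + s * 1ℚ
          l = solve-∀ ℚ-ring

        -- With d = s₀ and φ ≤ n + 1 ≤ 64 s₀ the failure probability is at most 256 / (p₂ s₀). From
        -- J² ≤ k ≤ 8 p n and p = J p₂ follows p₂ s₀ ≥ J / 512, and 256 · 512 = 131072.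
        finish : ∀ E₁ → IsExpander (fromEdges E₁) s₀ → 𝔼 p₂ xs (λ E → fails G (E₁ ++ E)) ≤ ι 131072 * 1/suc j
        finish E₁ expander = *-cancelˡ (ι J) (0<ι (ℕ.s≤s ℕ.z≤n)) (≤-respʳ
            (sym (trans (l₀ (ι J) (ι 131072) (1/suc j)) (trans (cong (ι 131072 *_) (suc*1/suc j)) (ℚ.*-identityʳ (ι 131072)))))
            (*-cancelˡ (ι (J ℕ.* s₀)) (0<ι (ℕ.*-mono-≤ {1} {J} (ℕ.s≤s ℕ.z≤n) 1≤s₀)) chain))
          where
          open ℚ.≤-Reasoning
          Y = 𝔼 p₂ xs (λ E → fails G (E₁ ++ E))
          0≤Y = 𝔼-nonneg pp₂ xs (λ E → 0≤fails G (E₁ ++ E))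
          S = ι s₀
          l₀ : ∀ a b c → a * (b * c) ≡ b * (a * c)
          l₀ = solve-∀ ℚ-ring
          boosted : p₂ * ι (s₀ ℕ.* s₀) * Y ≤ ι 4 * ι (64 ℕ.* s₀)
          boosted = ℚ.≤-trans (boost-ends G 3≤n s₀ 1≤s₀ E₁
              (λ E s → expander⇒manyEnds {G = fromEdges E₁} {G ∪ fromEdges E}
                (λ u v a → ∪-⊑ʳ G (fromEdges E) u v (fromEdges-⊆ {E = E₁} {E} s u v a)) expander) pp₂)
            (*-monoˡ (0≤ι 4) (ι-mono (ℕ.≤-trans (φ≤1+n (G ∪ fromEdges E₁)) 1+n≤64s₀)))
          l₁ : ∀ J s Y → J * s * (J * Y) ≡ J * J * (s * Y)
          l₁ = solve-∀ ℚ-ring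
          l₂ : ∀ a J p s Y → a * (J * p * s) * (s * Y) ≡ a * J * (p * (s * s) * Y)
          l₂ = solve-∀ ℚ-ring
          l₃ : ∀ a J b s → a * J * (b * s) ≡ J * s * (a * b)
          l₃ = solve-∀ ℚ-ring
          k≤512ps : ι k ≤ ι 512 * (ι J * p₂ * S)
          k≤512ps = begin
            ι k                               ≤⟨ k≤8pn ⟩
            ι 8 * (p * ι n)                 ≤⟨ *-monoˡ (0≤ι 8) (*-monoˡ 0≤p (ι-mono (ℕ.≤-trans (ℕ.n≤1+n n) 1+n≤64s₀))) ⟩
            ι 8 * (p * ι (64 ℕ.* s₀))       ≡⟨ cong₂ (λ a b → ι 8 * (a * b)) (sym Jp₂≡p) (ι-* 64 s₀) ⟩
            ι 8 * (ι J * p₂ * (ι 64 * S)) ≡⟨ l₄ (ι 8) (ι J * p₂) (ι 64) S ⟩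
            ι 512 * (ι J * p₂ * S)          ∎
            where
            l₄ : ∀ a b c d → a * (b * (c * d)) ≡ a * c * (b * d)
            l₄ = solve-∀ ℚ-ring
          chain : ι (J ℕ.* s₀) * (ι J * Y) ≤ ι (J ℕ.* s₀) * ι 131072
          chain = begin
            ι (J ℕ.* s₀) * (ι J * Y)
              ≡⟨ trans (cong (_* (ι J * Y)) (ι-* J s₀)) (l₁ (ι J) S Y) ⟩
            ι J * ι J * (S * Y)
              ≤⟨ *-monoʳ (0≤* (0≤ι s₀) 0≤Y) (≤-respˡ (ι-* J J) (ℚ.≤-trans (ι-mono JJ≤k) k≤512ps)) ⟩
            ι 512 * (ι J * p₂ * S) * (S * Y)
              ≡⟨ trans (l₂ (ι 512) (ι J) p₂ S Y) (cong (λ q → ι 512 * ι J * (p₂ * q * Y)) (sym (ι-* s₀ s₀))) ⟩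
            ι 512 * ι J * (p₂ * ι (s₀ ℕ.* s₀) * Y)
              ≤⟨ *-monoˡ (0≤* (0≤ι 512) (0≤ι J)) boosted ⟩
            ι 512 * ι J * (ι 4 * ι (64 ℕ.* s₀))
              ≡⟨ cong (λ q → ι 512 * ι J * (ι 4 * q)) (ι-* 64 s₀) ⟩
            ι 512 * ι J * (ι 4 * (ι 64 * S))
              ≡⟨ cong (ι 512 * ι J *_) (sym (ℚ.*-assoc (ι 4) (ι 64) S)) ⟩
            ι 512 * ι J * (ι 256 * S)
              ≡⟨ l₃ (ι 512) (ι J) (ι 256) S ⟩
            ι J * S * ι 131072
              ≡⟨ cong (_* ι 131072) (sym (ι-* J s₀)) ⟩
            ι (J ℕ.* s₀) * ι 131072 ∎

      -- Either the first portion is an expander and `finish` applies to the second, or `violations`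
      -- is at least 1 and dominates the failure probability.
      sparse-case : ι (suc j) * 𝔼 p (vertexPairs n) (fails G) ≤ ι 524288
      sparse-case = begin
        ι J * 𝔼 p xs (fails G)
          ≤⟨ *-monoˡ (0≤ι J) (ℚ.≤-trans (𝔼-anti (⊎ₚ-prob pp₁ pp₂) pp p₁₂≤p xs (fails-antitone G))
               (ℚ.≤-trans (ℚ.≤-reflexive (sym (𝔼-∪ p₁ p₂ xs (fails-antitone G)))) (𝔼-mono pp₁ xs pointwise))) ⟩
        ι J * 𝔼 p₁ xs (λ E → violations s₀ E + c)
          ≡⟨ cong (ι J *_) (trans (𝔼-+ p₁ xs (violations s₀) (λ _ → c)) (cong (𝔼 p₁ xs (violations s₀) +_) (𝔼-const p₁ xs c))) ⟩
        ι J * (𝔼 p₁ xs (violations s₀) + c)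
          ≤⟨ *-monoˡ (0≤ι J) (ℚ.+-monoˡ-≤ c (expected-violations {n} s₀ t 1≤t pp₁ 4p₁n≤Θ 32s₀≤n)) ⟩
        ι J * ((1ℚ + x) ^ℚ n - 1ℚ + ½ ^ℚ s₀ + c)
          ≡⟨ l (ι J) ((1ℚ + x) ^ℚ n - 1ℚ) (½ ^ℚ s₀) (ι 131072) (1/suc j) ⟩
        ι J * ((1ℚ + x) ^ℚ n - 1ℚ) + ι J * ½ ^ℚ s₀ + ι 131072 * (ι J * 1/suc j)
          ≤⟨ ℚ.+-mono-≤ (ℚ.+-mono-≤ sum-bound halves) (ℚ.≤-reflexive (trans (cong (ι 131072 *_) (suc*1/suc j)) (ℚ.*-identityʳ (ι 131072)))) ⟩
        ι 131072 + 1ℚ + ι 131072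
          ≤⟨ ι-mono {262145} {524288} (ℕ.m≤m+n 262145 262143) ⟩
        ι 524288 ∎
        where
        open ℚ.≤-Reasoning
        c = ι 131072 * 1/suc j
        l : ∀ J a b m i → J * (a + b + m * i) ≡ J * a + J * b + m * (J * i)
        l = solve-∀ ℚ-ring
        p₁₂≤p : p₁ ⊎ₚ p₂ ≤ p
        p₁₂≤p = ≤-from (p₁ * p₂) (0≤* (proj₁ pp₁) 0≤p₂) (l′ p p₂)
          where
          l′ : ∀ p q → p - q + q - (p - q) * q + (p - q) * q ≡ p
          l′ = solve-∀ ℚ-ring
        0≤c : 0ℚ ≤ c
        0≤c = 0≤* (0≤ι 131072) (0≤1/suc j)
        pointwise : ∀ E₁ → 𝔼 p₂ xs (λ E → fails G (E₁ ++ E)) ≤ violations s₀ E₁ + c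
        pointwise E₁ with expander-or-violation s₀ E₁
        ... | inj₁ 1≤v = ℚ.≤-trans (𝔼-≤ pp₂ xs λ E → fails≤1 G (E₁ ++ E)) (ℚ.≤-trans 1≤v (≤+ 0≤c))
        ... | inj₂ expander = ℚ.≤-trans (finish E₁ expander)
          (≤-respʳ (ℚ.+-comm c (violations s₀ E₁)) (≤+ (violations-nonneg s₀ E₁)))

-- Lower bounds for partial sums of the logarithm

module Logarithm where
  open import Data.Rational.Base hiding (_/_)
  open import Tactic.RingSolver using (solve-∀)
  open Rationals

  private
    tangent : ∀ {y d} → 0ℚ ≤ y → 0ℚ ≤ d → ∀ i → y ^ℚ suc i + ι (suc i) * (d * y ^ℚ i) ≤ (y + d) ^ℚ suc i
    tangent {y} {d} 0≤y 0≤d zero = ℚ.≤-reflexive (l y d)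
      where
      l : ∀ y d → y * 1ℚ + 1ℚ * (d * 1ℚ) ≡ (y + d) * 1ℚ
      l = solve-∀ ℚ-ring
    tangent {y} {d} 0≤y 0≤d (suc i) = ℚ.≤-trans
      (≤-from (d * (ι (suc i) * (d * y ^ℚ i))) (0≤* 0≤d (0≤* (0≤ι (suc i)) (0≤* 0≤d (^-nonneg 0≤y i))))
        (trans (cong (λ t → y * (y * y ^ℚ i) + t * (d * (y * y ^ℚ i)) + d * (ι (suc i) * (d * y ^ℚ i))) (ι-suc (suc i)))
          (l y d (y ^ℚ i) (ι (suc i)))))
      (*-monoˡ (0≤+ 0≤y 0≤d) (tangent 0≤y 0≤d i))
      where
      l : ∀ y d a i → y * (y * a) + (1ℚ + i) * (d * (y * a)) + d * (i * (d * a)) ≡ (y + d) * (y * a + i * (d * a))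
      l = solve-∀ ℚ-ring

    logSum-mono : ∀ {y x} → 0ℚ ≤ y → y ≤ x → ∀ M → logSum y M ≤ logSum x M
    logSum-mono 0≤y y≤x zero    = ℚ.≤-refl
    logSum-mono 0≤y y≤x (suc M) = ℚ.+-mono-≤ (logSum-mono 0≤y y≤x M) (*-monoʳ (0≤1/suc M) (^-mono 0≤y y≤x (suc M)))

    -- With y′ = y + q (1 - y) one has 1 - y′ = (1 - q)(1 - y), so -log (1 - y) grows by -log (1 -
    -- q) ≥ q. The partial sum has derivative (1 - y^M) / (1 - y), whence the error q y^M.
    logSum-step : ∀ {y q} → 0ℚ ≤ y → y ≤ 1ℚ → 0ℚ ≤ q → ∀ M →
      logSum y M + q ≤ logSum (y + q * (1ℚ - y)) M + q * y ^ℚ M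
    logSum-step {y} {q} 0≤y y≤1 0≤q zero = ℚ.≤-reflexive (cong (0ℚ +_) (sym (ℚ.*-identityʳ q)))
    logSum-step {y} {q} 0≤y y≤1 0≤q (suc M) = begin
      logSum y M + y * a * t + q
        ≡⟨ l₁ (logSum y M) (y * a * t) q ⟩
      logSum y M + q + y * a * t
        ≤⟨ ℚ.+-monoˡ-≤ (y * a * t) (logSum-step 0≤y y≤1 0≤q M) ⟩
      logSum y′ M + q * a + y * a * t
        ≡⟨ l₂ (logSum y′ M) q y a t ⟩
      logSum y′ M + (y * a * t + 1ℚ * (d * a)) + q * (y * a)
        ≡⟨ cong (λ s → logSum y′ M + (y * a * t + s * (d * a)) + q * (y * a)) (sym (suc*1/suc M)) ⟩
      logSum y′ M + (y * a * t + ι (suc M) * t * (d * a)) + q * (y * a)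
        ≡⟨ cong (λ s → logSum y′ M + s + q * (y * a)) (l₃ (y * a) t (ι (suc M)) (d * a)) ⟩
      logSum y′ M + (y * a + ι (suc M) * (d * a)) * t + q * (y * a)
        ≤⟨ ℚ.+-monoˡ-≤ (q * (y * a)) (ℚ.+-monoʳ-≤ (logSum y′ M) (*-monoʳ (0≤1/suc M) (tangent 0≤y 0≤d M))) ⟩
      logSum y′ M + y′ ^ℚ suc M * t + q * (y * a) ∎
      where
      open ℚ.≤-Reasoning
      d = q * (1ℚ - y)
      y′ = y + d
      a = y ^ℚ M
      t = 1/suc M
      0≤d : 0ℚ ≤ d
      0≤d = 0≤* 0≤q (0≤⇒- y≤1)
      l₁ : ∀ a b c → a + b + c ≡ a + c + b
      l₁ = solve-∀ ℚ-ring
      l₂ : ∀ L q y a t → L + q * a + y * a * t ≡ L + (y * a * t + 1ℚ * (q * (1ℚ - y) * a)) + q * (y * a)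
      l₂ = solve-∀ ℚ-ring
      l₃ : ∀ u t s v → u * t + s * t * v ≡ (u + s * v) * t
      l₃ = solve-∀ ℚ-ring

  -- The derivative of − log (1 − y) is at least 1, so −N log (1 − q) ≥ N q.
  logSum-lower : ∀ n {q} → 0ℚ ≤ q → q ≤ 1ℚ → ∀ N → 1/suc n ≤ (1ℚ - q) ^ℚ N → ∀ M → let x = 1ℚ - 1/suc n in
    ι N * q ≤ logSum x M + ι N * q * x ^ℚ M
  logSum-lower n {q} 0≤q q≤1 N h M = ℚ.≤-trans (upTo N ℕ.≤-refl) (ℚ.+-monoˡ-≤ (ι N * q * x ^ℚ M) (logSum-mono (0≤y N) (y≤x ℕ.≤-refl) M))
    where
    open ℚ.≤-Reasoning
    x = 1ℚ - 1/suc n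
    y : ℕ → ℚ
    y i = 1ℚ - (1ℚ - q) ^ℚ i
    0≤1-q = 0≤⇒- q≤1
    1-q≤1 = 1-≤1 0≤q
    0≤y : ∀ i → 0ℚ ≤ y i
    0≤y i = 0≤⇒- (^-≤1 0≤1-q 1-q≤1 i)
    y≤1 : ∀ i → y i ≤ 1ℚ
    y≤1 i = 1-≤1 (^-nonneg 0≤1-q i)
    y≤x : ∀ {i} → i ℕ.≤ N → y i ≤ x
    y≤x i≤N = ℚ.+-monoʳ-≤ 1ℚ (ℚ.neg-antimono-≤ (ℚ.≤-trans h (^-anti 0≤1-q 1-q≤1 i≤N)))
    y-suc : ∀ i → y i + q * (1ℚ - y i) ≡ y (suc i)
    y-suc i = l q ((1ℚ - q) ^ℚ i)
      where
      l : ∀ q a → 1ℚ - a + q * (1ℚ - (1ℚ - a)) ≡ 1ℚ - (1ℚ - q) * a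
      l = solve-∀ ℚ-ring
    l₁ : ∀ i q L z → L + i * q * z + q ≡ L + q + i * q * z
    l₁ = solve-∀ ℚ-ring
    l₂ : ∀ i q → (1ℚ + i) * q ≡ i * q + q
    l₂ = solve-∀ ℚ-ring
    l₃ : ∀ L i q z → L + q * z + i * q * z ≡ L + (1ℚ + i) * q * z
    l₃ = solve-∀ ℚ-ring
    upTo : ∀ i → i ℕ.≤ N → ι i * q ≤ logSum (y i) M + ι i * q * x ^ℚ M
    upTo zero _ = ℚ.≤-trans (ℚ.≤-reflexive (ℚ.*-zeroˡ q)) (0≤+ (0≤logSum M) (0≤* (0≤* (0≤ι 0) 0≤q) (^-nonneg (0≤⇒- (1/suc≤1 n)) M)))
      where
      0≤logSum : ∀ M → 0ℚ ≤ logSum (y 0) M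
      0≤logSum zero    = ℚ.≤-refl
      0≤logSum (suc M) = 0≤+ (0≤logSum M) (0≤* (^-nonneg (0≤y 0) (suc M)) (0≤1/suc M))
    upTo (suc i) i<N = begin
      ι (suc i) * q
        ≡⟨ trans (cong (_* q) (ι-suc i)) (l₂ (ι i) q) ⟩
      ι i * q + q
        ≤⟨ ℚ.+-monoˡ-≤ q (upTo i (ℕ.<⇒≤ i<N)) ⟩
      logSum (y i) M + ι i * q * x ^ℚ M + q
        ≡⟨ l₁ (ι i) q (logSum (y i) M) (x ^ℚ M) ⟩
      logSum (y i) M + q + ι i * q * x ^ℚ M
        ≤⟨ ℚ.+-monoˡ-≤ (ι i * q * x ^ℚ M) (logSum-step (0≤y i) (y≤1 i) 0≤q M) ⟩
      logSum (y i + q * (1ℚ - y i)) M + q * y i ^ℚ M + ι i * q * x ^ℚ M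
        ≡⟨ cong (λ z → logSum z M + q * y i ^ℚ M + ι i * q * x ^ℚ M) (y-suc i) ⟩
      logSum (y (suc i)) M + q * y i ^ℚ M + ι i * q * x ^ℚ M
        ≤⟨ ℚ.+-monoˡ-≤ (ι i * q * x ^ℚ M) (ℚ.+-monoʳ-≤ (logSum (y (suc i)) M) (*-monoˡ 0≤q (^-mono (0≤y i) (y≤x (ℕ.<⇒≤ i<N)) M))) ⟩
      logSum (y (suc i)) M + q * x ^ℚ M + ι i * q * x ^ℚ M
        ≡⟨ trans (l₃ (logSum (y (suc i)) M) (ι i) q (x ^ℚ M)) (cong (λ t → logSum (y (suc i)) M + t * q * x ^ℚ M) (sym (ι-suc i))) ⟩
      logSum (y (suc i)) M + ι (suc i) * q * x ^ℚ M ∎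

  -- An explicit rate for the truncation error, which decides how late an approximation of `log n`
  -- has to be taken.
  power-small : ∀ n K M → suc n ℕ.* K ℕ.≤ M → (1ℚ - 1/suc n) ^ℚ M ≤ 1/suc K
  power-small n K M h = *-cancelˡ (ι (suc K)) (0<ι (ℕ.s≤s ℕ.z≤n)) (begin
    ι (suc K) * x ^ℚ M
      ≡⟨ trans (cong (_* x ^ℚ M) (ι-suc K)) (ℚ.*-comm (1ℚ + ι K) (x ^ℚ M)) ⟩
    x ^ℚ M * (1ℚ + ι K)
      ≤⟨ *-monoˡ (^-nonneg (0≤⇒- (1/suc≤1 n)) M) (ℚ.+-monoʳ-≤ 1ℚ K≤) ⟩
    x ^ℚ M * (1ℚ + ι M * 1/suc n)
      ≤⟨ ^-inverse-bound (0≤1/suc n) (1/suc≤1 n) M ⟩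
    1ℚ
      ≡⟨ sym (suc*1/suc K) ⟩
    ι (suc K) * 1/suc K ∎)
    where
    open ℚ.≤-Reasoning
    x = 1ℚ - 1/suc n
    l : ∀ a b c → a * b * c ≡ b * (a * c)
    l = solve-∀ ℚ-ring
    K≤ : ι K ≤ ι M * 1/suc n
    K≤ = ≤-respˡ (trans (cong (_* 1/suc n) (ι-* (suc n) K)) (trans (l (ι (suc n)) (ι K) (1/suc n))
        (trans (cong (ι K *_) (suc*1/suc n)) (ℚ.*-identityʳ (ι K)))))
      (*-monoʳ (0≤1/suc n) (ι-mono h))

  -- This is `logSum-lower` with q = ½ and N = k. One factor 2 is lost by -log ½ ≥ ½, the other by
  -- the truncation.
  log-lower : ∀ n k → 2 ℕ.^ k ℕ.≤ suc n → ∀ M → (1ℚ - 1/suc n) ^ℚ M ≤ ½ → ι k ≤ ι 4 * logSum (1ℚ - 1/suc n) M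
  log-lower n k 2^k≤ M small = begin
    ι k
      ≤⟨ ≤-from (ι 2 * ι k * (½ - z)) (0≤* (0≤* (0≤ι 2) (0≤ι k)) (0≤⇒- small)) (l (ι k) z) ⟩
    ι 4 * (ι k * ½ - ι k * ½ * z)
      ≤⟨ *-monoˡ (0≤ι 4) bound ⟩
    ι 4 * L ∎
    where
    open ℚ.≤-Reasoning
    z = (1ℚ - 1/suc n) ^ℚ M
    L = logSum (1ℚ - 1/suc n) M
    l : ∀ k z → k + ι 2 * k * (½ - z) ≡ ι 4 * (k * ½ - k * ½ * z)
    l k z = trans (l₀ (ι 2) ½ k z) (trans (l₁ k z) (sym (l₂ (ι 4) ½ k z)))
      where
      l₀ : ∀ t h k z → k + t * k * (h - z) ≡ k + t * h * k - t * k * z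
      l₀ = solve-∀ ℚ-ring
      l₁ : ∀ k z → k + 1ℚ * k - (1ℚ + 1ℚ) * k * z ≡ (1ℚ + 1ℚ) * (k - k * z)
      l₁ = solve-∀ ℚ-ring
      l₂ : ∀ f h k z → f * (k * h - k * h * z) ≡ f * h * (k - k * z)
      l₂ = solve-∀ ℚ-ring
    l′ : ∀ L a b → L + b - a ≡ L - (a - b)
    l′ = solve-∀ ℚ-ring
    ½^k : 1/suc n ≤ (1ℚ - ½) ^ℚ k
    ½^k = *-cancelˡ (ι (suc n)) (0<ι (ℕ.s≤s ℕ.z≤n)) (≤-respˡ (sym (suc*1/suc n))
      (≤-respˡ (trans (sym (^-*-distrib (ι 2) ½ k)) (1^ k)) (*-monoʳ (^-nonneg (ℚ.nonNegative⁻¹ ½) k) (≤-respˡ (ι-^ 2 k) (ι-mono 2^k≤)))))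
    lower : ι k * ½ ≤ L + ι k * ½ * z
    lower = logSum-lower n (ℚ.nonNegative⁻¹ ½) (≤-from ½ (ℚ.nonNegative⁻¹ ½) refl) k ½^k M
    bound : ι k * ½ - ι k * ½ * z ≤ L
    bound = -⇒≤ {ι k * ½ - ι k * ½ * z} {L} (≤-respʳ (l′ L (ι k * ½) (ι k * ½ * z)) (0≤⇒- lower))

-- The first term of the threshold

module SparseRegime where
  open import Data.Nat.Base using (_/_)
  open import Data.Nat.DivMod using (m/n*n≤m; m≡m%n+[m/n]*n; m%n<n)
  open import Data.Rational.Base hiding (_/_)
  open import Tactic.RingSolver using (solve-∀)
  open Rationals
  open Expectation
  open Boosting using (fails; fails-antitone)
  open Logarithm
  open SparseCase using (sparse-case)

  ι-cancel : ∀ {m n} → ι m ≤ ι n → m ℕ.≤ n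
  ι-cancel {m} {n} h = ℕ.≮⇒≥ λ n<m → ℚ.<-irrefl refl (ℚ.<-≤-trans
    (subst (ι n <_) (trans (ℚ.+-comm (ι n) 1ℚ) (sym (ι-suc n))) (subst (_< ι n + 1ℚ) (ℚ.+-identityʳ (ι n)) (ℚ.+-monoʳ-< (ι n) 0<1)))
    (ℚ.≤-trans (ι-mono n<m) h))

  ^-distribʳ-* : ∀ k m n → (m ℕ.* n) ℕ.^ k ≡ m ℕ.^ k ℕ.* n ℕ.^ k
  ^-distribʳ-* zero    m n = refl
  ^-distribʳ-* (suc k) m n = trans (cong (m ℕ.* n ℕ.*_) (^-distribʳ-* k m n)) (l m n (m ℕ.^ k) (n ℕ.^ k))
    where
    l : ∀ a b c d → a ℕ.* b ℕ.* (c ℕ.* d) ≡ a ℕ.* c ℕ.* (b ℕ.* d)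
    l = ℕSolver.solve-∀

  root≤1 : ∀ {y} j → 0ℚ ≤ y → y ^ℚ suc j ≤ 1ℚ → y ≤ 1ℚ
  root≤1 {y} j 0≤y h with ℚ.≤-total y 1ℚ
  ... | inj₁ y≤1 = y≤1
  ... | inj₂ 1≤y = ℚ.≤-trans (≤-respˡ (ℚ.*-identityʳ y) (*-monoˡ 0≤y (1≤^ 1≤y j))) h

  private
    -- The gain 1 + 8/J outweighs all losses together: j / J for the first portion, J / (J + 1) for
    -- N / n, (4 j + 3) / (4 J) for rounding N, 4 J / (4 J + 1) for truncating the logarithm, and J²
    -- / (J² + 2) for the tolerance 1 added to p n.
    polynomial-gap : ∀ j → 3 ℕ.≤ j → let J = suc j in
      J ℕ.* suc J ℕ.* suc (4 ℕ.* J) ℕ.* J ℕ.* (J ℕ.* J ℕ.+ 2) ℕ.< (J ℕ.+ 8) ℕ.* (4 ℕ.* j ℕ.+ 3) ℕ.* j ℕ.* J ℕ.* (J ℕ.* J)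
    polynomial-gap j 3≤j = subst Claim (ℕ.m∸n+n≡m 3≤j) (at (j ℕ.∸ 3))
      where
      Claim : ℕ → Set
      Claim j = let J = suc j in
        J ℕ.* suc J ℕ.* suc (4 ℕ.* J) ℕ.* J ℕ.* (J ℕ.* J ℕ.+ 2) ℕ.< (J ℕ.+ 8) ℕ.* (4 ℕ.* j ℕ.+ 3) ℕ.* j ℕ.* J ℕ.* (J ℕ.* J)
      expand : ∀ i → let j = i ℕ.+ 3 ; J = suc j in
        (J ℕ.+ 8) ℕ.* (4 ℕ.* j ℕ.+ 3) ℕ.* j ℕ.* J ≡
        suc J ℕ.* suc (4 ℕ.* J) ℕ.* (J ℕ.* J ℕ.+ 2) ℕ.+ (22 ℕ.* (i ℕ.* i ℕ.* i) ℕ.+ 216 ℕ.* (i ℕ.* i) ℕ.+ 670 ℕ.* i ℕ.+ 629 ℕ.+ 1)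
      expand = ℕSolver.solve-∀
      regroup : ∀ J a b c → J ℕ.* a ℕ.* b ℕ.* J ℕ.* c ≡ a ℕ.* b ℕ.* c ℕ.* (J ℕ.* J)
      regroup = ℕSolver.solve-∀
      at : ∀ i → Claim (i ℕ.+ 3)
      at i = ℕ.≤-<-trans (ℕ.≤-reflexive (regroup J (suc J) (suc (4 ℕ.* J)) (J ℕ.* J ℕ.+ 2)))
        (ℕ.*-monoˡ-< (J ℕ.* J) {{ℕ.m*n≢0 J J}} {c} {d} c<d)
        where
        J = suc (i ℕ.+ 3)
        c = suc J ℕ.* suc (4 ℕ.* J) ℕ.* (J ℕ.* J ℕ.+ 2)
        d = (J ℕ.+ 8) ℕ.* (4 ℕ.* (i ℕ.+ 3) ℕ.+ 3) ℕ.* (i ℕ.+ 3) ℕ.* J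
        c<d : c ℕ.< d
        c<d = subst (c ℕ.<_) (sym (expand i)) (ℕ.m<m+n c (ℕ.m≤n+m 1 (22 ℕ.* (i ℕ.* i ℕ.* i) ℕ.+ 216 ℕ.* (i ℕ.* i) ℕ.+ 670 ℕ.* i ℕ.+ 629)))

  module _ (n′ k j : ℕ)
    (2^k≤n : 2 ℕ.^ k ℕ.≤ suc n′) (n<2^k : suc n′ ℕ.< 2 ℕ.^ suc k) (k<2^J : k ℕ.< 2 ℕ.^ suc j)
    (4JJ≤k : 4 ℕ.* (suc j ℕ.* suc j) ℕ.≤ k) (131072≤k : 131072 ℕ.≤ k) (8≤J : 8 ℕ.≤ suc j) where

    private
      n = suc n′
      J = suc j
      Q = k ℕ.* k ℕ.* k

      n<2^n : ∀ n → n ℕ.< 2 ℕ.^ n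
      n<2^n zero    = ℕ.s≤s ℕ.z≤n
      n<2^n (suc n) = ℕ.+-mono-≤ (ℕ.≤-trans (ℕ.s≤s ℕ.z≤n) (n<2^n n)) (ℕ.≤-trans (n<2^n n) (ℕ.≤-reflexive (sym (ℕ.+-identityʳ (2 ℕ.^ n)))))

      k≤n : k ℕ.≤ n
      k≤n = ℕ.≤-trans (ℕ.<⇒≤ (n<2^n k)) 2^k≤n

      32J≤k : J ℕ.* 32 ℕ.≤ k
      32J≤k = ℕ.≤-trans (ℕ.≤-reflexive (l J)) (ℕ.≤-trans (ℕ.*-monoʳ-≤ 4 (ℕ.*-monoʳ-≤ J 8≤J)) 4JJ≤k)
        where
        l : ∀ J → J ℕ.* 32 ≡ 4 ℕ.* (J ℕ.* 8)
        l = ℕSolver.solve-∀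

      4J≤n : 4 ℕ.* J ℕ.≤ n
      4J≤n = ℕ.≤-trans (ℕ.≤-trans (ℕ.≤-reflexive (ℕ.*-comm 4 J)) (ℕ.*-monoʳ-≤ J (ℕ.m≤m+n 4 28))) (ℕ.≤-trans 32J≤k k≤n)

      JJ≤k : J ℕ.* J ℕ.≤ k
      JJ≤k = ℕ.≤-trans (ℕ.m≤n*m (J ℕ.* J) 4) 4JJ≤k

      1≤k : 1 ℕ.≤ k
      1≤k = ℕ.≤-trans (ℕ.s≤s ℕ.z≤n) 131072≤k

      3≤n : 3 ℕ.≤ n
      3≤n = ℕ.≤-trans (ℕ.m≤m+n 3 131069) (ℕ.≤-trans 131072≤k k≤n)

      -- Since k < 2^J, k^(3J) is at most 2^(3J²) ≤ 2^k ≤ n; that is, n^(1/J) ≥ k³. This fixes J at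
      -- about log log n.
      Q^J≤n : Q ℕ.^ J ℕ.≤ n
      Q^J≤n = begin
        Q ℕ.^ J                                      ≤⟨ ℕ.^-monoˡ-≤ J (ℕ.*-mono-≤ (ℕ.*-mono-≤ k≤ k≤) k≤) ⟩
        (2 ℕ.^ J ℕ.* 2 ℕ.^ J ℕ.* 2 ℕ.^ J) ℕ.^ J      ≡⟨ cong (ℕ._^ J) (sym (trans (ℕ.^-distribˡ-+-* 2 (J ℕ.+ J) J) (cong (ℕ._* 2 ℕ.^ J) (ℕ.^-distribˡ-+-* 2 J J)))) ⟩
        (2 ℕ.^ (J ℕ.+ J ℕ.+ J)) ℕ.^ J                ≡⟨ ℕ.^-*-assoc 2 (J ℕ.+ J ℕ.+ J) J ⟩
        2 ℕ.^ ((J ℕ.+ J ℕ.+ J) ℕ.* J)                ≤⟨ ℕ.^-monoʳ-≤ 2 (ℕ.≤-trans 3JJ 4JJ≤k) ⟩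
        2 ℕ.^ k                                      ≤⟨ 2^k≤n ⟩
        n                                            ∎
        where
        open ℕ.≤-Reasoning
        k≤ = ℕ.<⇒≤ k<2^J
        3JJ : (J ℕ.+ J ℕ.+ J) ℕ.* J ℕ.≤ 4 ℕ.* (J ℕ.* J)
        3JJ = ℕ.≤-trans (ℕ.≤-reflexive (l J)) (ℕ.*-monoˡ-≤ (J ℕ.* J) (ℕ.m≤m+n 3 1))
          where
          l : ∀ J → (J ℕ.+ J ℕ.+ J) ℕ.* J ≡ 3 ℕ.* (J ℕ.* J)
          l = ℕSolver.solve-∀

    module _ {p : ℚ} (pp : IsProb p) where

      private
        0≤p = proj₁ pp
        p₁ = p - p * 1/suc j
        X = p * ι n
        B = (1ℚ - p₁) ^ℚ n

        p₂≤p : p * 1/suc j ≤ p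
        p₂≤p = ≤-respʳ (ℚ.*-identityʳ p) (*-monoˡ 0≤p (1/suc≤1 j))

        0≤p₁ : 0ℚ ≤ p₁
        0≤p₁ = 0≤⇒- p₂≤p

        p₁≤1 : p₁ ≤ 1ℚ
        p₁≤1 = ℚ.≤-trans (1-≤ p (p * 1/suc j) (0≤* 0≤p (0≤1/suc j))) (proj₂ pp)
          where
          1-≤ : ∀ p q → 0ℚ ≤ q → p - q ≤ p
          1-≤ p q 0≤q = ≤-from q 0≤q (l p q)
            where
            l : ∀ p q → p - q + q ≡ p
            l = solve-∀ ℚ-ring

        0≤1-p₁ = 0≤⇒- p₁≤1
        1-p₁≤1 = 1-≤1 0≤p₁

        Jp₁ : ι J * p₁ ≡ ι j * p
        Jp₁ = trans (l (ι J) p (1/suc j)) (trans (cong₂ (λ a b → a * p - p * b) (ι-suc j) (suc*1/suc j)) (l′ (ι j) p))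
          where
          l : ∀ J p i → J * (p - p * i) ≡ J * p - p * (J * i)
          l = solve-∀ ℚ-ring
          l′ : ∀ j p → (1ℚ + j) * p - p * 1ℚ ≡ j * p
          l′ = solve-∀ ℚ-ring

        N = (n ℕ.* J) / suc J

        N-lo : N ℕ.* suc J ℕ.≤ n ℕ.* J
        N-lo = m/n*n≤m (n ℕ.* J) (suc J)

        N-hi : J ℕ.* n′ ℕ.≤ suc J ℕ.* N
        N-hi = ℕ.+-cancelˡ-≤ J _ _ (begin
          J ℕ.+ J ℕ.* n′                                ≡⟨ trans (sym (ℕ.*-suc J n′)) (ℕ.*-comm J n) ⟩
          n ℕ.* J                                       ≡⟨ m≡m%n+[m/n]*n (n ℕ.* J) (suc J) ⟩
          (n ℕ.* J) ℕ.% suc J ℕ.+ N ℕ.* suc J           ≤⟨ ℕ.+-mono-≤ (ℕ.s≤s⁻¹ (m%n<n (n ℕ.* J) (suc J))) (ℕ.≤-reflexive (ℕ.*-comm N (suc J))) ⟩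
          J ℕ.+ suc J ℕ.* N                             ∎)
          where open ℕ.≤-Reasoning

        b = (1ℚ - p₁) ^ℚ N

      -- If (1 - p₁) ^ N ≤ 1 / n for N = nJ / (J + 1), then (1 - p₁) ^ n falls below 1 / n by
      -- the further factor n ^ (1 / J).
      private
        below : b ≤ 1/suc n′ → ι (n ℕ.* Q) * B ≤ 1ℚ
        below b≤ = root≤1 j (0≤* (0≤ι (n ℕ.* Q)) (^-nonneg 0≤1-p₁ n)) (begin
          (ι (n ℕ.* Q) * B) ^ℚ J
            ≡⟨ trans (^-*-distrib (ι (n ℕ.* Q)) B J) (cong (_* B ^ℚ J) (sym (ι-^ (n ℕ.* Q) J))) ⟩
          ι ((n ℕ.* Q) ℕ.^ J) * B ^ℚ J
            ≤⟨ *-mono (0≤ι ((n ℕ.* Q) ℕ.^ J)) (^-nonneg (^-nonneg 0≤1-p₁ N) (suc J)) (ι-mono nQ^J) B^J ⟩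
          ι (n ℕ.^ suc J) * b ^ℚ suc J
            ≡⟨ trans (cong (_* b ^ℚ suc J) (ι-^ n (suc J))) (sym (^-*-distrib (ι n) b (suc J))) ⟩
          (ι n * b) ^ℚ suc J
            ≤⟨ ^-≤1 (0≤* (0≤ι n) (^-nonneg 0≤1-p₁ N)) (≤-respʳ (suc*1/suc n′) (*-monoˡ (0≤ι n) b≤)) (suc J) ⟩
          1ℚ ∎)
          where
          open ℚ.≤-Reasoning
          nQ^J : (n ℕ.* Q) ℕ.^ J ℕ.≤ n ℕ.^ suc J
          nQ^J = ℕ.≤-trans (ℕ.≤-reflexive (^-distribʳ-* J n Q)) (ℕ.≤-trans (ℕ.*-monoʳ-≤ (n ℕ.^ J) Q^J≤n) (ℕ.≤-reflexive (ℕ.*-comm (n ℕ.^ J) n)))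
          B^J : B ^ℚ J ≤ b ^ℚ suc J
          B^J = ≤-respˡ (^-^ (1ℚ - p₁) J n) (≤-respʳ (^-^ (1ℚ - p₁) (suc J) N)
            (^-anti 0≤1-p₁ 1-p₁≤1 (ℕ.≤-trans (ℕ.≤-reflexive (ℕ.*-comm (suc J) N)) (ℕ.≤-trans N-lo (ℕ.≤-reflexive (ℕ.*-comm n J))))))

      module _ (M : ℕ) (small : (1ℚ - 1/suc n′) ^ℚ M ≤ 1/suc (4 ℕ.* J)) where

        private
          ℓ = logSum (1ℚ - 1/suc n′) M
          z = (1ℚ - 1/suc n′) ^ℚ M

          z≤½ : z ≤ ½
          z≤½ = ℚ.≤-trans small (*-cancelˡ (ι (suc (4 ℕ.* J))) (0<ι (ℕ.s≤s ℕ.z≤n))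
            (≤-respˡ (sym (suc*1/suc (4 ℕ.* J))) (*-monoʳ {½} (ℚ.nonNegative⁻¹ ½) (ι-mono {2} (ℕ.s≤s (ℕ.≤-trans (ℕ.s≤s ℕ.z≤n) (ℕ.m≤n*m J 4)))))))

          k≤4ℓ : ι k ≤ ι 4 * ℓ
          k≤4ℓ = log-lower n′ k 2^k≤n M z≤½

        module _ (above-threshold : ι (J ℕ.+ 8) * ℓ ≤ ι J * (X + 1ℚ)) where

          private
            0≤ℓ : 0ℚ ≤ ℓ
            0≤ℓ = *-cancelˡ (ι 4) (0<ι (ℕ.s≤s ℕ.z≤n)) (≤-respˡ (sym (ℚ.*-zeroʳ (ι 4))) (ℚ.≤-trans (0≤ι k) k≤4ℓ))

          k≤8X : ι k ≤ ι 8 * X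
          k≤8X = +-cancelʳ (ι k) (begin
            ι k + ι k
              ≤⟨ ℚ.+-mono-≤ k≤4ℓ k≤4ℓ ⟩
            ι 4 * ℓ + ι 4 * ℓ
              ≡⟨ sym (ℚ.*-distribʳ-+ ℓ (ι 4) (ι 4)) ⟩
            ι 8 * ℓ
              ≤⟨ *-monoˡ (0≤ι 8) ℓ≤ ⟩
            ι 8 * (X + 1ℚ)
              ≡⟨ trans (ℚ.*-distribˡ-+ (ι 8) X 1ℚ) (cong (ι 8 * X +_) (ℚ.*-identityʳ (ι 8))) ⟩
            ι 8 * X + ι 8
              ≤⟨ ℚ.+-monoʳ-≤ (ι 8 * X) (ι-mono (ℕ.≤-trans (ℕ.m≤m+n 8 131064) 131072≤k)) ⟩
            ι 8 * X + ι k ∎)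
            where
            open ℚ.≤-Reasoning
            ℓ≤ : ℓ ≤ X + 1ℚ
            ℓ≤ = *-cancelˡ (ι J) (0<ι (ℕ.s≤s ℕ.z≤n)) (ℚ.≤-trans (*-monoʳ 0≤ℓ (ι-mono (ℕ.m≤m+n J 8))) above-threshold)

          private
            0<X : 0ℚ < X
            0<X = ℚ.*-cancelˡ-<-nonNeg (ι 8) (subst (_< ι 8 * X) (sym (ℚ.*-zeroʳ (ι 8))) (ℚ.<-≤-trans (0<ι 1≤k) k≤8X))

            W = ι N * p₁

            -- If 1/n ≤ (1 - p₁)^N, then N p₁ is at most log n up to truncation by `logSum-lower`,
            -- while `above-threshold` makes p n at least (1 + 8/J) log n - 1. As N p₁ is nearly p
            -- n, this contradicts `polynomial-gap`.
            impossible : ¬ (1/suc n′ ≤ b)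
            impossible h = ℕ.<⇒≱ numbers (ι-cancel (*-cancelˡ X 0<X (subst₂ _≤_ (ℚ.*-comm _ X) (ℚ.*-comm _ X) total)))
              where
              open ℚ.≤-Reasoning
              lhs rhs : ℕ
              lhs = (J ℕ.+ 8) ℕ.* (4 ℕ.* j ℕ.+ 3) ℕ.* j ℕ.* J ℕ.* (J ℕ.* J)
              rhs = J ℕ.* suc J ℕ.* suc (4 ℕ.* J) ℕ.* J ℕ.* (J ℕ.* J ℕ.+ 2)
              numbers : rhs ℕ.< lhs
              numbers = polynomial-gap j (ℕ.≤-trans (ℕ.m≤m+n 3 4) (ℕ.s≤s⁻¹ 8≤J))
              4J = ι (4 ℕ.* J)
              4J+1 = ι (suc (4 ℕ.* J))
              S1 : 4J * W ≤ 4J+1 * ℓ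
              S1 = +-cancelʳ W (begin
                4J * W + W                     ≡⟨ trans (l 4J W) (cong (_* W) (sym (ι-suc (4 ℕ.* J)))) ⟩
                4J+1 * W                       ≤⟨ *-monoˡ (0≤ι (suc (4 ℕ.* J))) (ℚ.≤-trans (logSum-lower n′ 0≤p₁ p₁≤1 N h M) (ℚ.+-monoʳ-≤ ℓ (*-monoˡ (0≤* (0≤ι N) 0≤p₁) small))) ⟩
                4J+1 * (ℓ + W * 1/suc (4 ℕ.* J)) ≡⟨ trans (l′ 4J+1 ℓ W (1/suc (4 ℕ.* J))) (cong (λ t → 4J+1 * ℓ + t) (trans (cong (W *_) (suc*1/suc (4 ℕ.* J))) (ℚ.*-identityʳ W))) ⟩
                4J+1 * ℓ + W                   ∎)
                where
                l : ∀ a W → a * W + W ≡ (1ℚ + a) * W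
                l = solve-∀ ℚ-ring
                l′ : ∀ a L W i → a * (L + W * i) ≡ a * L + W * (a * i)
                l′ = solve-∀ ℚ-ring
              S2 : ι (J ℕ.+ 8) * (4J * W) ≤ 4J+1 * (ι J * (X + 1ℚ))
              S2 = begin
                ι (J ℕ.+ 8) * (4J * W)       ≤⟨ *-monoˡ (0≤ι (J ℕ.+ 8)) S1 ⟩
                ι (J ℕ.+ 8) * (4J+1 * ℓ)     ≡⟨ l (ι (J ℕ.+ 8)) 4J+1 ℓ ⟩
                4J+1 * (ι (J ℕ.+ 8) * ℓ)     ≤⟨ *-monoˡ (0≤ι (suc (4 ℕ.* J))) above-threshold ⟩
                4J+1 * (ι J * (X + 1ℚ))      ∎
                where
                l : ∀ a b c → a * (b * c) ≡ b * (a * c)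
                l = solve-∀ ℚ-ring
              S3 : ι (J ℕ.* n′) * (ι j * p) ≤ ι (suc J) * ι J * W
              S3 = begin
                ι (J ℕ.* n′) * (ι j * p)            ≤⟨ *-monoʳ (0≤* (0≤ι j) 0≤p) (ι-mono N-hi) ⟩
                ι (suc J ℕ.* N) * (ι j * p)         ≡⟨ cong₂ _*_ (ι-* (suc J) N) (sym Jp₁) ⟩
                ι (suc J) * ι N * (ι J * p₁)      ≡⟨ l (ι (suc J)) (ι N) (ι J) p₁ ⟩
                ι (suc J) * ι J * W                 ∎
                where
                l : ∀ a b c d → a * b * (c * d) ≡ a * c * (b * d)
                l = solve-∀ ℚ-ring
              -- Passing from n - 1 to n loses at most the factor (4 j + 3) / (4 J), because n ≥ 4
              -- J.
              S4 : (4 ℕ.* j ℕ.+ 3) ℕ.* n ℕ.* J ℕ.≤ 4 ℕ.* J ℕ.* (J ℕ.* n′)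
              S4 = ℕ.≤-trans (ℕ.*-monoˡ-≤ J lemma) (ℕ.≤-reflexive (l (4 ℕ.* J) n′ J))
                where
                l : ∀ a b c → a ℕ.* b ℕ.* c ≡ a ℕ.* (c ℕ.* b)
                l = ℕSolver.solve-∀
                l′ : ∀ j n′ → (4 ℕ.* j ℕ.+ 3) ℕ.* suc n′ ℕ.+ suc n′ ≡ 4 ℕ.* suc j ℕ.* n′ ℕ.+ 4 ℕ.* suc j
                l′ = ℕSolver.solve-∀
                lemma : (4 ℕ.* j ℕ.+ 3) ℕ.* n ℕ.≤ 4 ℕ.* J ℕ.* n′
                lemma = ℕ.+-cancelʳ-≤ n _ _ (ℕ.≤-trans (ℕ.≤-reflexive (l′ j n′)) (ℕ.+-monoʳ-≤ (4 ℕ.* J ℕ.* n′) 4J≤n))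
              C₁ C₂ : ℕ
              C₁ = (J ℕ.+ 8) ℕ.* (4 ℕ.* j ℕ.+ 3) ℕ.* j ℕ.* J
              C₂ = J ℕ.* suc J ℕ.* suc (4 ℕ.* J) ℕ.* J
              S5 : ι C₁ * X ≤ ι C₂ * (X + 1ℚ)
              S5 = begin
                ι C₁ * X
                  ≡⟨ trans (cong (_* X) (trans (ι-* ((J ℕ.+ 8) ℕ.* (4 ℕ.* j ℕ.+ 3) ℕ.* j) J) (cong (_* ι J) (trans (ι-* ((J ℕ.+ 8) ℕ.* (4 ℕ.* j ℕ.+ 3)) j) (cong (_* ι j) (ι-* (J ℕ.+ 8) (4 ℕ.* j ℕ.+ 3)))))))
                      (l₁ (ι (J ℕ.+ 8)) (ι (4 ℕ.* j ℕ.+ 3)) (ι j) (ι J) p (ι n)) ⟩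
                ι (J ℕ.+ 8) * (ι (4 ℕ.* j ℕ.+ 3) * ι n * ι J * (ι j * p))
                  ≡⟨ cong (λ t → ι (J ℕ.+ 8) * (t * (ι j * p))) (sym (trans (ι-* ((4 ℕ.* j ℕ.+ 3) ℕ.* n) J) (cong (_* ι J) (ι-* (4 ℕ.* j ℕ.+ 3) n)))) ⟩
                ι (J ℕ.+ 8) * (ι ((4 ℕ.* j ℕ.+ 3) ℕ.* n ℕ.* J) * (ι j * p))
                  ≤⟨ *-monoˡ (0≤ι (J ℕ.+ 8)) (*-monoʳ (0≤* (0≤ι j) 0≤p) (ι-mono S4)) ⟩
                ι (J ℕ.+ 8) * (ι (4 ℕ.* J ℕ.* (J ℕ.* n′)) * (ι j * p))
                  ≡⟨ cong (ι (J ℕ.+ 8) *_) (trans (cong (_* (ι j * p)) (ι-* (4 ℕ.* J) (J ℕ.* n′))) (ℚ.*-assoc 4J (ι (J ℕ.* n′)) (ι j * p))) ⟩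
                ι (J ℕ.+ 8) * (4J * (ι (J ℕ.* n′) * (ι j * p)))
                  ≤⟨ *-monoˡ (0≤ι (J ℕ.+ 8)) (*-monoˡ (0≤ι (4 ℕ.* J)) S3) ⟩
                ι (J ℕ.+ 8) * (4J * (ι (suc J) * ι J * W))
                  ≡⟨ l₂ (ι (J ℕ.+ 8)) 4J (ι (suc J)) (ι J) W ⟩
                ι J * ι (suc J) * (ι (J ℕ.+ 8) * (4J * W))
                  ≤⟨ *-monoˡ (0≤* (0≤ι J) (0≤ι (suc J))) S2 ⟩
                ι J * ι (suc J) * (4J+1 * (ι J * (X + 1ℚ)))
                  ≡⟨ trans (l₃ (ι J) (ι (suc J)) 4J+1 (X + 1ℚ)) (cong (_* (X + 1ℚ)) (sym (trans (ι-* (J ℕ.* suc J ℕ.* suc (4 ℕ.* J)) J) (cong (_* ι J) (trans (ι-* (J ℕ.* suc J) (suc (4 ℕ.* J))) (cong (_* 4J+1) (ι-* J (suc J)))))))) ⟩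
                ι C₂ * (X + 1ℚ) ∎
                where
                l₁ : ∀ a b c d p n → a * b * c * d * (p * n) ≡ a * (b * n * d * (c * p))
                l₁ = solve-∀ ℚ-ring
                l₂ : ∀ a b c d W → a * (b * (c * d * W)) ≡ d * c * (a * (b * W))
                l₂ = solve-∀ ℚ-ring
                l₃ : ∀ a b c X → a * b * (c * (a * X)) ≡ a * b * c * a * X
                l₃ = solve-∀ ℚ-ring
              JJ≤2X : ι (J ℕ.* J) ≤ ι 2 * X
              JJ≤2X = *-cancelˡ (ι 4) (0<ι (ℕ.s≤s ℕ.z≤n)) (begin
                ι 4 * ι (J ℕ.* J)    ≡⟨ sym (ι-* 4 (J ℕ.* J)) ⟩
                ι (4 ℕ.* (J ℕ.* J))    ≤⟨ ι-mono 4JJ≤k ⟩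
                ι k                    ≤⟨ k≤8X ⟩
                ι 8 * X                ≡⟨ ℚ.*-assoc (ι 4) (ι 2) X ⟩
                ι 4 * (ι 2 * X)      ∎)
              total : ι lhs * X ≤ ι rhs * X
              total = begin
                ι lhs * X
                  ≡⟨ trans (cong (_* X) (ι-* C₁ (J ℕ.* J))) (l₁ (ι C₁) (ι (J ℕ.* J)) X) ⟩
                ι (J ℕ.* J) * (ι C₁ * X)
                  ≤⟨ *-monoˡ (0≤ι (J ℕ.* J)) S5 ⟩
                ι (J ℕ.* J) * (ι C₂ * (X + 1ℚ))
                  ≡⟨ l₂ (ι (J ℕ.* J)) (ι C₂) X ⟩
                ι C₂ * (ι (J ℕ.* J) * X + ι (J ℕ.* J))
                  ≤⟨ *-monoˡ (0≤ι C₂) (ℚ.+-monoʳ-≤ (ι (J ℕ.* J) * X) JJ≤2X) ⟩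
                ι C₂ * (ι (J ℕ.* J) * X + ι 2 * X)
                  ≡⟨ trans (l₃ (ι C₂) (ι (J ℕ.* J)) (ι 2) X) (cong (_* X) (trans (cong (ι C₂ *_) (sym (ι-+ (J ℕ.* J) 2))) (sym (ι-* C₂ (J ℕ.* J ℕ.+ 2))))) ⟩
                ι rhs * X ∎
                where
                l₁ : ∀ a b X → a * b * X ≡ b * (a * X)
                l₁ = solve-∀ ℚ-ring
                l₂ : ∀ a b X → a * (b * (X + 1ℚ)) ≡ b * (a * X + a)
                l₂ = solve-∀ ℚ-ring
                l₃ : ∀ a b c X → a * (b * X + c * X) ≡ a * (b + c) * X
                l₃ = solve-∀ ℚ-ring

          -- n (1 - p₁)^n is roughly the expected number of isolated vertices of the first portion;
          -- it has to be at most k⁻³, not merely small.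
          isolated-bound : ι (n ℕ.* Q) * B ≤ 1ℚ
          isolated-bound with ℚ.≤-total b (1/suc n′)
          ... | inj₁ h = below h
          ... | inj₂ h = ⊥-elim (impossible h)

      -- At p n = 32 k there is ample room. For t = ⌊n / (8 k)⌋ one has t p₁ ≥ 1 and so (1 - p₁)^t ≤
      -- ½; the 8 k-th power of this beats n k³ ≤ 2^(5k).
      large-bound : X ≡ ι (32 ℕ.* k) → ι (n ℕ.* Q) * B ≤ 1ℚ
      large-bound X≡ = begin
        ι (n ℕ.* Q) * B
          ≤⟨ *-mono (0≤ι (n ℕ.* Q)) (^-nonneg (^-nonneg 0≤1-p₁ t) m) (ι-mono nQ≤) B≤ ⟩
        ι (2 ℕ.^ m) * ((1ℚ - p₁) ^ℚ t) ^ℚ m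
          ≡⟨ trans (cong (_* ((1ℚ - p₁) ^ℚ t) ^ℚ m) (ι-^ 2 m)) (sym (^-*-distrib (ι 2) ((1ℚ - p₁) ^ℚ t) m)) ⟩
        (ι 2 * (1ℚ - p₁) ^ℚ t) ^ℚ m
          ≤⟨ ^-≤1 (0≤* (0≤ι 2) (^-nonneg 0≤1-p₁ t)) half m ⟩
        1ℚ ∎
        where
        open ℚ.≤-Reasoning
        m = 8 ℕ.* k
        instance
          m≢0 : ℕ.NonZero m
          m≢0 = ℕ.>-nonZero (ℕ.*-mono-≤ {1} {8} (ℕ.s≤s ℕ.z≤n) 1≤k)
        t = n / m
        tm≤n : t ℕ.* m ℕ.≤ n
        tm≤n = m/n*n≤m n m
        B≤ : B ≤ ((1ℚ - p₁) ^ℚ t) ^ℚ m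
        B≤ = ≤-respʳ (^-^ (1ℚ - p₁) m t) (^-anti 0≤1-p₁ 1-p₁≤1 (ℕ.≤-trans (ℕ.≤-reflexive (ℕ.*-comm m t)) tm≤n))
        nQ≤ : n ℕ.* Q ℕ.≤ 2 ℕ.^ m
        nQ≤ = ℕ.≤-trans (ℕ.*-mono-≤ (ℕ.<⇒≤ n<2^k) (ℕ.*-mono-≤ (ℕ.*-mono-≤ k≤ k≤) k≤))
          (ℕ.≤-trans (ℕ.≤-reflexive (sym (trans (ℕ.^-distribˡ-+-* 2 (suc k) (k ℕ.+ k ℕ.+ k)) (cong (2 ℕ.^ suc k ℕ.*_) (trans (ℕ.^-distribˡ-+-* 2 (k ℕ.+ k) k) (cong (ℕ._* 2 ℕ.^ k) (ℕ.^-distribˡ-+-* 2 k k)))))))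
            (ℕ.^-monoʳ-≤ 2 (ℕ.≤-trans (ℕ.+-monoˡ-≤ (k ℕ.+ (k ℕ.+ k ℕ.+ k)) 1≤k) (ℕ.≤-trans (ℕ.≤-reflexive (l k)) (ℕ.*-monoˡ-≤ k (ℕ.m≤m+n 5 3))))))
          where
          k≤ = ℕ.<⇒≤ (n<2^n k)
          l : ∀ k → k ℕ.+ (k ℕ.+ (k ℕ.+ k ℕ.+ k)) ≡ 5 ℕ.* k
          l = ℕSolver.solve-∀
        n≤2tm : n ℕ.≤ 2 ℕ.* (t ℕ.* m)
        n≤2tm = ℕ.≤-trans (ℕ.≤-reflexive (m≡m%n+[m/n]*n n m)) (ℕ.≤-trans (ℕ.+-monoˡ-≤ (t ℕ.* m) (ℕ.≤-trans (ℕ.<⇒≤ (m%n<n n m)) m≤tm)) (ℕ.≤-reflexive (cong (t ℕ.* m ℕ.+_) (sym (ℕ.+-identityʳ (t ℕ.* m))))))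
          where
          m≤n : m ℕ.≤ n
          m≤n = ℕ.≤-trans 8k≤2^k 2^k≤n
            where
            8k≤2^k : 8 ℕ.* k ℕ.≤ 2 ℕ.^ k
            8k≤2^k = subst (λ k → 8 ℕ.* k ℕ.≤ 2 ℕ.^ k) (ℕ.m∸n+n≡m {k} {6} (ℕ.≤-trans (ℕ.m≤m+n 6 131066) 131072≤k)) (go (k ℕ.∸ 6))
              where
              go : ∀ i → 8 ℕ.* (i ℕ.+ 6) ℕ.≤ 2 ℕ.^ (i ℕ.+ 6)
              go zero    = ℕ.m≤m+n 48 16
              go (suc i) = ℕ.≤-trans (ℕ.≤-reflexive (ℕ.*-suc 8 (i ℕ.+ 6)))
                (ℕ.+-mono-≤ (ℕ.≤-trans (ℕ.≤-trans (ℕ.m≤m+n 8 40) (ℕ.*-monoʳ-≤ 8 (ℕ.m≤n+m 6 i))) (go i)) (ℕ.≤-trans (go i) (ℕ.≤-reflexive (sym (ℕ.+-identityʳ _)))))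
          m≤tm : m ℕ.≤ t ℕ.* m
          m≤tm = ℕ.≤-trans (ℕ.≤-reflexive (sym (ℕ.*-identityˡ m))) (ℕ.*-monoˡ-≤ m 1≤t)
            where
            1≤t : 1 ℕ.≤ t
            1≤t = ℕ.n≢0⇒n>0 λ t≡0 → ℕ.<⇒≱ (m%n<n n m) (ℕ.≤-trans m≤n (ℕ.≤-reflexive (trans (m≡m%n+[m/n]*n n m) (trans (cong (λ s → n ℕ.% m ℕ.+ s ℕ.* m) t≡0) (ℕ.+-identityʳ _)))))
        tp₁≥1 : 1ℚ ≤ ι t * p₁
        tp₁≥1 = *-cancelˡ (ι (n ℕ.* J)) (0<ι {n ℕ.* J} (ℕ.s≤s ℕ.z≤n)) (begin
          ι (n ℕ.* J) * 1ℚ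
            ≡⟨ ℚ.*-identityʳ (ι (n ℕ.* J)) ⟩
          ι (n ℕ.* J)
            ≤⟨ ι-mono nJ≤ ⟩
          ι (t ℕ.* j ℕ.* (32 ℕ.* k))
            ≡⟨ trans (ι-* (t ℕ.* j) (32 ℕ.* k)) (cong₂ _*_ (ι-* t j) (sym X≡)) ⟩
          ι t * ι j * (p * ι n)
            ≡⟨ l (ι t) (ι j) p (ι n) ⟩
          ι t * ι n * (ι j * p)
            ≡⟨ cong (ι t * ι n *_) (sym Jp₁) ⟩
          ι t * ι n * (ι J * p₁)
            ≡⟨ trans (l′ (ι t) (ι n) (ι J) p₁) (cong (_* (ι t * p₁)) (sym (ι-* n J))) ⟩
          ι (n ℕ.* J) * (ι t * p₁) ∎)
          where
          l : ∀ t j p n → t * j * (p * n) ≡ t * n * (j * p)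
          l = solve-∀ ℚ-ring
          l′ : ∀ t n J p → t * n * (J * p) ≡ n * J * (t * p)
          l′ = solve-∀ ℚ-ring
          nJ≤ : n ℕ.* J ℕ.≤ t ℕ.* j ℕ.* (32 ℕ.* k)
          nJ≤ = ℕ.≤-trans (ℕ.*-mono-≤ n≤2tm J≤2j) (ℕ.≤-reflexive (l₃ t k j))
            where
            J≤2j : J ℕ.≤ 2 ℕ.* j
            J≤2j = ℕ.≤-trans (ℕ.+-monoˡ-≤ j (ℕ.≤-trans (ℕ.m≤m+n 1 6) (ℕ.s≤s⁻¹ 8≤J))) (ℕ.≤-reflexive (cong (j ℕ.+_) (sym (ℕ.+-identityʳ j))))
            l₃ : ∀ t k j → 2 ℕ.* (t ℕ.* (8 ℕ.* k)) ℕ.* (2 ℕ.* j) ≡ t ℕ.* j ℕ.* (32 ℕ.* k)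
            l₃ = ℕSolver.solve-∀
        half : ι 2 * (1ℚ - p₁) ^ℚ t ≤ 1ℚ
        half = ℚ.≤-trans (≤-respˡ (ℚ.*-comm ((1ℚ - p₁) ^ℚ t) (ι 2)) (*-monoˡ (^-nonneg 0≤1-p₁ t) (ℚ.+-monoʳ-≤ 1ℚ tp₁≥1)))
          (^-inverse-bound 0≤p₁ p₁≤1 t)

    -- The choice of Θ requires p n ≤ 32 k. A larger p is lowered to 32 k / n, which can only raise
    -- the failure probability.
    sparse-regime : ∀ (G : Graph n) M → (1ℚ - 1/suc n′) ^ℚ M ≤ 1/suc (4 ℕ.* J) → ∀ {p} → IsProb p →
      ι (J ℕ.+ 8) * logSum (1ℚ - 1/suc n′) M ≤ ι J * (p * ι n + 1ℚ) →
      ι J * 𝔼 p (vertexPairs n) (fails G) ≤ ι 524288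
    sparse-regime G M small {p} pp thr with ℚ.≤-total (p * ι n) (ι (32 ℕ.* k))
    ... | inj₁ h = sparse-case G k j 3≤n 131072≤k JJ≤k (ℕ.≤-trans 32J≤k k≤n) pp (isolated-bound pp M small thr) (k≤8X pp M small thr) h
    ... | inj₂ h = ℚ.≤-trans (*-monoˡ (0≤ι J) (𝔼-anti pp′ pp p′≤p (vertexPairs n) (fails-antitone G)))
      (sparse-case G k j 3≤n 131072≤k JJ≤k (ℕ.≤-trans 32J≤k k≤n) pp′ (large-bound pp′ p′n) k≤8p′n (ℚ.≤-reflexive p′n))
      where
      p′ = ι (32 ℕ.* k) * 1/suc n′
      p′n : p′ * ι n ≡ ι (32 ℕ.* k)
      p′n = trans (ℚ.*-assoc (ι (32 ℕ.* k)) (1/suc n′) (ι n)) (trans (cong (ι (32 ℕ.* k) *_) (trans (ℚ.*-comm (1/suc n′) (ι n)) (suc*1/suc n′))) (ℚ.*-identityʳ (ι (32 ℕ.* k))))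
      p′≤p : p′ ≤ p
      p′≤p = ≤-respʳ (trans (ℚ.*-assoc p (ι n) (1/suc n′)) (trans (cong (p *_) (suc*1/suc n′)) (ℚ.*-identityʳ p))) (*-monoʳ (0≤1/suc n′) h)
      pp′ : IsProb p′
      pp′ = 0≤* (0≤ι (32 ℕ.* k)) (0≤1/suc n′) , ℚ.≤-trans p′≤p (proj₂ pp)
      k≤8p′n : ι k ≤ ι 8 * (p′ * ι n)
      k≤8p′n = ≤-respʳ (trans (ι-* 8 (32 ℕ.* k)) (cong (ι 8 *_) (sym p′n)))
        (ι-mono (ℕ.≤-trans (ℕ.m≤n*m k 256) (ℕ.≤-reflexive (ℕ.*-assoc 8 32 k))))

-- The threshold at a late approximation

module Threshold where
  open import Data.Rational.Base
  open import Tactic.RingSolver using (solve-∀)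
  open Rationals
  open Expectation
  open Boosting using (fails; 0≤fails)
  open DenseCase using (√-floor; m*m≤n⇒m≤n; dense-case)
  open Logarithm
  open SparseRegime using (ι-cancel; sparse-regime)

  lg-exists : ∀ n → ∃[ k ] (1 ℕ.≤ n → 2 ℕ.^ k ℕ.≤ n × n ℕ.< 2 ℕ.^ suc k)
  lg-exists zero = 0 , λ ()
  lg-exists (suc zero) = 0 , λ _ → ℕ.s≤s ℕ.z≤n , ℕ.s≤s (ℕ.s≤s ℕ.z≤n)
  lg-exists (suc n@(suc _)) with lg-exists n
  ... | k , spec with suc n ℕ.<? 2 ℕ.^ suc k
  ...   | yes h = k , λ _ → ℕ.m≤n⇒m≤1+n (proj₁ (spec (ℕ.s≤s ℕ.z≤n))) , h
  ...   | no ¬h = suc k , λ _ → ℕ.≮⇒≥ ¬h ,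
    ℕ.≤-trans (ℕ.s≤s (proj₂ (spec (ℕ.s≤s ℕ.z≤n)))) (ℕ.+-mono-≤ (ℕ.m^n>0 2 (suc k)) (ℕ.m≤m+n (2 ℕ.^ suc k) 0))

  abstract
    lg : ℕ → ℕ
    lg n = proj₁ (lg-exists n)

    lg-lower : ∀ {n} → 1 ℕ.≤ n → 2 ℕ.^ lg n ℕ.≤ n
    lg-lower {n} h = proj₁ (proj₂ (lg-exists n) h)

    lg-upper : ∀ {n} → 1 ℕ.≤ n → n ℕ.< 2 ℕ.^ suc (lg n)
    lg-upper {n} h = proj₂ (proj₂ (lg-exists n) h)

    lg-zero : lg 0 ≡ 0
    lg-zero = refl

  ≤-lg : ∀ {m n} → 2 ℕ.^ m ℕ.≤ n → m ℕ.≤ lg n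
  ≤-lg {m} {n} h = ℕ.≮⇒≥ λ lt → ℕ.<⇒≱ (lg-upper (ℕ.≤-trans (ℕ.m^n>0 2 m) h)) (ℕ.≤-trans (ℕ.^-monoʳ-≤ 2 lt) h)

  lglg : ℕ → ℕ
  lglg n = lg (lg n)

  abstract
    tower : ℕ → ℕ
    tower m = 2 ℕ.^ (2 ℕ.^ m)

    tower-lglg : ∀ {m n} → tower m ℕ.≤ n → m ℕ.≤ lglg n
    tower-lglg h = ≤-lg (≤-lg h)

    1≤tower : ∀ m → 1 ℕ.≤ tower m
    1≤tower m = ℕ.m^n>0 2 (2 ℕ.^ m)

  4JJ≤2^j : ∀ j → 17 ℕ.≤ j → 4 ℕ.* (suc j ℕ.* suc j) ℕ.≤ 2 ℕ.^ j
  4JJ≤2^j j h = subst (λ j → 4 ℕ.* (suc j ℕ.* suc j) ℕ.≤ 2 ℕ.^ j) (ℕ.m∸n+n≡m h) (go (j ℕ.∸ 17))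
    where
    expand : ∀ i → 4 ℕ.* (suc (suc i ℕ.+ 17) ℕ.* suc (suc i ℕ.+ 17)) ℕ.+ (4 ℕ.* (i ℕ.* i) ℕ.+ 136 ℕ.* i ℕ.+ 1148) ≡ 2 ℕ.* (4 ℕ.* (suc (i ℕ.+ 17) ℕ.* suc (i ℕ.+ 17)))
    expand = ℕSolver.solve-∀
    go : ∀ i → 4 ℕ.* (suc (i ℕ.+ 17) ℕ.* suc (i ℕ.+ 17)) ℕ.≤ 2 ℕ.^ (i ℕ.+ 17)
    go zero    = ℕ.m≤m+n 1296 129776
    go (suc i) = ℕ.≤-trans (ℕ.m≤m+n _ (4 ℕ.* (i ℕ.* i) ℕ.+ 136 ℕ.* i ℕ.+ 1148)) (ℕ.≤-trans (ℕ.≤-reflexive (expand i)) (ℕ.*-monoʳ-≤ 2 (go i)))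

  private
    largest-≥ : {P : Pred ℕ 0ℓ} (P? : Decidable P) → ∀ b j → j ℕ.≤ b → P j → j ℕ.≤ largest P? b
    largest-≥ P? zero    j j≤b pj = j≤b
    largest-≥ P? (suc b) j j≤b pj with P? (suc b)
    ... | yes _ = j≤b
    ... | no ¬p with ℕ.m≤n⇒m<n∨m≡n j≤b
    ...   | inj₁ j<b  = largest-≥ P? b j (ℕ.s≤s⁻¹ j<b) pj
    ...   | inj₂ refl = contradiction pj ¬p

    ≤numerator : ∀ q → q ≤ ι ℤ.∣ ℚ.numerator q ∣
    ≤numerator q@(mkℚ n d _) = ℚ.≤-trans q≤∣q∣ (*≤* (ℤ.*-monoˡ-≤-nonNeg (ℤ.+ ℤ.∣ n ∣) (ℤ.+≤+ (ℕ.s≤s ℕ.z≤n))))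
      where
      q≤∣q∣ : q ≤ ∣ q ∣
      q≤∣q∣ with ℚ.≤-total 0ℚ q
      ... | inj₁ 0≤q = ℚ.≤-reflexive (sym (ℚ.0≤p⇒∣p∣≡p 0≤q))
      ... | inj₂ q≤0 = ℚ.≤-trans q≤0 (ℚ.0≤∣p∣ q)

  -- An integer w is a point of every grid, so rounding the root down to the grid cannot pass below
  -- w.
  sqrtGrid-≥ : ∀ x m w → ι w * ι w ≤ x → ι w ≤ sqrtGrid x m
  sqrtGrid-≥ x m w h = ≤-respˡ at-w (*-monoʳ (0≤1/suc m) (ι-mono
    (largest-≥ {SquareBelow x m} (squareBelow? x m) (suc a ℕ.* suc m) (w ℕ.* suc m) (ℕ.*-monoˡ-≤ (suc m) (ℕ.m≤n⇒m≤1+n w≤a))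
      (≤-respˡ (cong₂ _*_ (sym at-w) (sym at-w)) (ℚ.≤-trans h (ℚ.p≤p⊔q x 0ℚ))))))
    where
    a = ℤ.∣ ℚ.numerator x ∣
    w≤a : w ℕ.≤ a
    w≤a = m*m≤n⇒m≤n w (ι-cancel (≤-respˡ (sym (ι-* w w)) (ℚ.≤-trans h (≤numerator x))))
    at-w : grid m (w ℕ.* suc m) ≡ ι w
    at-w = trans (cong (_* 1/suc m) (ι-* w (suc m))) (trans (ℚ.*-assoc (ι w) (ι (suc m)) (1/suc m))
      (trans (cong (ι w *_) (suc*1/suc m)) (ℚ.*-identityʳ (ι w))))

  abstract
    -- Common to both terms: the constant of `sparse-case`, which exceeds the 2 · 192 arising from
    -- `dense-case`.
    failureBound : ℕ
    failureBound = 524288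

    failureBound≡ : failureBound ≡ 524288
    failureBound≡ = refl

  δᵣ : ℕ → ℚ
  δᵣ n = ι 8 * 1/suc (lglg n)

  -- 2^17 = 131072 is the size demanded of k in the sparse case.
  module _ (n′ : ℕ) (17≤j : 17 ℕ.≤ lglg (suc n′)) where

    private
      n k j J : ℕ
      n = suc n′
      k = lg n
      j = lglg n
      J = suc j
      1≤n : 1 ℕ.≤ n
      1≤n = ℕ.s≤s ℕ.z≤n

      1≤k : 1 ℕ.≤ k
      1≤k = ℕ.n≢0⇒n>0 λ k≡0 → contradiction 17≤j (subst (λ k → ¬ (17 ℕ.≤ lg k)) (sym k≡0) (subst (λ j → ¬ (17 ℕ.≤ j)) (sym lg-zero) λ ()))
      2^j≤k : 2 ℕ.^ j ℕ.≤ k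
      2^j≤k = lg-lower 1≤k
      4JJ≤k : 4 ℕ.* (J ℕ.* J) ℕ.≤ k
      4JJ≤k = ℕ.≤-trans (4JJ≤2^j j 17≤j) 2^j≤k
      131072≤k : 131072 ℕ.≤ k
      131072≤k = ℕ.≤-trans (ℕ.^-monoʳ-≤ 2 17≤j) 2^j≤k
      8≤J : 8 ℕ.≤ J
      8≤J = ℕ.m≤n⇒m≤1+n (ℕ.≤-trans (ℕ.m≤m+n 8 9) 17≤j)
      131072≤n : 131072 ℕ.≤ n
      131072≤n = ℕ.≤-trans (ℕ.^-monoʳ-≤ 2 (ℕ.≤-trans (ℕ.m≤m+n 17 131055) 131072≤k)) (lg-lower 1≤n)

      ℓ : ℕ → ℚ
      ℓ = logSum (1ℚ - 1/suc n′)

    module _ (G : Graph n) (i : ℕ) (late : n ℕ.* (4 ℕ.* J) ℕ.≤ i) {p : ℚ} (pp : IsProb p) where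

      private
        F = 𝔼 p (vertexPairs n) (fails G)
        small : (1ℚ - 1/suc n′) ^ℚ i ≤ 1/suc (4 ℕ.* J)
        small = power-small n′ (4 ℕ.* J) i late

      first-term : (1ℚ + δᵣ n) * ℓ i * 1/suc n′ ≤ p + 1/suc n′ → ι J * F ≤ ι failureBound
      first-term h = ≤-respʳ (cong ι (sym failureBound≡)) (sparse-regime n′ k j (lg-lower 1≤n) (lg-upper 1≤n) (lg-upper 1≤k) 4JJ≤k 131072≤k 8≤J G i small pp (begin
        ι (J ℕ.+ 8) * ℓ i
          ≡⟨ sym eq ⟩
        ι J * (ι n * ((1ℚ + δᵣ n) * ℓ i * 1/suc n′))
          ≤⟨ *-monoˡ (0≤ι J) (*-monoˡ (0≤ι n) h) ⟩
        ι J * (ι n * (p + 1/suc n′))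
          ≡⟨ cong (ι J *_) (trans (ℚ.*-distribˡ-+ (ι n) p (1/suc n′)) (cong₂ _+_ (ℚ.*-comm (ι n) p) (suc*1/suc n′))) ⟩
        ι J * (p * ι n + 1ℚ) ∎))
        where
        open ℚ.≤-Reasoning
        l : ∀ J n e d L m → J * (n * ((1ℚ + e * d) * L * m)) ≡ (J + e * (J * d)) * L * (n * m)
        l = solve-∀ ℚ-ring
        eq : ι J * (ι n * ((1ℚ + δᵣ n) * ℓ i * 1/suc n′)) ≡ ι (J ℕ.+ 8) * ℓ i
        eq = trans (l (ι J) (ι n) (ι 8) (1/suc j) (ℓ i) (1/suc n′))
          (trans (cong₂ (λ a b → (ι J + ι 8 * a) * ℓ i * b) (suc*1/suc j) (suc*1/suc n′))
            (trans (ℚ.*-identityʳ ((ι J + ι 8 * 1ℚ) * ℓ i)) (cong (_* ℓ i) (trans (cong (ι J +_) (ℚ.*-identityʳ (ι 8))) (sym (ι-+ J 8))))))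

      -- The integer w = j n ⌊√n⌋ satisfies w² ≤ n³ J² ≤ n³ log n at this approximation, so it is at
      -- most the computed root. The tolerance then gives w ≤ p r³ + ½, and w ≥ 1 turns this into w
      -- ≤ 2 p r³.
      second-term : ∀ r → IsRegular G r → 1 ℕ.≤ r → ∀ R → r ℕ.^ 3 ≡ suc R →
        1ℚ * sqrtGrid (ι (n ℕ.^ 3) * ℓ i) i * 1/suc R ≤ p + ½ * 1/suc R → ι J * F ≤ ι failureBound
      second-term r regular 1≤r R r³ h = begin
        ι J * F
          ≤⟨ *-monoʳ 0≤F (ι-mono J≤2j) ⟩
        ι (2 ℕ.* j) * F
          ≡⟨ trans (cong (_* F) (ι-* 2 j)) (ℚ.*-assoc (ι 2) (ι j) F) ⟩
        ι 2 * (ι j * F)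
          ≤⟨ *-monoˡ (0≤ι 2) (dense-case G r regular 3≤n 1≤r j hh n<h² pp w≤2pr³) ⟩
        ι 384
          ≤⟨ ι-mono (ℕ.≤-trans (ℕ.m≤m+n 384 523904) (ℕ.≤-reflexive (sym failureBound≡))) ⟩
        ι failureBound ∎
        where
        open ℚ.≤-Reasoning
        0≤F = 𝔼-nonneg pp (vertexPairs n) (0≤fails G)
        3≤n : 3 ℕ.≤ n
        3≤n = ℕ.≤-trans (ℕ.m≤m+n 3 131069) 131072≤n
        1≤j : 1 ℕ.≤ j
        1≤j = ℕ.≤-trans (ℕ.m≤m+n 1 16) 17≤j
        J≤2j : J ℕ.≤ 2 ℕ.* j
        J≤2j = ℕ.≤-trans (ℕ.+-monoˡ-≤ j 1≤j) (ℕ.≤-reflexive (cong (j ℕ.+_) (sym (ℕ.+-identityʳ j))))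
        hh = proj₁ (√-floor n)
        h²≤n = proj₁ (proj₂ (√-floor n))
        n<h² = proj₂ (proj₂ (√-floor n))
        1≤h : 1 ℕ.≤ hh
        1≤h = ℕ.n≢0⇒n>0 λ e → contradiction (subst (λ q → n ℕ.< suc q ℕ.* suc q) e n<h²) λ { (ℕ.s≤s ()) }
        w = j ℕ.* n ℕ.* hh
        1≤w : 1 ℕ.≤ w
        1≤w = ℕ.*-mono-≤ (ℕ.*-mono-≤ 1≤j 1≤n) 1≤h
        JJ≤ℓ : ι (J ℕ.* J) ≤ ℓ i
        JJ≤ℓ = *-cancelˡ (ι 4) (0<ι (ℕ.s≤s ℕ.z≤n)) (ℚ.≤-trans (≤-respˡ (ι-* 4 (J ℕ.* J)) (ι-mono 4JJ≤k))
          (log-lower n′ k (lg-lower 1≤n) i (ℚ.≤-trans small (*-cancelˡ (ι (suc (4 ℕ.* J))) (0<ι (ℕ.s≤s ℕ.z≤n))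
            (≤-respˡ (sym (suc*1/suc (4 ℕ.* J))) (*-monoʳ {½} (ℚ.nonNegative⁻¹ ½) (ι-mono {2} (ℕ.s≤s (ℕ.≤-trans (ℕ.s≤s ℕ.z≤n) (ℕ.m≤n*m J 4))))))))))
        square : ι w * ι w ≤ ι (n ℕ.^ 3) * ℓ i
        square = begin
          ι w * ι w                          ≡⟨ trans (sym (ι-* w w)) (cong ι (e₁ j n hh)) ⟩
          ι (n ℕ.* n ℕ.* (hh ℕ.* hh) ℕ.* (j ℕ.* j))  ≤⟨ ι-mono (ℕ.*-mono-≤ (ℕ.*-monoʳ-≤ (n ℕ.* n) h²≤n) (ℕ.*-mono-≤ (ℕ.n≤1+n j) (ℕ.n≤1+n j))) ⟩
          ι (n ℕ.* n ℕ.* n ℕ.* (J ℕ.* J))      ≡⟨ trans (ι-* (n ℕ.* n ℕ.* n) (J ℕ.* J)) (cong (λ m → ι m * ι (J ℕ.* J)) (e₂ n)) ⟩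
          ι (n ℕ.^ 3) * ι (J ℕ.* J)          ≤⟨ *-monoˡ (0≤ι (n ℕ.^ 3)) JJ≤ℓ ⟩
          ι (n ℕ.^ 3) * ℓ i                    ∎
          where
          e₁ : ∀ j n h → j ℕ.* n ℕ.* h ℕ.* (j ℕ.* n ℕ.* h) ≡ n ℕ.* n ℕ.* (h ℕ.* h) ℕ.* (j ℕ.* j)
          e₁ = ℕSolver.solve-∀
          e₂ : ∀ n → n ℕ.* n ℕ.* n ≡ n ℕ.* (n ℕ.* (n ℕ.* 1))
          e₂ = ℕSolver.solve-∀
        Rᵣ = ι (suc R)
        s = sqrtGrid (ι (n ℕ.^ 3) * ℓ i) i
        w≤ : ι w ≤ p * Rᵣ + ½
        w≤ = begin
          ι w                        ≤⟨ sqrtGrid-≥ (ι (n ℕ.^ 3) * ℓ i) i w square ⟩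
          s                            ≡⟨ sym (trans (l s Rᵣ (1/suc R)) (trans (cong (s *_) (suc*1/suc R)) (ℚ.*-identityʳ s))) ⟩
          Rᵣ * (1ℚ * s * 1/suc R)      ≤⟨ *-monoˡ (0≤ι (suc R)) h ⟩
          Rᵣ * (p + ½ * 1/suc R)       ≡⟨ trans (l′ Rᵣ p ½ (1/suc R)) (cong (p * Rᵣ +_) (trans (cong (½ *_) (suc*1/suc R)) (ℚ.*-identityʳ ½))) ⟩
          p * Rᵣ + ½                   ∎
          where
          l : ∀ s a b → a * (1ℚ * s * b) ≡ s * (a * b)
          l = solve-∀ ℚ-ring
          l′ : ∀ a p h b → a * (p + h * b) ≡ p * a + h * (a * b)
          l′ = solve-∀ ℚ-ring
        w≤2pr³ : ι w ≤ ι 2 * (p * ι (r ℕ.^ 3))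
        w≤2pr³ = subst (λ m → ι w ≤ ι 2 * (p * ι m)) (sym r³) (+-cancelʳ (ι w) (begin
          ι w + ι w                ≤⟨ ℚ.+-mono-≤ w≤ w≤ ⟩
          p * Rᵣ + ½ + (p * Rᵣ + ½)    ≡⟨ l (p * Rᵣ) ½ ⟩
          ι 2 * (p * Rᵣ) + 1ℚ        ≤⟨ ℚ.+-monoʳ-≤ (ι 2 * (p * Rᵣ)) (ι-mono 1≤w) ⟩
          ι 2 * (p * Rᵣ) + ι w     ∎))
          where
          l : ∀ a h → a + h + (a + h) ≡ (1ℚ + 1ℚ) * a + (h + h)
          l = solve-∀ ℚ-ring

    -- An inequality between reals controls approximations only up to a positive error, and clamping
    -- shifts p as well. The error τ is small enough for both terms: it adds at most 1 to p n and at
    -- most ½ to p r³.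
    tolerance : ∀ r (G : Graph n) → IsRegular G r → ∃[ τ ] (0ℚ < τ × (∀ i → n ℕ.* (4 ℕ.* J) ℕ.≤ i → ∀ {p} → IsProb p →
      approx (threshold ℝ.1ℝ (ℝ.fromℚ (δᵣ n)) n r) i ≤ p + τ → ι J * 𝔼 p (vertexPairs n) (fails G) ≤ ι failureBound))
    tolerance zero G regular = 1/suc n′ , 0<1/suc n′ , λ i late pp h → first-term G i late pp h
    tolerance r@(suc r′) G regular = positive-power (r ℕ.^ 3) (ℕ.m^n>0 r 3) λ R r³ →
      1/suc n′ ⊓ (½ * 1/suc R) , 0<⊓ (0<1/suc n′) (0<* (ℚ.positive⁻¹ ½) (0<1/suc R)) , λ i late {p} pp h →
      ⊓-either (approx A i) (approx (root ℝ.÷ (r ℕ.^ 3)) i) h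
        (λ h₁ → first-term G i late pp (ℚ.≤-trans h₁ (ℚ.+-monoʳ-≤ p (ℚ.p⊓q≤p (1/suc n′) (½ * 1/suc R)))))
        (λ h₂ → second-term G i late pp r regular (ℕ.s≤s ℕ.z≤n) R r³
          (≤-respˡ (cong (λ m → approx (root ℝ.÷ m) i) r³) (ℚ.≤-trans h₂ (ℚ.+-monoʳ-≤ p (ℚ.p⊓q≤q (1/suc n′) (½ * 1/suc R))))))
      where
      A root : ℝ
      A = ((ℝ.1ℝ ℝ.+ ℝ.fromℚ (δᵣ n)) ℝ.* log n) ℝ.÷ n
      root = ℝ.1ℝ ℝ.* √ (ℝ.fromℕ (n ℕ.^ 3) ℝ.* log n)
      positive-power : ∀ {B : Set} m → 1 ℕ.≤ m → (∀ R → m ≡ suc R → B) → B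
      positive-power (suc R) _ f = f R refl
      0<⊓ : ∀ {x y} → 0ℚ < x → 0ℚ < y → 0ℚ < x ⊓ y
      0<⊓ {x} {y} 0<x 0<y with ℚ.⊓-sel x y
      ... | inj₁ e = subst (0ℚ <_) (sym e) 0<x
      ... | inj₂ e = subst (0ℚ <_) (sym e) 0<y
      ⊓-either : ∀ {B : Set} x y {z} → x ⊓ y ≤ z → (x ≤ z → B) → (y ≤ z → B) → B
      ⊓-either x y h f g with ℚ.⊓-sel x y
      ... | inj₁ e = f (≤-respˡ e h)
      ... | inj₂ e = g (≤-respˡ e h)

  tolerance-at : ∀ n → 1 ℕ.≤ n → 17 ℕ.≤ lglg n → ∀ r (G : Graph n) → IsRegular G r →
    ∃[ τ ] (0ℚ < τ × (∀ i → n ℕ.* (4 ℕ.* suc (lglg n)) ℕ.≤ i → ∀ {p} → IsProb p →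
      approx (threshold ℝ.1ℝ (ℝ.fromℚ (δᵣ n)) n r) i ≤ p + τ → ι (suc (lglg n)) * 𝔼 p (vertexPairs n) (fails G) ≤ ι failureBound))
  tolerance-at (suc n′) _ = tolerance n′

-- Passage from rational densities to the real probability

module Convergence where
  open import Data.Rational.Base
  open import Tactic.RingSolver using (solve-∀)
  open Rationals
  open Expectation
  open Boosting using (fails; fails-complement)
  open Threshold

  private
    2*½ : ∀ ε → ½ * ε + ½ * ε ≡ ε
    2*½ ε = trans (sym (ℚ.*-distribʳ-+ ε ½ ½)) (ℚ.*-identityˡ ε)

    0<½* : ∀ {ε} → 0ℚ < ε → 0ℚ < ½ * ε
    0<½* = 0<* (ℚ.positive⁻¹ ½)

    ≤∣-∣ : ∀ x y {ε} → ∣ x - y ∣ ≤ ε → x ≤ y + ε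
    ≤∣-∣ x y {ε} h with ℚ.≤-total 0ℚ (x - y)
    ... | inj₁ 0≤d = ≤-from (ε - (x - y)) (0≤⇒- (ℚ.≤-trans (ℚ.≤-reflexive (sym (ℚ.0≤p⇒∣p∣≡p 0≤d))) h)) (l x y ε)
      where
      l : ∀ x y e → x + (e - (x - y)) ≡ y + e
      l = solve-∀ ℚ-ring
    ... | inj₂ d≤0 = ℚ.≤-trans (-⇒≤ {x} {y} (≤-respʳ (l x y) (ℚ.neg-antimono-≤ d≤0))) (≤+ (ℚ.≤-trans (ℚ.0≤∣p∣ (x - y)) h))
      where
      l : ∀ x y → - (x - y) ≡ y - x
      l = solve-∀ ℚ-ring

    ∣-∣≤ : ∀ x y {ε} → x ≤ y + ε → y ≤ x + ε → ∣ x - y ∣ ≤ ε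
    ∣-∣≤ x y {ε} h k with ℚ.∣p∣≡p∨∣p∣≡-p (x - y)
    ... | inj₁ e = ≤-respˡ (sym e) (-⇒≤ (≤-respʳ (l x y ε) (0≤⇒- h)))
      where
      l : ∀ x y e → y + e - x ≡ e - (x - y)
      l = solve-∀ ℚ-ring
    ... | inj₂ e = ≤-respˡ (sym e) (-⇒≤ (≤-respʳ (l x y ε) (0≤⇒- k)))
      where
      l : ∀ x y e → x + e - y ≡ e - (- (x - y))
      l = solve-∀ ℚ-ring

    ∣-∣-sym : ∀ x y {ε} → ∣ x - y ∣ ≤ ε → ∣ y - x ∣ ≤ ε
    ∣-∣-sym x y {ε} h = ≤-respˡ (trans (sym (ℚ.∣-p∣≡∣p∣ (x - y))) (cong ∣_∣ (l x y))) h
      where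
      l : ∀ x y → - (x - y) ≡ y - x
      l = solve-∀ ℚ-ring

    ∣-∣-trans : ∀ x y z {ε ε′} → ∣ x - y ∣ ≤ ε → ∣ y - z ∣ ≤ ε′ → ∣ x - z ∣ ≤ ε + ε′
    ∣-∣-trans x y z h k = ≤-respˡ (cong ∣_∣ (l x y z)) (ℚ.≤-trans (ℚ.∣p+q∣≤∣p∣+∣q∣ (x - y) (y - z)) (ℚ.+-mono-≤ h k))
      where
      l : ∀ x y z → x - y + (y - z) ≡ x - z
      l = solve-∀ ℚ-ring

    ∣-∣-refl : ∀ x {ε} → 0ℚ ≤ ε → ∣ x - x ∣ ≤ ε
    ∣-∣-refl x 0≤ε = ∣-∣≤ x x (≤+ 0≤ε) (≤+ 0≤ε)

    -- The approximations of a real in [0, 1] may leave the interval, whereas the estimates require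
    -- a genuine probability.
    clamp : ℚ → ℚ
    clamp q = 0ℚ ⊔ (q ⊓ 1ℚ)

    clamp-prob : ∀ q → IsProb (clamp q)
    clamp-prob q = ℚ.p≤p⊔q 0ℚ (q ⊓ 1ℚ) , ℚ.⊔-lub 0≤1 (ℚ.p⊓q≤q q 1ℚ)

    clamp-near : ∀ q {ε} → 0ℚ ≤ ε → 0ℚ ≤ q + ε → q ≤ 1ℚ + ε → ∣ clamp q - q ∣ ≤ ε
    clamp-near q {ε} 0≤ε lo hi = ∣-∣≤ (clamp q) q
      (ℚ.⊔-lub lo (ℚ.≤-trans (ℚ.p⊓q≤p q 1ℚ) (≤+ 0≤ε)))
      (ℚ.≤-trans below (ℚ.+-monoˡ-≤ ε (ℚ.p≤q⊔p 0ℚ (q ⊓ 1ℚ))))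
      where
      below : q ≤ (q ⊓ 1ℚ) + ε
      below with ℚ.⊓-sel q 1ℚ
      ... | inj₁ e = ≤-respʳ (cong (_+ ε) (sym e)) (≤+ 0≤ε)
      ... | inj₂ e = ≤-respʳ (cong (_+ ε) (sym e)) hi

    even : ℕ → Bool
    even zero    = true
    even (suc n) = not (even n)

    even-double : ∀ n → even (n ℕ.+ n) ≡ true
    even-double zero    = refl
    even-double (suc n) = trans (cong (λ m → not (even m)) (ℕ.+-suc n n)) (lemma (even (n ℕ.+ n)) (even-double n))
      where
      lemma : ∀ b → b ≡ true → not (not b) ≡ true
      lemma true _ = refl

  -- A real number alternating between approximations of x and y turns the Cauchy property of
  -- the polynomial `probability` into its continuity.
  alternate : (x : ℝ) (y : ℕ → ℚ) → (∀ ε → 0ℚ < ε → ∃[ N ] (∀ n → N ℕ.≤ n → ∣ y n - approx x n ∣ ≤ ε)) → ℝ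
  alternate x y near = mkℝ z z-cauchy
    where
    z : ℕ → ℚ
    z n = if even n then approx x n else y n
    z-near : ∀ {ε} → 0ℚ ≤ ε → ∀ n → ∣ y n - approx x n ∣ ≤ ε → ∣ z n - approx x n ∣ ≤ ε
    z-near 0≤ε n h with even n
    ... | true  = ∣-∣-refl (approx x n) 0≤ε
    ... | false = h
    z-cauchy : IsCauchy z
    z-cauchy ε 0<ε =
      let h = ½ * ε
          0<h = 0<½* 0<ε
          (N₁ , c) = cauchy x h 0<h
          (N₂ , d) = near (½ * h) (0<½* 0<h) in
      N₁ ℕ.⊔ N₂ , λ m n a b →
        ≤-respʳ (sum ε)
          (∣-∣-trans (z m) (approx x m) (z n)
            (z-near (ℚ.<⇒≤ (0<½* 0<h)) m (d m (ℕ.m⊔n≤o⇒n≤o N₁ N₂ a)))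
            (∣-∣-trans (approx x m) (approx x n) (z n) (c m n (ℕ.m⊔n≤o⇒m≤o N₁ N₂ a) (ℕ.m⊔n≤o⇒m≤o N₁ N₂ b))
              (∣-∣-sym (z n) (approx x n) (z-near (ℚ.<⇒≤ (0<½* 0<h)) n (d n (ℕ.m⊔n≤o⇒n≤o N₁ N₂ b))))))
      where
      l : ∀ a b → a + (b + a) ≡ a + a + b
      l = solve-∀ ℚ-ring
      sum : ∀ ε → ½ * (½ * ε) + (½ * ε + ½ * (½ * ε)) ≡ ε
      sum ε = trans (l (½ * (½ * ε)) (½ * ε)) (trans (cong (_+ ½ * ε) (2*½ (½ * ε))) (2*½ ε))

  module _ (p : ℝ) (0≤p : ℝ.0ℝ ℝ.≤ p) (p≤1 : p ℝ.≤ ℝ.1ℝ) where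

    clamped : ℕ → ℚ
    clamped i = clamp (approx p i)

    near : ∀ ε → 0ℚ < ε → ∃[ N ] (∀ i → N ℕ.≤ i → ∣ clamped i - approx p i ∣ ≤ ε)
    near ε 0<ε = let (N₁ , lo) = 0≤p ε 0<ε ; (N₂ , hi) = p≤1 ε 0<ε in
      N₁ ℕ.⊔ N₂ , λ i h → clamp-near (approx p i) (ℚ.<⇒≤ 0<ε) (lo i (ℕ.m⊔n≤o⇒m≤o N₁ N₂ h)) (hi i (ℕ.m⊔n≤o⇒n≤o N₁ N₂ h))

    -- The alternating real agrees with p at the even index e and with the clamped approximation at
    -- e + 1. Its probability is one Cauchy sequence, so the two values are close, and `likely`
    -- passes from the clamped density to p.
    probability→1 : ∀ {n} {P : Pred (Graph n) 0ℓ} (P? : Decidable P) {ε} (I : ℕ) →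
      (∀ i → I ℕ.≤ i → 1ℚ ≤ 𝔼 (clamped i) (vertexPairs n) (λ E → ⟦ does (P? (fromEdges E)) ⟧) + ε) →
      ∀ ε′ → 0ℚ < ε′ → ∃[ N ] (∀ m → N ℕ.≤ m → ∣ approx (probability p P?) m - 1ℚ ∣ ≤ ε + ε′)
    probability→1 {n} P? {ε} I likely ε′ 0<ε′ = N₂ , λ m h →
      ≤-respʳ (sum ε ε′)
        (∣-∣-trans (Pr p m) (Pr p e) 1ℚ (c₂ m e h N₂≤e)
          (∣-∣-trans (Pr p e) (Pr q (suc e)) 1ℚ
            (≤-respˡ (cong (λ t → ∣ t - Pr q (suc e) ∣) at-e) (c₁ e (suc e) N₁≤e (ℕ.m≤n⇒m≤1+n N₁≤e)))
            (≤-respˡ (cong (λ t → ∣ t - 1ℚ ∣) (sym at-1+e)) (∣-∣≤ X 1ℚ (ℚ.≤-trans X≤1 (≤+ 0≤ε)) (likely (suc e) I≤1+e)))))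
      where
      holds : List (Fin n × Fin n) → ℚ
      holds E = ⟦ does (P? (fromEdges E)) ⟧
      Pr : ℝ → ℕ → ℚ
      Pr p = approx (probability p P?)
      q = alternate p clamped near
      N₁ = proj₁ (cauchy (probability q P?) (½ * ε′) (0<½* 0<ε′))
      c₁ = proj₂ (cauchy (probability q P?) (½ * ε′) (0<½* 0<ε′))
      N₂ = proj₁ (cauchy (probability p P?) (½ * ε′) (0<½* 0<ε′))
      c₂ = proj₂ (cauchy (probability p P?) (½ * ε′) (0<½* 0<ε′))
      M = N₁ ℕ.⊔ N₂ ℕ.⊔ I
      e = M ℕ.+ M
      M≤e : M ℕ.≤ e
      M≤e = ℕ.m≤m+n M M
      N₁≤e : N₁ ℕ.≤ e
      N₁≤e = ℕ.≤-trans (ℕ.m≤m⊔n N₁ N₂) (ℕ.≤-trans (ℕ.m≤m⊔n (N₁ ℕ.⊔ N₂) I) M≤e)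
      N₂≤e : N₂ ℕ.≤ e
      N₂≤e = ℕ.≤-trans (ℕ.m≤n⊔m N₁ N₂) (ℕ.≤-trans (ℕ.m≤m⊔n (N₁ ℕ.⊔ N₂) I) M≤e)
      I≤1+e : I ℕ.≤ suc e
      I≤1+e = ℕ.m≤n⇒m≤1+n (ℕ.≤-trans (ℕ.m≤n⊔m (N₁ ℕ.⊔ N₂) I) M≤e)
      at-even : ∀ i → even i ≡ true → approx q i ≡ approx p i
      at-even i h = cong (λ b → if b then approx p i else clamped i) h
      at-odd : ∀ i → even i ≡ false → approx q i ≡ clamped i
      at-odd i h = cong (λ b → if b then approx p i else clamped i) h
      X = 𝔼 (clamped (suc e)) (vertexPairs n) holds
      at-e : Pr q e ≡ Pr p e
      at-e = trans (approx-probability q P? e) (trans (cong (λ t → 𝔼 t (vertexPairs n) holds) (at-even e (even-double M))) (sym (approx-probability p P? e)))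
      at-1+e : Pr q (suc e) ≡ X
      at-1+e = trans (approx-probability q P? (suc e)) (cong (λ t → 𝔼 t (vertexPairs n) holds) (at-odd (suc e) (cong not (even-double M))))
      X≤1 : X ≤ 1ℚ
      X≤1 = 𝔼-≤ (clamp-prob (approx p (suc e))) (vertexPairs n) λ E → ⟦⟧≤1 (does (P? (fromEdges E)))
      0≤ε : 0ℚ ≤ ε
      0≤ε = +-cancelʳ X (≤-respˡ (sym (ℚ.+-identityˡ X)) (ℚ.≤-trans X≤1 (≤-respʳ (ℚ.+-comm X ε) (likely (suc e) I≤1+e))))
      l : ∀ a e → a + (a + e) ≡ e + (a + a)
      l = solve-∀ ℚ-ring
      sum : ∀ ε ε′ → ½ * ε′ + (½ * ε′ + ε) ≡ ε + ε′
      sum ε ε′ = trans (l (½ * ε′) ε) (cong (ε +_) (2*½ ε′))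

  private
    reciprocal-≤ : ∀ c K j → c ℕ.* suc K ℕ.≤ suc j → ι c * 1/suc j ≤ 1/suc K
    reciprocal-≤ c K j h = *-cancelˡ (ι (suc j)) (0<ι (ℕ.s≤s ℕ.z≤n)) (begin
      ι (suc j) * (ι c * 1/suc j)
        ≡⟨ trans (l (ι (suc j)) (ι c) (1/suc j)) (trans (cong (ι c *_) (suc*1/suc j)) (ℚ.*-identityʳ (ι c))) ⟩
      ι c
        ≡⟨ sym (trans (ℚ.*-assoc (ι c) (ι (suc K)) (1/suc K)) (trans (cong (ι c *_) (suc*1/suc K)) (ℚ.*-identityʳ (ι c)))) ⟩
      ι c * ι (suc K) * 1/suc K
        ≤⟨ *-monoʳ (0≤1/suc K) (≤-respˡ (ι-* c (suc K)) (ι-mono h)) ⟩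
      ι (suc j) * 1/suc K ∎)
      where
      open ℚ.≤-Reasoning
      l : ∀ a b c → a * (b * c) ≡ b * (a * c)
      l = solve-∀ ℚ-ring

  δ : ℕ → ℝ
  δ n = ℝ.fromℚ (δᵣ n)

  δ→0 : IsLittleO1 δ
  δ→0 ε (ε₀ , 0<ε₀ , N₀ , ε₀≤) = tower (8 ℕ.* suc K) , λ n _ h ε′ 0<ε′ → N₀ , λ m N₀≤m → begin
    ∣ δᵣ n - 0ℚ ∣
      ≡⟨ trans (cong ∣_∣ (ℚ.+-identityʳ (δᵣ n))) (ℚ.0≤p⇒∣p∣≡p (0≤* (0≤ι 8) (0≤1/suc (lglg n)))) ⟩
    δᵣ n
      ≤⟨ reciprocal-≤ 8 K (lglg n) (ℕ.m≤n⇒m≤1+n (tower-lglg h)) ⟩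
    1/suc K
      ≤⟨ ℚ.≤-trans K≤ (≤-respˡ (ℚ.+-identityˡ ε₀) (ε₀≤ m N₀≤m)) ⟩
    approx ε m
      ≤⟨ ≤+ (ℚ.<⇒≤ 0<ε′) ⟩
    approx ε m + ε′ ∎
    where
    open ℚ.≤-Reasoning
    K = proj₁ (archimedean ε₀ 0<ε₀)
    K≤ = proj₂ (archimedean ε₀ 0<ε₀)

  tends : (S : Pred ℕ 0ℓ) (r : ℕ → ℕ) (G : ∀ n → S n → Graph n) (p : ℕ → ℝ) →
    (∀ n (s : S n) → IsRegular (G n s) (r n)) →
    (∀ n → S n → ℝ.0ℝ ℝ.≤ p n × p n ℝ.≤ ℝ.1ℝ) →
    (∀ n → S n → threshold ℝ.1ℝ (δ n) n (r n) ℝ.≤ p n) →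
    TendsToAlong S (λ n s → probability (p n) (λ R → hamiltonian? (G n s ∪ R))) ℝ.1ℝ
  tends S r G p regular bounds above ε (ε₀ , 0<ε₀ , N₀ , ε₀≤) = tower m₀ , at
    where
    K = proj₁ (archimedean ε₀ 0<ε₀)
    K≤ = proj₂ (archimedean ε₀ 0<ε₀)
    -- The 17 secures the size conditions, the rest brings the bound `failureBound` / J below 1 / (K
    -- + 1). Only ε enters, so convergence is uniform in the graphs and densities.
    m₀ = 17 ℕ.+ failureBound ℕ.* suc K
    at : ∀ n (s : S n) → tower m₀ ℕ.≤ n → ℝ.abs (probability (p n) (λ R → hamiltonian? (G n s ∪ R)) ℝ.- ℝ.1ℝ) ℝ.≤ ε
    at n s h ε′ 0<ε′ = N₀ ℕ.⊔ N , λ m le → ℚ.≤-trans (close m (ℕ.m⊔n≤o⇒n≤o N₀ N le))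
      (ℚ.+-monoˡ-≤ ε′ (≤-respˡ (ℚ.+-identityˡ ε₀) (ε₀≤ m (ℕ.m⊔n≤o⇒m≤o N₀ N le))))
      where
      H = G n s
      j = lglg n
      m₀≤j : m₀ ℕ.≤ j
      m₀≤j = tower-lglg h
      17≤j : 17 ℕ.≤ j
      17≤j = ℕ.≤-trans (ℕ.m≤m+n 17 (failureBound ℕ.* suc K)) m₀≤j
      tol = tolerance-at n (ℕ.≤-trans (1≤tower m₀) h) 17≤j (r n) H (regular n s)
      τ = proj₁ tol
      0<τ = proj₁ (proj₂ tol)
      0≤p = proj₁ (bounds n s)
      p≤1 = proj₂ (bounds n s)
      p̂ = clamped (p n) 0≤p p≤1
      near-τ = near (p n) 0≤p p≤1 (½ * τ) (0<½* 0<τ)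
      above-τ = above n s (½ * τ) (0<½* 0<τ)
      I₁ = proj₁ near-τ
      I₂ = proj₁ above-τ
      I₃ = n ℕ.* (4 ℕ.* suc j)
      I = I₁ ℕ.⊔ I₂ ℕ.⊔ I₃
      holds : List (Fin n × Fin n) → ℚ
      holds E = ⟦ does (hamiltonian? (H ∪ fromEdges E)) ⟧
      likely : ∀ i → I ℕ.≤ i → 1ℚ ≤ 𝔼 (p̂ i) (vertexPairs n) holds + ε₀
      likely i I≤i = ≤-respˡ complement (ℚ.+-monoʳ-≤ X (ℚ.≤-trans F≤ K≤))
        where
        xs = vertexPairs n
        X = 𝔼 (p̂ i) xs holds
        F = 𝔼 (p̂ i) xs (fails H)
        complement : X + F ≡ 1ℚ
        complement = trans (sym (𝔼-+ (p̂ i) xs holds (fails H))) (trans (𝔼-cong (p̂ i) xs (fails-complement H)) (𝔼-const (p̂ i) xs 1ℚ))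
        thr≤ : approx (threshold ℝ.1ℝ (δ n) n (r n)) i ≤ p̂ i + τ
        thr≤ = ℚ.≤-trans (proj₂ above-τ i (ℕ.≤-trans (ℕ.m≤n⊔m I₁ I₂) (ℕ.≤-trans (ℕ.m≤m⊔n (I₁ ℕ.⊔ I₂) I₃) I≤i)))
          (≤-respʳ (trans (ℚ.+-assoc (p̂ i) (½ * τ) (½ * τ)) (cong (p̂ i +_) (2*½ τ)))
            (ℚ.+-monoˡ-≤ (½ * τ) (≤∣-∣ (approx (p n) i) (p̂ i) (∣-∣-sym (p̂ i) (approx (p n) i)
              (proj₂ near-τ i (ℕ.≤-trans (ℕ.m≤m⊔n I₁ I₂) (ℕ.≤-trans (ℕ.m≤m⊔n (I₁ ℕ.⊔ I₂) I₃) I≤i)))))))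
        JF : ι (suc j) * F ≤ ι failureBound
        JF = proj₂ (proj₂ tol) i (ℕ.≤-trans (ℕ.m≤n⊔m (I₁ ℕ.⊔ I₂) I₃) I≤i) (clamp-prob (approx (p n) i)) thr≤
        F≤ : F ≤ 1/suc K
        F≤ = ℚ.≤-trans
          (*-cancelˡ (ι (suc j)) (0<ι (ℕ.s≤s ℕ.z≤n)) (≤-respʳ (sym (trans (l (ι (suc j)) (ι failureBound) (1/suc j)) (trans (cong (ι failureBound *_) (suc*1/suc j)) (ℚ.*-identityʳ (ι failureBound))))) JF))
          (reciprocal-≤ failureBound K j (ℕ.m≤n⇒m≤1+n (ℕ.≤-trans (ℕ.m≤n+m (failureBound ℕ.* suc K) 17) m₀≤j)))
          where
          l : ∀ a b c → a * (b * c) ≡ b * (a * c)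
          l = solve-∀ ℚ-ring
      N = proj₁ (probability→1 (p n) 0≤p p≤1 (λ R → hamiltonian? (H ∪ R)) I likely ε′ 0<ε′)
      close = proj₂ (probability→1 (p n) 0≤p p≤1 (λ R → hamiltonian? (H ∪ R)) I likely ε′ 0<ε′)

  0ℝ<1ℝ : ℝ.0ℝ ℝ.< ℝ.1ℝ
  0ℝ<1ℝ = 1ℚ , 0<1 , 0 , λ _ _ → ℚ.≤-refl

open import Defs
open Convergence using (0ℝ<1ℝ; δ; δ→0; tends)

theorem6p1 : ∃[ c ] (0ℝ < c × ∃[ δ ] (IsLittleO1 δ ×
    ((S : Pred ℕ 0ℓ) (r : ℕ → ℕ) (G : ∀ n → S n → Graph n) (p : ℕ → ℝ) →
    (∀ n (s : S n) → IsRegular (G n s) (r n)) →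
    (∀ n → S n → 0ℝ ≤ p n × p n ≤ 1ℝ) →
    (∀ n → S n → threshold c (δ n) n (r n) ≤ p n) →
    TendsToAlong S (λ n s → probability (p n) (λ R → hamiltonian? (G n s ∪ R))) 1ℝ)))
theorem6p1 = 1ℝ , 0ℝ<1ℝ , δ , δ→0 , tends
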